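{- Let $p$ be a prime, $q=p^m$ and $1\le r<p$. Then $$1+p\,(q-d(p,m,r))\le 1+q+\frac{(r-1)(p-1)}{2}\lfloor 2\sqrt{q}\rfloor .$$
   Context: Write $\mathbb{F}_q^*=\{\alpha_1,\dots,\alpha_{q-1}\}$ and fix an $\mathbb{F}_p$-linear isomorphism $\mathbb{F}_q\cong\mathbb{F}_p^m$. Let $C$ be the $\mathbb{F}_p$-linear code of length $q-1$ spanned by the rows of the $rm\times(q-1)$ matrix over $\mathbb{F}_p$ whose $j$-th column is obtained by stacking the coordinate vectors in $\mathbb{F}_p^m$ of $\alpha_j,\alpha_j^2,\dots,\alpha_j^r$. Its minimum Hamming distance depends only on $p,m,r$ and is denoted $d(p,m,r)$. -}

module Defs where

open import Level using (0ℓ)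
open import Data.Nat using (ℕ; zero; suc; _+_; _*_; _∸_; _≤_; _<_; _≤ᵇ_; _≡ᵇ_; NonZero)
open import Data.Nat.DivMod using (_mod_)
open import Data.Bool using (Bool; true; false; if_then_else_; not; _∧_)
open import Data.Fin using (Fin; toℕ)
import Data.Fin as Fin
open import Data.Vec using (Vec; zipWith; lookup)
open import Data.List using (List; map; allFin)
open import Data.Nat.ListAction using (sum)
open import Data.Product using (Σ; _×_; ∃)
open import Function.Bundles using (_↔_; Inverse)
open import Relation.Binary.PropositionalEquality using (_≡_; _≢_)
open import Relation.Nullary.Decidable using (⌊_⌋)
open import Algebra.Structures using (IsCommutativeRing)

sqrtSearch : ℕ → ℕ → ℕ
sqrtSearch n zero    = zero
sqrtSearch n (suc k) = if (suc k * suc k) ≤ᵇ n then suc k else sqrtSearch n k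

⌊√_⌋ : ℕ → ℕ
⌊√ n ⌋ = sqrtSearch n n

_+ₚ_ : ∀ {p} .{{_ : NonZero p}} → Fin p → Fin p → Fin p
_+ₚ_ {p} a b = (toℕ a + toℕ b) mod p

record FiniteField (q : ℕ) : Set₁ where
  field
    Carrier : Set
    _⊕_ _⊗_ : Carrier → Carrier → Carrier
    ⊖_      : Carrier → Carrier
    0# 1#   : Carrier
    isCommutativeRing : IsCommutativeRing _≡_ _⊕_ _⊗_ ⊖_ 0# 1#
    0≢1     : 0# ≢ 1#
    inverse : ∀ x → x ≢ 0# → Σ Carrier (λ y → x ⊗ y ≡ 1#)
    enum    : Fin q ↔ Carrier

  _^_ : Carrier → ℕ → Carrier
  x ^ zero  = 1#
  x ^ suc k = x ⊗ (x ^ k)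

  isNonzero : Carrier → Bool
  isNonzero x = not ⌊ Inverse.from enum x Fin.≟ Inverse.from enum 0# ⌋

-- An 𝔽_p-linear isomorphism 𝔽_q ≅ 𝔽_p^m (additive bijection; additivity
-- is the same as 𝔽_p-linearity).

record Coordinates {q : ℕ} (K : FiniteField q) (p m : ℕ) .{{_ : NonZero p}} : Set where
  open FiniteField K
  field
    coordIso : Carrier ↔ Vec (Fin p) m
  coord : Carrier → Vec (Fin p) m
  coord = Inverse.to coordIso
  field
    additive : ∀ x y → coord (x ⊕ y) ≡ zipWith _+ₚ_ (coord x) (coord y)

-- The code C.  Rows of the rm × (q-1) matrix are indexed by (k , i),
-- k : Fin r (power k+1), i : Fin m (coordinate i); the entry in the column
-- of α ∈ 𝔽_q^* is the i-th coordinate of α^(k+1).  A codeword is an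
-- 𝔽_p-linear combination of the rows with coefficients λ : Fin r → Fin m → Fin p.

module Code {q : ℕ} (K : FiniteField q) {p m : ℕ} .{{_ : NonZero p}}
            (φ : Coordinates K p m) (r : ℕ) where
  open FiniteField K
  open Coordinates φ

  Coeffs : Set
  Coeffs = Fin r → Fin m → Fin p

  codeword : Coeffs → Carrier → Fin p
  codeword λc α =
    sum (map (λ k → sum (map (λ i → toℕ (λc k i) * toℕ (lookup (coord (α ^ suc (toℕ k))) i))
                             (allFin m)))
             (allFin r)) mod p

  weight : Coeffs → ℕ
  weight λc = sum (map (λ j → let α = Inverse.to enum j in
                              if isNonzero α ∧ not (toℕ (codeword λc α) ≡ᵇ 0)
                              then 1 else 0)
                       (allFin q))

  IsMinDistance : ℕ → Set
  IsMinDistance d =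
    Σ Coeffs (λ λc → (0 < weight λc) × (weight λc ≡ d))
    × (∀ λc → 0 < weight λc → d ≤ weight λc)

{- Each functional contributes the trace of a_j x^j, so a codeword is x ↦ Tr f(x) with deg f = n ≤ r, and
its zeros are counted by the affine points of y^p - y = f(x).  When n = 1 the translates of the kernel
are disjoint.  When n ≥ 2 the L-functions of the nontrivial additive characters are polynomials of degree n - 1; their
product has integral coefficients, and the product of opposite top coefficients is a power of q.
Bombieri's auxiliary polynomials bound the error terms of the even power sums by C q^l.  Szegő's recursion turns these
bounds into Serre's inequality for the first coefficient without complex roots. -}
module Submission where

open import Level using (0ℓ)
open import Algebra.Bundles using (CommutativeRing)
open import Data.Nat.Base as N using (ℕ; zero; suc; z≤n; s≤s; _∸_; NonZero)
import Data.Nat.Properties as NP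
open import Data.Fin.Base as Fin using (Fin; toℕ)
import Data.Fin.Properties as FinP
open import Data.Integer.Base as ℤ using (ℤ)
import Data.Integer.Properties as ℤP
open import Data.Nat.Primality using (Prime)
open import Data.Vec.Base using (Vec; []; _∷_)
open import Data.Product using (Σ; _×_; _,_; proj₁; proj₂; Σ-syntax)
open import Data.Sum using (_⊎_; inj₁; inj₂; [_,_]′)
open import Data.Empty using (⊥; ⊥-elim)
open import Function using (_∘_)
open import Relation.Nullary using (¬_; yes; no; Dec)
open import Relation.Binary.PropositionalEquality as ≡ using (_≡_; _≢_)
open import Defs

-- All estimates are carried out in an archimedean ordered field, in the end ℚ. That a polynomial A
-- has no zero in the closed unit disc is expressed by geometric decay of the coefficients of 1/A;
-- multiplication by `rev N A` / A then does not increase sums of squares, as for a Blaschke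
-- product, and the strict form of this is the positivity on which the recursion runs. As √q need
-- not lie in the field, variables are rescaled by R with R² slightly above q, and exactness returns
-- because an integer of absolute value below 1 is 0. This is used twice: for the functional
-- equation, and for Serre's gain from 2√q to M = ⌊2√q⌋. There z + q/z = M + 1, the reversed
-- polynomial has the value (-z)^g H at -z with an integer H ≠ 0, and a first coefficient above g M
-- would give |H| < 1 by the inequality of the means. The auxiliary polynomials require q^(2l) to be
-- the square of q^l, so only even power sums are bounded, and 1/A is reached through A(t) A(-t).
-- The condition r < p makes n invertible modulo p, which gives the degree n - 1 of the L-functions
-- and the unique weights in Bombieri's construction.

infixr 5 _∙_
_∙_ : {A : Set} {x y z : A} -> x ≡ y -> y ≡ z -> x ≡ z
_∙_ = ≡.trans

open ≡ using () renaming (sym to !; cong to ap; cong₂ to ap₂; refl to idp)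

-- Ring identities and a solver with integer coefficients.

module Rings where

 open import Algebra.Bundles using (RawRing)
 open import Data.Integer.Base using (+_; -[1+_]; _⊖_)
 open import Data.Maybe.Base using (Maybe; just; nothing)
 import Algebra.Solver.Ring as Solver
 open import Algebra.Solver.Ring.AlmostCommutativeRing using (fromCommutativeRing; _-Raw-AlmostCommutative⟶_)

 module Kit (R : CommutativeRing 0ℓ 0ℓ) where
  open CommutativeRing R public using (Carrier; _≈_; _+_; _*_; -_; _-_; 0#; 1#; isCommutativeRing; refl; sym; trans; reflexive; setoid; isEquivalence; +-cong; +-congˡ; +-congʳ; *-cong; *-congˡ; *-congʳ; -‿cong; +-assoc; +-comm; +-identityˡ; +-identityʳ; *-assoc; *-comm; *-identityˡ; *-identityʳ; *-identity; distribˡ; distribʳ; distrib; zeroˡ; zeroʳ; -‿inverseˡ; -‿inverseʳ; ring; semiring; commutativeSemiring; +-abelianGroup; *-commutativeMonoid; +-group)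
  open import Algebra.Properties.Ring ring public using (-‿distribˡ-*; -‿distribʳ-*; -‿involutive; -0#≈0#; x∙y⁻¹≈ε⇒x≈y; x≈y⇒x∙y⁻¹≈ε; +-cancelˡ; +-cancelʳ)
  open import Algebra.Properties.AbelianGroup +-abelianGroup public using (⁻¹-∙-comm)
  open import Algebra.Properties.Semiring.Exp semiring public using (_^_; ^-congˡ; ^-homo-*; ^-assocʳ)
  open import Algebra.Properties.Semiring.Mult semiring public using (×-congʳ; ×-assoc-*; ×-homo-+; ×1-homo-*) renaming (_×_ to infixr 8 _×ℕ_)
  open import Algebra.Properties.Semiring.Sum semiring public using (sum; sum-cong-≋; sum-replicate; sum-replicate-zero; ∑-distrib-+; ∑-comm; *-distribˡ-sum; *-distribʳ-sum; sum-permute; sum-remove)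
  open import Relation.Binary.Reasoning.Setoid setoid public
  El : Set
  El = Carrier
  infixr 5 _&_
  _&_ : ∀ {x y z} -> x ≈ y -> y ≈ z -> x ≈ z
  _&_ = trans
  fromℕ : ℕ -> Carrier
  fromℕ n = n ×ℕ 1#
  fromℕ-+ : ∀ m n -> fromℕ (m N.+ n) ≈ fromℕ m + fromℕ n
  fromℕ-+ m n = ×-homo-+ 1# m n
  fromℕ-* : ∀ m n -> fromℕ (m N.* n) ≈ fromℕ m * fromℕ n
  fromℕ-* = ×1-homo-*
  fromℤ : ℤ -> Carrier
  fromℤ (+ n) = fromℕ n
  fromℤ -[1+ n ] = - fromℕ (suc n)
  private
   can₁ : ∀ x a b -> (x + a) - (x + b) ≈ a - b
   can₁ x a b = begin (x + a) + - (x + b) ≈⟨ +-cong (+-comm x a) (sym (⁻¹-∙-comm x b)) ⟩ (a + x) + (- x + - b) ≈⟨ +-assoc a x _ ⟩ a + (x + (- x + - b)) ≈⟨ +-congˡ (sym (+-assoc x (- x) (- b))) ⟩ a + ((x + - x) + - b) ≈⟨ +-congˡ (+-congʳ (-‿inverseʳ x)) ⟩ a + (0# + - b) ≈⟨ +-congˡ (+-identityˡ (- b)) ⟩ a - b ∎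
  fromℤ-⊖ : ∀ m n -> fromℤ (m ⊖ n) ≈ fromℕ m - fromℕ n
  fromℤ-⊖ m zero = sym (+-identityʳ _) & +-congˡ (sym -0#≈0#)
  fromℤ-⊖ zero (suc n) = sym (+-identityˡ _)
  fromℤ-⊖ (suc m) (suc n) = reflexive (ap fromℤ (ℤP.[1+m]⊖[1+n]≡m⊖n m n)) & fromℤ-⊖ m n & sym (can₁ 1# (fromℕ m) (fromℕ n))
  fromℤ-+ : ∀ i j -> fromℤ (i ℤ.+ j) ≈ fromℤ i + fromℤ j
  fromℤ-+ (+ m) (+ n) = fromℕ-+ m n
  fromℤ-+ (+ m) -[1+ n ] = fromℤ-⊖ m (suc n)
  fromℤ-+ -[1+ m ] (+ n) = fromℤ-⊖ n (suc m) & +-comm _ _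
  fromℤ-+ -[1+ m ] -[1+ n ] = -‿cong (reflexive (ap (\ k -> fromℕ (suc k)) (! (NP.+-suc m n))) & fromℕ-+ (suc m) (suc n)) & sym (⁻¹-∙-comm _ _)
  fromℤ-neg : ∀ i -> fromℤ (ℤ.- i) ≈ - fromℤ i
  fromℤ-neg (+ zero) = sym -0#≈0#
  fromℤ-neg (+ suc n) = refl
  fromℤ-neg -[1+ n ] = sym (-‿involutive _)
  private
   fromℤ-*-+ : ∀ m j -> fromℤ (+ m ℤ.* j) ≈ fromℕ m * fromℤ j
   fromℤ-*-+ m (+ n) = reflexive (ap fromℤ (! (ℤP.pos-* m n))) & fromℕ-* m n
   fromℤ-*-+ m -[1+ n ] = reflexive (ap fromℤ (! (ℤP.neg-distribʳ-* (+ m) (+ suc n)))) & fromℤ-neg (+ m ℤ.* + suc n) & -‿cong (fromℤ-*-+ m (+ suc n)) & -‿distribʳ-* _ _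
  fromℤ-* : ∀ i j -> fromℤ (i ℤ.* j) ≈ fromℤ i * fromℤ j
  fromℤ-* (+ m) j = fromℤ-*-+ m j
  fromℤ-* -[1+ m ] j = reflexive (ap fromℤ (! (ℤP.neg-distribˡ-* (+ suc m) j))) & fromℤ-neg (+ suc m ℤ.* j) & -‿cong (fromℤ-*-+ (suc m) j) & -‿distribˡ-* _ _
  private
   ℤ-raw : RawRing 0ℓ 0ℓ
   ℤ-raw = record { Carrier = ℤ ; _≈_ = _≡_ ; _+_ = ℤ._+_ ; _*_ = ℤ._*_ ; -_ = ℤ.-_ ; 0# = + 0 ; 1# = + 1 }

   -- The interpretation of coefficients, arranged so that 1 denotes 1# itself.
   ⟦_⟧ : ℤ -> Carrier
   ⟦ + 1 ⟧ = 1#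
   ⟦ -[1+ 0 ] ⟧ = - 1#
   ⟦ i ⟧ = fromℤ i
   ⟦⟧-fromℤ : ∀ i -> ⟦ i ⟧ ≈ fromℤ i
   ⟦⟧-fromℤ (+ 0) = refl
   ⟦⟧-fromℤ (+ 1) = sym (+-identityʳ 1#)
   ⟦⟧-fromℤ (+ suc (suc n)) = refl
   ⟦⟧-fromℤ -[1+ 0 ] = -‿cong (sym (+-identityʳ 1#))
   ⟦⟧-fromℤ -[1+ suc n ] = refl
   morphism : ℤ-raw -Raw-AlmostCommutative⟶ fromCommutativeRing R
   morphism = record { ⟦_⟧ = ⟦_⟧ ; +-homo = \ i j -> ⟦⟧-fromℤ (i ℤ.+ j) & fromℤ-+ i j & sym (+-cong (⟦⟧-fromℤ i) (⟦⟧-fromℤ j)) ; *-homo = \ i j -> ⟦⟧-fromℤ (i ℤ.* j) & fromℤ-* i j & sym (*-cong (⟦⟧-fromℤ i) (⟦⟧-fromℤ j)) ; -‿homo = \ i -> ⟦⟧-fromℤ (ℤ.- i) & fromℤ-neg i & sym (-‿cong (⟦⟧-fromℤ i)) ; 0-homo = refl ; 1-homo = refl }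
   coe≟ : ∀ i j -> Maybe (⟦ i ⟧ ≈ ⟦ j ⟧)
   coe≟ i j with i ℤP.≟ j
   ... | yes idp = just refl
   ... | no _ = nothing
  open Solver ℤ-raw (fromCommutativeRing R) morphism coe≟ public using (solve; con; _:+_; _:*_; :-_; _:-_; _:=_; _:^_; Polynomial)
  0∶ 1∶ : ∀ {n} -> Polynomial n
  0∶ = con (+ 0)
  1∶ = con (+ 1)

  -- Reduces an equation to a ring identity with its hypotheses as the summands of the difference.
  from-dif : ∀ {x y} -> x - y ≈ 0# -> x ≈ y
  from-dif {x} {y} = x∙y⁻¹≈ε⇒x≈y x y
  to-dif : ∀ {x y} -> x ≈ y -> x - y ≈ 0#
  to-dif {x} {y} = x≈y⇒x∙y⁻¹≈ε

open Rings

-- Formal power series over a commutative ring.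

module PowSer where

 open N using (_≤_; _<_)

 module Ser (R : CommutativeRing 0ℓ 0ℓ) where
  private module R = Kit R
  open R using (Carrier; _≈_; 0#; 1#)
  Seq : Set
  Seq = ℕ -> Carrier
  infix 4 _≋_
  _≋_ : Seq -> Seq -> Set
  f ≋ g = ∀ i -> f i ≈ g i
  tail : Seq -> Seq
  tail f = f ∘ suc
  infixl 6 _⊕_
  infixl 7 _⊛_
  _⊕_ : Seq -> Seq -> Seq
  (f ⊕ g) i = f i R.+ g i
  ⊖_ : Seq -> Seq
  (⊖ f) i = R.- f i
  -- The Cauchy product, read off from f = f 0 + t · `tail f`, so that its laws become inductions on
  -- the index.
  _⊛_ : Seq -> Seq -> Seq
  (f ⊛ g) zero = f 0 R.* g 0
  (f ⊛ g) (suc n) = f 0 R.* g (suc n) R.+ (tail f ⊛ g) n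
  𝟘 𝟙 : Seq
  𝟘 _ = 0#
  𝟙 zero = 1#
  𝟙 (suc _) = 0#
  const : Carrier -> Seq
  const a zero = a
  const a (suc _) = 0#
  infixr 5 _◃_
  _◃_ : Carrier -> Seq -> Seq
  (a ◃ f) zero = a
  (a ◃ f) (suc n) = f n
  ⊛-cong : ∀ {f f' g g'} -> f ≋ f' -> g ≋ g' -> f ⊛ g ≋ f' ⊛ g'
  ⊛-cong p q zero = R.*-cong (p 0) (q 0)
  ⊛-cong p q (suc n) = R.+-cong (R.*-cong (p 0) (q (suc n))) (⊛-cong (p ∘ suc) q n)
  ⊛-zeroˡ : ∀ g -> 𝟘 ⊛ g ≋ 𝟘
  ⊛-zeroˡ g zero = R.zeroˡ _
  ⊛-zeroˡ g (suc n) = R.+-cong (R.zeroˡ _) (⊛-zeroˡ g n) R.& R.+-identityˡ _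
  con-⊛ : ∀ a g i -> (const a ⊛ g) i ≈ a R.* g i
  con-⊛ a g zero = R.refl
  con-⊛ a g (suc n) = R.+-congˡ (⊛-zeroˡ g n) R.& R.+-identityʳ _
  ⊛-ideˡ : ∀ g -> 𝟙 ⊛ g ≋ g
  ⊛-ideˡ g zero = R.*-identityˡ _
  ⊛-ideˡ g (suc n) = R.+-cong (R.*-identityˡ _) (⊛-zeroˡ g n) R.& R.+-identityʳ _
  ⊛-disʳ : ∀ h f g -> (f ⊕ g) ⊛ h ≋ f ⊛ h ⊕ g ⊛ h
  ⊛-disʳ h f g zero = R.distribʳ _ _ _
  ⊛-disʳ h f g (suc n) = R.+-cong (R.distribʳ _ _ _) (⊛-disʳ h (tail f) (tail g) n) R.& R.solve 4 (\ a b c d -> (a R.:+ b) R.:+ (c R.:+ d) R.:= (a R.:+ c) R.:+ (b R.:+ d)) R.refl _ _ _ _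
  sca-⊛ : ∀ a f g n -> ((\ i -> a R.* f i) ⊛ g) n ≈ a R.* (f ⊛ g) n
  sca-⊛ a f g zero = R.*-assoc _ _ _
  sca-⊛ a f g (suc n) = R.+-cong (R.*-assoc _ _ _) (sca-⊛ a (tail f) g n) R.& R.sym (R.distribˡ _ _ _)

  -- The recursion of _⊛_ seen from the second factor.
  ⊛-sucʳ : ∀ f g n -> (f ⊛ g) (suc n) ≈ (f ⊛ tail g) n R.+ f (suc n) R.* g 0
  ⊛-sucʳ f g zero = R.refl
  ⊛-sucʳ f g (suc n) = R.+-congˡ (⊛-sucʳ (tail f) g n) R.& R.sym (R.+-assoc _ _ _)
  ⊛-comm : ∀ f g -> f ⊛ g ≋ g ⊛ f
  ⊛-comm f g zero = R.*-comm _ _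
  ⊛-comm f g (suc n) = R.+-cong (R.*-comm _ _) (⊛-comm (tail f) g n) R.& R.+-comm _ _ R.& R.sym (⊛-sucʳ g f n)
  ⊛-ass : ∀ f g h -> (f ⊛ g) ⊛ h ≋ f ⊛ (g ⊛ h)
  ⊛-ass f g h zero = R.*-assoc _ _ _
  ⊛-ass f g h (suc n) = R.trans (R.+-congˡ (⊛-disʳ h (\ i -> f 0 R.* g (suc i)) (tail f ⊛ g) n R.& R.+-cong (sca-⊛ (f 0) (tail g) h n) (⊛-ass (tail f) g h n))) (R.solve 5 (\ a b c d e -> a R.:* b R.:* c R.:+ (a R.:* d R.:+ e) R.:= a R.:* (b R.:* c R.:+ d) R.:+ e) R.refl _ _ _ _ _)
  ≋-refl : ∀ {f} -> f ≋ f
  ≋-refl i = R.refl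
  ≋-sym : ∀ {f g} -> f ≋ g -> g ≋ f
  ≋-sym p i = R.sym (p i)
  ≋-trans : ∀ {f g h} -> f ≋ g -> g ≋ h -> f ≋ h
  ≋-trans p q i = p i R.& q i
  ⊕-cong : ∀ {f f' g g'} -> f ≋ f' -> g ≋ g' -> f ⊕ g ≋ f' ⊕ g'
  ⊕-cong p q i = R.+-cong (p i) (q i)
  ⊛-disˡ : ∀ f g h -> f ⊛ (g ⊕ h) ≋ f ⊛ g ⊕ f ⊛ h
  ⊛-disˡ f g h i = ⊛-comm f (g ⊕ h) i R.& ⊛-disʳ f g h i R.& R.+-cong (⊛-comm g f i) (⊛-comm h f i)
  ⊛-ideʳ : ∀ f -> f ⊛ 𝟙 ≋ f
  ⊛-ideʳ f i = ⊛-comm f 𝟙 i R.& ⊛-ideˡ f i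
  ⊛-zeroʳ : ∀ f -> f ⊛ 𝟘 ≋ 𝟘
  ⊛-zeroʳ f i = ⊛-comm f 𝟘 i R.& ⊛-zeroˡ f i
  infix 4 _≈ˢ_
  -- A record around `_≋_`: unlike the bare function type, it lets the two series be inferred from a
  -- proof, as the ring bundle and its solver require.
  record _≈ˢ_ (f g : Seq) : Set where
   constructor ⟪_⟫
   field at : f ≋ g
  open _≈ˢ_ public
  serRing : CommutativeRing 0ℓ 0ℓ
  serRing = record { Carrier = Seq ; _≈_ = _≈ˢ_ ; _+_ = _⊕_ ; _*_ = _⊛_ ; -_ = ⊖_ ; 0# = 𝟘 ; 1# = 𝟙 ; isCommutativeRing = record { isRing = record { +-isAbelianGroup = record { isGroup = record { isMonoid = record { isSemigroup = record { isMagma = record { isEquivalence = record { refl = ⟪ (\ i -> R.refl) ⟫ ; sym = \ p -> ⟪ (\ i -> R.sym (at p i)) ⟫ ; trans = \ p q -> ⟪ (\ i -> at p i R.& at q i) ⟫ } ; ∙-cong = \ p q -> ⟪ (\ i -> R.+-cong (at p i) (at q i)) ⟫ } ; assoc = \ f g h -> ⟪ (\ i -> R.+-assoc _ _ _) ⟫ } ; identity = (\ f -> ⟪ (\ i -> R.+-identityˡ _) ⟫) , (\ f -> ⟪ (\ i -> R.+-identityʳ _) ⟫) } ; inverse = (\ f -> ⟪ (\ i -> R.-‿inverseˡ _) ⟫) , (\ f -> ⟪ (\ i -> R.-‿inverseʳ _) ⟫) ; ⁻¹-cong = \ p -> ⟪ (\ i -> R.-‿cong (at p i)) ⟫ } ;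 comm = \ f g -> ⟪ (\ i -> R.+-comm _ _) ⟫ } ; *-cong = \ p q -> ⟪ ⊛-cong (at p) (at q) ⟫ ; *-assoc = \ f g h -> ⟪ ⊛-ass f g h ⟫ ; *-identity = (\ f -> ⟪ ⊛-ideˡ f ⟫) , (\ f -> ⟪ ⊛-ideʳ f ⟫) ; distrib = (\ f g h -> ⟪ ⊛-disˡ f g h ⟫) , (\ f g h -> ⟪ ⊛-disʳ f g h ⟫) } ; *-comm = \ f g -> ⟪ ⊛-comm f g ⟫ } }
  Deg< : Seq -> ℕ -> Set
  Deg< f n = ∀ i -> n ≤ i -> f i ≈ 0#
  Deg<-mono : ∀ {f m n} -> m ≤ n -> Deg< f m -> Deg< f n
  Deg<-mono m≤n d i n≤i = d i (NP.≤-trans m≤n n≤i)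
  Deg<-resp : ∀ {f g n} -> f ≋ g -> Deg< f n -> Deg< g n
  Deg<-resp e d i l = R.sym (e i) R.& d i l
  Deg<-⊕ : ∀ {f g n} -> Deg< f n -> Deg< g n -> Deg< (f ⊕ g) n
  Deg<-⊕ d e i l = R.+-cong (d i l) (e i l) R.& R.+-identityˡ _
  Deg<-⊖ : ∀ {f n} -> Deg< f n -> Deg< (⊖ f) n
  Deg<-⊖ d i l = R.-‿cong (d i l) R.& R.-0#≈0#
  -- The asymmetric bounds m and n + 1 give the sharp bound m + n without a subtraction.
  Deg<-⊛ : ∀ {f g} m n -> Deg< f m -> Deg< g (suc n) -> Deg< (f ⊛ g) (m N.+ n)
  Deg<-⊛ {f} {g} zero n d e i l = ⊛-cong {f} {𝟘} {g} {g} (\ j -> d j z≤n) (\ _ -> R.refl) i R.& ⊛-zeroˡ g i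
  Deg<-⊛ {f} {g} (suc m) n d e (suc i) (s≤s l) = R.trans (R.+-cong (R.*-congˡ (e (suc i) (s≤s (NP.≤-trans (NP.m≤n+m n m) l))) R.& R.zeroʳ _) (Deg<-⊛ {tail f} {g} m n (\ j k -> d (suc j) (s≤s k)) e i l)) (R.+-identityˡ _)
  top-⊛ : ∀ {f g} m n -> Deg< f (suc m) -> Deg< g (suc n) -> (f ⊛ g) (m N.+ n) ≈ f m R.* g n
  top-⊛ {f} {g} zero zero d e = R.refl
  top-⊛ {f} {g} zero (suc n) d e = R.+-congˡ (R.trans (⊛-cong {tail f} {𝟘} {g} {g} (\ j -> d (suc j) (s≤s z≤n)) (\ _ -> R.refl) n) (⊛-zeroˡ g n)) R.& R.+-identityʳ _
  top-⊛ {f} {g} (suc m) n d e = R.trans (R.+-cong (R.*-congˡ (e (suc (m N.+ n)) (s≤s (NP.m≤n+m n m))) R.& R.zeroʳ _) (top-⊛ {tail f} {g} m n (\ j k -> d (suc j) (s≤s k)) e)) (R.+-identityˡ _)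
  step : Seq -> Seq -> Seq
  step g u = tail (g ⊕ ⊖ (\ i -> g 0 R.* u i))
  -- Long division for u 0 = 1: the next coefficient is the constant term of the current remainder
  -- g, and `step` subtracts that multiple of u and divides by t.
  quot : Seq -> Seq -> Seq
  quot g u zero = g 0
  quot g u (suc n) = quot (step g u) u n
  quot-⊛ : ∀ g u -> u 0 ≈ 1# -> quot g u ⊛ u ≋ g
  quot-⊛ g u u₀ zero = R.*-congˡ u₀ R.& R.*-identityʳ _
  quot-⊛ g u u₀ (suc n) = R.+-congˡ (quot-⊛ (step g u) u u₀ n) R.& R.solve 2 (\ a b -> a R.:+ (b R.:- a) R.:= b) R.refl _ _
  -- The constant term of the product is f 0; once it is 0, the tail of f satisfies the same
  -- hypothesis.
  ⊛-canʳ : ∀ f u -> u 0 ≈ 1# -> f ⊛ u ≋ 𝟘 -> f ≋ 𝟘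
  ⊛-canʳ f u u₀ e zero = R.sym (R.*-identityʳ _) R.& R.*-congˡ (R.sym u₀) R.& e 0
  ⊛-canʳ f u u₀ e (suc i) = ⊛-canʳ (tail f) u u₀ (\ n -> R.sym (R.+-congʳ (R.*-congʳ (⊛-canʳ f u u₀ e zero) R.& R.zeroˡ _) R.& R.+-identityˡ _) R.& e (suc n)) i

  -- t d/dt
  θ : Seq -> Seq
  θ f i = R.fromℕ i R.* f i
  θ-⊛ : ∀ f g -> θ (f ⊛ g) ≋ θ f ⊛ g ⊕ f ⊛ θ g
  θ-⊛ f g zero = R.solve 2 (\ a b -> R.0∶ R.:* (a R.:* b) R.:= R.0∶ R.:* a R.:* b R.:+ a R.:* (R.0∶ R.:* b)) R.refl _ _
  θ-⊛ f g (suc n) = R.distribˡ _ _ _ R.& R.+-congˡ lem R.& R.solve 6 (\ k a b t x y -> k R.:* (a R.:* b) R.:+ (t R.:+ (x R.:+ y)) R.:= (R.0∶ R.:* a R.:* b R.:+ (t R.:+ x)) R.:+ (a R.:* (k R.:* b) R.:+ y)) R.refl (R.fromℕ (suc n)) (f 0) (g (suc n)) ((tail f ⊛ g) n) ((θ (tail f) ⊛ g) n) ((tail f ⊛ θ g) n) R.& R.+-congʳ (R.+-congˡ lem2)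
   where
   lem : R.fromℕ (suc n) R.* (tail f ⊛ g) n ≈ (tail f ⊛ g) n R.+ ((θ (tail f) ⊛ g) n R.+ (tail f ⊛ θ g) n)
   lem = R.distribʳ _ _ _ R.& R.+-cong (R.*-identityˡ _) (θ-⊛ (tail f) g n)
   lem2 : (tail f ⊛ g) n R.+ (θ (tail f) ⊛ g) n ≈ (tail (θ f) ⊛ g) n
   lem2 = R.sym (⊛-disʳ g (tail f) (θ (tail f)) n) R.& ⊛-cong {tail f ⊕ θ (tail f)} {tail (θ f)} {g} {g} (\ i -> R.+-congʳ (R.sym (R.*-identityˡ _)) R.& R.sym (R.distribʳ _ _ _)) (\ _ -> R.refl) n

open PowSer

-- Quotient rings, division by monic polynomials, and reversal.

module PolRin where

 open N using (_≤_; _<_; _⊔_)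

 module QuoRing (R : CommutativeRing 0ℓ 0ℓ) (d : CommutativeRing.Carrier R) where
  private module R = Kit R
  open R using (_≈_)
  infix 4 _≈/_
  -- A congruence carries its cofactor, so the quotient by a principal ideal is formed without
  -- deciding divisibility.
  record _≈/_ (x y : R.El) : Set where
   constructor _,_
   field
    witness : R.El
    proof : x ≈ y R.+ d R.* witness
  open _≈/_ public
  ≈⇒≈/ : ∀ {x y} -> x ≈ y -> x ≈/ y
  ≈⇒≈/ {x} {y} e = R.0# , e R.& R.solve 2 (\ y d -> y R.:= y R.:+ d R.:* R.0∶) R.refl y d
  ≈/0 : ∀ {x} w -> x ≈ d R.* w -> x ≈/ R.0#
  ≈/0 w e = w , e R.& R.sym (R.+-identityˡ _)
  quoRing : CommutativeRing 0ℓ 0ℓ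
  quoRing = record { Carrier = R.El ; _≈_ = _≈/_ ; _+_ = R._+_ ; _*_ = R._*_ ; -_ = R.-_ ; 0# = R.0# ; 1# = R.1# ; isCommutativeRing = record { isRing = record { +-isAbelianGroup = record { isGroup = record { isMonoid = record { isSemigroup = record { isMagma = record { isEquivalence = record { refl = ≈⇒≈/ R.refl ; sym = \ { {x} {y} (w , e) -> R.- w , R.solve 3 (\ y d w -> y R.:= (y R.:+ d R.:* w) R.:+ d R.:* (R.:- w)) R.refl y d w R.& R.+-congʳ (R.sym e) } ; trans = \ { {x} {y} {z} (w , e) (v , e') -> v R.+ w , e R.& R.+-congʳ e' R.& R.solve 4 (\ z d v w -> z R.:+ d R.:* v R.:+ d R.:* w R.:= z R.:+ d R.:* (v R.:+ w)) R.refl z d v w } } ; ∙-cong = \ { {x} {y} {u} {v} (w , e) (w' , e') -> w R.+ w' , R.+-cong e e' R.& R.solve 5 (\ y v d w w' -> (y R.:+ d R.:* w) R.:+ (v R.:+ d R.:* w') R.:= (y R.:+ v) R.:+ d R.:* (w R.:+ w')) R.refl y v d w w' } } ; assoc = \ f g h -> ≈⇒≈/ (R.+-assoc f g h) } ; identity = (\ f -> ≈⇒≈/ (R.+-identityˡ f)) , (\ f -> ≈⇒≈/ (R.+-identityʳ f)) } ; inverse = (\ f -> ≈⇒≈/ (R.-‿inverseˡ f)) , (\ f -> ≈⇒≈/ (R.-‿inverseʳ f)) ; ⁻¹-cong = \ { {x} {y} (w , e) -> R.- w , R.-‿cong e R.& R.solve 3 (\ y d w -> R.:- (y R.:+ d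 R.:* w) R.:= R.:- y R.:+ d R.:* (R.:- w)) R.refl y d w } } ; comm = \ f g -> ≈⇒≈/ (R.+-comm f g) } ; *-cong = \ { {x} {y} {u} {v} (w , e) (w' , e') -> w R.* v R.+ y R.* w' R.+ d R.* w R.* w' , R.*-cong e e' R.& R.solve 5 (\ y v d w w' -> (y R.:+ d R.:* w) R.:* (v R.:+ d R.:* w') R.:= (y R.:* v) R.:+ d R.:* (w R.:* v R.:+ y R.:* w' R.:+ d R.:* w R.:* w')) R.refl y v d w w' } ; *-assoc = \ f g h -> ≈⇒≈/ (R.*-assoc f g h) ; *-identity = (\ f -> ≈⇒≈/ (R.*-identityˡ f)) , (\ f -> ≈⇒≈/ (R.*-identityʳ f)) ; distrib = (\ f g h -> ≈⇒≈/ (R.distribˡ f g h)) , (\ f g h -> ≈⇒≈/ (R.distribʳ f g h)) } ; *-comm = \ f g -> ≈⇒≈/ (R.*-comm f g) } }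

 module Pol (R : CommutativeRing 0ℓ 0ℓ) where
  open Ser R public
  private
   module R = Kit R
   module S = Kit serRing
  open R using (Carrier; _≈_; 0#; 1#)
  Monic : Seq -> ℕ -> Set
  Monic f k = (f k ≈ 1#) × Deg< f (suc k)
  Mon-⊛ : ∀ {f g} m n -> Monic f m -> Monic g n -> Monic (f ⊛ g) (m N.+ n)
  Mon-⊛ {f} {g} m n (t , d) (t' , d') = top-⊛ {f} {g} m n d d' R.& R.*-cong t t' R.& R.*-identityˡ _ , Deg<-⊛ {f} {g} (suc m) n d d'
  Mon-𝟙 : Monic 𝟙 0
  Mon-𝟙 = R.refl , \ { (suc _) _ -> R.refl }
  scale : Carrier -> Seq -> Seq
  scale a f i = a R.* f i
  -- Recursion through F = F 0 + t · `tail F`: t times the remainder of the tail, plus F 0, has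
  -- degree at most d, and subtracting c D, with c its coefficient at d, brings the degree below d.
  divMon : ∀ {D d} -> Monic D d -> ∀ n F -> Deg< F n -> Σ[ w ∈ Seq ] Σ[ r ∈ Seq ] (Deg< w n × Deg< r d × F ≋ D ⊛ w ⊕ r)
  divMon {D} M zero F degF = 𝟘 , 𝟘 , (\ _ _ -> R.refl) , (\ _ _ -> R.refl) , \ i -> degF i z≤n R.& R.sym (R.+-identityʳ _ R.& ⊛-comm D 𝟘 i R.& ⊛-zeroˡ D i)
  divMon {D} {d} M@(top , degD) (suc n) F degF with divMon M n (tail F) (\ i l -> degF (suc i) (s≤s l))
  ... | w , r , degw , degr , eq = (c ◃ w) , r' , degcw , degr' , eq'
   where
   r₀ = F 0 ◃ r
   c = r₀ d
   r' : Seq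
   r' i = r₀ i R.- c R.* D i
   degcw : Deg< (c ◃ w) (suc n)
   degcw (suc i) (s≤s l) = degw i l
   degr₀ : Deg< r₀ (suc d)
   degr₀ (suc i) (s≤s l) = degr i l
   degr' : Deg< r' d
   degr' i l with NP.m≤n⇒m<n∨m≡n l
   ... | inj₁ d<i = R.+-cong (degr₀ i d<i) (R.-‿cong (R.*-congˡ (degD i d<i) R.& R.zeroʳ _)) R.& R.-‿inverseʳ 0#
   ... | inj₂ idp = R.+-congˡ (R.-‿cong (R.*-congˡ top R.& R.*-identityʳ _)) R.& R.-‿inverseʳ _
   eq' : F ≋ D ⊛ (c ◃ w) ⊕ r'
   eq' zero = R.solve 3 (\ f d c -> f R.:= d R.:* c R.:+ (f R.:- c R.:* d)) R.refl _ _ _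
   eq' (suc i) = eq i R.& R.trans (R.solve 4 (\ p r c d -> p R.:+ r R.:= (p R.:+ d R.:* c) R.:+ (r R.:- c R.:* d)) R.refl _ _ c (D (suc i))) (R.+-congʳ (R.sym (⊛-sucʳ D (c ◃ w) i)))
  -- As D is monic, the coefficient of D w at d + n is that of w at n; the small degree of D w
  -- therefore kills the coefficients of w from the top down.
  Mon-⊛-sma : ∀ {D d} -> Monic D d -> ∀ n w -> Deg< w n -> Deg< (D ⊛ w) d -> w ≋ 𝟘
  Mon-⊛-sma M zero w degw small i = degw i z≤n
  Mon-⊛-sma {D} {d} M@(top , degD) (suc n) w degw small = Mon-⊛-sma M n w degw' small
   where
   degw' : Deg< w n
   degw' i l with NP.m≤n⇒m<n∨m≡n l
   ... | inj₁ n<i = degw i n<i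
   ... | inj₂ idp = R.sym (R.*-congʳ top R.& R.*-identityˡ _) R.& R.sym (top-⊛ {D} {w} d n degD degw) R.& small (d N.+ n) (NP.m≤m+n d n)
  Mon-⊛-can : ∀ {D d} -> Monic D d -> ∀ n w -> Deg< w n -> D ⊛ w ≋ 𝟘 -> w ≋ 𝟘
  Mon-⊛-can M n w degw e = Mon-⊛-sma M n w degw (\ i _ -> e i)
  record Poly : Set where
   constructor poly
   field
    coeff : Seq
    bound : ℕ
    degree : Deg< coeff bound
  open Poly public
  infix 4 _≈ᴾ_
  record _≈ᴾ_ (f g : Poly) : Set where
   constructor ⟪_⟫
   field at : coeff f ≋ coeff g
  open _≈ᴾ_ public renaming (at to atᴾ)
  polyRing : CommutativeRing 0ℓ 0ℓ
  polyRing = record { Carrier = Poly ; _≈_ = _≈ᴾ_ ; _+_ = \ f g -> poly (coeff f ⊕ coeff g) (bound f N.⊔ bound g) (Deg<-⊕ (Deg<-mono (NP.m≤m⊔n _ _) (degree f)) (Deg<-mono (NP.m≤n⊔m _ _) (degree g))) ; _*_ = \ f g -> poly (coeff f ⊛ coeff g) (bound f N.+ bound g) (Deg<-⊛ {coeff f} {coeff g} (bound f) (bound g) (degree f) (Deg<-mono (NP.n≤1+n _) (degree g))) ; -_ = \ f -> poly (⊖ coeff f) (bound f) (Deg<-⊖ (degree f)) ; 0# = poly 𝟘 0 (\ _ _ -> R.refl) ; 1# = poly 𝟙 1 (\ { (suc _) _ -> R.refl }) ; isCommutativeRing = record { isRing = record { +-isAbelianGroup = record { isGroup = record { isMonoid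 = record { isSemigroup = record { isMagma = record { isEquivalence = record { refl = ⟪ ≋-refl ⟫ ; sym = \ p -> ⟪ ≋-sym (atᴾ p) ⟫ ; trans = \ p q -> ⟪ ≋-trans (atᴾ p) (atᴾ q) ⟫ } ; ∙-cong = \ p q -> ⟪ ⊕-cong (atᴾ p) (atᴾ q) ⟫ } ; assoc = \ f g h -> ⟪ at (S.+-assoc _ _ _) ⟫ } ; identity = (\ f -> ⟪ at (S.+-identityˡ _) ⟫) , (\ f -> ⟪ at (S.+-identityʳ _) ⟫) } ; inverse = (\ f -> ⟪ at (S.-‿inverseˡ _) ⟫) , (\ f -> ⟪ at (S.-‿inverseʳ _) ⟫) ; ⁻¹-cong = \ p -> ⟪ at (S.-‿cong ⟪ atᴾ p ⟫) ⟫ } ; comm = \ f g -> ⟪ at (S.+-comm _ _) ⟫ } ; *-cong = \ p q -> ⟪ ⊛-cong (atᴾ p) (atᴾ q) ⟫ ; *-assoc = \ f g h -> ⟪ ⊛-ass (coeff f) (coeff g) (coeff h) ⟫ ; *-identity = (\ f -> ⟪ ⊛-ideˡ (coeff f) ⟫) , (\ f -> ⟪ ⊛-ideʳ (coeff f) ⟫) ; distrib = (\ f g h -> ⟪ ⊛-disˡ (coeff f) (coeff g) (coeff h) ⟫) , (\ f g h -> ⟪ ⊛-disʳ (coeff f) (coeff g) (coeff h) ⟫) } ; *-comm = \ f g -> ⟪ ⊛-comm (coeff f) (coeff g) ⟫ } }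
  conP : Carrier -> Poly
  conP a = poly (const a) 1 \ { (suc _) _ -> R.refl }
  X : Poly
  X = poly (0# ◃ 𝟙) 2 \ { (suc (suc _)) _ -> R.refl ; (suc zero) (s≤s ()) }
  X-⊛ : ∀ f -> (0# ◃ 𝟙) ⊛ f ≋ 0# ◃ f
  X-⊛ f zero = R.zeroˡ _
  X-⊛ f (suc n) = R.+-cong (R.zeroˡ _) (⊛-ideˡ f n) R.& R.+-identityˡ _
  shift : ℕ -> Seq -> Seq
  shift zero f = f
  shift (suc k) f = 0# ◃ shift k f
  -- For deg f ≤ n this is t^n f(1/t); higher coefficients are cut off.
  rev : ℕ -> Seq -> Seq
  rev zero f zero = f 0
  rev zero f (suc i) = 0#
  rev (suc n) f zero = f (suc n)
  rev (suc n) f (suc i) = rev n f i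
  rev-0 : ∀ n f -> rev n f 0 ≈ f n
  rev-0 zero f = R.refl
  rev-0 (suc n) f = R.refl
  rev-cong : ∀ n {f g} -> f ≋ g -> rev n f ≋ rev n g
  rev-cong zero e zero = e 0
  rev-cong zero e (suc i) = R.refl
  rev-cong (suc n) e zero = e _
  rev-cong (suc n) e (suc i) = rev-cong n e i
  rev-⊕ : ∀ n f g -> rev n (f ⊕ g) ≋ rev n f ⊕ rev n g
  rev-⊕ zero f g zero = R.refl
  rev-⊕ zero f g (suc i) = R.sym (R.+-identityˡ _)
  rev-⊕ (suc n) f g zero = R.refl
  rev-⊕ (suc n) f g (suc i) = rev-⊕ n f g i
  rev-sca : ∀ n a f -> rev n (scale a f) ≋ scale a (rev n f)
  rev-sca zero a f zero = R.refl
  rev-sca zero a f (suc i) = R.sym (R.zeroʳ _)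
  rev-sca (suc n) a f zero = R.refl
  rev-sca (suc n) a f (suc i) = rev-sca n a f i
  rev-tail : ∀ a f -> rev (suc a) f ≋ shift (suc a) (const (f 0)) ⊕ rev a (tail f)
  rev-tail a f zero = R.sym (R.+-identityˡ _ R.& rev-0 a (tail f))
  rev-tail zero f (suc zero) = R.sym (R.+-identityʳ _)
  rev-tail zero f (suc (suc j)) = R.sym (R.+-identityʳ _)
  rev-tail (suc a) f (suc j) = rev-tail a f j
  rev-0◃ : ∀ n h -> rev (suc n) (0# ◃ h) ≋ rev n h
  rev-0◃ n h i = rev-tail n (0# ◃ h) i R.& R.+-congʳ (shi-0 (suc n) i) R.& R.+-identityˡ _
   where
   shi-0 : ∀ k i -> shift k (const 0#) i ≈ 0#
   shi-0 zero zero = R.refl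
   shi-0 zero (suc i) = R.refl
   shi-0 (suc k) zero = R.refl
   shi-0 (suc k) (suc i) = shi-0 k i
  rev-shi : ∀ k b g -> Deg< g (suc b) -> rev (k N.+ b) g ≋ shift k (rev b g)
  rev-shi zero b g d i = R.refl
  rev-shi (suc k) b g d zero = d _ (s≤s (NP.m≤n+m b k))
  rev-shi (suc k) b g d (suc i) = rev-shi k b g d i
  shi-con-⊛ : ∀ k a f -> shift k (const a) ⊛ f ≋ shift k (scale a f)
  shi-con-⊛ zero a f i = con-⊛ a f i
  shi-con-⊛ (suc k) a f zero = R.zeroˡ _
  shi-con-⊛ (suc k) a f (suc i) = R.+-congʳ (R.zeroˡ _) R.& R.+-identityˡ _ R.& shi-con-⊛ k a f i
  shi-sca : ∀ k a f -> scale a (shift k f) ≋ shift k (scale a f)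
  shi-sca zero a f i = R.refl
  shi-sca (suc k) a f zero = R.zeroʳ _
  shi-sca (suc k) a f (suc i) = shi-sca k a f i
  -- Induction on the degree of f: in f g = f 0 · g + t · (`tail f` g) the first term reverses to
  -- t^(a+1) times a constant multiple of `rev b g`, and the second is the inductive case.
  rev-⊛ : ∀ a b f g -> Deg< f (suc a) -> Deg< g (suc b) -> rev (a N.+ b) (f ⊛ g) ≋ rev a f ⊛ rev b g
  rev-⊛ zero b f g df dg = ≋-trans (rev-cong b (≋-trans (⊛-cong {g = g} f≋ ≋-refl) (con-⊛ (f 0) g))) (≋-trans (rev-sca b (f 0) g) (≋-trans (≋-sym (con-⊛ (f 0) (rev b g))) (⊛-cong {g = rev b g} c≋ ≋-refl)))
   where
   f≋ : f ≋ const (f 0)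
   f≋ zero = R.refl
   f≋ (suc i) = df (suc i) (s≤s z≤n)
   c≋ : const (f 0) ≋ rev 0 f
   c≋ zero = R.refl
   c≋ (suc i) = R.refl
  rev-⊛ (suc a) b f g df dg = ≋-trans (rev-cong (suc (a N.+ b)) split) (≋-trans (rev-⊕ (suc (a N.+ b)) _ _) (≋-trans (⊕-cong (≋-trans (rev-sca (suc a N.+ b) (f 0) g) (≋-trans (\ i -> R.*-congˡ (rev-shi (suc a) b g dg i)) (≋-trans (shi-sca (suc a) (f 0) (rev b g)) (≋-sym (shi-con-⊛ (suc a) (f 0) (rev b g)))))) (≋-trans (rev-0◃ (a N.+ b) (tail f ⊛ g)) (rev-⊛ a b (tail f) g (\ i l -> df (suc i) (s≤s l)) dg))) (≋-trans (≋-sym (⊛-disʳ (rev b g) (shift (suc a) (const (f 0))) (rev a (tail f)))) (⊛-cong {g = rev b g} (≋-sym (rev-tail a f)) ≋-refl))))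
   where
   split : f ⊛ g ≋ scale (f 0) g ⊕ (0# ◃ (tail f ⊛ g))
   split zero = R.sym (R.+-identityʳ _)
   split (suc i) = R.refl
  rev-at : ∀ n f i -> i ≤ n -> rev n f i ≡ f (n N.∸ i)
  rev-at zero f zero l = idp
  rev-at (suc n) f zero l = idp
  rev-at (suc n) f (suc i) (s≤s l) = rev-at n f i l
  rev-Deg : ∀ n f -> Deg< (rev n f) (suc n)
  rev-Deg zero f (suc i) l = R.refl
  rev-Deg (suc n) f (suc i) (s≤s l) = rev-Deg n f i l
  rev-rev : ∀ n {f} -> Deg< f (suc n) -> rev n (rev n f) ≋ f
  rev-rev n {f} d i with i NP.≤? n
  ... | yes l = R.reflexive (rev-at n (rev n f) i l ∙ rev-at n f (n N.∸ i) (NP.m∸n≤m n i) ∙ ap f (NP.m∸[m∸n]≡n l))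
  ... | no nl = rev-Deg n (rev n f) i (NP.≰⇒> nl) R.& R.sym (d i (NP.≰⇒> nl))
  -- The vector lists the coefficients below the leading 1, so that the monic polynomials of degree
  -- k over a finite field are enumerated by vectors of length k.
  mon : ∀ {k} -> Vec Carrier k -> Seq
  mon [] = 𝟙
  mon (a ∷ v) = a ◃ mon v
  mon-Mon : ∀ {k} (v : Vec Carrier k) -> Monic (mon v) k
  mon-Mon [] = Mon-𝟙
  mon-Mon (a ∷ v) with mon-Mon v
  ... | t , d = t , \ { (suc i) (s≤s l) -> d i l }
  toVec : ∀ k -> Seq -> Vec Carrier k
  toVec zero f = []
  toVec (suc k) f = f 0 ∷ toVec k (tail f)
  mon-toVec : ∀ k f -> Monic f k -> mon (toVec k f) ≋ f
  mon-toVec zero f (t , d) zero = R.sym t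
  mon-toVec zero f (t , d) (suc i) = R.sym (d (suc i) (s≤s z≤n))
  mon-toVec (suc k) f (t , d) zero = R.refl
  mon-toVec (suc k) f (t , d) (suc i) = mon-toVec k (tail f) (t , \ j l -> d (suc j) (s≤s l)) i

open PolRin

-- Pigeonhole, Frobenius, and Fermat's theorem in finite domains.

module FinRin where

 open N using (_≤_; _<_)
 open import Data.Nat.Combinatorics using (_C_; nCn≡1; k![n∸k]!∣n!)
 open import Data.Nat.Combinatorics.Specification using (nCk≡n!/k![n-k]!)
 open import Data.Nat.Divisibility using (_∣_; divides; ∣⇒≤; m∣m*n; ∣-trans; n∣m*n)
 open import Data.Nat.DivMod using (m/n*n≡m)
 open import Data.Nat.Primality using (euclidsLemma; prime⇒nonTrivial)
 open import Data.Fin.Base using (punchOut)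
 open import Data.Fin.Permutation using (permutation)
 open import Data.Vec.Functional using (Vector)

 -- A value y outside the image could be punched out, leaving an injection into a smaller set.
 inj⇒sur : ∀ {n} (f : Fin n -> Fin n) -> (∀ {i j} -> f i ≡ f j -> i ≡ j) -> ∀ y -> Σ[ x ∈ Fin n ] f x ≡ y
 inj⇒sur {suc n} f inj y with FinP.any? (\ x -> f x FinP.≟ y)
 ... | yes r = r
 ... | no ¬r = ⊥-elim (NP.<⇒≱ (NP.n<1+n n) (FinP.injective⇒≤ {f = g} (\ e -> inj (FinP.punchOut-injective (miss _) (miss _) e))))
  where
  miss : ∀ x -> y ≢ f x
  miss x e = ¬r (x , ! e)
  g : Fin (suc n) -> Fin n
  g x = punchOut (miss x)

 pri>1 : ∀ {p} -> Prime p -> 1 < p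
 pri>1 pr = N.nonTrivial⇒n>1 _ {{prime⇒nonTrivial pr}}

 pri∤! : ∀ {p} -> Prime p -> ∀ k -> k < p -> ¬ (p ∣ k N.!)
 pri∤! pr zero k<p d = NP.<⇒≱ (pri>1 pr) (∣⇒≤ d)
 pri∤! pr (suc k) k<p d with euclidsLemma (suc k) (k N.!) pr d
 ... | inj₁ e = NP.<⇒≱ k<p (∣⇒≤ e)
 ... | inj₂ e = pri∤! pr k (NP.<-trans (NP.n<1+n k) k<p) e

 -- The prime p divides p! = C(p,k) k! (p-k)! but neither of the two factorials.
 pri∣C : ∀ {p} -> Prime p -> ∀ k -> 0 < k -> k < p -> p ∣ p C k
 pri∣C {p@(suc p')} pr k 0<k k<p with euclidsLemma (p C k) (k N.! N.* (p ∸ k) N.!) pr p∣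
  where
  instance _ = (k NP.!* (p ∸ k) !≢0)
  eq : (p C k) N.* (k N.! N.* (p ∸ k) N.!) ≡ p N.!
  eq = ap (N._* (k N.! N.* (p ∸ k) N.!)) (nCk≡n!/k![n-k]! (NP.<⇒≤ k<p)) ∙ m/n*n≡m (k![n∸k]!∣n! (NP.<⇒≤ k<p))
  p∣ : p ∣ (p C k) N.* (k N.! N.* (p ∸ k) N.!)
  p∣ = ≡.subst (p ∣_) (! eq) (m∣m*n (p' N.!))
 ... | inj₁ d = d
 ... | inj₂ d with euclidsLemma (k N.!) ((p ∸ k) N.!) pr d
 ... | inj₁ e = ⊥-elim (pri∤! pr k k<p e)
 ... | inj₂ e = ⊥-elim (pri∤! pr (p ∸ k) (NP.∸-monoʳ-< 0<k (NP.<⇒≤ k<p)) e)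

 module Fro (R : CommutativeRing 0ℓ 0ℓ) {p : ℕ} (pr : Prime p) (char : CommutativeRing._≈_ R (Kit.fromℕ R p) (CommutativeRing.0# R)) where
  open Kit R
  open import Algebra.Properties.CommutativeSemiring.Binomial commutativeSemiring using (theorem; binomialTerm)
  mul-0 : ∀ {k} -> p ∣ k -> ∀ x -> k ×ℕ x ≈ 0#
  mul-0 (divides c idp) x = begin (c N.* p) ×ℕ x ≈⟨ ×-congʳ (c N.* p) (*-identityˡ x) ⟨ (c N.* p) ×ℕ (1# * x) ≈⟨ ×-assoc-* (c N.* p) 1# x ⟨ fromℕ (c N.* p) * x ≈⟨ *-congʳ (fromℕ-* c p) ⟩ fromℕ c * fromℕ p * x ≈⟨ *-congʳ (*-congˡ char) ⟩ fromℕ c * 0# * x ≈⟨ solve 2 (\ c x -> c :* 0∶ :* x := 0∶) refl (fromℕ c) x ⟩ 0# ∎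
  sum-last : ∀ n (f : Vector Carrier (suc n)) -> (∀ i -> toℕ i < n -> f i ≈ 0#) -> sum f ≈ f (Fin.fromℕ n)
  sum-last zero f e = +-identityʳ _
  sum-last (suc n) f e = +-cong (e Fin.zero (s≤s z≤n)) (sum-last n (f ∘ Fin.suc) (\ i l -> e (Fin.suc i) (s≤s l))) & +-identityˡ _
  -- By `pri∣C` only the two outer terms of the binomial expansion survive in characteristic p.
  fro-+ : ∀ x y -> (x + y) ^ p ≈ x ^ p + y ^ p
  fro-+ x y with pri>1 pr
  fro-+ x y | s≤s {n = p'} (s≤s {n = p''} _) = begin (x + y) ^ p ≈⟨ theorem p x y ⟩ term Fin.zero + sum (term ∘ Fin.suc) ≈⟨ +-cong first (sum-last p' (term ∘ Fin.suc) middle & last) ⟩ y ^ p + x ^ p ≈⟨ +-comm _ _ ⟩ x ^ p + y ^ p ∎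
   where
   term = binomialTerm x y p
   first : term Fin.zero ≈ y ^ p
   first = +-identityʳ _ & *-identityˡ _
   middle : ∀ i -> toℕ i < p' -> term (Fin.suc i) ≈ 0#
   middle i l = mul-0 (pri∣C pr (suc (toℕ i)) (s≤s z≤n) (s≤s l)) _
   last : term (Fin.fromℕ p) ≈ x ^ p
   last = reflexive (ap₂ (\ a b -> a ×ℕ (x ^ b * y ^ (p ∸ toℕ (Fin.fromℕ p)))) (ap (p C_) (FinP.toℕ-fromℕ p) ∙ nCn≡1 p) (FinP.toℕ-fromℕ p)) & +-identityʳ _ & *-congˡ (reflexive (ap (y ^_) (ap (p ∸_) (FinP.toℕ-fromℕ p) ∙ NP.n∸n≡0 p))) & *-identityʳ _
  p^k≢0 : ∀ k -> 0 < p N.^ k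
  p^k≢0 k = NP.m^n>0 p {{N.>-nonZero (NP.<-trans (s≤s z≤n) (pri>1 pr))}} k
  0^n : ∀ {n} -> 0 < n -> 0# ^ n ≈ 0#
  0^n {suc n} _ = zeroˡ _
  1^n : ∀ n -> 1# ^ n ≈ 1#
  1^n zero = refl
  1^n (suc n) = *-identityˡ _ & 1^n n
  ^-^-comm : ∀ x m n -> (x ^ m) ^ n ≈ (x ^ n) ^ m
  ^-^-comm x m n = ^-assocʳ x m n & reflexive (ap (x ^_) (NP.*-comm m n)) & sym (^-assocʳ x n m)
  Frob : ℕ -> Carrier -> Carrier
  Frob k x = x ^ (p N.^ k)
  Frob-cong : ∀ k {x y} -> x ≈ y -> Frob k x ≈ Frob k y
  Frob-cong k = ^-congˡ (p N.^ k)
  Frob-∘ : ∀ j k x -> Frob j (Frob k x) ≈ Frob (k N.+ j) x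
  Frob-∘ j k x = ^-assocʳ x (p N.^ k) (p N.^ j) & reflexive (ap (x ^_) (! (NP.^-distribˡ-+-* p k j)))
  Frob-+ : ∀ k x y -> Frob k (x + y) ≈ Frob k x + Frob k y
  Frob-+ zero x y = *-identityʳ _ & sym (+-cong (*-identityʳ _) (*-identityʳ _))
  Frob-+ (suc k) x y = begin (x + y) ^ (p N.* p N.^ k) ≈⟨ ^-assocʳ (x + y) p (p N.^ k) ⟨ Frob k ((x + y) ^ p) ≈⟨ Frob-cong k (fro-+ x y) ⟩ Frob k (x ^ p + y ^ p) ≈⟨ Frob-+ k _ _ ⟩ Frob k (x ^ p) + Frob k (y ^ p) ≈⟨ +-cong (^-assocʳ x p (p N.^ k)) (^-assocʳ y p (p N.^ k)) ⟩ Frob (suc k) x + Frob (suc k) y ∎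
  Frob-0 : ∀ k -> Frob k 0# ≈ 0#
  Frob-0 k = 0^n (p^k≢0 k)
  Frob-1 : ∀ k -> Frob k 1# ≈ 1#
  Frob-1 k = 1^n (p N.^ k)
  Frob-* : ∀ k x y -> Frob k (x * y) ≈ Frob k x * Frob k y
  Frob-* k x y = ^-distrib-* x y (p N.^ k)
   where open import Algebra.Properties.CommutativeSemiring.Exp commutativeSemiring using (^-distrib-*)
  Frob-neg : ∀ k x -> Frob k (- x) ≈ - Frob k x
  Frob-neg k x = sym (begin - Frob k x ≈⟨ +-identityʳ _ ⟨ - Frob k x + 0# ≈⟨ +-congˡ (sym (Frob-0 k) & Frob-cong k (sym (-‿inverseʳ x))) ⟩ - Frob k x + Frob k (x - x) ≈⟨ +-congˡ (Frob-+ k x (- x)) ⟩ - Frob k x + (Frob k x + Frob k (- x)) ≈⟨ solve 2 (\ a b -> :- a :+ (a :+ b) := b) refl _ _ ⟩ Frob k (- x) ∎)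
  Frob-fromℕ : ∀ k n -> Frob k (fromℕ n) ≈ fromℕ n
  Frob-fromℕ k zero = Frob-0 k
  Frob-fromℕ k (suc n) = Frob-+ k 1# (fromℕ n) & +-cong (Frob-1 k) (Frob-fromℕ k n)

 -- Stated up to the equality of the ring, since it is also applied to residue fields, where
 -- equality is congruence modulo a polynomial.
 record FinDom (R : CommutativeRing 0ℓ 0ℓ) (n : ℕ) : Set where
  open CommutativeRing R
  field
   dom : ∀ x y -> x * y ≈ 0# -> x ≈ 0# ⊎ y ≈ 0#
   1≉0 : ¬ (1# ≈ 0#)
   rep : Fin n -> Carrier
   index : Carrier -> Fin n
   ind-cong : ∀ {x y} -> x ≈ y -> index x ≡ index y
   rep-ind : ∀ x -> rep (index x) ≈ x
   ind-rep : ∀ i -> index (rep i) ≡ i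
  _≈?_ : ∀ x y -> Dec (x ≈ y)
  x ≈? y with index x FinP.≟ index y
  ... | yes e = yes (trans (sym (rep-ind x)) (trans (reflexive (ap rep e)) (rep-ind y)))
  ... | no ne = no (\ e -> ne (ind-cong e))

 module Fer (R : CommutativeRing 0ℓ 0ℓ) (n : ℕ) (F : FinDom R n) where
  open Kit R hiding (sum-permute; sum-cong-≋; ∑-distrib-+; sum-remove)
  open FinDom F
  open import Algebra.Properties.CommutativeMonoid.Sum *-commutativeMonoid renaming (sum to product) using (sum-permute; sum-cong-≋; ∑-distrib-+; sum-remove)
  cancel : ∀ x {y z} -> ¬ (x ≈ 0#) -> x * y ≈ x * z -> y ≈ z
  cancel x {y} {z} x≉0 e with dom x (y - z) (solve 3 (\ x y z -> x :* (y :- z) := x :* y :- x :* z) refl x y z & to-dif e)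
  ... | inj₁ x≈0 = ⊥-elim (x≉0 x≈0)
  ... | inj₂ d = from-dif d
  private
   -- Replacing 0 by 1 turns the product over all elements into the product of the nonzero ones,
   -- without an enumeration of the latter.
   nz : Carrier -> Carrier
   nz y with y ≈? 0#
   ... | yes _ = 1#
   ... | no _ = y
   nz≉0 : ∀ y -> ¬ (nz y ≈ 0#)
   nz≉0 y with y ≈? 0#
   ... | yes _ = 1≉0
   ... | no ne = ne
   nz-cong : ∀ {y z} -> y ≈ z -> nz y ≈ nz z
   nz-cong {y} {z} e with y ≈? 0# | z ≈? 0#
   ... | yes _ | yes _ = refl
   ... | no _ | no _ = e
   ... | yes a | no b = ⊥-elim (b (sym e & a))
   ... | no a | yes b = ⊥-elim (a (e & b))
   pro≉0 : ∀ {k} (f : Vector Carrier k) -> (∀ i -> ¬ (f i ≈ 0#)) -> ¬ (product f ≈ 0#)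
   pro≉0 {zero} f h = 1≉0
   pro≉0 {suc k} f h e with dom _ _ e
   ... | inj₁ a = h Fin.zero a
   ... | inj₂ b = pro≉0 (f ∘ Fin.suc) (h ∘ Fin.suc) b
   pro-con : ∀ {k} x -> product {k} (\ _ -> x) ≈ x ^ k
   pro-con {zero} x = refl
   pro-con {suc k} x = *-congˡ (pro-con {k} x)
   module _ (x : Carrier) (x≉0 : ¬ (x ≈ 0#)) where
    fac : Carrier -> Carrier
    fac y with y ≈? 0#
    ... | yes _ = 1#
    ... | no _ = x
    nz-* : ∀ y -> nz (x * y) ≈ fac y * nz y
    nz-* y with y ≈? 0# | (x * y) ≈? 0#
    ... | yes _ | yes _ = sym (*-identityˡ _)
    ... | yes a | no b = ⊥-elim (b (*-congˡ a & zeroʳ x))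
    ... | no _ | no _ = refl
    ... | no a | yes b with dom x y b
    ... | inj₁ c = ⊥-elim (x≉0 c)
    ... | inj₂ c = ⊥-elim (a c)
    move : Fin n -> Fin n
    move i = index (x * rep i)
    move-inj : ∀ {i j} -> move i ≡ move j -> i ≡ j
    move-inj {i} {j} e = ! (ind-rep i) ∙ ind-cong (cancel x x≉0 (sym (rep-ind _) & reflexive (ap rep e) & rep-ind _)) ∙ ind-rep j
    back : Fin n -> Fin n
    back j = proj₁ (inj⇒sur move move-inj j)
    move-back : ∀ j -> move (back j) ≡ j
    move-back j = proj₂ (inj⇒sur move move-inj j)
    -- Multiplication by x permutes the elements, so it leaves the product of all `nz` unchanged.
    -- Cancelling this product leaves the factors `fac`, which are x except for a single 1.
    prod-fac : product {n} (\ i -> fac (rep i)) ≈ 1#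
    prod-fac = cancel (product {n} (\ i -> nz (rep i))) (pro≉0 _ (\ i -> nz≉0 (rep i))) (*-comm _ _ & sym (∑-distrib-+ (\ i -> fac (rep i)) (\ i -> nz (rep i))) & sum-cong-≋ (\ i -> sym (nz-* (rep i)) & nz-cong (sym (rep-ind (x * rep i)))) & sym (sum-permute (\ i -> nz (rep i)) (permutation move back move-back (\ i -> move-inj (move-back (move i))))) & sym (*-identityʳ _))
    fac-0 : fac (rep (index 0#)) ≈ 1#
    fac-0 with rep (index 0#) ≈? 0#
    ... | yes _ = refl
    ... | no a = ⊥-elim (a (rep-ind 0#))
    fac-≢ : ∀ i -> i ≢ index 0# -> fac (rep i) ≈ x
    fac-≢ i ne with rep i ≈? 0#
    ... | yes a = ⊥-elim (ne (! (ind-rep i) ∙ ind-cong a))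
    ... | no _ = refl
  private
   non-case : ∀ {k} -> n ≡ suc k -> ∀ x -> ¬ (x ≈ 0#) -> x ^ k ≈ 1#
   non-case {k} idp x x≉0 = begin x ^ k ≈⟨ pro-con {k} x ⟨ product {k} (\ _ -> x) ≈⟨ sum-cong-≋ (\ i -> fac-≢ x x≉0 (Fin.punchIn z i) (FinP.punchInᵢ≢i z i)) ⟨ product (\ i -> f (Fin.punchIn z i)) ≈⟨ *-identityˡ _ ⟨ 1# * product (\ i -> f (Fin.punchIn z i)) ≈⟨ *-congʳ (fac-0 x x≉0) ⟨ f z * product (\ i -> f (Fin.punchIn z i)) ≈⟨ sum-remove {i = z} f ⟨ product f ≈⟨ prod-fac x x≉0 ⟩ 1# ∎
    where
    z = index 0#
    f : Vector Carrier n
    f i = fac x x≉0 (rep i)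
  fer : ∀ x -> x ^ n ≈ x
  fer x = go n idp
   where
   go : ∀ m -> n ≡ m -> x ^ m ≈ x
   go zero e with () ← ≡.subst Fin e (index x)
   go (suc k) e with x ≈? 0#
   ... | yes x≈0 = *-congʳ x≈0 & zeroˡ _ & sym x≈0
   ... | no x≉0 = *-congˡ (non-case e x x≉0) & *-identityʳ x

open FinRin

-- Irreducible polynomials over a finite field and Euclid's lemma.

module Fac where

 open N using (_≤_; _<_)
 open import Data.Fin.Base using (fromℕ<)
 open import Function.Bundles using (Inverse)
 open import Relation.Nullary.Decidable using (_×-dec_; ¬?; map′)

 fieRing : ∀ {q} -> FiniteField q -> CommutativeRing 0ℓ 0ℓ
 fieRing K = record { isCommutativeRing = FiniteField.isCommutativeRing K }

 module Factorisation {q : ℕ} (K : FiniteField q) where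
  open FiniteField K using (enum; inverse; 0≢1) public
  module K = Kit (fieRing K)
  open Pol (fieRing K) public
  module P = Kit polyRing
  private module S = Kit serRing
  open K using (Carrier; 0#; 1#)
  elt : Fin q -> Carrier
  elt = Inverse.to enum
  idx : Carrier -> Fin q
  idx = Inverse.from enum
  elt-idx : ∀ x -> elt (idx x) ≡ x
  elt-idx = Inverse.strictlyInverseˡ enum
  idx-elt : ∀ i -> idx (elt i) ≡ i
  idx-elt = Inverse.strictlyInverseʳ enum
  opaque
   _≟ᴷ_ : ∀ (x y : Carrier) -> Dec (x ≡ y)
   x ≟ᴷ y = map′ (\ e -> ! (elt-idx x) ∙ ap elt e ∙ elt-idx y) (ap idx) (idx x FinP.≟ idx y)
  opaque
   anyVec : ∀ k {Q : Vec Carrier k -> Set} -> (∀ v -> Dec (Q v)) -> Dec (Σ _ Q)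
   anyVec zero Q? = map′ ([] ,_) (\ { ([] , h) -> h }) (Q? [])
   anyVec (suc k) {Q} Q? = map′ (\ { (i , v , h) -> elt i ∷ v , h }) (\ { (a ∷ v , h) -> idx a , v , ≡.subst (\ b -> Q (b ∷ v)) (! (elt-idx a)) h }) (FinP.any? (\ i -> anyVec k (\ v -> Q? (elt i ∷ v))))
  opaque
   zeroSeq? : ∀ n f -> Deg< f n -> Dec (f ≋ 𝟘)
   zeroSeq? n f d = map′ (\ h i -> go h i) (\ h i -> h (toℕ i)) (FinP.all? {n} (\ i -> f (toℕ i) ≟ᴷ 0#))
    where
    go : (∀ (i : Fin n) -> f (toℕ i) ≡ 0#) -> ∀ i -> f i ≡ 0#
    go h i with i NP.<? n
    ... | yes l = ap f (! (FinP.toℕ-fromℕ< l)) ∙ h (fromℕ< l)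
    ... | no l = d i (NP.≮⇒≥ l)
  monP : ∀ {k} -> Vec Carrier k -> Poly
  monP {k} v = poly (mon v) (suc k) (proj₂ (mon-Mon v))
  infix 4 _∣_
  _∣_ : Poly -> Poly -> Set
  D ∣ F = Σ[ w ∈ Poly ] F P.≈ D P.* w
  ∣-trans : ∀ {A B C} -> A ∣ B -> B ∣ C -> A ∣ C
  ∣-trans {A} {B} {C} (w , e) (v , e') = w P.* v , e' P.& P.*-congʳ {v} {B} {A P.* w} e P.& P.*-assoc A w v
  ∣-* : ∀ D F -> D ∣ D P.* F
  ∣-* D F = F , P.refl {D P.* F}
  ∣-*ˡ : ∀ {D} G F -> D ∣ F -> D ∣ G P.* F
  ∣-*ˡ {D} G F (w , e) = G P.* w , P.*-congˡ {G} {F} {D P.* w} e P.& P.solve 3 (\ g d w -> g P.:* (d P.:* w) P.:= d P.:* (g P.:* w)) P.refl G D w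
  opaque
   divide : ∀ {d} (v : Vec Carrier d) F -> Σ[ w ∈ Poly ] Σ[ r ∈ Poly ] (Deg< (coeff r) d × F P.≈ monP v P.* w P.+ r)
   divide {d} v F with divMon {mon v} (mon-Mon v) (bound F) (coeff F) (degree F)
   ... | w , r , dw , dr , e = poly w (bound F) dw , poly r d dr , dr , ⟪ e ⟫
  -- The difference of the two cofactors times v equals r, whose degree is below that of v.
  rem-zero : ∀ {d} (v : Vec Carrier d) F w r -> Deg< (coeff r) d -> F P.≈ monP v P.* w P.+ r -> monP v ∣ F -> coeff r ≋ 𝟘
  rem-zero {d} v F w r dr e (w' , e') = r≋0
   where
   diff : monP v P.* (w' P.- w) P.≈ r
   diff = P.solve 3 (\ a b c -> a P.:* (b P.:- c) P.:= a P.:* b P.:- a P.:* c) P.refl (monP v) w' w P.& P.+-congʳ {P.- (monP v P.* w)} {monP v P.* w'} {monP v P.* w P.+ r} (P.sym {F} {monP v P.* w'} e' P.& e) P.& P.solve 2 (\ a b -> a P.:+ b P.:- a P.:= b) P.refl (monP v P.* w) r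
   small : coeff (w' P.- w) ≋ 𝟘
   small = Mon-⊛-sma (mon-Mon v) _ _ (degree (w' P.- w)) (Deg<-resp (≋-sym (atᴾ diff)) dr)
   r≋0 : coeff r ≋ 𝟘
   r≋0 = ≋-trans (≋-sym (atᴾ diff)) (≋-trans (⊛-cong {mon v} ≋-refl small) (⊛-zeroʳ (mon v)))
  opaque
   _∣?_ : ∀ {d} (v : Vec Carrier d) F -> Dec (monP v ∣ F)
   _∣?_ {d} v F with divide v F
   ... | w , r , dr , e with zeroSeq? d (coeff r) dr
   ... | yes z = yes (w , e P.& P.+-congˡ {monP v P.* w} {r} {P.0#} ⟪ z ⟫ P.& P.+-identityʳ (monP v P.* w))
   ... | no nz = no (\ h -> nz (rem-zero v F w r dr e h))
  opaque
   normalise : ∀ n F -> Deg< (coeff F) n -> (F P.≈ P.0#) ⊎ (Σ[ k ∈ ℕ ] Σ[ v ∈ Vec Carrier k ] Σ[ c ∈ Carrier ] (k < n × c ≢ 0# × F P.≈ conP c P.* monP v))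
   normalise zero F d = inj₁ ⟪ (\ i -> d i z≤n) ⟫
   normalise (suc n) F d with coeff F n ≟ᴷ 0#
   ... | yes e with normalise n F d'
    where
    d' : Deg< (coeff F) n
    d' i l with NP.m≤n⇒m<n∨m≡n l
    ... | inj₁ n<i = d i n<i
    ... | inj₂ idp = e
   ... | inj₁ z = inj₁ z
   ... | inj₂ (k , v , c , k<n , r) = inj₂ (k , v , c , NP.m<n⇒m<1+n k<n , r)
   normalise (suc n) F d | no ne with inverse (coeff F n) ne
   ... | y , cy = inj₂ (n , toVec n G , coeff F n , NP.n<1+n n , ne , ⟪ eq ⟫)
    where
    G : Seq
    G = scale y (coeff F)
    monG : Monic G n
    monG = K.*-comm y _ ∙ cy , \ i l -> ap (y K.*_) (d i l) ∙ K.zeroʳ y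
    eq : coeff F ≋ const (coeff F n) ⊛ mon (toVec n G)
    eq i = ! (con-⊛ (coeff F n) _ i ∙ ap (coeff F n K.*_) (mon-toVec n G monG i) ∙ ! (K.*-assoc _ _ _) ∙ ap (K._* coeff F i) cy ∙ K.*-identityˡ _)
  1≢0 : 1# ≢ 0#
  1≢0 e = 0≢1 (! e)

  -- A monic polynomial of degree e < d is not divisible by one of degree d.
  ∣-deg : ∀ {d e} (u : Vec Carrier d) (v : Vec Carrier e) -> monP u ∣ monP v -> d ≤ e
  ∣-deg {d} {e} u v (w , eq) with d NP.≤? e
  ... | yes l = l
  ... | no nl = ⊥-elim (1≢0 (! (proj₁ (mon-Mon v)) ∙ atᴾ eq e ∙ ≋-trans (⊛-cong {mon u} ≋-refl w≋0) (⊛-zeroʳ (mon u)) e))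
   where
   w≋0 : coeff w ≋ 𝟘
   w≋0 = Mon-⊛-sma (mon-Mon u) _ _ (degree w) (Deg<-resp {mon v} (atᴾ eq) (Deg<-mono (NP.≰⇒> nl) (proj₂ (mon-Mon v))))
  mon-inj : ∀ {k} (u v : Vec Carrier k) -> mon u ≋ mon v -> u ≡ v
  mon-inj [] [] e = idp
  mon-inj (a ∷ u) (b ∷ v) e = ap₂ _∷_ (e 0) (mon-inj u v (e ∘ suc))
  -- If v = u w, then u (w - 1) = v - u has degree below d because the leading terms cancel, so w =
  -- 1.
  ∣-same-deg : ∀ {d} (u v : Vec Carrier d) -> monP u ∣ monP v -> u ≡ v
  ∣-same-deg {d} u v (w , eq) = mon-inj u v (≋-sym v≋u)
   where
   w≋1 : coeff (w P.- P.1#) ≋ 𝟘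
   w≋1 = Mon-⊛-sma (mon-Mon u) _ _ (degree (w P.- P.1#)) small
    where
    diff : mon u ⊛ coeff (w P.- P.1#) ≋ mon v ⊕ (⊖ mon u)
    diff = at (S.distribˡ (mon u) (coeff w) (⊖ 𝟙) S.& S.+-cong (S.sym ⟪ atᴾ eq ⟫) (S.sym (S.-‿distribʳ-* (mon u) 𝟙) S.& S.-‿cong (S.*-identityʳ (mon u))))
    small : Deg< (mon u ⊛ coeff (w P.- P.1#)) d
    small i l with NP.m≤n⇒m<n∨m≡n l
    ... | inj₁ d<i = diff i ∙ ap₂ (\ a b -> a K.- b) (proj₂ (mon-Mon v) i d<i) (proj₂ (mon-Mon u) i d<i) ∙ K.-‿inverseʳ 0#
    ... | inj₂ idp = diff i ∙ ap₂ (\ a b -> a K.- b) (proj₁ (mon-Mon v)) (proj₁ (mon-Mon u)) ∙ K.-‿inverseʳ 1#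
   v≋u : mon v ≋ mon u
   v≋u = ≋-trans (atᴾ eq) (≋-trans (⊛-cong {mon u} ≋-refl (at (S.from-dif {coeff w} {𝟙} ⟪ w≋1 ⟫))) (⊛-ideʳ (mon u)))
  Irreducible : ∀ {d} -> Vec Carrier d -> Set
  Irreducible {d} v = 1 ≤ d × (∀ j -> 0 < j -> j < d -> (u : Vec Carrier j) -> ¬ (monP u ∣ monP v))
  -- The degree ranges over `Fin d`, which makes the existence of a proper divisor a finite search.
  ProDiv : ∀ {d} -> Vec Carrier d -> Set
  ProDiv {d} v = Σ[ j ∈ Fin d ] (0 < toℕ j) × (Σ[ u ∈ Vec Carrier (toℕ j) ] (monP u ∣ monP v))
  noProDiv : ∀ {d} (v : Vec Carrier d) -> ¬ ProDiv v -> ∀ j -> 0 < j -> j < d -> (u : Vec Carrier j) -> ¬ (monP u ∣ monP v)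
  noProDiv {d} v n j 0<j j<d u h = n (fromℕ< j<d , ≡.subst (0 <_) (! (FinP.toℕ-fromℕ< j<d)) 0<j , ≡.subst (\ k -> Σ[ u ∈ Vec Carrier k ] (monP u ∣ monP v)) (! (FinP.toℕ-fromℕ< j<d)) (u , h))
  opaque
   proDiv? : ∀ {d} (v : Vec Carrier d) -> Dec (ProDiv v)
   proDiv? {d} v = FinP.any? (\ j -> (0 NP.<? toℕ j) ×-dec anyVec (toℕ j) (\ u -> u ∣? monP v))
   irr? : ∀ {d} (v : Vec Carrier d) -> Dec (Irreducible v)
   irr? {d} v = (1 NP.≤? d) ×-dec map′ (noProDiv v) (\ { h (j , 0<j , u , e) -> h (toℕ j) 0<j (FinP.toℕ<n j) u e }) (¬? (proDiv? v))
  opaque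
   -- While a proper divisor exists, pass to it; n bounds the degrees and makes the descent
   -- structural.
   irrFac : ∀ n {k} -> k ≤ n -> 1 ≤ k -> (v : Vec Carrier k) -> Σ[ d ∈ ℕ ] Σ[ u ∈ Vec Carrier d ] (Irreducible u × monP u ∣ monP v)
   irrFac zero k≤n 1≤k v with () ← NP.≤-trans 1≤k k≤n
   irrFac (suc n) {k} k≤n 1≤k v with proDiv? v
   ... | no h = k , v , (1≤k , noProDiv v h) , (P.1# , P.sym {monP v P.* P.1#} {monP v} (P.*-identityʳ (monP v)))
   ... | yes (j , 0<j , u , e) with irrFac n (NP.≤-pred (NP.<-≤-trans (FinP.toℕ<n j) k≤n)) 0<j u
   ... | d , t , irr , e' = d , t , irr , ∣-trans {monP t} {monP u} {monP v} e' e
  con-can : ∀ {D} c F -> c ≢ 0# -> D ∣ conP c P.* F -> D ∣ F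
  con-can {D} c F c≢0 (w , e) with inverse c c≢0
  ... | y , cy = conP y P.* w , P.sym {conP y P.* (conP c P.* F)} {F} one P.& P.*-congˡ {conP y} {conP c P.* F} {D P.* w} e P.& P.solve 3 (\ g d w -> g P.:* (d P.:* w) P.:= d P.:* (g P.:* w)) P.refl (conP y) D w
   where
   one : conP y P.* (conP c P.* F) P.≈ F
   one = ⟪ (\ i -> con-⊛ y _ i ∙ ap (y K.*_) (con-⊛ c (coeff F) i) ∙ ! (K.*-assoc _ _ _) ∙ ap (K._* coeff F i) (K.*-comm y c ∙ cy) ∙ K.*-identityˡ _) ⟫
  private
   -- One division step of the descent in Euclid's lemma: t B = A B - w (r B).
   sub∣ : ∀ {D} A r w B t -> A P.≈ r P.* w P.+ t -> D ∣ A P.* B -> D ∣ r P.* B -> D ∣ t P.* B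
   sub∣ {D} A r w B t e (u , e1) (u' , e2) = u P.- w P.* u' , P.solve 4 (\ r w t b -> t P.:* b P.:= (r P.:* w P.:+ t) P.:* b P.:- w P.:* (r P.:* b)) P.refl r w t B P.& P.+-cong {(r P.* w P.+ t) P.* B} {D P.* u} {P.- (w P.* (r P.* B))} {P.- (w P.* (D P.* u'))} (P.*-congʳ {B} {r P.* w P.+ t} {A} (P.sym {A} {r P.* w P.+ t} e) P.& e1) (P.-‿cong {w P.* (r P.* B)} {w P.* (D P.* u')} (P.*-congˡ {w} {r P.* B} {D P.* u'} e2)) P.& P.solve 4 (\ d u w u' -> d P.:* u P.:- w P.:* (d P.:* u') P.:= d P.:* (u P.:- w P.:* u')) P.refl D u w u'
  opaque
   -- Euclid's lemma by descent instead of Bézout: division of v by r leaves t of smaller degree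
   -- with v dividing t B, and t is nonzero because the irreducible v has no divisor r of degree
   -- strictly between 0 and d. The descent ends in degree 0, where r = 1.
   euc-mon : ∀ {d} {v : Vec Carrier d} -> Irreducible v -> ∀ n {j} -> j < n -> j < d -> ∀ (r : Vec Carrier j) B -> monP v ∣ monP r P.* B -> monP v ∣ B
   euc-mon irr (suc n) {zero} j<n j<d [] B (w , e) = w , ⟪ ≋-trans (≋-sym (⊛-ideˡ (coeff B))) (atᴾ e) ⟫
   euc-mon {d} {v} irr (suc n) {suc j} (s≤s j<n) j<d r B h with divide r (monP v)
   ... | w , t , dt , e with normalise (suc j) t dt
   ... | inj₁ z = ⊥-elim (proj₂ irr (suc j) (s≤s z≤n) j<d r (w , e P.& P.+-congˡ {monP r P.* w} {t} {P.0#} z P.& P.+-identityʳ (monP r P.* w)))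
   ... | inj₂ (k , u , c , k≤j , c≢0 , et) = euc-mon {v = v} irr n (NP.<-≤-trans k≤j j<n) (NP.<-trans k≤j j<d) u B (con-can {monP v} c (monP u P.* B) c≢0 (proj₁ div-rem , (P.sym {conP c P.* monP u P.* B} {conP c P.* (monP u P.* B)} (P.*-assoc (conP c) (monP u) B) P.& P.*-congʳ {B} {conP c P.* monP u} {t} (P.sym {t} {conP c P.* monP u} et)) P.& proj₂ div-rem))
    where
    div-rem : monP v ∣ t P.* B
    div-rem = sub∣ {monP v} (monP v) (monP r) w B t e (∣-* (monP v) B) h
  opaque
   euc : ∀ {d} {v : Vec Carrier d} -> Irreducible v -> ∀ A B -> monP v ∣ A P.* B -> (monP v ∣ A) ⊎ (monP v ∣ B)
   euc {d} {v} irr A B h with divide v A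
   ... | w , t , dt , e with normalise d t dt
   ... | inj₁ z = inj₁ (w , e P.& P.+-congˡ {monP v P.* w} {t} {P.0#} z P.& P.+-identityʳ (monP v P.* w))
   ... | inj₂ (k , u , c , k<d , c≢0 , et) = inj₂ (euc-mon {v = v} irr d k<d k<d u B (con-can {monP v} c (monP u P.* B) c≢0 (proj₁ div-rem , (P.sym {conP c P.* monP u P.* B} {conP c P.* (monP u P.* B)} (P.*-assoc (conP c) (monP u) B) P.& P.*-congʳ {B} {conP c P.* monP u} {t} (P.sym {t} {conP c P.* monP u} et)) P.& proj₂ div-rem)))
    where
    div-rem : monP v ∣ t P.* B
    div-rem = sub∣ {monP v} A (monP v) w B t e h (∣-* (monP v) B)

open Fac

-- Finite sums, Iverson brackets, and sums over monic polynomials.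

module Summation where

 open N using (_≤_; _<_)
 open import Data.Fin.Base using (fromℕ<)
 import Data.Vec.Properties as VecP

 module RanSums (S : CommutativeRing 0ℓ 0ℓ) where
  open Kit S
  opaque
   sumTo : ℕ -> (ℕ -> Carrier) -> Carrier
   sumTo n f = sum {n} (f ∘ toℕ)
  opaque
   unfolding sumTo
   sumTo-zero : ∀ f -> sumTo 0 f ≡ 0#
   sumTo-zero f = idp
   sumTo-suc : ∀ n f -> sumTo (suc n) f ≡ f 0 + sumTo n (f ∘ suc)
   sumTo-suc n f = idp
   sumTo-sum : ∀ n f -> sumTo n f ≡ sum {n} (f ∘ toℕ)
   sumTo-sum n f = idp
   sumTo-comm : ∀ m n (f : ℕ -> ℕ -> Carrier) -> sumTo m (\ i -> sumTo n (f i)) ≈ sumTo n (\ j -> sumTo m (\ i -> f i j))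
   sumTo-comm m n f = ∑-comm {m} {n} (\ i j -> f (toℕ i) (toℕ j))
  opaque
   unfolding sumTo
   sumTo-cong : ∀ n {f g : ℕ -> Carrier} -> (∀ i -> i < n -> f i ≈ g i) -> sumTo n f ≈ sumTo n g
   sumTo-cong n h = sum-cong-≋ {n} (\ i -> h (toℕ i) (FinP.toℕ<n i))
  opaque
   unfolding sumTo
   sumTo-0 : ∀ n {f : ℕ -> Carrier} -> (∀ i -> i < n -> f i ≈ 0#) -> sumTo n f ≈ 0#
   sumTo-0 n h = sumTo-cong n h & sum-replicate-zero n
  opaque
   unfolding sumTo
   sumTo-snoc : ∀ n f -> sumTo (suc n) f ≈ sumTo n f + f n
   sumTo-snoc zero f = +-comm _ _
   sumTo-snoc (suc n) f = +-congˡ (sumTo-snoc n (f ∘ suc)) & sym (+-assoc _ _ _)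
  opaque
   unfolding sumTo
   sumTo-ext : ∀ {m n} -> m ≤ n -> ∀ f -> (∀ i -> m ≤ i -> f i ≈ 0#) -> sumTo n f ≈ sumTo m f
   sumTo-ext {n = n} z≤n f h = sumTo-0 n (\ i _ -> h i z≤n)
   sumTo-ext (s≤s l) f h = +-congˡ (sumTo-ext l (f ∘ suc) (\ i k -> h (suc i) (s≤s k)))
  opaque
   unfolding sumTo
   sumTo-sin : ∀ n j f -> j < n -> (∀ i -> i ≢ j -> f i ≈ 0#) -> sumTo n f ≈ f j
   sumTo-sin (suc n) zero f l h = +-congˡ (sumTo-0 n (\ i _ -> h (suc i) (\ ()))) & +-identityʳ _
   sumTo-sin (suc n) (suc j) f (s≤s l) h = +-cong (h 0 (\ ())) (sumTo-sin n j (f ∘ suc) l (\ i ne -> h (suc i) (ne ∘ NP.suc-injective))) & +-identityˡ _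
  opaque
   unfolding sumTo
   sumTo-+ : ∀ n f g -> sumTo n (\ i -> f i + g i) ≈ sumTo n f + sumTo n g
   sumTo-+ n f g = ∑-distrib-+ {n} (f ∘ toℕ) (g ∘ toℕ)
  opaque
   unfolding sumTo
   sumTo-*ˡ : ∀ n x f -> x * sumTo n f ≈ sumTo n (\ i -> x * f i)
   sumTo-*ˡ n x f = *-distribˡ-sum {n} x (f ∘ toℕ)
  opaque
   unfolding sumTo
   sumTo-*ʳ : ∀ n x f -> sumTo n f * x ≈ sumTo n (\ i -> f i * x)
   sumTo-*ʳ n x f = *-distribʳ-sum {n} x (f ∘ toℕ)
  opaque
   unfolding sumTo
   sumTo-rev : ∀ n f -> sumTo (suc n) f ≈ sumTo (suc n) (\ i -> f (n ∸ i))
   sumTo-rev zero f = refl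
   sumTo-rev (suc n) f = sumTo-snoc (suc n) f & +-comm _ _ & +-congˡ (sumTo-rev n f)
  open Ser S using (_⊛_)
  opaque
   unfolding sumTo
   ⊛-sum : ∀ f g n -> (f ⊛ g) n ≈ sumTo (suc n) (\ i -> f i * g (n ∸ i))
   ⊛-sum f g zero = sym (+-identityʳ _)
   ⊛-sum f g (suc n) = +-congˡ (⊛-sum (f ∘ suc) g n)

  -- Iverson brackets
  opaque
   [_] : ∀ {A : Set} -> Dec A -> Carrier
   [ yes _ ] = 1#
   [ no _ ] = 0#
  opaque
   unfolding [_]
   [yes] : ∀ {A : Set} (d : Dec A) -> A -> [ d ] ≈ 1#
   [yes] (yes _) a = refl
   [yes] (no na) a = ⊥-elim (na a)
  opaque
   unfolding [_]
   [no] : ∀ {A : Set} (d : Dec A) -> ¬ A -> [ d ] ≈ 0#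
   [no] (yes a) na = ⊥-elim (na a)
   [no] (no _) na = refl
  [⇔] : ∀ {A B : Set} (d : Dec A) (e : Dec B) -> (A -> B) -> (B -> A) -> [ d ] ≈ [ e ]
  [⇔] d@(yes a) e f g = [yes] d a & sym ([yes] e (f a))
  [⇔] d@(no na) e f g = [no] d na & sym ([no] e (na ∘ g))
  [×] : ∀ {A B C : Set} (d : Dec A) (e : Dec B) (f : Dec C) -> (A -> B) -> (A -> C) -> (B -> C -> A) -> [ d ] ≈ [ e ] * [ f ]
  [×] d e@(yes b) f@(yes c) _ _ h = [yes] d (h b c) & sym (*-cong ([yes] e b) ([yes] f c) & *-identityˡ _)
  [×] d e@(no nb) f g _ _ = [no] d (nb ∘ g) & sym (*-congʳ ([no] e nb) & zeroˡ _)
  [×] d e@(yes _) f@(no nc) _ g _ = [no] d (nc ∘ g) & sym (*-congˡ ([no] f nc) & zeroʳ _)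
  opaque
   unfolding [_]
   sum-δ : ∀ {n} (j : Fin n) (f : Fin n -> Carrier) -> sum (\ i -> [ i FinP.≟ j ] * f i) ≈ f j
   sum-δ {suc n} Fin.zero f = +-cong (*-identityˡ _) (sum-cong-≋ {n} (\ i -> zeroˡ _) & sum-replicate-zero n) & +-identityʳ _
   sum-δ {suc n} (Fin.suc j) f = +-cong (zeroˡ _) (sum-cong-≋ {n} (\ i -> *-congʳ ([⇔] (Fin.suc i FinP.≟ Fin.suc j) (i FinP.≟ j) FinP.suc-injective (ap Fin.suc))) & sum-δ j (f ∘ Fin.suc)) & +-identityˡ _

 module VecSums {q : ℕ} (K : FiniteField q) (S : CommutativeRing 0ℓ 0ℓ) where
  open Factorisation K using (elt; idx; elt-idx; idx-elt; _≟ᴷ_; module K)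
  open Kit S
  open RanSums S public
  opaque
   sumV : ∀ k -> (Vec K.El k -> Carrier) -> Carrier
   sumV zero f = f []
   sumV (suc k) f = sum {q} (\ i -> sumV k (\ v -> f (elt i ∷ v)))
  opaque
   unfolding sumV
   sumV-cong : ∀ k {f g : Vec K.El k -> Carrier} -> (∀ v -> f v ≈ g v) -> sumV k f ≈ sumV k g
   sumV-cong zero h = h []
   sumV-cong (suc k) h = sum-cong-≋ {q} (\ i -> sumV-cong k (\ v -> h _))
  opaque
   unfolding sumV
   sumV-0 : ∀ k {f : Vec K.El k -> Carrier} -> (∀ v -> f v ≈ 0#) -> sumV k f ≈ 0#
   sumV-0 zero h = h []
   sumV-0 (suc k) h = sum-cong-≋ {q} (\ i -> sumV-0 k (\ v -> h _)) & sum-replicate-zero q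
  opaque
   unfolding sumV
   sumV-+ : ∀ k f g -> sumV k (\ v -> f v + g v) ≈ sumV k f + sumV k g
   sumV-+ zero f g = refl
   sumV-+ (suc k) f g = sum-cong-≋ {q} (\ i -> sumV-+ k _ _) & ∑-distrib-+ {q} _ _
  opaque
   unfolding sumV
   sumV-*ˡ : ∀ k x f -> x * sumV k f ≈ sumV k (\ v -> x * f v)
   sumV-*ˡ zero x f = refl
   sumV-*ˡ (suc k) x f = *-distribˡ-sum {q} x _ & sum-cong-≋ {q} (\ i -> sumV-*ˡ k x _)
  sumV-*ʳ : ∀ k x f -> sumV k f * x ≈ sumV k (\ v -> f v * x)
  sumV-*ʳ k x f = *-comm _ _ & sumV-*ˡ k x f & sumV-cong k (\ v -> *-comm _ _)
  opaque
   unfolding sumV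
   sumV-sum : ∀ k n (f : Vec K.El k -> Fin n -> Carrier) -> sumV k (\ v -> sum (f v)) ≈ sum (\ i -> sumV k (\ v -> f v i))
   sumV-sum zero n f = refl
   sumV-sum (suc k) n f = sum-cong-≋ {q} (\ i -> sumV-sum k n _) & ∑-comm {q} {n} _
  opaque
   unfolding sumV sumTo
   sumV-sumTo : ∀ k n (f : Vec K.El k -> ℕ -> Carrier) -> sumV k (\ v -> sumTo n (f v)) ≈ sumTo n (\ i -> sumV k (\ v -> f v i))
   sumV-sumTo k n f = sumV-sum k n (\ v i -> f v (toℕ i))
  opaque
   unfolding sumV
   sumV-nil : ∀ f -> sumV 0 f ≡ f []
   sumV-nil f = idp
   sumV-cons : ∀ k f -> sumV (suc k) f ≡ sum {q} (\ i -> sumV k (\ v -> f (elt i ∷ v)))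
   sumV-cons k f = idp
  opaque
   unfolding sumV
   sumV-sumV : ∀ j k (f : Vec K.El j -> Vec K.El k -> Carrier) -> sumV j (\ u -> sumV k (f u)) ≈ sumV k (\ v -> sumV j (\ u -> f u v))
   sumV-sumV zero k f = refl
   sumV-sumV (suc j) k f = sum-cong-≋ {q} (\ i -> sumV-sumV j k _) & sym (sumV-sum k q _)
  opaque
   _≟ⱽ_ : ∀ {k} (u v : Vec K.El k) -> Dec (u ≡ v)
   _≟ⱽ_ = VecP.≡-dec _≟ᴷ_
  opaque
   unfolding sumV
   sumV-δ : ∀ k v₀ (f : Vec K.El k -> Carrier) -> sumV k (\ v -> [ v ≟ⱽ v₀ ] * f v) ≈ f v₀
   sumV-δ zero [] f = *-congʳ ([yes] ([] ≟ⱽ []) idp) & *-identityˡ _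
   sumV-δ (suc k) (a ∷ v₀) f = begin sum {q} (\ i -> sumV k (\ v -> [ (elt i ∷ v) ≟ⱽ (a ∷ v₀) ] * f (elt i ∷ v))) ≈⟨ sum-cong-≋ {q} (\ i -> sumV-cong k (\ v -> *-congʳ (split i v) & *-assoc _ _ _) & sym (sumV-*ˡ k _ _)) ⟩ sum {q} (\ i -> [ i FinP.≟ idx a ] * sumV k (\ v -> [ v ≟ⱽ v₀ ] * f (elt i ∷ v))) ≈⟨ sum-δ (idx a) _ ⟩ sumV k (\ v -> [ v ≟ⱽ v₀ ] * f (elt (idx a) ∷ v)) ≈⟨ sumV-δ k v₀ _ ⟩ f (elt (idx a) ∷ v₀) ≡⟨ ap (\ b -> f (b ∷ v₀)) (elt-idx a) ⟩ f (a ∷ v₀) ∎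
    where
    split : ∀ i v -> [ (elt i ∷ v) ≟ⱽ (a ∷ v₀) ] ≈ [ i FinP.≟ idx a ] * [ v ≟ⱽ v₀ ]
    split i v = [×] ((elt i ∷ v) ≟ⱽ (a ∷ v₀)) (i FinP.≟ idx a) (v ≟ⱽ v₀) (\ e -> ! (idx-elt i) ∙ ap idx (VecP.∷-injectiveˡ e)) VecP.∷-injectiveʳ (\ { idp idp -> ap (_∷ v) (elt-idx a) })
  -- Double counting: f (ι x) is expanded as a sum over y of the indicator of y = ι x, the sums are
  -- exchanged, and the fibre of the injection ι has one element where D holds and none elsewhere.
  sumV-rei : ∀ {j k} (ι : Vec K.El j -> Vec K.El k) -> (∀ {u v} -> ι u ≡ ι v -> u ≡ v) -> (D : Vec K.El k -> Set) (D? : ∀ y -> Dec (D y)) -> (∀ x -> D (ι x)) -> (∀ y -> D y -> Σ[ x ∈ _ ] ι x ≡ y) -> ∀ (f : Vec K.El k -> Carrier) -> sumV k (\ y -> [ D? y ] * f y) ≈ sumV j (\ x -> f (ι x))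
  sumV-rei {j} {k} ι inj D D? D-ι surj f = sym (begin sumV j (\ x -> f (ι x)) ≈⟨ sumV-cong j (\ x -> sym (sumV-δ k (ι x) f)) ⟩ sumV j (\ x -> sumV k (\ y -> [ y ≟ⱽ ι x ] * f y)) ≈⟨ sumV-sumV j k _ ⟩ sumV k (\ y -> sumV j (\ x -> [ y ≟ⱽ ι x ] * f y)) ≈⟨ sumV-cong k (\ y -> sym (sumV-*ʳ j _ _) & *-congʳ (fibre y)) ⟩ sumV k (\ y -> [ D? y ] * f y) ∎)
   where
   fibre : ∀ y -> sumV j (\ x -> [ y ≟ⱽ ι x ]) ≈ [ D? y ]
   fibre y with D? y
   ... | no nd = sumV-0 j (\ x -> [no] (y ≟ⱽ ι x) (\ e -> nd (≡.subst D (! e) (D-ι x)))) & sym ([no] (no nd) nd)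
   ... | yes d with surj y d
   ... | x₀ , idp = (sumV-cong j (\ x -> [⇔] (ι x₀ ≟ⱽ ι x) (x ≟ⱽ x₀) (\ e -> inj (! e)) (\ { idp -> idp }) & sym (*-identityʳ _)) & sumV-δ j x₀ (\ _ -> 1#)) & sym ([yes] (yes d) d)

 module PriPow {q : ℕ} (K : FiniteField q) where
  open Factorisation K public
  opaque
   product : ∀ {i j} -> Vec K.El i -> Vec K.El j -> Vec K.El (i N.+ j)
   product {i} {j} u v = toVec (i N.+ j) (mon u ⊛ mon v)
  opaque
   unfolding product
   mon-pro : ∀ {i j} (u : Vec K.El i) (v : Vec K.El j) -> mon (product u v) ≋ mon u ⊛ mon v
   mon-pro {i} {j} u v = mon-toVec (i N.+ j) _ (Mon-⊛ {mon u} {mon v} i j (mon-Mon u) (mon-Mon v))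
  pow : ∀ {d} -> Vec K.El d -> ∀ e -> Vec K.El (e N.* d)
  pow v zero = []
  pow v (suc e) = product v (pow v e)
  -- The cofactor w comes with an arbitrary degree bound. As Q is monic, the leading coefficient of
  -- w reappears in h, which has no coefficient beyond k; `down` lowers the bound to k - d step by
  -- step.
  quo-mon : ∀ {d k} (Q : Vec K.El d) {h : Seq} (w : Poly) -> d ≤ k -> Monic h k -> h ≋ mon Q ⊛ coeff w -> Monic (coeff w) (k ∸ d)
  quo-mon {d} {k} Q {h} w d≤k (t , dh) e = ! (lead (k ∸ d) dw) ∙ ap h (NP.m+[n∸m]≡n d≤k) ∙ t , dw
   where
   lead : ∀ m -> Deg< (coeff w) (suc m) -> h (d N.+ m) ≡ coeff w m
   lead m dm = e _ ∙ top-⊛ {mon Q} {coeff w} d m (proj₂ (mon-Mon Q)) dm ∙ ap (K._* coeff w m) (proj₁ (mon-Mon Q)) ∙ K.*-identityˡ _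
   down : ∀ n -> Deg< (coeff w) (suc (k ∸ d) N.+ n) -> Deg< (coeff w) (suc (k ∸ d))
   down zero dm = ≡.subst (Deg< (coeff w)) (NP.+-identityʳ _) dm
   down (suc n) dm = down n dm'
    where
    m = suc (k ∸ d) N.+ n
    dm1 : Deg< (coeff w) (suc m)
    dm1 = ≡.subst (Deg< (coeff w)) (NP.+-suc _ n) dm
    k<d+m : k < d N.+ m
    k<d+m = NP.≤-trans (s≤s (NP.≤-reflexive (! (NP.m+[n∸m]≡n d≤k)))) (NP.≤-trans (NP.≤-reflexive (! (NP.+-suc d (k ∸ d)))) (NP.+-monoʳ-≤ d (NP.m≤m+n _ n)))
    dm' : Deg< (coeff w) m
    dm' i l with NP.m≤n⇒m<n∨m≡n l
    ... | inj₁ m<i = dm1 i m<i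
    ... | inj₂ idp = ! (lead m dm1) ∙ dh _ k<d+m
   dw : Deg< (coeff w) (suc (k ∸ d))
   dw = down (bound w) (Deg<-mono (NP.m≤n+m (bound w) _) (degree w))
  mon-quo : ∀ {d k} (Q : Vec K.El d) (h : Vec K.El k) -> monP Q ∣ monP h -> Σ[ w ∈ Vec K.El (k ∸ d) ] mon h ≋ mon Q ⊛ mon w
  mon-quo {d} {k} Q h (w , e) = toVec _ (coeff w) , ≋-trans (atᴾ e) (⊛-cong {mon Q} ≋-refl (≋-sym (mon-toVec _ (coeff w) (quo-mon Q {mon h} w (∣-deg Q h (w , e)) (mon-Mon h) (atᴾ e)))))
  mon-can : ∀ {d} (Q : Vec K.El d) (f g : Poly) -> monP Q P.* f P.≈ monP Q P.* g -> f P.≈ g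
  mon-can Q f g e = P.from-dif ⟪ Mon-⊛-can (mon-Mon Q) _ _ (degree (f P.- g)) (atᴾ (P.solve 3 (\ a b c -> a P.:* (b P.:- c) P.:= a P.:* b P.:- a P.:* c) P.refl (monP Q) f g P.& P.to-dif e)) ⟫
  module _ {d} (Q : Vec K.El d) where
   pow-suc : ∀ e -> monP (pow Q (suc e)) P.≈ monP Q P.* monP (pow Q e)
   pow-suc e = ⟪ mon-pro Q (pow Q e) ⟫
   pow-suc-∣ : ∀ e {h h₁} -> h P.≈ monP Q P.* h₁ -> monP (pow Q e) ∣ h₁ -> monP (pow Q (suc e)) ∣ h
   pow-suc-∣ e {h} {h₁} eq (w , e') = w , eq P.& P.*-congˡ {monP Q} e' P.& P.sym (P.*-assoc (monP Q) (monP (pow Q e)) w) P.& P.*-congʳ {w} (P.sym (pow-suc e))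
   pow-suc-∣⁻ : ∀ e {h h₁} -> h P.≈ monP Q P.* h₁ -> monP (pow Q (suc e)) ∣ h -> monP (pow Q e) ∣ h₁
   pow-suc-∣⁻ e {h} {h₁} eq (w , e') = w , mon-can Q h₁ (monP (pow Q e) P.* w) (P.sym eq P.& e' P.& P.*-congʳ {w} (pow-suc e) P.& P.*-assoc (monP Q) (monP (pow Q e)) w)
  Same : ∀ {d e} -> Vec K.El d -> Vec K.El e -> Set
  Same {d} {e} u v = Σ[ p ∈ d ≡ e ] ≡.subst (Vec K.El) p u ≡ v
  irr-∣ : ∀ {d e} (u : Vec K.El d) (v : Vec K.El e) -> Irreducible u -> Irreducible v -> monP u ∣ monP v -> Same u v
  irr-∣ {d} {e} u v (1≤d , _) irr h with NP.m≤n⇒m<n∨m≡n (∣-deg u v h)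
  ... | inj₁ d<e = ⊥-elim (proj₂ irr d 1≤d d<e u h)
  ... | inj₂ idp = idp , ∣-same-deg u v h
  -- By Euclid's lemma u divides h₁, because the monic irreducibles u and Q differ; one factor u is
  -- cancelled and the argument repeated.
  pow-∣-oth : ∀ {d₀ d} (Q : Vec K.El d₀) (u : Vec K.El d) -> Irreducible Q -> Irreducible u -> ¬ Same u Q -> ∀ e h₁ -> monP (pow u e) ∣ monP Q P.* h₁ -> monP (pow u e) ∣ h₁
  pow-∣-oth Q u irQ iru ne zero h₁ _ = h₁ , ⟪ ≋-sym (⊛-ideˡ (coeff h₁)) ⟫
  pow-∣-oth Q u irQ iru ne (suc e) h₁ h with euc {v = u} iru (monP Q) h₁ (∣-trans {monP u} {monP (pow u (suc e))} {monP Q P.* h₁} (monP (pow u e) , pow-suc u e) h)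
  ... | inj₁ a = ⊥-elim (ne (irr-∣ u Q iru irQ a))
  ... | inj₂ (h₂ , eq) = pow-suc-∣ u e eq (pow-∣-oth Q u irQ iru ne e h₂ (pow-suc-∣⁻ u e (P.*-congˡ {monP Q} eq P.& P.solve 3 (\ a b c -> a P.:* (b P.:* c) P.:= b P.:* (a P.:* c)) P.refl (monP Q) (monP u) h₂) h))

open Summation

-- The degree as a sum over prime power divisors.

module PriDiv where

 open N using (_≤_; _<_)

 module DegIde {q : ℕ} (K : FiniteField q) (S : CommutativeRing 0ℓ 0ℓ) where
  open PriPow K hiding (_⊛_)
  open Kit S
  open VecSums K S public

  -- A sum over the pairs (prime of degree i + 1, exponent e + 1) with i, e < B.
  sumPri : ℕ -> (∀ {d} -> Vec K.El d -> ℕ -> Carrier) -> Carrier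
  sumPri B g = sumTo B (\ i -> sumV (suc i) (\ v -> sumTo B (\ e -> ([ irr? v ] * fromℕ (suc i)) * g v (suc e))))
  van : ∀ {A : Set} (na : ¬ A) {x y} -> ([ no na ] * x) * y ≈ 0#
  van na = *-congʳ (*-congʳ ([no] (no na) na) & zeroˡ _) & zeroˡ _
  sumPri-cong : ∀ B {g h : ∀ {d} -> Vec K.El d -> ℕ -> Carrier} -> (∀ {d} (v : Vec K.El d) e -> Irreducible v -> 1 ≤ e -> e ≤ B -> g v e ≈ h v e) -> sumPri B g ≈ sumPri B h
  sumPri-cong B {g} {h} eq = sumTo-cong B (\ i _ -> sumV-cong (suc i) (\ v -> sumTo-cong B (\ e e<B -> lemma v e e<B)))
   where
   lemma : ∀ {i} (v : Vec K.El (suc i)) e -> e < B -> ([ irr? v ] * fromℕ (suc i)) * g v (suc e) ≈ ([ irr? v ] * fromℕ (suc i)) * h v (suc e)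
   lemma v e e<B with irr? v
   ... | yes ir = *-congˡ (eq v (suc e) ir (s≤s z≤n) e<B)
   ... | no ni = van ni & sym (van ni)
  sumPri-+ : ∀ B (g h : ∀ {d} -> Vec K.El d -> ℕ -> Carrier) -> sumPri B (\ v e -> g v e + h v e) ≈ sumPri B g + sumPri B h
  sumPri-+ B g h = sumTo-cong B (\ i _ -> sumV-cong (suc i) (\ v -> sumTo-cong B (\ e _ -> distribˡ _ _ _) & sumTo-+ B _ _) & sumV-+ (suc i) _ _) & sumTo-+ B _ _
  sumPri-*ˡ : ∀ B x (g : ∀ {d} -> Vec K.El d -> ℕ -> Carrier) -> x * sumPri B g ≈ sumPri B (\ v e -> x * g v e)
  sumPri-*ˡ B x g = sumTo-*ˡ B x _ & sumTo-cong B (\ i _ -> sumV-*ˡ (suc i) x _ & sumV-cong (suc i) (\ v -> sumTo-*ˡ B x _ & sumTo-cong B (\ e _ -> solve 3 (\ a b c -> a :* (b :* c) := b :* (a :* c)) refl x _ _)))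
  sumPri-0 : ∀ B (g : ∀ {d} -> Vec K.El d -> ℕ -> Carrier) -> (∀ {d} (v : Vec K.El d) e -> Irreducible v -> 1 ≤ e -> e ≤ B -> g v e ≈ 0#) -> sumPri B g ≈ 0#
  sumPri-0 B g h = sumPri-cong B {g} {\ _ _ -> 0#} h & sumTo-0 B (\ i _ -> sumV-0 (suc i) (\ v -> sumTo-0 B (\ e _ -> zeroʳ _)))
  sumPri-sumTo : ∀ B n (g : ℕ -> ∀ {d} -> Vec K.El d -> ℕ -> Carrier) -> sumTo n (\ j -> sumPri B (g j)) ≈ sumPri B (\ v e -> sumTo n (\ j -> g j v e))
  sumPri-sumTo B n g = sumTo-comm n B _ & sumTo-cong B (\ i _ -> sym (sumV-sumTo (suc i) n _) & sumV-cong (suc i) (\ v -> sumTo-comm n B _ & sumTo-cong B (\ e _ -> sym (sumTo-*ˡ n _ _))))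
  sumPri-sumV : ∀ B k (g : Vec K.El k -> ∀ {d} -> Vec K.El d -> ℕ -> Carrier) -> sumV k (\ h -> sumPri B (g h)) ≈ sumPri B (\ v e -> sumV k (\ h -> g h v e))
  sumPri-sumV B k g = sumV-sumTo k B _ & sumTo-cong B (\ i _ -> sumV-sumV k (suc i) _ & sumV-cong (suc i) (\ v -> sumV-sumTo k B _ & sumTo-cong B (\ e _ -> sym (sumV-*ˡ k _ _))))
  same? : ∀ {d e} (u : Vec K.El d) (v : Vec K.El e) -> Dec (Same u v)
  same? {d} {e} u v with d NP.≟ e
  ... | no ne = no (ne ∘ proj₁)
  ... | yes idp with u ≟ⱽ v
  ... | yes p = yes (idp , p)
  ... | no np = no (\ { (idp , p) -> np p })
  private
   same-sum : ∀ {i d₀} (Q : Vec K.El d₀) -> d₀ ≡ i -> (g : Vec K.El i -> Carrier) -> (x : Carrier) -> (∀ v -> Same v Q -> g v ≈ x) -> sumV i (\ v -> [ same? v Q ] * g v) ≈ x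
   same-sum {i} Q idp g x h = sumV-cong i (\ v -> *-congʳ ([⇔] (same? v Q) (v ≟ⱽ Q) (\ { (idp , p) -> p }) (\ p -> idp , p))) & sumV-δ i Q g & h Q (idp , idp)
   sumV-con-fir : ∀ {k B} (a c : Vec K.El k -> Carrier) -> (1≤B : 1 ≤ B) -> sumV k (\ v -> sumTo B (\ e -> a v * (c v * [ e NP.≟ 0 ]))) ≈ sumV k (\ v -> c v * a v)
   sumV-con-fir {k} {suc B} a c 1≤B = sumV-cong k (\ v -> sumTo-sin (suc B) 0 _ (s≤s z≤n) (\ i ne -> *-congˡ (*-congˡ ([no] (i NP.≟ 0) ne) & zeroʳ _) & zeroʳ _) & *-congˡ (*-congˡ ([yes] (0 NP.≟ 0) idp) & *-identityʳ _) & *-comm _ _)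
  dvd : ∀ {k} -> Vec K.El k -> ∀ {d} -> Vec K.El d -> ℕ -> Carrier
  dvd h v e = [ pow v e ∣? monP h ]
  one-pri : ∀ B {d₀} (Q : Vec K.El d₀) -> Irreducible Q -> d₀ ≤ B -> sumPri B (\ v e -> [ same? v Q ] * [ e NP.≟ 1 ]) ≈ fromℕ d₀
  one-pri (suc B) {suc d} Q irr d₀≤B = begin sumPri (suc B) (\ v e -> [ same? v Q ] * [ e NP.≟ 1 ]) ≈⟨ sumTo-cong (suc B) (\ i _ -> sumV-cong (suc i) (\ v -> sumTo-cong (suc B) (\ e _ -> *-congˡ (*-congˡ ([⇔] (suc e NP.≟ 1) (e NP.≟ 0) NP.suc-injective (ap suc)))))) ⟩ sumTo (suc B) (\ i -> sumV (suc i) (\ v -> sumTo (suc B) (\ e -> ([ irr? v ] * fromℕ (suc i)) * ([ same? v Q ] * [ e NP.≟ 0 ])))) ≈⟨ sumTo-cong (suc B) (\ i _ -> sumV-con-fir {suc i} {suc B} (\ v -> [ irr? v ] * fromℕ (suc i)) (\ v -> [ same? v Q ]) (s≤s z≤n)) ⟩ sumTo (suc B) (\ i -> sumV (suc i) (\ v -> [ same? v Q ] * ([ irr? v ] * fromℕ (suc i)))) ≈⟨ sumTo-sin (suc B) d _ d₀≤B (\ i ne -> sumV-0 (suc i) (\ v -> *-congʳ ([no] (same? v Q) (\ s -> ne (NP.suc-injective (proj₁ s)))) & zeroˡ _)) ⟩ sumV (suc d) (\ v -> [ same? v Q ] * ([ irr? v ] * fromℕ (suc d))) ≈⟨ same-sum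 Q idp _ _ (\ { v (idp , idp) -> *-congʳ ([yes] (irr? v) irr) & *-identityˡ _ }) ⟩ fromℕ (suc d) ∎
  pow-too-big : ∀ {k} (h : Vec K.El k) {d} (v : Vec K.El d) e -> k < e N.* d -> dvd h v e ≈ 0#
  pow-too-big h v e l = [no] (pow v e ∣? monP h) (\ p -> NP.<⇒≱ l (∣-deg (pow v e) h p))
  private
   e≤ed : ∀ e {d} -> 1 ≤ d -> e ≤ e N.* d
   e≤ed e {suc d} _ = NP.m≤m*n e (suc d)
   ed≥1 : ∀ {e d} -> 1 ≤ e -> 1 ≤ d -> 1 ≤ e N.* d
   ed≥1 {suc e} {suc d} _ _ = s≤s z≤n
  -- The analogue of log h as the sum of von Mangoldt's function over the divisors of h. Removing an
  -- irreducible factor Q lowers the number of admissible exponents of Q by one and changes no other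
  -- prime. The number n is fuel, and B is any cutoff not below the degree.
  deg-ide : ∀ n B {k} -> k ≤ n -> k ≤ B -> (h : Vec K.El k) -> sumPri B (dvd h) ≈ fromℕ k
  deg-ide n B {zero} k≤n k≤B h = sumPri-0 B (dvd h) (\ v e ir 1≤e _ -> pow-too-big h v e (ed≥1 1≤e (proj₁ ir)))
  deg-ide (suc n) B {suc k} k≤n k≤B h with irrFac (suc k) NP.≤-refl (s≤s z≤n) h
  ... | d₀ , Q , irQ , Q∣h with mon-quo Q h Q∣h
  ... | h₁ , eq = begin sumPri B (dvd h) ≈⟨ compare ⟩ sumPri B (dvd h₁) + fromℕ d₀ ≈⟨ +-congʳ (deg-ide n B k₁≤n (NP.≤-trans (NP.m∸n≤m (suc k) d₀) k≤B) h₁) ⟩ fromℕ (suc k ∸ d₀) + fromℕ d₀ ≈⟨ fromℕ-+ (suc k ∸ d₀) d₀ ⟨ fromℕ (suc k ∸ d₀ N.+ d₀) ≡⟨ ap fromℕ (NP.m∸n+n≡m d₀≤k) ⟩ fromℕ (suc k) ∎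
   where
   d₀≤k : d₀ ≤ suc k
   d₀≤k = ∣-deg Q h Q∣h
   k₁≤n : suc k ∸ d₀ ≤ n
   k₁≤n = NP.≤-trans (NP.∸-monoʳ-≤ (suc k) (proj₁ irQ)) (NP.≤-pred k≤n)
   heq : monP h P.≈ monP Q P.* monP h₁
   heq = ⟪ eq ⟫

   -- Row by row: the sum over the exponents grows by one for Q and is unchanged for the other primes.
   row : ∀ {d} (v : Vec K.El d) -> Irreducible v -> sumTo B (\ e -> dvd h v (suc e)) ≈ sumTo B (\ e -> dvd h₁ v (suc e)) + sumTo B (\ e -> [ same? v Q ] * [ suc e NP.≟ 1 ])
   row v ir = go B k≤B (same? v Q)
    where
    go : ∀ B' -> suc k ≤ B' -> (s : Dec (Same v Q)) -> sumTo B' (\ e -> dvd h v (suc e)) ≈ sumTo B' (\ e -> dvd h₁ v (suc e)) + sumTo B' (\ e -> [ s ] * [ suc e NP.≟ 1 ])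
    go B' _ (no ns) = sumTo-cong B' (\ e _ -> [⇔] (pow v (suc e) ∣? monP h) (pow v (suc e) ∣? monP h₁) (\ { (w , p) -> pow-∣-oth Q v irQ ir ns (suc e) (monP h₁) (w , P.sym heq P.& p) }) (\ p -> let (w , p') = ∣-*ˡ {monP (pow v (suc e))} (monP Q) (monP h₁) p in w , heq P.& p')) & sym (+-identityʳ _) & +-congˡ (sym (sumTo-0 B' (\ e _ -> *-congʳ ([no] (no ns) ns) & zeroˡ _)))
    go (suc B') l s@(yes (idp , idp)) = begin sumTo (suc B') (\ e -> dvd h v (suc e)) ≈⟨ sumTo-cong (suc B') (\ e _ -> [⇔] (pow v (suc e) ∣? monP h) (pow v e ∣? monP h₁) (pow-suc-∣⁻ v e heq) (pow-suc-∣ v e heq)) ⟩ sumTo (suc B') (dvd h₁ v) ≡⟨ sumTo-suc B' _ ⟩ dvd h₁ v 0 + sumTo B' (\ e -> dvd h₁ v (suc e)) ≈⟨ +-cong ([yes] (pow v 0 ∣? monP h₁) (monP h₁ , ⟪ ≋-sym (⊛-ideˡ (mon h₁)) ⟫)) (sym (sumTo-snoc B' (\ e -> dvd h₁ v (suc e)) & +-congˡ (pow-too-big h₁ v (suc B') big) & +-identityʳ _)) ⟩ 1# + sumTo (suc B') (\ e -> dvd h₁ v (suc e)) ≈⟨ +-comm _ _ ⟩ sumTo (suc B') (\ e -> dvd h₁ v (suc e)) + 1# ≈⟨ +-congˡ (sym (sumTo-sin (suc B') 0 _ (s≤s z≤n) (\ i ne -> *-congˡ ([no] (suc i NP.≟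 1) (ne ∘ NP.suc-injective)) & zeroʳ _) & *-cong ([yes] s (idp , idp)) ([yes] (1 NP.≟ 1) idp) & *-identityˡ _)) ⟩ sumTo (suc B') (\ e -> dvd h₁ v (suc e)) + sumTo (suc B') (\ e -> [ s ] * [ suc e NP.≟ 1 ]) ∎
     where
     big : suc k ∸ d₀ < suc B' N.* d₀
     big = NP.<-≤-trans (s≤s (NP.∸-monoʳ-≤ (suc k) (proj₁ irQ))) (NP.≤-trans l (e≤ed (suc B') (proj₁ irQ)))
   pull : ∀ {i} (v : Vec K.El (suc i)) -> sumTo B (\ e -> ([ irr? v ] * fromℕ (suc i)) * dvd h v (suc e)) ≈ sumTo B (\ e -> ([ irr? v ] * fromℕ (suc i)) * dvd h₁ v (suc e)) + sumTo B (\ e -> ([ irr? v ] * fromℕ (suc i)) * ([ same? v Q ] * [ suc e NP.≟ 1 ]))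
   pull {i} v with irr? v
   ... | yes ir = sym (sumTo-*ˡ B _ _) & *-congˡ (row v ir) & distribˡ _ _ _ & +-cong (sumTo-*ˡ B _ _) (sumTo-*ˡ B _ _)
   ... | no ni = sumTo-0 B (\ e _ -> van ni) & sym (+-cong (sumTo-0 B (\ e _ -> van ni)) (sumTo-0 B (\ e _ -> van ni)) & +-identityʳ _)
   compare : sumPri B (dvd h) ≈ sumPri B (dvd h₁) + fromℕ d₀
   compare = begin sumPri B (dvd h) ≈⟨ sumTo-cong B (\ i _ -> sumV-cong (suc i) pull & sumV-+ (suc i) _ _) ⟩ sumTo B (\ i -> sumV (suc i) (\ v -> sumTo B (\ e -> ([ irr? v ] * fromℕ (suc i)) * dvd h₁ v (suc e))) + sumV (suc i) (\ v -> sumTo B (\ e -> ([ irr? v ] * fromℕ (suc i)) * ([ same? v Q ] * [ suc e NP.≟ 1 ])))) ≈⟨ sumTo-+ B _ _ ⟩ sumPri B (dvd h₁) + sumPri B (\ v e -> [ same? v Q ] * [ e NP.≟ 1 ]) ≈⟨ +-congˡ (one-pri B Q irQ (NP.≤-trans d₀≤k k≤B)) ⟩ sumPri B (dvd h₁) + fromℕ d₀ ∎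

open PriDiv

-- Newton's identity for the series of a multiplicative character.

module NewIde where

 open N using (_≤_; _<_)

 module New {q : ℕ} (K : FiniteField q) (S : CommutativeRing 0ℓ 0ℓ) (χ : ∀ {k} -> Vec (FiniteField.Carrier K) k -> CommutativeRing.Carrier S) (χ-pro : ∀ {i j} (u : Vec (FiniteField.Carrier K) i) (v : Vec (FiniteField.Carrier K) j) -> CommutativeRing._≈_ S (χ (PriPow.product K u v)) (CommutativeRing._*_ S (χ u) (χ v))) where
  open PriPow K hiding (_⊛_)
  open DegIde K S public
  open Kit S
  private module Q = Ser S
  c : ℕ -> Carrier
  c k = sumV k χ
  private
   pro-inj : ∀ {i j} (Q : Vec K.El i) {u v : Vec K.El j} -> product Q u ≡ product Q v -> u ≡ v
   pro-inj Q {u} {v} e = mon-inj u v (atᴾ (mon-can Q (monP u) (monP v) ⟪ ≋-trans (≋-sym (mon-pro Q u)) (≋-trans (\ i -> ap (\ w -> mon w i) e) (mon-pro Q v)) ⟫))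
   recast : ∀ {i j j'} (Q : Vec K.El i) (h : Vec K.El (i N.+ j)) -> j' ≡ j -> Σ[ w ∈ Vec K.El j' ] mon h ≋ Pol._⊛_ (fieRing K) (mon Q) (mon w) -> Σ[ w ∈ Vec K.El j ] product Q w ≡ h
   recast Q h idp (w , e) = w , mon-inj (product Q w) h (≋-trans (mon-pro Q w) (≋-sym e))
   div-sum′ : ∀ {i} (Q : Vec K.El i) j -> sumV (i N.+ j) (\ h -> [ Q ∣? monP h ] * χ h) ≈ χ Q * c j
   div-sum′ {i} Q j = sumV-rei (product Q) (pro-inj Q) (\ h -> monP Q ∣ monP h) (\ h -> Q ∣? monP h) (\ w -> monP w , ⟪ mon-pro Q w ⟫) (\ h d -> recast Q h (NP.m+n∸m≡n i j) (mon-quo Q h d)) χ & sumV-cong j (\ w -> χ-pro Q w) & sym (sumV-*ˡ j (χ Q) χ)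
  -- The multiples of Q of degree k are the Q w with w monic of degree k - i, and χ is
  -- multiplicative.
  div-sum : ∀ {i} (Q : Vec K.El i) k -> sumV k (\ h -> [ Q ∣? monP h ] * χ h) ≈ [ i NP.≤? k ] * (χ Q * c (k ∸ i))
  div-sum {i} Q k with i NP.≤? k
  ... | no nl = sumV-0 k (\ h -> *-congʳ ([no] (Q ∣? monP h) (\ d -> nl (∣-deg Q h d))) & zeroˡ _) & sym (*-congʳ ([no] (no nl) nl) & zeroˡ _)
  ... | yes l = go k (NP.m+[n∸m]≡n l) & sym (*-congʳ ([yes] (yes l) l) & *-identityˡ _)
   where
   go : ∀ k' -> i N.+ (k ∸ i) ≡ k' -> sumV k' (\ h -> [ Q ∣? monP h ] * χ h) ≈ χ Q * c (k ∸ i)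
   go _ idp = div-sum′ Q (k ∸ i)
  sumPri-*ʳ : ∀ B (g : ∀ {d} -> Vec K.El d -> ℕ -> Carrier) x -> sumPri B g * x ≈ sumPri B (\ v e -> g v e * x)
  sumPri-*ʳ B g x = *-comm _ _ & sumPri-*ˡ B x g & sumPri-cong B {\ v e -> x * g v e} {\ v e -> g v e * x} (\ _ _ _ _ _ -> *-comm _ _)
  -- The degree k of h is expanded over the prime powers dividing h, and the sum over h is carried
  -- out first.
  new′ : ∀ k B -> k ≤ B -> fromℕ k * c k ≈ sumPri B (\ {d} v e -> [ e N.* d NP.≤? k ] * (χ (pow v e) * c (k ∸ e N.* d)))
  new′ k B k≤B = begin fromℕ k * c k ≈⟨ sumV-*ˡ k _ χ ⟩ sumV k (\ h -> fromℕ k * χ h) ≈⟨ sumV-cong k (\ h -> *-congʳ (sym (deg-ide k B NP.≤-refl k≤B h)) & sumPri-*ʳ B (dvd h) (χ h)) ⟩ sumV k (\ h -> sumPri B (\ v e -> dvd h v e * χ h)) ≈⟨ sumPri-sumV B k (\ h v e -> dvd h v e * χ h) ⟩ sumPri B (\ v e -> sumV k (\ h -> dvd h v e * χ h)) ≈⟨ sumPri-cong B {\ v e -> sumV k (\ h -> dvd h v e * χ h)} {\ {d} v e -> [ e N.* d NP.≤? k ] * (χ (pow v e) * c (k ∸ e N.* d))} (\ v e _ _ _ -> div-sum (pow v e) k) ⟩ sumPri B (\ {d} v e -> [ e N.* d NP.≤? k ] * (χ (pow v e) * c (k ∸ e N.* d))) ∎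
  -- The coefficient of T^j in the logarithmic derivative T L'/L, with primes and exponents cut off
  -- at B; every B ≥ j gives the same value.
  powSum : ℕ -> ℕ -> Carrier
  powSum B j = sumPri B (\ {d} v e -> [ e N.* d NP.≟ j ] * χ (pow v e))
  private
   new″ : ∀ k B -> k ≤ B -> fromℕ k * c k ≈ sumTo (suc k) (\ j -> powSum B j * c (k ∸ j))
   new″ k B k≤B = new′ k B k≤B & sym (begin sumTo (suc k) (\ j -> powSum B j * c (k ∸ j)) ≈⟨ sumTo-cong (suc k) (\ j _ -> sumPri-*ʳ B (\ {d} v e -> [ e N.* d NP.≟ j ] * χ (pow v e)) (c (k ∸ j))) ⟩ sumTo (suc k) (\ j -> sumPri B (\ {d} v e -> [ e N.* d NP.≟ j ] * χ (pow v e) * c (k ∸ j))) ≈⟨ sumPri-sumTo B (suc k) (\ j {d} v e -> [ e N.* d NP.≟ j ] * χ (pow v e) * c (k ∸ j)) ⟩ sumPri B (\ {d} v e -> sumTo (suc k) (\ j -> [ e N.* d NP.≟ j ] * χ (pow v e) * c (k ∸ j))) ≈⟨ sumPri-cong B {\ {d} v e -> sumTo (suc k) (\ j -> [ e N.* d NP.≟ j ] * χ (pow v e) * c (k ∸ j))} {\ {d} v e -> [ e N.* d NP.≤? k ] * (χ (pow v e) * c (k ∸ e N.* d))} (\ v e _ _ _ -> col (χ (pow v e)) _) ⟩ sumPri B (\ {d} v e -> [ e N.* d NP.≤? k ] * (χ (pow v e) * c (k ∸ e N.* d))) ∎)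
     where
     col : ∀ x m -> sumTo (suc k) (\ j -> [ m NP.≟ j ] * x * c (k ∸ j)) ≈ [ m NP.≤? k ] * (x * c (k ∸ m))
     col x m with m NP.≤? k
     ... | yes l = sumTo-sin (suc k) m _ (s≤s l) (\ i ne -> *-congʳ (*-congʳ ([no] (m NP.≟ i) (ne ∘ !)) & zeroˡ _) & zeroˡ _) & *-assoc _ _ _ & *-congʳ ([yes] (m NP.≟ m) idp & sym ([yes] (yes l) l))
     ... | no nl = sumTo-0 (suc k) (\ i i≤k -> *-congʳ (*-congʳ ([no] (m NP.≟ i) (\ { idp -> nl (NP.≤-pred i≤k) })) & zeroˡ _) & zeroˡ _) & sym (*-congʳ ([no] (no nl) nl) & zeroˡ _)
  sumPri-ext : ∀ {B B'} -> B ≤ B' -> (g : ∀ {d} -> Vec K.El d -> ℕ -> Carrier) -> (∀ {d} (v : Vec K.El d) e -> B < d -> g v (suc e) ≈ 0#) -> (∀ {d} (v : Vec K.El (suc d)) e -> B < e -> g v e ≈ 0#) -> sumPri B' g ≈ sumPri B g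
  sumPri-ext {B} {B'} l g hd he = trans (sumTo-ext l _ (\ i B≤i -> sumV-0 (suc i) (\ v -> sumTo-0 B' (\ e _ -> *-congˡ (hd v e (s≤s B≤i)) & zeroʳ _)))) (sumTo-cong B (\ i _ -> sumV-cong (suc i) (\ v -> sumTo-ext l _ (\ e B≤e -> *-congˡ (he v (suc e) (s≤s B≤e)) & zeroʳ _))))
  powSum-sta : ∀ {j B} -> j ≤ B -> powSum B j ≈ powSum j j
  powSum-sta {j} l = sumPri-ext l (\ {d} v e -> [ e N.* d NP.≟ j ] * χ (pow v e)) (\ v e l' -> big v (suc e) (NP.<-≤-trans l' (NP.m≤m+n _ _))) (\ {d} v e l' -> big v e (NP.<-≤-trans l' (NP.m≤m*n e (suc d))))
   where
   big : ∀ {d} (v : Vec K.El d) e -> j < e N.* d -> [ e N.* d NP.≟ j ] * χ (pow v e) ≈ 0#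
   big {d} v e l' = *-congʳ ([no] (e N.* d NP.≟ j) (\ { idp -> NP.<-irrefl idp l' })) & zeroˡ _
  S′ : ℕ -> Carrier
  S′ j = powSum j j

  -- T L' = S L for L = ∑ c_k T^k
  new : Q.θ c Q.≋ S′ Q.⊛ c
  new k = new″ k k NP.≤-refl & sym (⊛-sum S′ c k & sumTo-cong (suc k) (\ j j≤k -> *-congʳ (sym (powSum-sta (NP.≤-pred j≤k)))))

open NewIde

-- Congruences, counting zeros, and additive functions modulo p.

module AddCou where

 open N using (_+_; _*_; _^_; _≤_; _<_; _≡ᵇ_)
 open NP
 open import Data.Nat.DivMod
 open import Data.Nat.Divisibility
 open import Data.Nat.Primality using (euclidsLemma)
 open import Data.Nat.ListAction using (sum)
 open import Data.Nat.Tactic.RingSolver using (solve-∀)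
 open import Data.Bool using (Bool; true; false; if_then_else_; not; _∧_; T)
 open import Data.Fin.Base using (fromℕ<; remQuot; combine)
 open FinP using (toℕ-fromℕ<; toℕ<n; toℕ-injective; injective⇒≤; combine-remQuot)
 open import Data.Vec.Base using (zipWith; lookup)
 open import Data.Vec.Properties using (lookup-zipWith)
 open import Data.List as List using (List; []; _∷_; map; allFin; filter; length)
 open import Data.List.Properties using (length-tabulate)
 open import Data.List.Relation.Unary.All as All using (All; []; _∷_)
 open import Data.List.Relation.Unary.All.Properties using (all-filter)
 open import Data.List.Relation.Unary.AllPairs using (AllPairs; []; _∷_)
 open import Data.List.Relation.Unary.Unique.Propositional using (Unique)
 open import Data.List.Relation.Unary.Unique.Propositional.Properties using (filter⁺; allFin⁺)
 open import Data.List.Membership.Propositional.Properties using (∈-lookup)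
 open import Data.Product using (∃)
 open import Data.Unit using (tt)
 open import Function.Bundles using (_↔_; Inverse)
 open import Function.Definitions using (Injective)
 open import Relation.Nullary.Decidable using (⌊_⌋; dec-true)
 open ≡ using (refl; sym; trans; cong; cong₂; subst; module ≡-Reasoning)
 import Algebra.Properties.Group as GroupProperties

 toℕ-mod : ∀ a p .{{_ : NonZero p}} -> toℕ (a mod p) ≡ a % p
 toℕ-mod a p = toℕ-fromℕ< (m%n<n a p)

 module _ (p : ℕ) .{{_ : NonZero p}} where
  infix 4 _≈ₚ_
  _≈ₚ_ : ℕ -> ℕ -> Set
  a ≈ₚ b = a % p ≡ b % p
  %-≈ₚ : ∀ a -> a % p ≈ₚ a
  %-≈ₚ a = m%n%n≡m%n a p
  +-cong-≈ₚ : ∀ {a b c d} -> a ≈ₚ b -> c ≈ₚ d -> a + c ≈ₚ b + d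
  +-cong-≈ₚ {a} {b} {c} {d} e f = begin (a + c) % p ≡⟨ %-distribˡ-+ a c p ⟩ (a % p + c % p) % p ≡⟨ cong₂ (\ x y -> (x + y) % p) e f ⟩ (b % p + d % p) % p ≡⟨ %-distribˡ-+ b d p ⟨ (b + d) % p ∎
   where open ≡-Reasoning
  *-cong-≈ₚ : ∀ {a b c d} -> a ≈ₚ b -> c ≈ₚ d -> a * c ≈ₚ b * d
  *-cong-≈ₚ {a} {b} {c} {d} e f = begin (a * c) % p ≡⟨ %-distribˡ-* a c p ⟩ ((a % p) * (c % p)) % p ≡⟨ cong₂ (\ x y -> (x * y) % p) e f ⟩ ((b % p) * (d % p)) % p ≡⟨ %-distribˡ-* b d p ⟨ (b * d) % p ∎
   where open ≡-Reasoning
  +-canˡ-≈ₚ : ∀ a b -> a ≈ₚ a + b -> p ∣ b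
  +-canˡ-≈ₚ a b e = ∣m+n∣m⇒∣n {m = (a / p) * p} {n = b} (m%n≡0⇒n∣m _ _ lem) (n∣m*n (a / p))
   where
   open ≡-Reasoning
   step : a % p + ((a / p) * p + b) ≡ a % p + ((a + b) / p) * p
   step = begin a % p + ((a / p) * p + b) ≡⟨ +-assoc (a % p) _ b ⟨ a % p + (a / p) * p + b ≡⟨ cong (_+ b) (m≡m%n+[m/n]*n a p) ⟨ a + b ≡⟨ m≡m%n+[m/n]*n (a + b) p ⟩ (a + b) % p + ((a + b) / p) * p ≡⟨ cong (_+ ((a + b) / p) * p) e ⟨ a % p + ((a + b) / p) * p ∎
   lem : ((a / p) * p + b) % p ≡ 0
   lem = trans (cong (_% p) (+-cancelˡ-≡ (a % p) _ _ step)) (m*n%n≡0 ((a + b) / p) p)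
  sum-map-≈ₚ : ∀ {A : Set} (f g h : A -> ℕ) -> (∀ x -> f x ≈ₚ g x + h x) -> (xs : List A) -> sum (map f xs) ≈ₚ sum (map g xs) + sum (map h xs)
  sum-map-≈ₚ f g h e [] = refl
  sum-map-≈ₚ f g h e (x ∷ xs) = begin (f x + F) % p ≡⟨ +-cong-≈ₚ (e x) (sum-map-≈ₚ f g h e xs) ⟩ (g x + h x + (G + H)) % p ≡⟨ cong (_% p) (interchange (g x) (h x) G H) ⟩ (g x + G + (h x + H)) % p ∎
   where
   open ≡-Reasoning
   F = sum (map f xs)
   G = sum (map g xs)
   H = sum (map h xs)
   interchange : ∀ a b c d -> a + b + (c + d) ≡ a + c + (b + d)
   interchange = solve-∀

 lookup-injective : ∀ {A : Set} {xs : List A} -> Unique xs -> Injective _≡_ _≡_ (List.lookup xs)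
 lookup-injective {xs = x ∷ xs} (_ ∷ _) {Fin.zero} {Fin.zero} _ = refl
 lookup-injective {xs = x ∷ xs} (a ∷ _) {Fin.zero} {Fin.suc j} e = ⊥-elim (All.lookup a (∈-lookup j) e)
 lookup-injective {xs = x ∷ xs} (a ∷ _) {Fin.suc i} {Fin.zero} e = ⊥-elim (All.lookup a (∈-lookup i) (sym e))
 lookup-injective {xs = x ∷ xs} (_ ∷ u) {Fin.suc i} {Fin.suc j} e = cong Fin.suc (lookup-injective u e)

 -- Every x is either counted by b or satisfies P. For a codeword this bounds the length minus the
 -- weight by the number of zeros.
 ind-sum≥ : ∀ {A : Set} {P : A -> Set} (P? : ∀ x -> Dec (P x)) (b : A -> Bool) -> (∀ x -> b x ≡ false -> P x) -> (xs : List A) -> length xs ≤ sum (map (\ x -> if b x then 1 else 0) xs) + length (filter P? xs)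
 ind-sum≥ P? b e [] = z≤n
 ind-sum≥ P? b e (x ∷ xs) with ind-sum≥ P? b e xs | b x in eq | P? x
 ... | ih | true | no _ = s≤s ih
 ... | ih | true | yes _ = s≤s (≤-trans ih (+-monoʳ-≤ _ (n≤1+n _)))
 ... | ih | false | yes _ = ≤-trans (s≤s ih) (≤-reflexive (sym (+-suc _ _)))
 ... | ih | false | no ¬p = ⊥-elim (¬p (e x eq))

 ind-sum>0 : ∀ {A : Set} (b : A -> Bool) (xs : List A) -> 0 < sum (map (\ x -> if b x then 1 else 0) xs) -> ∃ \ x -> b x ≡ true
 ind-sum>0 b (x ∷ xs) pos with b x in eq
 ... | true = x , eq
 ... | false = ind-sum>0 b xs pos

 module AddFun {q : ℕ} (K : FiniteField q) {p : ℕ} .{{_ : NonZero p}} (pr : Prime p) (ℓ : FiniteField.Carrier K -> ℕ) (ℓ-⊕ : ∀ x y -> _≈ₚ_ p (ℓ (FiniteField._⊕_ K x y)) (ℓ x + ℓ y)) where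
  open FiniteField K
  private
   R : CommutativeRing _ _
   R = record { isCommutativeRing = isCommutativeRing }
   module R = CommutativeRing R
   open GroupProperties R.+-group using (∙-cancelʳ)
  multiple : ℕ -> Carrier -> Carrier
  multiple zero x = 0#
  multiple (suc j) x = x ⊕ multiple j x
  ℓ-0# : p ∣ ℓ 0#
  ℓ-0# = +-canˡ-≈ₚ p (ℓ 0#) (ℓ 0#) (trans (cong (\ z -> ℓ z % p) (sym (R.+-identityˡ 0#))) (ℓ-⊕ 0# 0#))
  ℓ-mul : ∀ j x -> _≈ₚ_ p (ℓ (multiple j x)) (j * ℓ x)
  ℓ-mul zero x = trans (n∣m⇒m%n≡0 _ _ ℓ-0#) (sym (n∣m⇒m%n≡0 0 p (p ∣0)))
  ℓ-mul (suc j) x = trans (ℓ-⊕ x (multiple j x)) (+-cong-≈ₚ p {a = ℓ x} refl (ℓ-mul j x))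
  zero? : ∀ j -> Dec (ℓ (Inverse.to enum j) % p ≡ 0)
  zero? j = ℓ (Inverse.to enum j) % p ≟ 0
  zeros : List (Fin q)
  zeros = filter zero? (allFin q)

  -- The translates of the zero set by 0, α, …, (p − 1)α are disjoint when ℓ α ≠ 0.
  p*zer≤q : ∀ α -> ¬ (p ∣ ℓ α) -> p * length zeros ≤ q
  p*zer≤q α α≢0 = injective⇒≤ {f = \ i -> tra (remQuot (length zeros) i)} \ {i} {i'} e -> trans (sym (combine-remQuot {p} (length zeros) i)) (trans (cong (\ t -> combine (proj₁ t) (proj₂ t)) (tra-inj _ _ e)) (combine-remQuot {p} (length zeros) i'))
   where
   point : Fin (length zeros) -> Carrier
   point = Inverse.to enum ∘ List.lookup zeros
   tra : Fin p × Fin (length zeros) -> Fin q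
   tra (j , i) = Inverse.from enum (point i ⊕ multiple (toℕ j) α)
   ℓ-tra : ∀ j i -> _≈ₚ_ p (ℓ (point i ⊕ multiple (toℕ j) α)) (toℕ j * ℓ α)
   ℓ-tra j i = trans (ℓ-⊕ _ _) (+-cong-≈ₚ p {b = 0} (trans (All.lookup (all-filter zero? (allFin q)) (∈-lookup i)) (sym (n∣m⇒m%n≡0 0 p (p ∣0)))) (ℓ-mul (toℕ j) α))
   -- The prime p divides (k - j) ℓ α but not ℓ α, hence it divides k - j < p.
   ind-≤ : ∀ {j k} -> j ≤ k -> k < p -> _≈ₚ_ p (j * ℓ α) (k * ℓ α) -> j ≡ k
   ind-≤ {j} {k} j≤k k<p e with euclidsLemma (k ∸ j) (ℓ α) pr (+-canˡ-≈ₚ p (j * ℓ α) _ (trans e (cong (_% p) (trans (cong (_* ℓ α) (sym (m+[n∸m]≡n j≤k))) (*-distribʳ-+ (ℓ α) j (k ∸ j))))))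
   ... | inj₂ d = ⊥-elim (α≢0 d)
   ... | inj₁ d with k ∸ j in eq
   ... | zero = ≤-antisym j≤k (m∸n≡0⇒m≤n eq)
   ... | suc t = ⊥-elim (<⇒≱ (≤-<-trans (≤-trans (≤-reflexive (sym eq)) (m∸n≤m k j)) k<p) (∣⇒≤ d))
   index-injective : ∀ j k -> _≈ₚ_ p (toℕ j * ℓ α) (toℕ k * ℓ α) -> j ≡ k
   index-injective j k e with ≤-total (toℕ j) (toℕ k)
   ... | inj₁ l = toℕ-injective (ind-≤ l (toℕ<n k) e)
   ... | inj₂ l = toℕ-injective (sym (ind-≤ l (toℕ<n j) (sym e)))
   to-injective : ∀ {i j} -> Inverse.to enum i ≡ Inverse.to enum j -> i ≡ j
   to-injective {i} {j} e = trans (sym (Inverse.strictlyInverseʳ enum i)) (trans (cong (Inverse.from enum) e) (Inverse.strictlyInverseʳ enum j))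
   from-injective : ∀ {x y} -> Inverse.from enum x ≡ Inverse.from enum y -> x ≡ y
   from-injective {x} {y} e = trans (sym (Inverse.strictlyInverseˡ enum x)) (trans (cong (Inverse.to enum) e) (Inverse.strictlyInverseˡ enum y))
   tra-inj : ∀ s t -> tra s ≡ tra t -> s ≡ t
   tra-inj (j , i) (k , l) e with refl ← index-injective j k (trans (sym (ℓ-tra j i)) (trans (cong (\ z -> ℓ z % p) (from-injective e)) (ℓ-tra k l))) = cong (j ,_) (lookup-injective (filter⁺ zero? (allFin⁺ q)) (to-injective (∙-cancelʳ (multiple (toℕ j) α) _ _ (from-injective e))))

 ≡ᵇ-fal : ∀ m -> not (m ≡ᵇ 0) ≡ false -> m ≡ 0
 ≡ᵇ-fal zero _ = refl

 ≡ᵇ-true : ∀ m -> not (m ≡ᵇ 0) ≡ true -> m ≢ 0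
 ≡ᵇ-true (suc m) _ ()

-- Archimedean ordered fields.

module OrderedFields where

 open import Algebra.Structures using (IsCommutativeRing)
 open import Data.Integer.Base using (+_; -[1+_])

 -- Equality is propositional and the order decidable, as for the rationals; square roots and limits
 -- are replaced by approximations that use `arc`.
 record OrdFie : Set₁ where
  infix 4 _≤_
  infixl 6 _+_
  infixl 7 _*_
  field
   Carrier : Set
   _+_ _*_ : Carrier -> Carrier -> Carrier
   -_ : Carrier -> Carrier
   0# 1# : Carrier
   isCommutativeRing : IsCommutativeRing _≡_ _+_ _*_ -_ 0# 1#
   _≤_ : Carrier -> Carrier -> Set
   ≤-total : ∀ x y -> x ≤ y ⊎ y ≤ x
   ≤-trans : ∀ {x y z} -> x ≤ y -> y ≤ z -> x ≤ z
   ≤-antisym : ∀ {x y} -> x ≤ y -> y ≤ x -> x ≡ y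
   _≤?_ : ∀ x y -> Dec (x ≤ y)
   +-monoʳ-≤ : ∀ z {x y} -> x ≤ y -> z + x ≤ z + y
   *-non : ∀ {x y} -> 0# ≤ x -> 0# ≤ y -> 0# ≤ x * y
   inverse : ∀ x -> x ≢ 0# -> Σ[ y ∈ Carrier ] x * y ≡ 1#
   0≢1 : 0# ≢ 1#
  ring : CommutativeRing 0ℓ 0ℓ
  ring = record { isCommutativeRing = isCommutativeRing }
  field
   arc : ∀ x -> Σ[ n ∈ ℕ ] x ≤ Kit.fromℕ ring n

 module OrdKit (F : OrdFie) where
  open OrdFie F public using (_≤_; ≤-total; ≤-trans; ≤-antisym; _≤?_; +-monoʳ-≤; *-non; inverse; 0≢1; ring; arc)
  open Kit ring public hiding (ring) renaming (trans to ≈-trans)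
  open RanSums ring public
  infix 4 _<_
  -- As the negation of the reverse order, a strict inequality is used by exhibiting the weak one
  -- that it forbids.
  _<_ : Carrier -> Carrier -> Set
  x < y = ¬ (y ≤ x)
  ≤-refl : ∀ {x} -> x ≤ x
  ≤-refl {x} with ≤-total x x
  ... | inj₁ l = l
  ... | inj₂ l = l
  ≤-reflexive : ∀ {x y} -> x ≡ y -> x ≤ y
  ≤-reflexive idp = ≤-refl
  <⇒≤ : ∀ {x y} -> x < y -> x ≤ y
  <⇒≤ {x} {y} l with ≤-total x y
  ... | inj₁ p = p
  ... | inj₂ p = ⊥-elim (l p)
  ≰⇒> : ∀ {x y} -> ¬ (x ≤ y) -> y < x
  ≰⇒> n = n
  ≮⇒≥ : ∀ {x y} -> ¬ (x < y) -> y ≤ x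
  ≮⇒≥ {x} {y} n with y ≤? x
  ... | yes l = l
  ... | no nl = ⊥-elim (n nl)
  <-≤-trans : ∀ {x y z} -> x < y -> y ≤ z -> x < z
  <-≤-trans l m n = l (≤-trans m n)
  ≤-<-trans : ∀ {x y z} -> x ≤ y -> y < z -> x < z
  ≤-<-trans l m n = m (≤-trans n l)
  ≤∧≢⇒< : ∀ {x y} -> x ≤ y -> x ≢ y -> x < y
  ≤∧≢⇒< l n m = n (≤-antisym l m)
  _≟_ : ∀ x y -> Dec (x ≡ y)
  x ≟ y with x ≤? y | y ≤? x
  ... | yes a | yes b = yes (≤-antisym a b)
  ... | no a | _ = no (\ { idp -> a ≤-refl })
  ... | yes _ | no b = no (\ { idp -> b ≤-refl })
  ≤ʳ : ∀ {x y z} -> y ≡ z -> x ≤ y -> x ≤ z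
  ≤ʳ idp l = l
  ≤ˡ : ∀ {x y z} -> x ≡ y -> x ≤ z -> y ≤ z
  ≤ˡ idp l = l
  by-non : ∀ {x y d} -> y - x ≡ d -> 0# ≤ d -> x ≤ y
  by-non {x} {y} idp l = ≤ˡ (+-identityʳ x) (≤ʳ (solve 2 (\ x y -> x :+ (y :- x) := y) idp x y) (+-monoʳ-≤ x l))
  diff≥0 : ∀ {x y} -> x ≤ y -> 0# ≤ y - x
  diff≥0 {x} {y} l = ≤ˡ (-‿inverseˡ x) (≤ʳ (+-comm (- x) y) (+-monoʳ-≤ (- x) l))
  +-non : ∀ {x y} -> 0# ≤ x -> 0# ≤ y -> 0# ≤ x + y
  +-non {x} {y} a b = ≤-trans a (≤ˡ (+-identityʳ x) (+-monoʳ-≤ x b))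
  +-mono-≤ : ∀ {x y u v} -> x ≤ y -> u ≤ v -> x + u ≤ y + v
  +-mono-≤ {x} {y} {u} {v} a b = ≤-trans (+-monoʳ-≤ x b) (≤ˡ (+-comm v x) (≤ʳ (+-comm v y) (+-monoʳ-≤ v a)))
  neg-mono : ∀ {x y} -> x ≤ y -> - y ≤ - x
  neg-mono {x} {y} l = by-non (solve 2 (\ x y -> :- x :- :- y := y :- x) idp x y) (diff≥0 l)
  neg-non : ∀ {x} -> x ≤ 0# -> 0# ≤ - x
  neg-non l = ≤ˡ -0#≈0# (neg-mono l)
  *-monoʳ-≤ : ∀ {z} -> 0# ≤ z -> ∀ {x y} -> x ≤ y -> z * x ≤ z * y
  *-monoʳ-≤ {z} p {x} {y} l = by-non (solve 3 (\ z x y -> z :* y :- z :* x := z :* (y :- x)) idp z x y) (*-non p (diff≥0 l))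
  *-monoˡ-≤ : ∀ {z} -> 0# ≤ z -> ∀ {x y} -> x ≤ y -> x * z ≤ y * z
  *-monoˡ-≤ {z} p {x} {y} l = ≤ˡ (*-comm z x) (≤ʳ (*-comm z y) (*-monoʳ-≤ p l))
  *-mono-≤ : ∀ {x y u v} -> 0# ≤ x -> 0# ≤ u -> x ≤ y -> u ≤ v -> x * u ≤ y * v
  *-mono-≤ a b l m = ≤-trans (*-monoˡ-≤ b l) (*-monoʳ-≤ (≤-trans a l) m)
  squ-non : ∀ x -> 0# ≤ x * x
  squ-non x with ≤-total 0# x
  ... | inj₁ l = *-non l l
  ... | inj₂ l = ≤ʳ (solve 1 (\ x -> (:- x) :* (:- x) := x :* x) idp x) (*-non (neg-non l) (neg-non l))
  0≤1 : 0# ≤ 1#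
  0≤1 = ≤ʳ (*-identityˡ 1#) (squ-non 1#)
  0<1 : 0# < 1#
  0<1 l = 0≢1 (≤-antisym 0≤1 l)
  fromℕ-non : ∀ n -> 0# ≤ fromℕ n
  fromℕ-non zero = ≤-refl
  fromℕ-non (suc n) = +-non 0≤1 (fromℕ-non n)
  fromℕ-mono : ∀ {m n} -> m N.≤ n -> fromℕ m ≤ fromℕ n
  fromℕ-mono {n = n} z≤n = fromℕ-non n
  fromℕ-mono (s≤s l) = +-monoʳ-≤ 1# (fromℕ-mono l)
  1≤fromℕ : ∀ {n} -> 1 N.≤ n -> 1# ≤ fromℕ n
  1≤fromℕ l = ≤ˡ (+-identityʳ 1#) (fromℕ-mono l)
  +-pos : ∀ {x y} -> 0# < x -> 0# ≤ y -> 0# < x + y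
  +-pos {x} {y} p l m = p (≤-trans (≤ˡ (+-identityʳ x) (+-monoʳ-≤ x l)) m)
  *-≢0 : ∀ {x y} -> x ≢ 0# -> y ≢ 0# -> x * y ≢ 0#
  *-≢0 {x} {y} nx ny e with inverse x nx
  ... | i , xi = ny (begin y ≡⟨ *-identityˡ y ⟨ 1# * y ≡⟨ ap (_* y) xi ⟨ x * i * y ≡⟨ solve 3 (\ x i y -> x :* i :* y := i :* (x :* y)) idp x i y ⟩ i * (x * y) ≡⟨ ap (i *_) e ⟩ i * 0# ≡⟨ zeroʳ i ⟩ 0# ∎)
  pos⇒≢0 : ∀ {x} -> 0# < x -> x ≢ 0#
  pos⇒≢0 p idp = p ≤-refl
  *-pos : ∀ {x y} -> 0# < x -> 0# < y -> 0# < x * y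
  *-pos p r = ≤∧≢⇒< (*-non (<⇒≤ p) (<⇒≤ r)) (\ e -> *-≢0 (pos⇒≢0 p) (pos⇒≢0 r) (! e))
  inv : ∀ x -> 0# < x -> Carrier
  inv x p = proj₁ (inverse x (pos⇒≢0 p))
  inv-* : ∀ x (p : 0# < x) -> x * inv x p ≡ 1#
  inv-* x p = proj₂ (inverse x (pos⇒≢0 p))
  *-can-≤ : ∀ {z} -> 0# < z -> ∀ {x y} -> z * x ≤ z * y -> x ≤ y
  *-can-≤ {z} p {x} {y} l with ≤-total x y
  ... | inj₁ m = m
  ... | inj₂ m = ≤-reflexive (! (from-dif (lemma (y - x) (≤-antisym (neg-sub (*-non (<⇒≤ p) (diff≥0 m))) (≤ʳ (solve 3 (\ z x y -> z :* y :- z :* x := z :* (y :- x)) idp z x y) (diff≥0 l))))))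
   where
   neg-sub : 0# ≤ z * (x - y) -> z * (y - x) ≤ 0#
   neg-sub h = ≤ˡ (solve 3 (\ z x y -> :- (z :* (x :- y)) := z :* (y :- x)) idp z x y) (≤ʳ -0#≈0# (neg-mono h))
   lemma : ∀ d -> z * d ≡ 0# -> d ≡ 0#
   lemma d e with d ≟ 0#
   ... | yes h = h
   ... | no nh = ⊥-elim (*-≢0 (pos⇒≢0 p) nh e)
  inv-pos : ∀ x (p : 0# < x) -> 0# < inv x p
  inv-pos x p l = 0<1 (≤ˡ (inv-* x p) (≤ʳ (zeroʳ x) (*-monoʳ-≤ (<⇒≤ p) l)))
  ^-non : ∀ {x} n -> 0# ≤ x -> 0# ≤ x ^ n
  ^-non zero p = 0≤1
  ^-non (suc n) p = *-non p (^-non n p)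
  ^-pos : ∀ {x} n -> 0# < x -> 0# < x ^ n
  ^-pos zero p = 0<1
  ^-pos (suc n) p = *-pos p (^-pos n p)
  ^-mono : ∀ {x y} n -> 0# ≤ x -> x ≤ y -> x ^ n ≤ y ^ n
  ^-mono zero p l = ≤-refl
  ^-mono (suc n) p l = *-mono-≤ p (^-non n p) l (^-mono n p l)
  1^ : ∀ n -> 1# ^ n ≡ 1#
  1^ zero = idp
  1^ (suc n) = *-identityˡ _ ∙ 1^ n
  1≤^ : ∀ {x} n -> 1# ≤ x -> 1# ≤ x ^ n
  1≤^ n l = ≤ˡ (1^ n) (^-mono n 0≤1 l)
  ^≤1 : ∀ {x} n -> 0# ≤ x -> x ≤ 1# -> x ^ n ≤ 1#
  ^≤1 n p l = ≤ʳ (1^ n) (^-mono n p l)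
  ^-*-dis : ∀ x y n -> (x * y) ^ n ≡ x ^ n * y ^ n
  ^-*-dis x y n = ^-distrib-* x y n
   where open import Algebra.Properties.CommutativeSemiring.Exp commutativeSemiring using (^-distrib-*)
  ∣_∣ : Carrier -> Carrier
  ∣ x ∣ with ≤-total 0# x
  ... | inj₁ _ = x
  ... | inj₂ _ = - x
  abs-cas : ∀ x -> (0# ≤ x × ∣ x ∣ ≡ x) ⊎ (x ≤ 0# × ∣ x ∣ ≡ - x)
  abs-cas x with ≤-total 0# x
  ... | inj₁ l = inj₁ (l , idp)
  ... | inj₂ l = inj₂ (l , idp)
  abs-non : ∀ x -> 0# ≤ ∣ x ∣
  abs-non x with abs-cas x
  ... | inj₁ (l , e) = ≤ʳ (! e) l
  ... | inj₂ (l , e) = ≤ʳ (! e) (neg-non l)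
  x≤abs : ∀ x -> x ≤ ∣ x ∣
  x≤abs x with abs-cas x
  ... | inj₁ (l , e) = ≤-reflexive (! e)
  ... | inj₂ (l , e) = ≤-trans l (abs-non x)
  -x≤abs : ∀ x -> - x ≤ ∣ x ∣
  -x≤abs x with abs-cas x
  ... | inj₁ (l , e) = ≤-trans (≤ʳ -0#≈0# (neg-mono l)) (abs-non x)
  ... | inj₂ (l , e) = ≤-reflexive (! e)
  abs-≤ : ∀ {x y} -> x ≤ y -> - x ≤ y -> ∣ x ∣ ≤ y
  abs-≤ {x} l m with abs-cas x
  ... | inj₁ (_ , e) = ≤ˡ (! e) l
  ... | inj₂ (_ , e) = ≤ˡ (! e) m
  abs-+ : ∀ x y -> ∣ x + y ∣ ≤ ∣ x ∣ + ∣ y ∣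
  abs-+ x y = abs-≤ (+-mono-≤ (x≤abs x) (x≤abs y)) (≤ˡ (⁻¹-∙-comm x y) (+-mono-≤ (-x≤abs x) (-x≤abs y)))
  abs-neg : ∀ x -> ∣ - x ∣ ≡ ∣ x ∣
  abs-neg x = ≤-antisym (abs-≤ (-x≤abs x) (≤ˡ (! (-‿involutive x)) (x≤abs x))) (abs-≤ (≤ˡ (-‿involutive x) (-x≤abs (- x))) (x≤abs (- x)))
  abs-≡ : ∀ {x} -> 0# ≤ x -> ∣ x ∣ ≡ x
  abs-≡ {x} l with abs-cas x
  ... | inj₁ (_ , e) = e
  ... | inj₂ (m , e) = e ∙ ap -_ x≡0 ∙ -0#≈0# ∙ ! x≡0
   where x≡0 = ≤-antisym m l
  abs-sq : ∀ x -> ∣ x ∣ * ∣ x ∣ ≡ x * x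
  abs-sq x with abs-cas x
  ... | inj₁ (_ , e) = ap₂ _*_ e e
  ... | inj₂ (_ , e) = ap₂ _*_ e e ∙ solve 1 (\ x -> (:- x) :* (:- x) := x :* x) idp x
  abs-* : ∀ x y -> ∣ x * y ∣ ≡ ∣ x ∣ * ∣ y ∣
  abs-* x y with abs-cas x | abs-cas y
  ... | inj₁ (a , e) | inj₁ (b , e') = abs-≡ (*-non a b) ∙ ! (ap₂ _*_ e e')
  ... | inj₁ (a , e) | inj₂ (b , e') = ! (abs-neg _) ∙ abs-≡ (≤ʳ (! (-‿distribʳ-* x y)) (*-non a (neg-non b))) ∙ -‿distribʳ-* x y ∙ ! (ap₂ _*_ e e')
  ... | inj₂ (a , e) | inj₁ (b , e') = ! (abs-neg _) ∙ abs-≡ (≤ʳ (! (-‿distribˡ-* x y)) (*-non (neg-non a) b)) ∙ -‿distribˡ-* x y ∙ ! (ap₂ _*_ e e')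
  ... | inj₂ (a , e) | inj₂ (b , e') = ap ∣_∣ m ∙ abs-≡ (*-non (neg-non a) (neg-non b)) ∙ ! (ap₂ _*_ e e')
   where
   m : x * y ≡ - x * - y
   m = solve 2 (\ x y -> x :* y := (:- x) :* (:- y)) idp x y
  abs-0 : ∣ 0# ∣ ≡ 0#
  abs-0 = abs-≡ ≤-refl
  abs-sumTo : ∀ n f -> ∣ sumTo n f ∣ ≤ sumTo n (\ i -> ∣ f i ∣)
  abs-sumTo zero f = ≤-reflexive (ap ∣_∣ (sumTo-zero f) ∙ abs-0 ∙ ! (sumTo-zero _))
  abs-sumTo (suc n) f = ≤ˡ (ap ∣_∣ (! (sumTo-suc n f))) (≤ʳ (! (sumTo-suc n _)) (≤-trans (abs-+ _ _) (+-monoʳ-≤ _ (abs-sumTo n (f ∘ suc)))))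
  sumTo-mono : ∀ n {f g : ℕ -> Carrier} -> (∀ i -> i N.< n -> f i ≤ g i) -> sumTo n f ≤ sumTo n g
  sumTo-mono zero {f} {g} h = ≤-reflexive (sumTo-zero f ∙ ! (sumTo-zero g))
  sumTo-mono (suc n) {f} {g} h = ≤ˡ (! (sumTo-suc n f)) (≤ʳ (! (sumTo-suc n g)) (+-mono-≤ (h 0 (s≤s z≤n)) (sumTo-mono n (\ i l -> h (suc i) (s≤s l)))))
  sumTo-non : ∀ n {f : ℕ -> Carrier} -> (∀ i -> 0# ≤ f i) -> 0# ≤ sumTo n f
  sumTo-non n h = ≤ˡ (sumTo-0 n {\ _ -> 0#} (\ _ _ -> idp)) (sumTo-mono n (\ i _ -> h i))
  sumTo-con : ∀ n x -> sumTo n (\ _ -> x) ≡ fromℕ n * x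
  sumTo-con zero x = sumTo-zero _ ∙ ! (zeroˡ x)
  sumTo-con (suc n) x = sumTo-suc n _ ∙ ap₂ _+_ (! (*-identityˡ x)) (sumTo-con n x) ∙ ! (distribʳ x 1# (fromℕ n))
  term≤sumTo : ∀ n {f : ℕ -> Carrier} -> (∀ i -> 0# ≤ f i) -> ∀ j -> j N.< n -> f j ≤ sumTo n f
  term≤sumTo (suc n) {f} h zero l = ≤ʳ (! (sumTo-suc n f)) (≤ˡ (+-identityʳ _) (+-monoʳ-≤ _ (sumTo-non n (\ i -> h (suc i)))))
  term≤sumTo (suc n) {f} h (suc j) (s≤s l) = ≤ʳ (! (sumTo-suc n f)) (≤-trans (term≤sumTo n (\ i -> h (suc i)) j l) (≤ˡ (+-identityˡ _) (+-mono-≤ (h 0) ≤-refl)))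
  squ-≤⇒≤ : ∀ {x y} -> 0# ≤ y -> x * x ≤ y * y -> x ≤ y
  squ-≤⇒≤ {x} {y} p l with x ≤? y
  ... | yes m = m
  ... | no n = ⊥-elim (<-squ l)
   where
   <-squ : ¬ (x * x ≤ y * y)
   <-squ l = *-pos (≤∧≢⇒< (diff≥0 (<⇒≤ n)) (\ e -> n (≤-reflexive (from-dif (! e))))) (+-pos {x} {y} (≤-<-trans p n) p) (≤ˡ (solve 2 (\ x y -> x :* x :- y :* y := (x :- y) :* (x :+ y)) idp x y) (≤ʳ (-‿inverseʳ (y * y)) (+-mono-≤ l ≤-refl)))
  ber : ∀ {x} -> 0# ≤ x -> ∀ n -> 1# + fromℕ n * x ≤ (1# + x) ^ n
  ber {x} p zero = ≤-reflexive (ap (\ t -> 1# + t) (zeroˡ x) ∙ +-identityʳ 1#)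
  ber {x} p (suc n) = ≤-trans (by-non (lemma (fromℕ n) x) (*-non (fromℕ-non n) (squ-non x))) (*-monoʳ-≤ (+-non 0≤1 p) (ber p n))
   where
   lemma : ∀ n x -> (1# + x) * (1# + n * x) - (1# + (1# + n) * x) ≡ n * (x * x)
   lemma = solve 2 (\ n x -> (1∶ :+ x) :* (1∶ :+ n :* x) :- (1∶ :+ (1∶ :+ n) :* x) := n :* (x :* x)) idp
  0<fromℕ : ∀ {n} -> 1 N.≤ n -> 0# < fromℕ n
  0<fromℕ l = <-≤-trans 0<1 (1≤fromℕ l)

  -- Powers of a number below 1 become smaller than any positive number.
  ^-sma : ∀ {μ} -> 0# ≤ μ -> μ < 1# -> ∀ δ -> 0# < δ -> Σ[ L ∈ ℕ ] μ ^ L < δ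
  ^-sma {μ} p μ<1 δ δ>0 with μ ≟ 0#
  ... | yes idp = 1 , \ l -> δ>0 (≤ʳ (zeroˡ 1#) l)
  ... | no ne = L , \ l -> con′ l
   where
   μ>0 : 0# < μ
   μ>0 = ≤∧≢⇒< p (ne ∘ !)
   ν = inv μ μ>0
   μν : μ * ν ≡ 1#
   μν = inv-* μ μ>0
   x = ν - 1#
   x>0 : 0# < x
   x>0 l = μ<1 (≤ˡ μν (≤ʳ (*-identityʳ μ) (*-monoʳ-≤ p (≤ˡ (solve 1 (\ v -> (v :- 1∶) :+ 1∶ := v) idp ν) (≤ʳ (+-identityˡ 1#) (+-mono-≤ l ≤-refl))))))
   i = inv (δ * x) (*-pos δ>0 x>0)
   L = proj₁ (arc i)
   -- δ ν^L ≥ δ (1 + L x) > δ x L ≥ 1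
   con′ : δ ≤ μ ^ L -> ⊥
   con′ l = δ>0 (≤ʳ (-‿inverseʳ 1#) (≤-trans (≤ˡ (solve 2 (\ d y -> (d :+ y) :- y := d) idp δ 1#) (+-mono-≤ low (≤-refl { - 1# }))) (+-mono-≤ high ≤-refl)))
    where
    1+x≡ν : 1# + x ≡ ν
    1+x≡ν = solve 1 (\ v -> 1∶ :+ (v :- 1∶) := v) idp ν
    high : δ * ν ^ L ≤ 1#
    high = ≤-trans (*-monoˡ-≤ (^-non L (<⇒≤ (inv-pos μ μ>0))) l) (≤-reflexive (! (^-*-dis μ ν L) ∙ ap (_^ L) μν ∙ 1^ L))
    low : δ + 1# ≤ δ * ν ^ L
    low = ≤-trans (≤-trans (+-monoʳ-≤ δ (≤ˡ (inv-* (δ * x) (*-pos δ>0 x>0)) (*-monoʳ-≤ (*-non (<⇒≤ δ>0) (<⇒≤ x>0)) (proj₂ (arc i))))) (≤-reflexive (solve 3 (\ d x n -> d :+ d :* x :* n := d :* (1∶ :+ n :* x)) idp δ x (fromℕ L)))) (*-monoʳ-≤ (<⇒≤ δ>0) (≤ʳ (ap (_^ L) 1+x≡ν) (ber (<⇒≤ x>0) L)))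
  ^-ant : ∀ {μ m n} -> 0# ≤ μ -> μ ≤ 1# -> m N.≤ n -> μ ^ n ≤ μ ^ m
  ^-ant {μ} {m} {n} p l m≤n = ≤ˡ (! (^-homo-* μ m (n ∸ m)) ∙ ap (μ ^_) (NP.m+[n∸m]≡n m≤n)) (≤ʳ (*-identityʳ _) (*-monoʳ-≤ (^-non m p) (^≤1 (n ∸ m) p l)))

  -- If x ≤ C δ for all small δ > 0 of the form μ ^ L, then x ≤ 0.
  ≤0-by-dec : ∀ {μ} -> 0# ≤ μ -> μ < 1# -> ∀ {x} C -> 0# ≤ C -> (L₀ : ℕ) -> (∀ L -> L₀ N.≤ L -> x ≤ C * μ ^ L) -> x ≤ 0#
  ≤0-by-dec {μ} p μ<1 {x} C 0≤C L₀ h with x ≤? 0#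
  ... | yes l = l
  ... | no x>0 with ^-sma p μ<1 (x * inv C⁺ C⁺>0) (*-pos x>0 (inv-pos C⁺ C⁺>0))
   where
   C⁺ = 1# + C
   C⁺>0 = +-pos 0<1 0≤C
  ... | L , small = ⊥-elim (small (≤-trans (≤-trans (*-monoˡ-≤ (<⇒≤ (inv-pos C⁺ C⁺>0)) (≤-trans (h (L₀ N.⊔ L) (NP.m≤m⊔n L₀ L)) (*-mono-≤ 0≤C (^-non (L₀ N.⊔ L) p) (≤ˡ (+-identityˡ C) (+-mono-≤ 0≤1 ≤-refl)) (^-ant p (<⇒≤ μ<1) (NP.m≤n⊔m L₀ L))))) (≤-reflexive (solve 3 (\ c m i -> c :* m :* i := (c :* i) :* m) idp C⁺ (μ ^ L) (inv C⁺ C⁺>0) ∙ ap (_* μ ^ L) (inv-* C⁺ C⁺>0) ∙ *-identityˡ _))) ≤-refl))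
   where
   C⁺ = 1# + C
   C⁺>0 = +-pos 0<1 0≤C
  -- The step from estimates to exact equations: it yields the functional equation and separates the
  -- two cases for the integer in Serre's argument.
  fromℤ-sma : ∀ i -> ∣ fromℤ i ∣ < 1# -> i ≡ + 0
  fromℤ-sma (+ zero) l = idp
  fromℤ-sma (+ suc n) l = ⊥-elim (l (≤ʳ (! (abs-≡ (fromℕ-non (suc n)))) (1≤fromℕ {suc n} (s≤s z≤n))))
  fromℤ-sma -[1+ n ] l = ⊥-elim (l (≤ʳ (! (abs-neg _ ∙ abs-≡ (fromℕ-non (suc n)))) (1≤fromℕ {suc n} (s≤s z≤n))))

open OrderedFields

-- Square sums under multiplication by the reversed polynomial over the polynomial.

module Contractions where

 module Sequences (F : OrdFie) where
  open OrdKit F public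
  open Pol ring public
  module S = Kit serRing
  ⊛-loc : ∀ i {f f' g g'} -> (∀ j -> j N.≤ i -> f j ≡ f' j) -> (∀ j -> j N.≤ i -> g j ≡ g' j) -> (f ⊛ g) i ≡ (f' ⊛ g') i
  ⊛-loc zero a b = ap₂ _*_ (a 0 z≤n) (b 0 z≤n)
  ⊛-loc (suc i) a b = ap₂ _+_ (ap₂ _*_ (a 0 z≤n) (b _ NP.≤-refl)) (⊛-loc i (\ j l -> a (suc j) (s≤s l)) (\ j l -> b j (NP.≤-trans l (NP.n≤1+n i))))
  opaque
   trunc : ℕ -> Seq -> Seq
   trunc L f i with i NP.<? L
   ... | yes _ = f i
   ... | no _ = 0#
   tru-< : ∀ {L} f {i} -> i N.< L -> trunc L f i ≡ f i
   tru-< {L} f {i} l with i NP.<? L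
   ... | yes _ = idp
   ... | no n = ⊥-elim (n l)
   tru-Deg : ∀ L f -> Deg< (trunc L f) L
   tru-Deg L f i l with i NP.<? L
   ... | yes m = ⊥-elim (NP.<⇒≱ m l)
   ... | no _ = idp
   tru-abs : ∀ L f i -> ∣ trunc L f i ∣ ≤ ∣ f i ∣
   tru-abs L f i with i NP.<? L
   ... | yes _ = ≤-refl
   ... | no _ = ≤ˡ (! abs-0) (abs-non (f i))
  sumTo-spl : ∀ m n f -> sumTo (m N.+ n) f ≡ sumTo m f + sumTo n (\ i -> f (m N.+ i))
  sumTo-spl zero n f = ! (ap (_+ sumTo n f) (sumTo-zero f) ∙ +-identityˡ _)
  sumTo-spl (suc m) n f = sumTo-suc (m N.+ n) f ∙ ap (f 0 +_) (sumTo-spl m n (f ∘ suc)) ∙ ! (+-assoc _ _ _) ∙ ap (_+ sumTo n (\ i -> f (suc m N.+ i))) (! (sumTo-suc m f))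
  sq : ℕ -> Seq -> Carrier
  sq K f = sumTo K (\ i -> f i * f i)
  sq-cong : ∀ K {f g} -> (∀ i -> i N.< K -> f i ≡ g i) -> sq K f ≡ sq K g
  sq-cong K h = sumTo-cong K (\ i l -> ap₂ _*_ (h i l) (h i l))
  sq-mono : ∀ {K L} f -> K N.≤ L -> sq K f ≤ sq L f
  sq-mono {K} {L} f l = ≤ˡ (+-identityʳ _) (≤ʳ (! (sumTo-spl K (L ∸ K) _) ∙ ap (\ n -> sq n f) (NP.m+[n∸m]≡n l)) (+-monoʳ-≤ (sq K f) (sumTo-non (L ∸ K) (\ i -> squ-non _))))
  sq-rev : ∀ n f -> sq (suc n) f ≡ (f ⊛ rev n f) n
  sq-rev n f = ! (⊛-sum f (rev n f) n ∙ sumTo-cong (suc n) (\ i l -> ap (f i *_) (rev-at n f (n ∸ i) (NP.m∸n≤m n i) ∙ ap f (NP.m∸[m∸n]≡n (NP.≤-pred l)))))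

  -- |P k| = |P* k|: both squares are the middle coefficient of P P* k k*.
  rev-iso : ∀ N L {A k} -> Deg< A (suc N) -> Deg< k (suc L) -> sq (suc (N N.+ L)) (A ⊛ k) ≡ sq (suc (N N.+ L)) (rev N A ⊛ k)
  rev-iso N L {A} {k} dA dk = begin sq (suc (N N.+ L)) (A ⊛ k) ≡⟨ sq-rev (N N.+ L) (A ⊛ k) ⟩ ((A ⊛ k) ⊛ rev (N N.+ L) (A ⊛ k)) (N N.+ L) ≡⟨ ⊛-cong {A ⊛ k} ≋-refl (rev-⊛ N L A k dA dk) (N N.+ L) ⟩ ((A ⊛ k) ⊛ (P ⊛ rev L k)) (N N.+ L) ≡⟨ at (S.solve 4 (\ a k p r -> (a S.:* k) S.:* (p S.:* r) S.:= (p S.:* k) S.:* (a S.:* r)) S.refl A k P (rev L k)) (N N.+ L) ⟩ ((P ⊛ k) ⊛ (A ⊛ rev L k)) (N N.+ L) ≡⟨ ⊛-cong {P ⊛ k} ≋-refl (⊛-cong {A} {rev N P} {rev L k} (≋-sym (rev-rev N dA)) ≋-refl) (N N.+ L) ⟩ ((P ⊛ k) ⊛ (rev N P ⊛ rev L k)) (N N.+ L) ≡⟨ ⊛-cong {P ⊛ k} ≋-refl (rev-⊛ N L P k (rev-Deg N A) dk) (N N.+ L) ⟨ ((P ⊛ k) ⊛ rev (N N.+ L) (P ⊛ k)) (N N.+ L) ≡⟨ sq-rev (N N.+ L) (P ⊛ k) ⟨ sq (suc (N N.+ L)) (P ⊛ k) ∎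
   where P = rev N A
  module Decaying (μ : Carrier) (μ>0 : 0# < μ) (μ<1 : μ < 1#) where
   μ≥0 = <⇒≤ μ>0
   ν = inv μ μ>0
   Bounded : Carrier -> Seq -> Set
   Bounded B f = ∀ j -> ∣ f j ∣ ≤ B * μ ^ j
   -- The sum of |f i| / μ^i over i < n: the factor by which multiplication by a polynomial f
   -- enlarges the constant in a bound B μ^j.
   decCon : ℕ -> Seq -> Carrier
   decCon zero f = 0#
   decCon (suc n) f = ∣ f 0 ∣ + ν * decCon n (tail f)
   decCon-non : ∀ n f -> 0# ≤ decCon n f
   decCon-non zero f = ≤-refl
   decCon-non (suc n) f = +-non (abs-non _) (*-non (<⇒≤ (inv-pos μ μ>0)) (decCon-non n (tail f)))
   ⊛-Bou : ∀ n f {g B} -> 0# ≤ B -> Deg< f n -> Bounded B g -> Bounded (decCon n f * B) (f ⊛ g)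
   ⊛-Bou zero f {g} {B} pB d b j = ≤-reflexive (ap ∣_∣ (⊛-cong {f} {𝟘} {g} (\ i -> d i z≤n) ≋-refl j ∙ ⊛-zeroˡ g j) ∙ abs-0 ∙ ! (ap (_* μ ^ j) (zeroˡ B) ∙ zeroˡ _))
   ⊛-Bou (suc n) f {g} {B} pB d b zero = ≤ˡ (! (abs-* _ _)) (≤-trans (*-monoʳ-≤ (abs-non (f 0)) (b 0)) (by-non (solve 4 (\ f c B m -> (f :+ c) :* B :* m :- f :* (B :* m) := c :* B :* m) idp ∣ f 0 ∣ (ν * decCon n (tail f)) B 1#) (*-non (*-non (*-non (<⇒≤ (inv-pos μ μ>0)) (decCon-non n (tail f))) pB) 0≤1)))
   ⊛-Bou (suc n) f {g} {B} pB d b (suc j) = ≤-trans (abs-+ _ _) (≤-trans (+-mono-≤ (≤ˡ (! (abs-* _ _)) (*-monoʳ-≤ (abs-non (f 0)) (b (suc j)))) (⊛-Bou n (tail f) pB (\ i l -> d (suc i) (s≤s l)) b j)) (≤-reflexive (! (begin (∣ f 0 ∣ + ν * D) * B * (μ * μ ^ j) ≡⟨ solve 6 (\ f v D B m k -> (f :+ v :* D) :* B :* (m :* k) := f :* (B :* (m :* k)) :+ (m :* v) :* (D :* B :* k)) idp ∣ f 0 ∣ ν D B μ (μ ^ j) ⟩ ∣ f 0 ∣ * (B * (μ * μ ^ j)) + (μ * ν) * (D * B * μ ^ j) ≡⟨ ap (\ t -> ∣ f 0 ∣ * (B * (μ * μ ^ j)) + t) (ap (_* (D * B * μ ^ j))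 (inv-* μ μ>0) ∙ *-identityˡ _) ⟩ ∣ f 0 ∣ * (B * (μ * μ ^ j)) + D * B * μ ^ j ∎))))
    where D = decCon n (tail f)
   -- A decaying inverse h expresses that A has no zero in a disc slightly larger than the unit
   -- disc. With P the reversed polynomial, P h is a Blaschke product.
   module Contraction (N : ℕ) (A h : Seq) (dA : Deg< A (suc N)) (hA : h ⊛ A ≋ 𝟙) (B : Carrier) (B≥0 : 0# ≤ B) (bh : Bounded B h) where
    P : Seq
    P = rev N A
    module Ext (K : ℕ) (g : Seq) (dg : Deg< g K) where
     k : Seq
     k = g ⊛ h
     Ak : A ⊛ k ≋ g
     Ak = at (S.solve 3 (\ a g h -> a S.:* (g S.:* h) S.:= g S.:* (h S.:* a)) S.refl A g h S.& S.*-congˡ {g} ⟪ hA ⟫ S.& S.*-identityʳ g)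
     Bk : Carrier
     Bk = decCon K g * B
     Bk≥0 : 0# ≤ Bk
     Bk≥0 = *-non (decCon-non K g) B≥0
     bk : Bounded Bk k
     bk = ⊛-Bou K g B≥0 dg bh
     kL : ℕ -> Seq
     kL L = trunc L k
     bkL : ∀ L -> Bounded Bk (kL L)
     bkL L j = ≤-trans (tru-abs L k j) (bk j)
     local : ∀ f L i -> i N.< L -> (f ⊛ kL L) i ≡ (f ⊛ k) i
     local f L i l = ⊛-loc i (\ _ _ -> idp) (\ j m -> tru-< k (NP.≤-<-trans m l))
     -- For k cut off at L, `rev-iso` is an exact equality of square sums. There A k agrees with g
     -- below L, and the N further coefficients have squares of size μ^L; letting L grow removes
     -- them.
     contraction : ∀ M -> sq M (P ⊛ k) ≤ sq K g
     contraction M = by-non {d = sq K g - sq M (P ⊛ k)} idp (≤ˡ -0#≈0# (≤ʳ (solve 2 (\ a b -> :- (a :- b) := b :- a) idp _ _) (neg-mono small)))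
      where
      B″ = decCon (suc N) A * Bk
      B″≥0 : 0# ≤ B″
      B″≥0 = *-non (decCon-non (suc N) A) Bk≥0
      C = fromℕ N * (B″ * B″)
      edge : ∀ L i -> (A ⊛ kL L) (L N.+ i) * (A ⊛ kL L) (L N.+ i) ≤ B″ * B″ * μ ^ L
      edge L i = ≤ˡ (abs-sq _) (≤-trans (*-mono-≤ (abs-non _) (abs-non _) le le) (≤-trans (≤-reflexive (solve 2 (\ b m -> b :* m :* (b :* m) := b :* b :* (m :* m)) idp B″ (μ ^ L))) (*-monoʳ-≤ (squ-non B″) (≤ʳ (*-identityʳ _) (*-monoʳ-≤ (^-non L μ≥0) (^≤1 L μ≥0 (<⇒≤ μ<1)))))))
       where
       le : ∣ (A ⊛ kL L) (L N.+ i) ∣ ≤ B″ * μ ^ L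
       le = ≤-trans (⊛-Bou (suc N) A Bk≥0 dA (bkL L) (L N.+ i)) (*-monoʳ-≤ B″≥0 (^-ant μ≥0 (<⇒≤ μ<1) (NP.m≤m+n L i)))
      main : ∀ L -> suc (M N.+ K) N.≤ L -> sq M (P ⊛ k) - sq K g ≤ C * μ ^ L
      main (suc L') (s≤s l) = ≤ˡ idp (≤-trans (+-mono-≤ chain ≤-refl) (≤-reflexive (solve 2 (\ g c -> (g :+ c) :- g := c) idp (sq K g) _)))
       where
       L = suc L'
       K≤L = NP.≤-trans (NP.m≤n+m K M) (NP.≤-trans l (NP.n≤1+n L'))
       M≤L = NP.≤-trans (NP.m≤m+n M K) (NP.≤-trans l (NP.n≤1+n L'))
       size : suc (N N.+ L') ≡ L N.+ N
       size = ap suc (NP.+-comm N L')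
       lower : sq L (A ⊛ kL L) ≡ sq K g
       lower = sq-cong L (\ i l -> local A L i l ∙ Ak i) ∙ sumTo-ext K≤L _ (\ i l -> ap (_* g i) (dg i l) ∙ zeroˡ _)
       chain : sq M (P ⊛ k) ≤ sq K g + C * μ ^ L
       chain = ≤-trans (≤-reflexive (sq-cong M (\ i l -> ! (local P L i (NP.<-≤-trans l M≤L))))) (≤-trans (sq-mono (P ⊛ kL L) (NP.≤-trans M≤L (NP.≤-trans (NP.m≤m+n L N) (NP.≤-reflexive (! size))))) (≤-trans (≤-reflexive (! (rev-iso N L' dA (tru-Deg L k)) ∙ ap (\ n -> sq n (A ⊛ kL L)) size ∙ sumTo-spl L N _)) (+-mono-≤ (≤-reflexive lower) (≤-trans (sumTo-mono N (\ i _ -> edge L i)) (≤-reflexive (sumTo-con N _ ∙ ! (*-assoc _ _ _)))))))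
      small : sq M (P ⊛ k) - sq K g ≤ 0#
      small = ≤0-by-dec μ≥0 μ<1 C (*-non (fromℕ-non N) (squ-non B″)) (suc (M N.+ K)) main

     -- Equality forces the recurrence P k = 0 beyond K; read backwards from a far index L it has
     -- characteristic polynomial P*, so k decays backwards as well and vanishes.
     rigid : K N.≤ N -> (∀ i -> K N.≤ i -> (P ⊛ k) i ≡ 0#) -> k ≋ 𝟘
     rigid K≤N Pk≡0 j = abs≤0 (≤0-by-dec μ≥0 μ<1 C C≥0 (suc j) main)
      where
      abs≤0 : ∀ {x} -> ∣ x ∣ ≤ 0# -> x ≡ 0#
      abs≤0 {x} l = ≤-antisym (≤-trans (x≤abs x) l) (≤ˡ (ap -_ -0#≈0# ∙ -0#≈0#) (≤ʳ (-‿involutive x) (neg-mono (≤-trans (-x≤abs x) (≤ʳ (! -0#≈0#) l)))))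
      B″ = decCon (suc N) P * Bk
      B″≥0 : 0# ≤ B″
      B″≥0 = *-non (decCon-non (suc N) P) Bk≥0
      C = fromℕ N * (B″ * B)
      C≥0 : 0# ≤ C
      C≥0 = *-non (fromℕ-non N) (*-non B″≥0 B≥0)
      main : ∀ L -> suc j N.≤ L -> ∣ k j ∣ ≤ C * μ ^ L
      main (suc L') (s≤s j≤L') = ≤ˡ (ap ∣_∣ value) bou′
       where
       L = suc L'
       -- m is the truncated k read backwards from L′, and b = A m is P k read backwards. Up to
       -- index L′ only the first N entries of b can be nonzero, and they are of size μ^L. Hence m =
       -- b h is of that size at the index t, where it equals k j.
       m b : Seq
       m = rev L' (kL L)
       b = A ⊛ m
       value : m (L' ∸ j) ≡ k j
       value = rev-at L' (kL L) (L' ∸ j) (NP.m∸n≤m L' j) ∙ ap (kL L) (NP.m∸[m∸n]≡n j≤L') ∙ tru-< k (s≤s j≤L')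
       b-rev : b ≋ rev (N N.+ L') (P ⊛ kL L)
       b-rev = ≋-sym (≋-trans (rev-⊛ N L' P (kL L) (rev-Deg N A) (tru-Deg L k)) (⊛-cong {rev N P} {A} {m} (rev-rev N dA) ≋-refl))
       m-b : m ≋ b ⊛ h
       m-b = at (S.sym (S.solve 3 (\ a m h -> (a S.:* m) S.:* h S.:= m S.:* (h S.:* a)) S.refl A m h S.& S.*-congˡ {m} ⟪ hA ⟫ S.& S.*-identityʳ m))
       b-mid : ∀ i -> N N.≤ i -> i N.≤ L' -> b i ≡ 0#
       b-mid i N≤i i≤L' = b-rev i ∙ rev-at (N N.+ L') _ i (NP.≤-trans i≤L' (NP.m≤n+m L' N)) ∙ local P L (N N.+ L' ∸ i) (s≤s up) ∙ Pk≡0 _ low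
        where
        up : N N.+ L' ∸ i N.≤ L'
        up = NP.≤-trans (NP.∸-monoʳ-≤ (N N.+ L') N≤i) (NP.≤-reflexive (NP.m+n∸m≡n N L'))
        low : K N.≤ N N.+ L' ∸ i
        low = NP.≤-trans K≤N (NP.≤-trans (NP.≤-reflexive (! (NP.m+n∸n≡m N L'))) (NP.∸-monoʳ-≤ (N N.+ L') i≤L'))
       b-edge : ∀ i -> i N.< N -> ∣ b i ∣ ≤ B″ * μ ^ L
       b-edge i i<N = ≤ˡ (ap ∣_∣ (! (b-rev i ∙ rev-at (N N.+ L') _ i (NP.≤-trans (NP.<⇒≤ i<N) (NP.m≤m+n N L'))))) (≤-trans (⊛-Bou (suc N) P Bk≥0 (rev-Deg N A) (bkL L) (N N.+ L' ∸ i)) (*-monoʳ-≤ B″≥0 (^-ant μ≥0 (<⇒≤ μ<1) far)))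
        where
        far : L N.≤ N N.+ L' ∸ i
        far = NP.≤-trans (NP.≤-reflexive (! (NP.m+n∸m≡n i L) ∙ ap (_∸ i) (NP.+-suc i L'))) (NP.∸-monoˡ-≤ i (NP.+-monoˡ-≤ L' i<N))
       t : ℕ
       t = L' ∸ j
       term : ∀ i -> i N.< suc t -> ∣ b i * h (t ∸ i) ∣ ≤ B″ * B * μ ^ L
       term i i≤t with i NP.<? N
       ... | yes i<N = ≤ˡ (! (abs-* _ _)) (≤-trans (*-mono-≤ (abs-non _) (abs-non _) (b-edge i i<N) (≤-trans (bh (t ∸ i)) (≤ʳ (*-identityʳ B) (*-monoʳ-≤ B≥0 (^≤1 (t ∸ i) μ≥0 (<⇒≤ μ<1)))))) (≤-reflexive (solve 3 (\ c m b -> c :* m :* b := c :* b :* m) idp B″ (μ ^ L) B)))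
       ... | no nl = ≤ˡ (! (ap ∣_∣ (ap (_* h (t ∸ i)) (b-mid i (NP.≮⇒≥ nl) (NP.≤-trans (NP.≤-pred i≤t) (NP.m∸n≤m L' j))) ∙ zeroˡ _) ∙ abs-0)) (*-non (*-non B″≥0 B≥0) (^-non L μ≥0))
       total : ∀ n -> n N.≤ suc t -> sumTo n (\ i -> ∣ b i * h (t ∸ i) ∣) ≤ fromℕ N * (B″ * B * μ ^ L)
       total n n≤ with n NP.≤? N
       ... | yes l = ≤-trans (sumTo-mono n (\ i i<n -> term i (NP.<-≤-trans i<n n≤))) (≤-trans (≤-reflexive (sumTo-con n _)) (*-monoˡ-≤ (*-non (*-non B″≥0 B≥0) (^-non L μ≥0)) (fromℕ-mono l)))
       total zero n≤ | no nl = ⊥-elim (nl z≤n)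
       total (suc n) n≤ | no nl = ≤-trans (≤-reflexive (sumTo-snoc n _ ∙ ap (\ x -> sumTo n (\ i -> ∣ b i * h (t ∸ i) ∣) + x) last≡0 ∙ +-identityʳ _)) (total n (NP.≤-trans (NP.n≤1+n n) n≤))
        where
        last≡0 : ∣ b n * h (t ∸ n) ∣ ≡ 0#
        last≡0 = ap ∣_∣ (ap (_* h (t ∸ n)) (b-mid n (NP.≤-pred (NP.≰⇒> nl)) (NP.≤-trans (NP.≤-pred n≤) (NP.m∸n≤m L' j))) ∙ zeroˡ _) ∙ abs-0
       bou′ : ∣ m t ∣ ≤ C * μ ^ L
       bou′ = ≤ˡ (ap ∣_∣ (! (m-b t ∙ ⊛-sum b h t))) (≤-trans (abs-sumTo (suc t) _) (≤-trans (total (suc t) NP.≤-refl) (≤-reflexive (! (*-assoc _ _ _)))))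
    loc-zero : ∀ K f -> (∀ i -> i N.< K -> (A ⊛ f) i ≡ 0#) -> ∀ i -> i N.< K -> f i ≡ 0#
    loc-zero K f z i i<K = begin f i ≡⟨ at (S.sym (S.sym (S.*-assoc h A f) S.& S.*-congʳ {f} ⟪ hA ⟫ S.& S.*-identityˡ f)) i ⟩ (h ⊛ (A ⊛ f)) i ≡⟨ ⊛-loc i (\ _ _ -> idp) (\ j l -> z j (NP.≤-<-trans l i<K)) ⟩ (h ⊛ 𝟘) i ≡⟨ ⊛-zeroʳ h i ⟩ 0# ∎
    -- k may be replaced by k′ = g / A, with g the series A k cut off at K, since both agree below
    -- K. If the square sum of P k′ below K already reached that of g, all later coefficients of P
    -- k′ would vanish by `contraction`, and `rigid` would give k′ = 0.
    positive : ∀ K k -> K N.≤ N -> Σ[ i ∈ ℕ ] (i N.< K × k i ≢ 0#) -> sq K (P ⊛ k) < sq K (A ⊛ k)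
    positive K k K≤N (i₀ , i₀<K , k≢0) l = k≢0 (agree i₀ i₀<K ∙ rigid K≤N tail-zero i₀)
     where
     g = trunc K (A ⊛ k)
     open Ext K g (tru-Deg K (A ⊛ k)) renaming (k to k′; Ak to Ak′)
     agree : ∀ i -> i N.< K -> k i ≡ k′ i
     agree i i<K = from-dif (loc-zero K (k ⊕ (⊖ k′)) (\ j j<K -> ⊛-disˡ A k (⊖ k′) j ∙ ap ((A ⊛ k) j +_) (at (S.sym (S.-‿distribʳ-* A k′)) j) ∙ ap (\ t -> (A ⊛ k) j - t) (Ak′ j ∙ tru-< (A ⊛ k) j<K) ∙ -‿inverseʳ _) i i<K)
     same : sq K (P ⊛ k) ≡ sq K (P ⊛ k′)
     same = sq-cong K (\ i i<K -> ⊛-loc i (\ _ _ -> idp) (\ j j≤i -> agree j (NP.≤-<-trans j≤i i<K)))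
     below : sq K g ≤ sq K (P ⊛ k′)
     below = ≤ˡ (sq-cong K (\ i i<K -> ! (tru-< (A ⊛ k) i<K))) (≤ʳ same l)
     tail-zero : ∀ i -> K N.≤ i -> (P ⊛ k′) i ≡ 0#
     tail-zero i K≤i with (P ⊛ k′) i ≟ 0#
     ... | yes e = e
     ... | no ne = ⊥-elim (*-≢0 ne ne (≤-antisym sq≤0 (squ-non _)))
      where
      x = (P ⊛ k′) i
      sq≤0 : x * x ≤ 0#
      sq≤0 = by-non {d = (sq K (P ⊛ k′) - sq K g) + ((sq i (P ⊛ k′) - sq K (P ⊛ k′)) + (sq K g - sq (suc i) (P ⊛ k′)))} (solve 4 (\ s g k x -> 0∶ :- x := (k :- g) :+ ((s :- k) :+ (g :- (s :+ x)))) idp (sq i (P ⊛ k′)) (sq K g) (sq K (P ⊛ k′)) (x * x) ∙ ap (\ t -> (sq K (P ⊛ k′) - sq K g) + ((sq i (P ⊛ k′) - sq K (P ⊛ k′)) + (sq K g - t))) (! (sumTo-snoc i _))) (+-non (diff≥0 below) (+-non (diff≥0 (sq-mono (P ⊛ k′) K≤i)) (diff≥0 (contraction (suc i)))))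

open Contractions

-- Schur-Cohn positivity and the descending Szegő step.

module Recursions where

 open import Data.List.Base as List using (List; []; _∷_; length)
 open import Data.List.Relation.Unary.All as All using (All; []; _∷_)

 module Szegő (F : OrdFie) where
  open Sequences F public
  -- Positive definiteness of the Schur-Cohn form on truncations; it stands for the location of all
  -- zeros of V in the open unit disc.
  Positive : ℕ -> Seq -> Seq -> Set
  Positive N U V = ∀ K k -> K N.≤ N -> Σ[ i ∈ ℕ ] (i N.< K × k i ≢ 0#) -> sq K (V ⊛ k) < sq K (U ⊛ k)
  record Stage (j : ℕ) (U V : Seq) : Set where
   field
    U₀ : U 0 ≡ 1#
    dU : Deg< U (suc j)
    rev-U : V ≋ rev j U
    pos : Positive j U V
  rev-lin : ∀ n s c f g -> rev n (\ i -> s * (f i - c * g i)) ≋ (\ i -> s * (rev n f i - c * rev n g i))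
  rev-lin zero s c f g zero = idp
  rev-lin zero s c f g (suc i) = solve 2 (\ s c -> 0∶ := s :* (0∶ :- c :* 0∶)) idp s c
  rev-lin (suc n) s c f g zero = idp
  rev-lin (suc n) s c f g (suc i) = rev-lin n s c f g i
  sq-shi : ∀ K f -> sq (suc K) (0# ◃ f) ≡ sq K f
  sq-shi K f = sumTo-suc K _ ∙ ap (_+ sq K f) (zeroˡ 0#) ∙ +-identityˡ _
  ◃-⊛ˡ : ∀ f g -> (0# ◃ f) ⊛ g ≋ 0# ◃ (f ⊛ g)
  ◃-⊛ˡ f g zero = zeroˡ _
  ◃-⊛ˡ f g (suc n) = ap (_+ (f ⊛ g) n) (zeroˡ _) ∙ +-identityˡ _
  module Descent {j : ℕ} {U V : Seq} (L : Stage (suc j) U V) where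
   open Stage L
   γ : Carrier
   γ = V 0
   -- Positivity at K = 1 for the constant series 1, where U 0 = 1 and V 0 = γ.
   γ²<1 : γ * γ < 1#
   γ²<1 l = pos 1 𝟙 (s≤s z≤n) (0 , s≤s z≤n , \ e -> 0≢1 (! e)) (≤ˡ (! (one ∙ ap₂ _*_ (at (S.*-identityʳ U) 0) (at (S.*-identityʳ U) 0) ∙ ap₂ _*_ U₀ U₀ ∙ *-identityˡ 1#)) (≤ʳ (! (one ∙ ap₂ _*_ (at (S.*-identityʳ V) 0) (at (S.*-identityʳ V) 0))) l))
    where
    one : ∀ {f} -> sq 1 f ≡ f 0 * f 0
    one {f} = sumTo-suc 0 _ ∙ ap (f 0 * f 0 +_) (sumTo-zero _) ∙ +-identityʳ _
   gap : 0# < 1# - γ * γ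
   gap l = γ²<1 (≤ˡ (solve 1 (\ g -> (1∶ :- g) :+ g := 1∶) idp (γ * γ)) (≤ʳ (+-identityˡ _) (+-mono-≤ l (≤-refl {γ * γ}))))
   s : Carrier
   s = inv (1# - γ * γ) gap
   s-gap : (1# - γ * γ) * s ≡ 1#
   s-gap = inv-* _ gap
   -- The solution of U = U′ + γ t V′, V = t V′ + γ U′, a Szegő step with reflection coefficient γ;
   -- the determinant 1 - γ² of the system explains the factor s.
   U′ V′ : Seq
   U′ i = s * (U i - γ * V i)
   V′ i = s * (V (suc i) - γ * U (suc i))
   U-spl : U ≋ U′ ⊕ scale γ (0# ◃ V′)
   U-spl zero = begin U 0 ≡⟨ U₀ ⟩ 1# ≡⟨ s-gap ⟨ (1# - γ * γ) * s ≡⟨ ap (\ u -> (u - γ * γ) * s) U₀ ⟨ (U 0 - γ * γ) * s ≡⟨ solve 3 (\ u g s -> (u :- g :* g) :* s := s :* (u :- g :* g) :+ g :* 0∶) idp (U 0) γ s ⟩ s * (U 0 - γ * γ) + γ * 0# ∎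
   U-spl (suc i) = ! (solve 4 (\ s u v g -> s :* (u :- g :* v) :+ g :* (s :* (v :- g :* u)) := (1∶ :- g :* g) :* s :* u) idp s (U (suc i)) (V (suc i)) γ ∙ ap (_* U (suc i)) s-gap ∙ *-identityˡ _)
   U′₀ : U′ 0 ≡ 1#
   U′₀ = ! (U-spl 0 ∙ ap (U′ 0 +_) (zeroʳ γ) ∙ +-identityʳ _) ∙ U₀
   V-spl : V ≋ (0# ◃ V′) ⊕ scale γ U′
   V-spl zero = ! (+-identityˡ _ ∙ ap (γ *_) U′₀ ∙ *-identityʳ γ)
   V-spl (suc i) = ! (solve 4 (\ s u v g -> s :* (v :- g :* u) :+ g :* (s :* (u :- g :* v)) := (1∶ :- g :* g) :* s :* v) idp s (U (suc i)) (V (suc i)) γ ∙ ap (_* V (suc i)) s-gap ∙ *-identityˡ _)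
   rev-V : U ≋ rev (suc j) V
   rev-V = ≋-sym (≋-trans (rev-cong (suc j) rev-U) (rev-rev (suc j) dU))
   -- The top coefficients cancel: at j + 1 the polynomial U has V 0 = γ, and V has U 0 = 1.
   dU′ : Deg< U′ (suc j)
   dU′ i l with NP.m≤n⇒m<n∨m≡n l
   ... | inj₁ l′ = ap₂ (\ u v -> s * (u - γ * v)) (dU i l′) (rev-U i ∙ rev-Deg (suc j) U i l′) ∙ solve 2 (\ s g -> s :* (0∶ :- g :* 0∶) := 0∶) idp s γ
   ... | inj₂ idp = ap₂ (\ u v -> s * (u - γ * v)) (! (rev-U 0)) (rev-U (suc j) ∙ rev-at j U j NP.≤-refl ∙ ap U (NP.n∸n≡0 j) ∙ U₀) ∙ solve 2 (\ s g -> s :* (g :- g :* 1∶) := 0∶) idp s γ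
   rev-U′ : V′ ≋ rev j U′
   rev-U′ i = ap₂ (\ v u -> s * (v - γ * u)) (rev-U (suc i)) (rev-V (suc i)) ∙ ! (rev-lin j s γ U V i)
   -- With a = U′ k~ and b = t V′ k~ one has |U k~|² - |V k~|² = (1 - γ²)(|a|² - |b|²). The choice
   -- of k~ cuts U′ k off at K, so the extra index K adds nothing to |a|², while the shift makes the
   -- first K + 1 terms of b those of V′ k below K.
   pos′ : Positive j U′ V′
   pos′ K k K≤j (i₀ , i₀<K , k≢0) l = pos (suc K) k~ (s≤s K≤j) (i₀ , NP.m<n⇒m<1+n i₀<K , \ e -> k≢0 (agree i₀ i₀<K ∙ e)) final
    where
    h = quot 𝟙 U′
    hU : h ⊛ U′ ≋ 𝟙
    hU = quot-⊛ 𝟙 U′ U′₀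
    g = trunc K (U′ ⊛ k)
    k~ = g ⊛ h
    Uk~ : U′ ⊛ k~ ≋ g
    Uk~ = at (S.solve 3 (\ a g h -> a S.:* (g S.:* h) S.:= g S.:* (h S.:* a)) S.refl U′ g h S.& S.*-congˡ {g} ⟪ hU ⟫ S.& S.*-identityʳ g)
    agree : ∀ i -> i N.< K -> k i ≡ k~ i
    agree i i<K = at (S.sym (S.solve 3 (\ a k h -> (a S.:* k) S.:* h S.:= k S.:* (h S.:* a)) S.refl U′ k h S.& S.*-congˡ {k} ⟪ hU ⟫ S.& S.*-identityʳ k)) i ∙ ⊛-loc i (\ j j≤i -> ! (tru-< (U′ ⊛ k) (NP.≤-<-trans j≤i i<K))) (\ _ _ -> idp)
    a b : Seq
    a = U′ ⊛ k~
    b = 0# ◃ (V′ ⊛ k~)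
    Uk : U ⊛ k~ ≋ a ⊕ scale γ b
    Uk = ≋-trans (⊛-cong {U} {g = k~} U-spl ≋-refl) (≋-trans (⊛-disʳ k~ U′ (scale γ (0# ◃ V′))) (⊕-cong ≋-refl (\ i -> sca-⊛ γ (0# ◃ V′) k~ i ∙ ap (γ *_) (◃-⊛ˡ V′ k~ i))))
    Vk : V ⊛ k~ ≋ b ⊕ scale γ a
    Vk = ≋-trans (⊛-cong {V} {g = k~} V-spl ≋-refl) (≋-trans (⊛-disʳ k~ (0# ◃ V′) (scale γ U′)) (⊕-cong (◃-⊛ˡ V′ k~) (sca-⊛ γ U′ k~)))
    combine : sq (suc K) (U ⊛ k~) + (1# - γ * γ) * sq (suc K) b ≡ sq (suc K) (V ⊛ k~) + (1# - γ * γ) * sq (suc K) a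
    combine = ap (sq (suc K) (U ⊛ k~) +_) (sumTo-*ˡ (suc K) (1# - γ * γ) (\ i -> b i * b i)) ∙ ! (sumTo-+ (suc K) (\ i -> (U ⊛ k~) i * (U ⊛ k~) i) (\ i -> (1# - γ * γ) * (b i * b i))) ∙ sumTo-cong (suc K) (\ i _ -> pointwise i) ∙ sumTo-+ (suc K) (\ i -> (V ⊛ k~) i * (V ⊛ k~) i) (\ i -> (1# - γ * γ) * (a i * a i)) ∙ ap (sq (suc K) (V ⊛ k~) +_) (! (sumTo-*ˡ (suc K) (1# - γ * γ) (\ i -> a i * a i)))
     where
     pointwise : ∀ i -> (U ⊛ k~) i * (U ⊛ k~) i + (1# - γ * γ) * (b i * b i) ≡ (V ⊛ k~) i * (V ⊛ k~) i + (1# - γ * γ) * (a i * a i)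
     pointwise i = ap (\ u -> u * u + (1# - γ * γ) * (b i * b i)) (Uk i) ∙ solve 3 (\ a b g -> (a :+ g :* b) :* (a :+ g :* b) :+ (1∶ :- g :* g) :* (b :* b) := (b :+ g :* a) :* (b :+ g :* a) :+ (1∶ :- g :* g) :* (a :* a)) idp (a i) (b i) γ ∙ ap (\ v -> v * v + (1# - γ * γ) * (a i * a i)) (! (Vk i))
    a≡ : sq (suc K) a ≡ sq K (U′ ⊛ k)
    a≡ = sq-cong (suc K) (\ i _ -> Uk~ i) ∙ sumTo-ext (NP.n≤1+n K) _ (\ i K≤i -> ap (_* g i) (tru-Deg K _ i K≤i) ∙ zeroˡ _) ∙ sq-cong K (\ i i<K -> tru-< (U′ ⊛ k) i<K)
    b≡ : sq (suc K) b ≡ sq K (V′ ⊛ k)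
    b≡ = sq-shi K (V′ ⊛ k~) ∙ sq-cong K (\ i i<K -> ⊛-loc i (\ _ _ -> idp) (\ j j≤i -> ! (agree j (NP.≤-<-trans j≤i i<K))))
    final : sq (suc K) (U ⊛ k~) ≤ sq (suc K) (V ⊛ k~)
    final = by-non (difference (sq (suc K) (U ⊛ k~)) (sq (suc K) (V ⊛ k~)) ((1# - γ * γ) * sq (suc K) a) ((1# - γ * γ) * sq (suc K) b) combine ∙ solve 3 (\ c a b -> c :* b :- c :* a := c :* (b :- a)) idp (1# - γ * γ) (sq (suc K) a) (sq (suc K) b) ∙ ap₂ (\ b a -> (1# - γ * γ) * (b - a)) b≡ a≡) (*-non (<⇒≤ gap) (diff≥0 l))
     where
     difference : ∀ u v ca cb -> u + cb ≡ v + ca -> v - u ≡ cb - ca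
     difference u v ca cb e = from-dif (solve 4 (\ u v a b -> (v :- u) :- (b :- a) := (v :+ a) :- (u :+ b)) idp u v ca cb ∙ to-dif (! e))
   lower : Stage j U′ V′
   lower = record { U₀ = U′₀ ; dU = dU′ ; rev-U = rev-U′ ; pos = pos′ }
  ev : ℕ -> Seq -> Carrier -> Carrier
  ev zero f x = 0#
  ev (suc n) f x = f 0 + x * ev n (tail f) x
  ev-cong : ∀ n {f g} x -> f ≋ g -> ev n f x ≡ ev n g x
  ev-cong zero x e = idp
  ev-cong (suc n) x e = ap₂ (\ a b -> a + x * b) (e 0) (ev-cong n x (e ∘ suc))
  ev-lin : ∀ n f c g x -> ev n (f ⊕ scale c g) x ≡ ev n f x + c * ev n g x
  ev-lin zero f c g x = solve 1 (\ c -> 0∶ := 0∶ :+ c :* 0∶) idp c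
  ev-lin (suc n) f c g x = ap (\ t -> f 0 + c * g 0 + x * t) (ev-lin n (tail f) c (tail g) x) ∙ solve 6 (\ a b c x s t -> a :+ c :* b :+ x :* (s :+ c :* t) := a :+ x :* s :+ c :* (b :+ x :* t)) idp (f 0) (g 0) c x (ev n (tail f) x) (ev n (tail g) x)
  ev-Deg : ∀ n f x -> Deg< f n -> ev (suc n) f x ≡ ev n f x
  ev-Deg zero f x d = ap₂ _+_ (d 0 z≤n) (zeroʳ x) ∙ +-identityˡ _
  ev-Deg (suc n) f x d = ap (\ t -> f 0 + x * t) (ev-Deg n (tail f) x (\ i l -> d (suc i) (s≤s l)))
  sumL proL : List Carrier -> Carrier
  sumL = List.foldr _+_ 0#
  proL = List.foldr _*_ 1#
  module Eva (z : Carrier) (1<z : 1# < z) where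
   x = - z
   1≤z = <⇒≤ 1<z
   0≤z : 0# ≤ z
   0≤z = ≤-trans 0≤1 1≤z
   -- If r runs over the zeros of V, `ts` stands in for the numbers 1 + z² + 2 z Re r, which bound
   -- |z + r|² when |r| ≤ 1: it has their sum, and `upper` is the resulting bound for V(-z)²,
   -- strengthened so that it can be carried through the recursion. The bounds on D control the
   -- cross term between V(-z) and U(-z).
   record Bound (j : ℕ) (U V : Seq) : Set where
    a = ev (suc j) V x
    b = ev (suc j) U x
    δ = V 0
    D = (z * z - 1#) * (a * b) - δ * (z * z * (a * a) - b * b)
    field
     b²≤a² : b * b ≤ a * a
     D≤ : D ≤ z * (a * a - b * b)
     -D≤ : - D ≤ z * (a * a - b * b)
     δ²≤1 : δ * δ ≤ 1#
     ts : List Carrier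
     ts-non : All (0# ≤_) ts
     ts-len : length ts ≡ j
     upper : z * z * (a * a) - b * b ≤ (z * z - 1#) * proL ts
     ts-sum : sumL ts ≡ fromℕ j * (1# + z * z) - (z + z) * U 1
     below : (z - 1#) ^ j * (z - 1#) ^ j ≤ a * a
   bou₀ : ∀ {U V} -> Stage 0 U V -> Bound 0 U V
   bou₀ {U} {V} L = record { b²≤a² = ≤-reflexive (ap₂ _*_ b≡a b≡a) ; D≤ = ≤-reflexive (ap₂ (\ a b -> (z * z - 1#) * (a * b) - V 0 * (z * z * (a * a) - b * b)) a≡1 b≡1 ∙ ap (\ v -> (z * z - 1#) * (1# * 1#) - v * (z * z * (1# * 1#) - 1# * 1#)) V₀ ∙ solve 1 (\ z -> (z :* z :- 1∶) :* (1∶ :* 1∶) :- 1∶ :* (z :* z :* (1∶ :* 1∶) :- 1∶ :* 1∶) := z :* (1∶ :* 1∶ :- 1∶ :* 1∶)) idp z ∙ ! rhs) ; -D≤ = ≤-reflexive (ap₂ (\ a b -> - ((z * z - 1#) * (a * b) - V 0 * (z * z * (a * a) - b * b))) a≡1 b≡1 ∙ ap (\ v -> - ((z * z - 1#) * (1# * 1#) - v * (z * z * (1# * 1#) - 1# * 1#))) V₀ ∙ solve 1 (\ z -> :- ((z :* z :- 1∶) :* (1∶ :* 1∶) :- 1∶ :* (z :* z :* (1∶ :* 1∶) :- 1∶ :* 1∶)) := z :* (1∶ :* 1∶ :- 1∶ :* 1∶)) idp z ∙ ! rhs) ; δ²≤1 = ≤-reflexive (ap₂ _*_ V₀ V₀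 ∙ *-identityˡ 1#) ; ts = [] ; ts-non = [] ; ts-len = idp ; upper = ≤-reflexive (ap₂ (\ a b -> z * z * (a * a) - b * b) a≡1 b≡1 ∙ solve 1 (\ z -> z :* z :* (1∶ :* 1∶) :- 1∶ :* 1∶ := (z :* z :- 1∶) :* 1∶) idp z) ; ts-sum = ! (ap (\ u -> 0# * (1# + z * z) - (z + z) * u) (dU 1 (s≤s z≤n)) ∙ solve 1 (\ z -> 0∶ :* (1∶ :+ z :* z) :- (z :+ z) :* 0∶ := 0∶) idp z) ; below = ≤-reflexive (! (ap₂ _*_ a≡1 a≡1)) }
    where
    open Stage L
    V₀ : V 0 ≡ 1#
    V₀ = rev-U 0 ∙ U₀
    a≡1 : ev 1 V x ≡ 1#
    a≡1 = ap₂ _+_ V₀ (zeroʳ x) ∙ +-identityʳ 1#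
    b≡1 : ev 1 U x ≡ 1#
    b≡1 = ap₂ _+_ U₀ (zeroʳ x) ∙ +-identityʳ 1#
    b≡a = b≡1 ∙ ! a≡1
    rhs : z * (ev 1 V x * ev 1 V x - ev 1 U x * ev 1 U x) ≡ z * (1# * 1# - 1# * 1#)
    rhs = ap₂ (\ a b -> z * (a * a - b * b)) a≡1 b≡1

open Recursions

-- Bounds for the value at -z from Szegő's recursion.

module SzeRec where

 open import Data.List.Base as List using (List; []; _∷_; length)
 open import Data.List.Relation.Unary.All as All using (All; []; _∷_)

 module SzegőBound (F : OrdFie) where
  open Szegő F public
  hal-non : ∀ {y} -> 0# ≤ y + y -> 0# ≤ y
  hal-non {y} l with ≤-total 0# y
  ... | inj₁ m = m
  ... | inj₂ m = ≤-trans l (≤ʳ (+-identityʳ y) (+-monoʳ-≤ y m))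

  -- a (a + c) ≥ 0 as soon as c² ≤ a²
  dominant : ∀ a c -> c * c ≤ a * a -> 0# ≤ a * (a + c)
  dominant a c l = hal-non (≤ʳ (solve 2 (\ a c -> (a :+ c) :* (a :+ c) :+ (a :* a :- c :* c) := a :* (a :+ c) :+ a :* (a :+ c)) idp a c) (+-non (squ-non (a + c)) (diff≥0 l)))

  -- One step of the recursion (a, b) ↦ (γ b - z a, b - γ z a); the loss s = a² - b² and the
  -- cross term D control the growth of z² a² - b².
  module Step (z : Carrier) (1≤z : 1# ≤ z) (γ δ a b : Carrier) (γ²≤1 : γ * γ ≤ 1#) (δ²≤1 : δ * δ ≤ 1#) (b²≤a² : b * b ≤ a * a) (D≤ : (z * z - 1#) * (a * b) - δ * (z * z * (a * a) - b * b) ≤ z * (a * a - b * b)) (-D≤ : - ((z * z - 1#) * (a * b) - δ * (z * z * (a * a) - b * b)) ≤ z * (a * a - b * b)) where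
   private
    a⁺ = (- z) * a + γ * b
    b⁺ = b + γ * ((- z) * a)
    D = (z * z - 1#) * (a * b) - δ * (z * z * (a * a) - b * b)
    0≤z = ≤-trans 0≤1 1≤z
    0≤z-1 = diff≥0 1≤z
    s≥0 = diff≥0 b²≤a²
   γ≤1 : γ ≤ 1#
   γ≤1 = squ-≤⇒≤ 0≤1 (≤ʳ (! (*-identityˡ 1#)) γ²≤1)
   -γ≤1 : - γ ≤ 1#
   -γ≤1 = squ-≤⇒≤ 0≤1 (≤ʳ (! (*-identityˡ 1#)) (≤ˡ (solve 1 (\ g -> g :* g := (:- g) :* (:- g)) idp γ) γ²≤1))
   -- The factor contributed by one step. The sum of the factors comes out as required because
   -- comparison of the coefficients of degree one gives U 1 = U′ 1 + γ δ, with δ the constant term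
   -- of V′.
   t : Carrier
   t = 1# + z * z - (z + z) * (γ * δ)
   t≥0 : 0# ≤ t
   t≥0 = ≤ʳ (solve 3 (\ z g d -> (1∶ :- z) :* (1∶ :- z) :+ z :* ((1∶ :- g :* g) :+ (1∶ :- d :* d) :+ (g :- d) :* (g :- d)) := 1∶ :+ z :* z :- (z :+ z) :* (g :* d)) idp z γ δ) (+-non (squ-non (1# - z)) (*-non 0≤z (+-non (+-non (diff≥0 γ²≤1) (diff≥0 δ²≤1)) (squ-non (γ - δ)))))
   s⁺ : a⁺ * a⁺ - b⁺ * b⁺ ≡ (1# - γ * γ) * (z * z * (a * a) - b * b)
   s⁺ = solve 4 (\ z g a b -> ((:- z) :* a :+ g :* b) :* ((:- z) :* a :+ g :* b) :- (b :+ g :* ((:- z) :* a)) :* (b :+ g :* ((:- z) :* a)) := (1∶ :- g :* g) :* (z :* z :* (a :* a) :- b :* b)) idp z γ a b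
   gro≥0 : 0# ≤ z * z * (a * a) - b * b
   gro≥0 = ≤ʳ (solve 3 (\ z a b -> ((z :- 1∶) :* (z :+ 1∶)) :* (a :* a) :+ (a :* a :- b :* b) := z :* z :* (a :* a) :- b :* b) idp z a b) (+-non (*-non (*-non 0≤z-1 (+-non 0≤z 0≤1)) (squ-non a)) s≥0)
   b⁺²≤a⁺² : b⁺ * b⁺ ≤ a⁺ * a⁺
   b⁺²≤a⁺² = by-non s⁺ (*-non (diff≥0 γ²≤1) gro≥0)
   -- With s = a² - b² the right side exceeds the left by z² s (1 - |γ|)² + 2 z |γ| (z s ± D), so
   -- the sign of γ decides which of the two bounds on D is used.
   upper : z * z * (a⁺ * a⁺) - b⁺ * b⁺ ≤ (z * z * (a * a) - b * b) * t
   upper with ≤-total 0# γ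
   ... | inj₁ γ≥0 = by-non (solve 5 (\ z g d a b -> (z :* z :* (a :* a) :- b :* b) :* (1∶ :+ z :* z :- (z :+ z) :* (g :* d)) :- (z :* z :* (((:- z) :* a :+ g :* b) :* ((:- z) :* a :+ g :* b)) :- (b :+ g :* ((:- z) :* a)) :* (b :+ g :* ((:- z) :* a))) := z :* z :* (a :* a :- b :* b) :* ((1∶ :- g) :* (1∶ :- g)) :+ (z :+ z) :* g :* (z :* (a :* a :- b :* b) :- (:- ((z :* z :- 1∶) :* (a :* b) :- d :* (z :* z :* (a :* a) :- b :* b))))) idp z γ δ a b) (+-non (*-non (*-non (squ-non z) s≥0) (squ-non (1# - γ))) (*-non (*-non (+-non 0≤z 0≤z) γ≥0) (diff≥0 -D≤)))
   ... | inj₂ γ≤0 = by-non (solve 5 (\ z g d a b -> (z :* z :* (a :* a) :- b :* b) :* (1∶ :+ z :* z :- (z :+ z) :* (g :* d)) :- (z :* z :* (((:- z) :* a :+ g :* b) :* ((:- z) :* a :+ g :* b)) :- (b :+ g :* ((:- z) :* a)) :* (b :+ g :* ((:- z) :* a))) := z :* z :* (a :* a :- b :* b) :* ((1∶ :+ g) :* (1∶ :+ g)) :+ (z :+ z) :* (:- g) :* (z :* (a :* a :- b :* b) :- ((z :* z :- 1∶) :* (a :* b) :- d :* (z :* z :* (a :* a) :- b :* b)))) idp z γ δ a b) (+-non (*-non (*-non (squ-non z) s≥0) (squ-non (1# + γ))) (*-non (*-non (+-non 0≤z 0≤z) (neg-non γ≤0)) (diff≥0 D≤)))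
   D⁺ : Carrier
   D⁺ = (z * z - 1#) * (a⁺ * b⁺) - γ * (z * z * (a⁺ * a⁺) - b⁺ * b⁺)
   D⁺≡ : D⁺ ≡ - ((1# - γ * γ) * z * (γ * z * (a * a - b * b) + (z * z - 1#) * (a * b)))
   D⁺≡ = solve 4 (\ z g a b -> (z :* z :- 1∶) :* (((:- z) :* a :+ g :* b) :* (b :+ g :* ((:- z) :* a))) :- g :* (z :* z :* (((:- z) :* a :+ g :* b) :* ((:- z) :* a :+ g :* b)) :- (b :+ g :* ((:- z) :* a)) :* (b :+ g :* ((:- z) :* a))) := :- ((1∶ :- g :* g) :* z :* (g :* z :* (a :* a :- b :* b) :+ (z :* z :- 1∶) :* (a :* b)))) idp z γ a b
   D⁺≤ : D⁺ ≤ z * (a⁺ * a⁺ - b⁺ * b⁺)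
   D⁺≤ = by-non (ap₂ (\ s d -> z * s - d) s⁺ D⁺≡ ∙ solve 4 (\ z g a b -> z :* ((1∶ :- g :* g) :* (z :* z :* (a :* a) :- b :* b)) :- (:- ((1∶ :- g :* g) :* z :* (g :* z :* (a :* a :- b :* b) :+ (z :* z :- 1∶) :* (a :* b)))) := (1∶ :- g :* g) :* z :* ((z :- 1∶) :* ((a :+ b) :* (a :+ b) :+ (z :- 1∶) :* (a :* (a :+ b))) :+ (1∶ :- (:- g)) :* (z :* (a :* a :- b :* b)))) idp z γ a b) (*-non (*-non (diff≥0 γ²≤1) 0≤z) (+-non (*-non 0≤z-1 (+-non (squ-non (a + b)) (*-non 0≤z-1 (dominant a b b²≤a²)))) (*-non (diff≥0 -γ≤1) (*-non 0≤z s≥0))))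
   -D⁺≤ : - D⁺ ≤ z * (a⁺ * a⁺ - b⁺ * b⁺)
   -D⁺≤ = by-non (ap₂ (\ s d -> z * s - - d) s⁺ D⁺≡ ∙ solve 4 (\ z g a b -> z :* ((1∶ :- g :* g) :* (z :* z :* (a :* a) :- b :* b)) :- (:- (:- ((1∶ :- g :* g) :* z :* (g :* z :* (a :* a :- b :* b) :+ (z :* z :- 1∶) :* (a :* b))))) := (1∶ :- g :* g) :* z :* ((z :- 1∶) :* ((a :+ (:- b)) :* (a :+ (:- b)) :+ (z :- 1∶) :* (a :* (a :+ (:- b)))) :+ (1∶ :- g) :* (z :* (a :* a :- b :* b)))) idp z γ a b) (*-non (*-non (diff≥0 γ²≤1) 0≤z) (+-non (*-non 0≤z-1 (+-non (squ-non (a + - b)) (*-non 0≤z-1 (dominant a (- b) (≤ˡ (solve 1 (\ b -> b :* b := (:- b) :* (:- b)) idp b) b²≤a²))))) (*-non (diff≥0 γ≤1) (*-non 0≤z s≥0))))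
   -- For c = γ b one has c² ≤ a², and (z a - c)² - (z - 1)² a² = (a - c)² + 2 (z - 1) a (a - c).
   below : (z - 1#) * (z - 1#) * (a * a) ≤ a⁺ * a⁺
   below = by-non (solve 4 (\ z g a b -> ((:- z) :* a :+ g :* b) :* ((:- z) :* a :+ g :* b) :- (z :- 1∶) :* (z :- 1∶) :* (a :* a) := (a :+ (:- (g :* b))) :* (a :+ (:- (g :* b))) :+ ((z :- 1∶) :+ (z :- 1∶)) :* (a :* (a :+ (:- (g :* b))))) idp z γ a b) (+-non (squ-non _) (*-non (+-non 0≤z-1 0≤z-1) (dominant a (- (γ * b)) c²≤a²)))
    where
    c²≤a² : (- (γ * b)) * (- (γ * b)) ≤ a * a
    c²≤a² = ≤-trans (≤-reflexive (solve 2 (\ g b -> (:- (g :* b)) :* (:- (g :* b)) := (g :* g) :* (b :* b)) idp γ b)) (≤-trans (*-monoˡ-≤ (squ-non b) γ²≤1) (≤-trans (≤-reflexive (*-identityˡ _)) b²≤a²))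
  module Recursion (z : Carrier) (1<z : 1# < z) where
   open Eva z 1<z public
   recBou : ∀ j {U V} -> Stage j U V -> Bound j U V
   recBou zero L = bou₀ L
   recBou (suc j) {U} {V} L = record { b²≤a² = ≡.subst₂ (\ a b -> b * b ≤ a * a) (! a⁺≡) (! b⁺≡) T.b⁺²≤a⁺² ; D≤ = ≡.subst₂ (\ a b -> (z * z - 1#) * (a * b) - γ * (z * z * (a * a) - b * b) ≤ z * (a * a - b * b)) (! a⁺≡) (! b⁺≡) T.D⁺≤ ; -D≤ = ≡.subst₂ (\ a b -> - ((z * z - 1#) * (a * b) - γ * (z * z * (a * a) - b * b)) ≤ z * (a * a - b * b)) (! a⁺≡) (! b⁺≡) T.-D⁺≤ ; δ²≤1 = <⇒≤ γ²<1 ; ts = T.t ∷ ts ; ts-non = T.t≥0 ∷ ts-non ; ts-len = ap suc ts-len ; upper = ≡.subst₂ (\ a b -> z * z * (a * a) - b * b ≤ (z * z - 1#) * proL (T.t ∷ ts)) (! a⁺≡) (! b⁺≡) (≤-trans T.upper (≤-trans (*-monoˡ-≤ T.t≥0 upper) (≤-reflexive (solve 3 (\ c p t -> c :* p :* t := c :* (t :* p)) idp (z * z - 1#) (proL ts) T.t)))) ; ts-sum = ap (T.t +_) ts-sum ∙ solve 6 (\ z n u g d o -> (o :+ z :* z :- (z :+ z) :* (g :* d)) :+ (n :* (o :+ z :* z) :- (z :+ z) :* u) := (o :+ z :* z :+ n :* (o :+ z :* z)) :- (z :+ z) :* (u :+ g :* d)) idp z (fromℕ j) (U′ 1) γ δ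 1# ∙ ap₂ (\ m u -> m - (z + z) * u) (solve 2 (\ z n -> 1∶ :+ z :* z :+ n :* (1∶ :+ z :* z) := (1∶ :+ n) :* (1∶ :+ z :* z)) idp z (fromℕ j)) (! (U-spl 1)) ; below = ≤-trans (≤-reflexive (solve 2 (\ y p -> y :* p :* (y :* p) := y :* y :* (p :* p)) idp (z - 1#) ((z - 1#) ^ j))) (≤-trans (*-monoʳ-≤ (squ-non _) below) (≡.subst (\ y -> (z - 1#) * (z - 1#) * (a * a) ≤ y * y) (! a⁺≡) T.below)) }
    where
    open Descent L
    open Bound (recBou j lower) hiding (D)
    module T = Step z 1≤z γ δ a b (<⇒≤ γ²<1) δ²≤1 b²≤a² D≤ -D≤
    a⁺≡ : ev (suc (suc j)) V x ≡ x * a + γ * b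
    a⁺≡ = ev-cong (suc (suc j)) x V-spl ∙ ev-lin (suc (suc j)) (0# ◃ V′) γ U′ x ∙ ap₂ (\ s t -> s + γ * t) (+-identityˡ _) (ev-Deg (suc j) U′ x dU′)
    b⁺≡ : ev (suc (suc j)) U x ≡ b + γ * (x * a)
    b⁺≡ = ev-cong (suc (suc j)) x U-spl ∙ ev-lin (suc (suc j)) U′ γ (0# ◃ V′) x ∙ ap₂ (\ s t -> s + γ * t) (ev-Deg (suc j) U′ x dU′) (+-identityˡ _)
  -- The power x^(n+1) lies above its tangent at y; each inductive step adds a positive multiple of
  -- (x - y)².
  tan : ∀ {x y} -> 0# ≤ x -> 0# ≤ y -> ∀ n -> y ^ suc n + fromℕ (suc n) * (y ^ n * (x - y)) ≤ x ^ suc n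
  tan {x} {y} px py zero = ≤-reflexive (solve 2 (\ x y -> y :* 1∶ :+ (1∶ :+ 0∶) :* (1∶ :* (x :- y)) := x :* 1∶) idp x y)
  tan {x} {y} px py (suc n) = ≤-trans (by-non (solve 4 (\ x y p n -> x :* (y :* p :+ (1∶ :+ n) :* (p :* (x :- y))) :- (y :* (y :* p) :+ (1∶ :+ (1∶ :+ n)) :* (y :* p :* (x :- y))) := (1∶ :+ n) :* p :* ((x :- y) :* (x :- y))) idp x y (y ^ n) (fromℕ n)) (*-non (*-non (fromℕ-non (suc n)) (^-non n py)) (squ-non (x - y)))) (*-monoʳ-≤ px (tan px py n))
  sumL-non : ∀ {ts} -> All (0# ≤_) ts -> 0# ≤ sumL ts
  sumL-non [] = ≤-refl
  sumL-non (p ∷ ps) = +-non p (sumL-non ps)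
  -- With B the mean of the n remaining factors and A the mean of all, t = (n + 1) A - n B, and t
  -- B^n ≤ A^(n+1) is the tangent inequality at B. A single factor is treated apart because its tail
  -- has no mean.
  am-gm : ∀ ts -> All (0# ≤_) ts -> ∀ {A} -> 0# ≤ A -> fromℕ (length ts) * A ≡ sumL ts -> proL ts ≤ A ^ length ts
  am-gm [] ps pA e = ≤-refl
  am-gm (t ∷ []) ps {A} pA e = ≤-reflexive (ap (_* 1#) (! (+-identityʳ t) ∙ ! e ∙ solve 1 (\ a -> (1∶ :+ 0∶) :* a := a) idp A))
  am-gm (t ∷ ts@(_ ∷ _)) (p ∷ ps) {A} pA e = ≤-trans (*-monoʳ-≤ p (am-gm ts ps pB eB)) (≤-trans (≤-reflexive (ap (_* B ^ n) t≡ ∙ solve 4 (\ a b m k -> ((1∶ :+ m) :* a :- m :* b) :* k := b :* k :+ (1∶ :+ m) :* (k :* (a :- b))) idp A B (fromℕ n) (B ^ n))) (tan pA pB n))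
   where
   n = length ts
   n>0 : 0# < fromℕ n
   n>0 = 0<fromℕ {n} (s≤s z≤n)
   B = sumL ts * inv (fromℕ n) n>0
   pB : 0# ≤ B
   pB = *-non (sumL-non ps) (<⇒≤ (inv-pos _ n>0))
   eB : fromℕ n * B ≡ sumL ts
   eB = solve 3 (\ n s i -> n :* (s :* i) := s :* (n :* i)) idp (fromℕ n) (sumL ts) (inv (fromℕ n) n>0) ∙ ap (sumL ts *_) (inv-* _ n>0) ∙ *-identityʳ _
   t≡ : t ≡ fromℕ (suc n) * A - fromℕ n * B
   t≡ = solve 2 (\ t s -> t := (t :+ s) :- s) idp t (sumL ts) ∙ ap₂ _-_ (! e) (! eB)
  module _ (z : Carrier) (1<z : 1# < z) {N : ℕ} {U V : Seq} (L : Stage N U V) where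
   open Recursion z 1<z

   -- The value at −z of a monic polynomial V of degree N with zeros in the unit disc.
   val² : ∀ {T} -> 0# ≤ T -> fromℕ N * T ≡ fromℕ N * (1# + z * z) - (z + z) * U 1 -> ev (suc N) V (- z) * ev (suc N) V (- z) ≤ T ^ N
   val² {T} pT e = *-can-≤ z²>1 (≤-trans (by-non {d = a * a - b * b} (solve 3 (\ z a b -> (z :* z :* (a :* a) :- b :* b) :- (z :* z :- 1∶) :* (a :* a) := a :* a :- b :* b) idp z a b) (diff≥0 b²≤a²)) (≤-trans upper (*-monoʳ-≤ (<⇒≤ z²>1) (≤ʳ (ap (T ^_) ts-len) (am-gm ts ts-non pT (ap (\ n -> fromℕ n * T) ts-len ∙ e ∙ ! ts-sum))))))
    where
    open Bound (recBou N L)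
    z²>1 : 0# < z * z - 1#
    z²>1 l = *-pos (≤∧≢⇒< (diff≥0 (<⇒≤ 1<z)) (\ e -> 1<z (≤-reflexive (from-dif (! e))))) (+-pos {z} {1#} (≤-<-trans 0≤1 1<z) 0≤1) (≤ˡ (solve 1 (\ z -> z :* z :- 1∶ := (z :- 1∶) :* (z :+ 1∶)) idp z) l)
   val²-bel : (z - 1#) ^ N * (z - 1#) ^ N ≤ ev (suc N) V (- z) * ev (suc N) V (- z)
   val²-bel = Bound.below (recBou N L)

   -- The mean is nonnegative, being the mean of the factors of the recursionBound.
   mean-non : 0# ≤ fromℕ N * (1# + z * z) - (z + z) * U 1
   mean-non = ≤ʳ (Bound.ts-sum (recBou N L)) (sumL-non (Bound.ts-non (recBou N L)))

open SzeRec

-- Decay of the inverse of a polynomial from its even power sums.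

module DecOfCoe where

 parity : ∀ j -> (Σ[ l ∈ ℕ ] j ≡ l N.+ l) ⊎ (Σ[ l ∈ ℕ ] j ≡ suc (l N.+ l))
 parity zero = inj₁ (0 , idp)
 parity (suc j) with parity j
 ... | inj₁ (l , idp) = inj₂ (l , idp)
 ... | inj₂ (l , idp) = inj₁ (suc l , ap suc (! (NP.+-suc l l)))

 module GroDec (F : OrdFie) where
  open SzegőBound F public
  sgn : ℕ -> Carrier
  sgn zero = 1#
  sgn (suc i) = - sgn i
  sgn-even : ∀ l -> sgn (l N.+ l) ≡ 1#
  sgn-even zero = idp
  sgn-even (suc l) = ap (\ n -> - sgn n) (NP.+-suc l l) ∙ -‿involutive _ ∙ sgn-even l
  alt : Seq -> Seq
  alt f i = sgn i * f i
  alt-⊛ : ∀ f g -> alt f ⊛ alt g ≋ alt (f ⊛ g)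
  alt-⊛ f g zero = solve 2 (\ a b -> (1∶ :* a) :* (1∶ :* b) := 1∶ :* (a :* b)) idp (f 0) (g 0)
  alt-⊛ f g (suc n) = ap (1# * f 0 * (- sgn n * g (suc n)) +_) (⊛-cong {tail (alt f)} {scale (- 1#) (alt (tail f))} {alt g} (\ i -> solve 2 (\ s a -> (:- s) :* a := (:- 1∶) :* (s :* a)) idp (sgn i) (f (suc i))) ≋-refl n ∙ sca-⊛ (- 1#) (alt (tail f)) (alt g) n ∙ ap (- 1# *_) (alt-⊛ (tail f) g n)) ∙ solve 4 (\ a s b t -> 1∶ :* a :* ((:- s) :* b) :+ (:- 1∶) :* (s :* t) := (:- s) :* (a :* b :+ t)) idp (f 0) (sgn n) (g (suc n)) ((tail f ⊛ g) n)
  θ-alt : ∀ f -> θ (alt f) ≋ alt (θ f)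
  θ-alt f i = solve 3 (\ n s a -> n :* (s :* a) := s :* (n :* a)) idp (fromℕ i) (sgn i) (f i)
  two : Carrier
  two = 1# + 1#
  two>0 : 0# < two
  two>0 = +-pos 0<1 0≤1
  half : Carrier
  half = inv two two>0
  half-two : two * half ≡ 1#
  half-two = inv-* two two>0

  -- the midpoint of x and 1
  tow1 : Carrier -> Carrier
  tow1 x = (1# + x) * half
  tow1-dou : ∀ x -> two * tow1 x ≡ 1# + x
  tow1-dou x = solve 3 (\ t x h -> t :* ((1∶ :+ x) :* h) := (t :* h) :* (1∶ :+ x)) idp two x half ∙ ap (_* (1# + x)) half-two ∙ *-identityˡ _
  tow1<1 : ∀ {x} -> x < 1# -> tow1 x < 1#
  tow1<1 {x} l m = l (by-non (solve 1 (\ x -> x :- 1∶ := (1∶ :+ x) :- (1∶ :+ 1∶) :* 1∶) idp x ∙ ap (\ t -> t - two * 1#) (! (tow1-dou x))) (diff≥0 (*-monoʳ-≤ (<⇒≤ two>0) m)))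
  tow1> : ∀ {x} -> x < 1# -> x < tow1 x
  tow1> {x} l m = l (by-non (solve 1 (\ x -> x :- 1∶ := (1∶ :+ 1∶) :* x :- (1∶ :+ x)) idp x ∙ ap (\ t -> two * x - t) (! (tow1-dou x))) (diff≥0 (*-monoʳ-≤ (<⇒≤ two>0) m)))
  tow1-non : ∀ {x} -> 0# ≤ x -> 0# ≤ tow1 x
  tow1-non p = *-non (+-non 0≤1 p) (<⇒≤ (inv-pos two two>0))
  -- `tow1` replaces the square root: κ^l ≤ ν^(2l) for ν = `tow1 κ`, which stays below 1 together
  -- with κ.
  ≤tow1² : ∀ x -> x ≤ tow1 x * tow1 x
  ≤tow1² x = *-can-≤ (*-pos two>0 two>0) (by-non (ap (\ t -> t - two * two * x) (solve 2 (\ t y -> t :* t :* (y :* y) := (t :* y) :* (t :* y)) idp two (tow1 x) ∙ ap₂ _*_ (tow1-dou x) (tow1-dou x)) ∙ solve 1 (\ x -> (1∶ :+ x) :* (1∶ :+ x) :- (1∶ :+ 1∶) :* (1∶ :+ 1∶) :* x := (1∶ :- x) :* (1∶ :- x)) idp x) (squ-non (1# - x)))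
  x^[l+l] : ∀ x l -> x ^ (l N.+ l) ≡ (x * x) ^ l
  x^[l+l] x l = ^-homo-* x l l ∙ ! (^-*-dis x x l)
  module Recurrence (σ U : Seq) (σ₀ : σ 0 ≡ 0#) (θU : θ U ≋ ⊖ (σ ⊛ U)) (C ν μ : Carrier) (C≥0 : 0# ≤ C) (ν≥0 : 0# ≤ ν) (μ>0 : 0# < μ) (μ<1 : μ < 1#) (ν<μ : ν < μ) (σ-bou : ∀ j -> ∣ σ j ∣ ≤ two * C * ν ^ j) where
   open Decaying μ μ>0 μ<1 renaming (ν to ρ)
   r : Carrier
   r = ν * ρ
   ρ≥0 = <⇒≤ (inv-pos μ μ>0)
   μρ : μ * ρ ≡ 1#
   μρ = inv-* μ μ>0
   r≥0 : 0# ≤ r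
   r≥0 = *-non ν≥0 ρ≥0
   1-r>0 : 0# < 1# - r
   1-r>0 l = ν<μ (≤ˡ (*-identityʳ μ) (≤ʳ (solve 3 (\ m n p -> m :* (n :* p) := n :* (m :* p)) idp μ ν ρ ∙ ap (ν *_) μρ ∙ *-identityʳ ν) (*-monoʳ-≤ μ≥0 (by-non (solve 1 (\ r -> r :- 1∶ := :- (1∶ :- r)) idp r) (neg-non l)))))
   Gc = inv (1# - r) 1-r>0
   geo : ∀ n -> (1# - r) * sumTo n (\ i -> r ^ suc i) ≡ r - r ^ suc n
   geo zero = ap ((1# - r) *_) (sumTo-zero _) ∙ solve 1 (\ r -> (1∶ :- r) :* 0∶ := r :- r :* 1∶) idp r
   geo (suc n) = ap ((1# - r) *_) (sumTo-snoc n _) ∙ distribˡ _ _ _ ∙ ap (_+ (1# - r) * r ^ suc n) (geo n) ∙ solve 2 (\ r p -> (r :- r :* p) :+ (1∶ :- r) :* (r :* p) := r :- r :* (r :* p)) idp r (r ^ n)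
   geo≤ : ∀ n -> sumTo n (\ i -> r ^ suc i) ≤ Gc
   geo≤ n = *-can-≤ 1-r>0 (≤ˡ (! (geo n)) (≤ʳ (! (inv-* (1# - r) 1-r>0)) (by-non (solve 2 (\ r p -> 1∶ :- (r :- p) := (1∶ :- r) :+ p) idp r (r ^ suc n)) (+-non (<⇒≤ 1-r>0) (^-non (suc n) r≥0)))))
   -- Beyond J the recurrence for U preserves a bound BU μ^j: it expresses n + 1 times the next
   -- coefficient by a sum of at most 2 C Gc times the bound, where Gc bounds the geometric series
   -- of r = ν / μ, and 2 C Gc ≤ J. The indices up to J are absorbed in BU.
   J : ℕ
   J = proj₁ (arc (two * C * Gc))
   BU : Carrier
   BU = sumTo (suc J) (\ j -> ∣ U j ∣ * ρ ^ j)
   BU≥0 : 0# ≤ BU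
   BU≥0 = sumTo-non (suc J) (\ j -> *-non (abs-non _) (^-non j ρ≥0))
   ρ^μ^ : ∀ j -> ρ ^ j * μ ^ j ≡ 1#
   ρ^μ^ j = ! (^-*-dis ρ μ j) ∙ ap (_^ j) (*-comm ρ μ ∙ μρ) ∙ 1^ j
   sma-ind : ∀ j -> j N.< suc J -> ∣ U j ∣ ≤ BU * μ ^ j
   sma-ind j l = ≤ˡ (*-assoc _ _ _ ∙ ap (∣ U j ∣ *_) (ρ^μ^ j) ∙ *-identityʳ _) (*-monoˡ-≤ (^-non j μ≥0) (term≤sumTo (suc J) (\ j -> *-non (abs-non _) (^-non j ρ≥0)) j l))
   lar-ind : ∀ n -> suc J N.≤ suc n -> (∀ j -> j N.≤ n -> ∣ U j ∣ ≤ BU * μ ^ j) -> ∣ U (suc n) ∣ ≤ BU * μ ^ suc n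
   lar-ind n J<n ih = *-can-≤ (0<fromℕ {suc n} (s≤s z≤n)) (≤-trans (≤-reflexive lhs) (≤-trans (abs-sumTo (suc n) _) (≤-trans (sumTo-mono (suc n) term) (≤-trans (≤-reflexive (! (sumTo-*ˡ (suc n) (two * C * (BU * μ ^ suc n)) (\ i -> r ^ suc i)))) (≤-trans (*-monoʳ-≤ (*-non (*-non (<⇒≤ two>0) C≥0) (*-non BU≥0 (^-non (suc n) μ≥0))) (geo≤ (suc n))) (≤-trans (≤-reflexive (solve 4 (\ t c b g -> t :* c :* b :* g := t :* c :* g :* b) idp two C (BU * μ ^ suc n) Gc)) (*-monoˡ-≤ (*-non BU≥0 (^-non (suc n) μ≥0)) (≤-trans (proj₂ (arc (two * C * Gc))) (fromℕ-mono (NP.≤-trans (NP.n≤1+n J) J<n))))))))))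
    where
    value : fromℕ (suc n) * U (suc n) ≡ - sumTo (suc n) (\ i -> σ (suc i) * U (n ∸ i))
    value = θU (suc n) ∙ ap -_ (ap (_+ (tail σ ⊛ U) n) (ap (_* U (suc n)) σ₀ ∙ zeroˡ _) ∙ +-identityˡ _ ∙ ⊛-sum (tail σ) U n)
    lhs : fromℕ (suc n) * ∣ U (suc n) ∣ ≡ ∣ sumTo (suc n) (\ i -> σ (suc i) * U (n ∸ i)) ∣
    lhs = ap (_* ∣ U (suc n) ∣) (! (abs-≡ (fromℕ-non (suc n)))) ∙ ! (abs-* _ _) ∙ ap ∣_∣ value ∙ abs-neg _
    term : ∀ i -> i N.< suc n -> ∣ σ (suc i) * U (n ∸ i) ∣ ≤ two * C * (BU * μ ^ suc n) * r ^ suc i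
    term i (s≤s i≤n) = ≤ˡ (! (abs-* _ _)) (≤-trans (*-mono-≤ (abs-non _) (abs-non _) (σ-bou (suc i)) (ih (n ∸ i) (NP.m∸n≤m n i))) (≤-reflexive (ap (\ v -> two * C * v * (BU * μ ^ (n ∸ i))) ν^ ∙ solve 5 (\ t c x b y -> t :* c :* x :* (b :* y) := t :* c :* b :* (x :* y)) idp two C (r ^ suc i * μ ^ suc i) BU (μ ^ (n ∸ i)) ∙ ap (\ t -> two * C * BU * t) (*-assoc _ _ _ ∙ ap (r ^ suc i *_) μ^) ∙ solve 5 (\ t c b x y -> t :* c :* b :* (x :* y) := t :* c :* (b :* y) :* x) idp two C BU (r ^ suc i) (μ ^ suc n))))
     where
     ν^ : ν ^ suc i ≡ r ^ suc i * μ ^ suc i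
     ν^ = ap (_^ suc i) (! (*-assoc ν ρ μ ∙ ap (ν *_) (*-comm ρ μ ∙ μρ) ∙ *-identityʳ ν)) ∙ ^-*-dis r μ (suc i)
     μ^ : μ ^ suc i * μ ^ (n ∸ i) ≡ μ ^ suc n
     μ^ = ! (^-homo-* μ (suc i) (n ∸ i)) ∙ ap (μ ^_) (ap suc (NP.m+[n∸m]≡n i≤n))
   next-ind : ∀ n -> (∀ j -> j N.≤ n -> ∣ U j ∣ ≤ BU * μ ^ j) -> Dec (suc J N.≤ suc n) -> ∣ U (suc n) ∣ ≤ BU * μ ^ suc n
   next-ind n ih (yes l) = lar-ind n l ih
   next-ind n ih (no nl) = sma-ind (suc n) (NP.≰⇒> nl)
   U-bou : ∀ n j -> j N.≤ n -> ∣ U j ∣ ≤ BU * μ ^ j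
   U-bou zero .0 z≤n = sma-ind 0 (s≤s z≤n)
   U-bou (suc n) j j≤ = go (NP.m≤n⇒m<n∨m≡n j≤)
    where
    go : j N.< suc n ⊎ j ≡ suc n -> ∣ U j ∣ ≤ BU * μ ^ j
    go (inj₁ (s≤s l)) = U-bou n j l
    go (inj₂ idp) = next-ind n (U-bou n) (suc J NP.≤? suc n)
  module _ (N : ℕ) (A τ : Seq) (A₀ : A 0 ≡ 1#) (dA : Deg< A (suc N)) (τ₀ : τ 0 ≡ 0#) (new : θ A ≋ τ ⊛ A) (C κ : Carrier) (C≥0 : 0# ≤ C) (κ≥0 : 0# ≤ κ) (κ<1 : κ < 1#) (gro : ∀ l -> ∣ τ (l N.+ l) ∣ ≤ C * κ ^ l) where
   private
    ν μ : Carrier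
    ν = tow1 κ
    μ = tow1 ν
    ν≥0 = tow1-non κ≥0
    ν<1 = tow1<1 κ<1
    μ>0 : 0# < μ
    μ>0 = ≤-<-trans ν≥0 (tow1> ν<1)
    μ<1 : μ < 1#
    μ<1 = tow1<1 ν<1
    open Decaying μ μ>0 μ<1 using (decCon; decCon-non; Bounded; ⊛-Bou; module Contraction)
    -- Only even power sums are controlled, so A is replaced by E = A(t) A(-t), whose logarithmic
    -- derivative σ has the coefficients 2 τ at even and 0 at odd indices. Then U = 1/E decays, and
    -- A(-t) U is the inverse of A.
    E σ U h : Seq
    E = A ⊛ alt A
    σ = τ ⊕ alt τ
    U = quot 𝟙 E
    h = alt A ⊛ U
    E₀ : E 0 ≡ 1#
    E₀ = ap₂ (\ a b -> a * (1# * b)) A₀ A₀ ∙ solve 0 (1∶ :* (1∶ :* 1∶) := 1∶) idp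
    UE : U ⊛ E ≋ 𝟙
    UE = quot-⊛ 𝟙 E E₀
    θE : θ E ≋ σ ⊛ E
    θE = ≋-trans (θ-⊛ A (alt A)) (≋-trans (⊕-cong (⊛-cong {θ A} {g = alt A} new ≋-refl) (⊛-cong {A} ≋-refl (≋-trans (θ-alt A) (≋-trans (\ i -> ap (sgn i *_) (new i)) (≋-sym (alt-⊛ τ A)))))) (at (S.solve 4 (\ t a t' a' -> (t S.:* a) S.:* a' S.:+ a S.:* (t' S.:* a') S.:= (t S.:+ t') S.:* (a S.:* a')) S.refl τ A (alt τ) (alt A))))
    θU : θ U ≋ ⊖ (σ ⊛ U)
    θU i = from-dif (ap (θ U i +_) (-‿involutive _) ∙ ⊛-canʳ (θ U ⊕ σ ⊛ U) E E₀ zero′ i)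
     where
     zero′ : (θ U ⊕ σ ⊛ U) ⊛ E ≋ 𝟘
     zero′ = ≋-trans (at (S.solve 4 (\ t s u e -> (t S.:+ s S.:* u) S.:* e S.:= t S.:* e S.:+ u S.:* (s S.:* e)) S.refl (θ U) σ U E S.& S.+-congˡ {θ U ⊛ E} (S.*-congˡ {U} (S.sym ⟪ θE ⟫)))) (≋-trans (≋-sym (θ-⊛ U E)) (≋-trans (\ i -> ap (fromℕ i *_) (UE i)) (\ { zero -> zeroˡ _ ; (suc i) -> zeroʳ _ })))
    σ-bou : ∀ j -> ∣ σ j ∣ ≤ two * C * ν ^ j
    σ-bou j with parity j
    ... | inj₂ (l , idp) = ≤ˡ (! (ap ∣_∣ (ap (\ s -> τ (suc (l N.+ l)) + - s * τ (suc (l N.+ l))) (sgn-even l) ∙ solve 1 (\ t -> t :+ (:- 1∶) :* t := 0∶) idp _) ∙ abs-0)) (*-non (*-non (<⇒≤ two>0) C≥0) (^-non (suc (l N.+ l)) ν≥0))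
    ... | inj₁ (l , idp) = ≤ˡ (! (ap ∣_∣ (ap (\ s -> t + s * t) (sgn-even l) ∙ solve 1 (\ t -> t :+ 1∶ :* t := (1∶ :+ 1∶) :* t) idp t) ∙ abs-* two t ∙ ap (_* ∣ t ∣) (abs-≡ (<⇒≤ two>0)))) (≤-trans (*-monoʳ-≤ (<⇒≤ two>0) (≤-trans (gro l) (*-monoʳ-≤ C≥0 (≤ʳ (! (x^[l+l] ν l)) (^-mono l κ≥0 (≤tow1² κ)))))) (≤-reflexive (! (*-assoc two C (ν ^ (l N.+ l))))))
     where t = τ (l N.+ l)
    σ₀ : σ 0 ≡ 0#
    σ₀ = ap (\ t -> t + 1# * t) τ₀ ∙ solve 0 (0∶ :+ 1∶ :* 0∶ := 0∶) idp
    open Recurrence σ U σ₀ θU C ν μ C≥0 ν≥0 μ>0 μ<1 (tow1> ν<1) σ-bou using (BU; BU≥0; U-bou)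
   hA : h ⊛ A ≋ 𝟙
   hA = ≋-trans (at (S.solve 3 (\ a u b -> (a S.:* u) S.:* b S.:= u S.:* (b S.:* a)) S.refl (alt A) U A)) UE
   Bh : Carrier
   Bh = decCon (suc N) (alt A) * BU
   Bh≥0 : 0# ≤ Bh
   Bh≥0 = *-non (decCon-non (suc N) (alt A)) BU≥0
   bh : Bounded Bh h
   bh = ⊛-Bou (suc N) (alt A) BU≥0 (\ i l -> ap (sgn i *_) (dA i l) ∙ zeroʳ _) (\ j -> U-bou j j NP.≤-refl)
   open Contraction N A h dA hA Bh Bh≥0 bh using (P; positive; module Ext)
   stage : Stage N A (rev N A)
   stage = record { U₀ = A₀ ; dU = dA ; rev-U = \ i -> idp ; pos = \ K k K≤N nz -> positive K k K≤N nz }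

   -- P = f P* with f = P h, and f has norm at most one.
   bla : Σ[ f ∈ Seq ] (rev N A ≋ f ⊛ A × (∀ M -> sq M f ≤ 1#))
   bla = P ⊛ k , at (S.sym (S.solve 3 (\ p k a -> (p S.:* k) S.:* a S.:= p S.:* (a S.:* k)) S.refl P k A S.& S.*-congˡ {P} ⟪ Ak ⟫ S.& S.*-identityʳ P)) , \ M -> ≤-trans (contraction M) (≤-reflexive (sumTo-suc 0 _ ∙ ap₂ _+_ (*-identityˡ 1#) (sumTo-zero _) ∙ +-identityʳ 1#))
    where
    dk : Deg< 𝟙 1
    dk (suc i) _ = idp
    open Ext 1 𝟙 dk

open DecOfCoe

-- Approximate square roots and the functional equation.

module Symmetry where

 open import Data.Integer.Base using (+_; -[1+_])

 disIVT : ∀ {P : ℕ -> Set} -> (∀ i -> Dec (P i)) -> P 0 -> ∀ n -> ¬ P n -> Σ[ i ∈ ℕ ] (P i × ¬ P (suc i))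
 disIVT P? p₀ zero np = ⊥-elim (np p₀)
 disIVT P? p₀ (suc n) np with P? n
 ... | yes p = n , p , np
 ... | no ¬p = disIVT P? p₀ n ¬p

 module SquRoo (F : OrdFie) where
  open GroDec F public
  min : ∀ x y -> Σ[ m ∈ Carrier ] ((0# < x -> 0# < y -> 0# < m) × m ≤ x × m ≤ y)
  min x y with ≤-total x y
  ... | inj₁ l = x , (\ p _ -> p) , ≤-refl , l
  ... | inj₂ l = y , (\ _ p -> p) , l , ≤-refl
  sqrtBou : Carrier -> Carrier
  sqrtBou W = 1# + fromℕ (suc (proj₁ (arc W)))
  -- Two neighbouring multiples x, y of δ = 1 / (n + 1) enclose the square root of W; n is so large
  -- that 2 δ Y ≤ ε, which bounds y² - x².
  module SqrtApp {W : Carrier} (W≥0 : 0# ≤ W) {ε : Carrier} (ε>0 : 0# < ε) where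
   private
    w = suc (proj₁ (arc W))
    Y = sqrtBou W
    n = proj₁ (arc ((Y + Y) * inv ε ε>0))
    n>0 : 0# < fromℕ (suc n)
    n>0 = 0<fromℕ {suc n} (s≤s z≤n)
    δ = inv (fromℕ (suc n)) n>0
    big : ¬ (fromℕ (w N.* suc n) * δ * (fromℕ (w N.* suc n) * δ) ≤ W)
    big l = <-≤-trans (≤-<-trans (proj₂ (arc W)) w<) (≤-trans (≤ˡ (*-identityʳ _) (*-monoʳ-≤ (fromℕ-non w) (1≤fromℕ {w} (s≤s z≤n)))) (≤-reflexive (! (ap₂ _*_ wδ wδ)))) l
     where
     wδ : fromℕ (w N.* suc n) * δ ≡ fromℕ w
     wδ = ap (_* δ) (fromℕ-* w (suc n)) ∙ *-assoc _ _ _ ∙ ap (\ t -> fromℕ w * t) (inv-* _ n>0) ∙ *-identityʳ _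
     w< : fromℕ (proj₁ (arc W)) < fromℕ w
     w< m = 0<1 (≤ˡ (solve 1 (\ x -> (1∶ :+ x) :- x := 1∶) idp _) (≤ʳ (-‿inverseʳ _) (+-mono-≤ m (≤-refl { - fromℕ (proj₁ (arc W)) }))))
    δ≥0′ : 0# ≤ δ
    δ≥0′ = <⇒≤ (inv-pos (fromℕ (suc n)) n>0)
    Below : ℕ -> Set
    Below i = fromℕ i * δ * (fromℕ i * δ) ≤ W
    module _ (i : ℕ) (low : Below i) where
     δ≥0 = <⇒≤ (inv-pos (fromℕ (suc n)) n>0)
     x = fromℕ i * δ
     y = fromℕ (suc i) * δ
     y≡ : y ≡ x + δ
     y≡ = solve 2 (\ i d -> (1∶ :+ i) :* d := i :* d :+ d) idp (fromℕ i) δ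
     δ≤1 : δ ≤ 1#
     δ≤1 = *-can-≤ n>0 (≤-trans (≤-reflexive (inv-* _ n>0)) (≤ʳ (! (*-identityʳ _)) (1≤fromℕ {suc n} (s≤s z≤n))))
     x≤w : x ≤ fromℕ w
     x≤w = squ-≤⇒≤ (fromℕ-non w) (≤-trans low (≤-trans (proj₂ (arc W)) (≤-trans (fromℕ-mono (NP.n≤1+n (proj₁ (arc W)))) (≤ˡ (*-identityʳ _) (*-monoʳ-≤ (fromℕ-non w) (1≤fromℕ {w} (s≤s z≤n)))))))
     y≤Y : y ≤ Y
     y≤Y = ≤ˡ (! y≡) (≤ʳ (+-comm (fromℕ w) 1#) (+-mono-≤ x≤w δ≤1))
     δYY : δ * (Y + Y) ≤ ε
     δYY = *-can-≤ n>0 (≤ˡ (! (! (*-assoc _ _ _) ∙ ap (_* (Y + Y)) (inv-* _ n>0) ∙ *-identityˡ _)) (≤-trans (≤-reflexive (! (*-assoc _ _ _ ∙ ap (\ t -> (Y + Y) * t) (*-comm _ _ ∙ inv-* ε ε>0) ∙ *-identityʳ _))) (*-monoˡ-≤ (<⇒≤ ε>0) (≤-trans (proj₂ (arc ((Y + Y) * inv ε ε>0))) (fromℕ-mono (NP.n≤1+n n))))))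
     upper : y * y ≤ W + ε
     upper = ≤-trans (by-non {d = δ * ((Y - y) + (Y - y)) + δ * δ} (ap (\ y -> x * x + δ * (Y + Y) - y * y) y≡ ∙ solve 3 (\ x d Y -> (x :* x :+ d :* (Y :+ Y)) :- (x :+ d) :* (x :+ d) := d :* ((Y :- (x :+ d)) :+ (Y :- (x :+ d))) :+ d :* d) idp x δ Y ∙ ap (\ y -> δ * ((Y - y) + (Y - y)) + δ * δ) (! y≡)) (+-non (*-non δ≥0 (+-non (diff≥0 y≤Y) (diff≥0 y≤Y))) (squ-non δ))) (+-mono-≤ low δYY)
   Root : Set
   Root = Σ[ y ∈ Carrier ] (0# ≤ y × W < y * y × y * y ≤ W + ε × y ≤ sqrtBou W)
   private
    fin : Σ[ i ∈ ℕ ] (Below i × ¬ Below (suc i)) -> Root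
    fin (i , low , high) = y i low , *-non (fromℕ-non (suc i)) δ≥0′ , high , upper i low , y≤Y i low
    search : Σ[ i ∈ ℕ ] (Below i × ¬ Below (suc i))
    search = disIVT {Below} (\ i -> _ ≤? W) (≤ˡ (solve 1 (\ d -> 0∶ := 0∶ :* d :* (0∶ :* d)) idp δ) W≥0) (w N.* suc n) big
   opaque
    root : Root
    root = fin search
  open SqrtApp public using (root)
  pow-gap : ∀ {x y Y} n -> 0# ≤ x -> x ≤ y -> y ≤ Y -> 1# ≤ Y -> y ^ n - x ^ n ≤ fromℕ n * (Y ^ n * (y - x))
  pow-gap zero px l m k = ≤-reflexive (solve 2 (\ x y -> 1∶ :- 1∶ := 0∶ :* (1∶ :* (y :- x))) idp _ _)
  pow-gap {x} {y} {Y} (suc n) px l m k = ≤-trans (by-non (solve 5 (\ X Z n p d -> n :* (p :* (:- d)) :- (Z :- X) := X :- (Z :+ n :* (p :* d))) idp (x ^ suc n) (y ^ suc n) (fromℕ (suc n)) (y ^ n) (x - y)) (diff≥0 (tan px (≤-trans px l) n))) (*-monoʳ-≤ (fromℕ-non (suc n)) (≤ˡ (ap (\ t -> y ^ n * t) (solve 2 (\ x y -> y :- x := :- (x :- y)) idp x y)) (*-monoˡ-≤ (diff≥0 l) (≤-trans (^-mono n (≤-trans px l) m) (≤ˡ (*-identityˡ _) (*-monoˡ-≤ (^-non n (≤-trans 0≤1 k)) k))))))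

 module NorPol (F : OrdFie) where
  open SquRoo F public
  sca : Carrier -> Seq -> Seq
  sca ρ f i = f i * ρ ^ i
  scaled-⊛ : ∀ ρ f g -> sca ρ (f ⊛ g) ≋ sca ρ f ⊛ sca ρ g
  scaled-⊛ ρ f g zero = solve 2 (\ a b -> a :* b :* 1∶ := (a :* 1∶) :* (b :* 1∶)) idp (f 0) (g 0)
  scaled-⊛ ρ f g (suc n) = solve 5 (\ a b t r p -> (a :* b :+ t) :* (r :* p) := (a :* 1∶) :* (b :* (r :* p)) :+ r :* (t :* p)) idp (f 0) (g (suc n)) ((tail f ⊛ g) n) ρ (ρ ^ n) ∙ ap (\ t -> f 0 * 1# * (g (suc n) * (ρ * ρ ^ n)) + t) (ap (\ t -> ρ * t) (scaled-⊛ ρ (tail f) g n) ∙ ! (sca-⊛ ρ (sca ρ (tail f)) (sca ρ g) n) ∙ ⊛-cong {scale ρ (sca ρ (tail f))} {tail (sca ρ f)} {sca ρ g} (\ i -> solve 3 (\ r a p -> r :* (a :* p) := a :* (r :* p)) idp ρ (f (suc i)) (ρ ^ i)) ≋-refl n)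
  module Data′ (g q : ℕ) (g≥1 : 1 N.≤ g) (q≥1 : 1 N.≤ q) (a : ℕ -> ℤ) (a₀ : a 0 ≡ + 1) (aN : a (g N.+ g) ≡ + (q N.^ g)) (a-deg : ∀ i -> g N.+ g N.< i -> a i ≡ + 0) (τ : Seq) (τ₀ : τ 0 ≡ 0#) (new : θ (\ i -> fromℤ (a i)) ≋ τ ⊛ (\ i -> fromℤ (a i))) (C : Carrier) (C≥0 : 0# ≤ C) (gro : ∀ l -> ∣ τ (l N.+ l) ∣ ≤ C * fromℕ q ^ l) where
   N : ℕ
   N = g N.+ g
   aF : Seq
   aF i = fromℤ (a i)
   Q : Carrier
   Q = fromℕ q
   1≤Q : 1# ≤ Q
   1≤Q = 1≤fromℕ q≥1
   fromℕ-^ : ∀ n -> fromℕ (q N.^ n) ≡ Q ^ n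
   fromℕ-^ zero = +-identityʳ 1#
   fromℕ-^ (suc n) = fromℕ-* q (q N.^ n) ∙ ap (\ t -> Q * t) (fromℕ-^ n)
   aF₀ : aF 0 ≡ 1#
   aF₀ = ap fromℤ a₀ ∙ +-identityʳ 1#
   aFN : aF N ≡ Q ^ g
   aFN = ap fromℤ aN ∙ fromℕ-^ g
   daF : Deg< aF (suc N)
   daF i l = ap fromℤ (a-deg i l)
   -- Rescaling the variable by ρ = 1/R turns the growth q^l of the even power sums into κ^l with κ
   -- = q / R² < 1.
   module AtRad (R : Carrier) (R≥0 : 0# ≤ R) (Q<R² : Q < R * R) where
    R>0 : 0# < R
    R>0 = ≤∧≢⇒< R≥0 (\ e -> Q<R² (≤ˡ (! (zeroˡ 0#) ∙ ap₂ _*_ e e) (≤-trans 0≤1 1≤Q)))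
    ρ : Carrier
    ρ = inv R R>0
    Rρ : R * ρ ≡ 1#
    Rρ = inv-* R R>0
    ρ≥0 : 0# ≤ ρ
    ρ≥0 = <⇒≤ (inv-pos R R>0)
    Rρ^ : ∀ n -> R ^ n * ρ ^ n ≡ 1#
    Rρ^ n = ! (^-*-dis R ρ n) ∙ ap (_^ n) Rρ ∙ 1^ n
    κ : Carrier
    κ = Q * (ρ * ρ)
    κ≥0 : 0# ≤ κ
    κ≥0 = *-non (fromℕ-non q) (squ-non ρ)
    R²ρ² : R * R * (ρ * ρ) ≡ 1#
    R²ρ² = solve 2 (\ r p -> r :* r :* (p :* p) := (r :* p) :* (r :* p)) idp R ρ ∙ ap₂ _*_ Rρ Rρ ∙ *-identityˡ 1#
    κ<1 : κ < 1#
    κ<1 l = Q<R² (≤ˡ (*-identityʳ _) (≤ʳ (solve 3 (\ r q p -> r :* (q :* p) := q :* (r :* p)) idp (R * R) Q (ρ * ρ) ∙ ap (\ t -> Q * t) R²ρ² ∙ *-identityʳ Q) (*-monoʳ-≤ (squ-non R) l)))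
    A τ′ : Seq
    A = sca ρ aF
    τ′ = sca ρ τ
    A₀ : A 0 ≡ 1#
    A₀ = *-identityʳ _ ∙ aF₀
    dA : Deg< A (suc N)
    dA i l = ap (_* ρ ^ i) (daF i l) ∙ zeroˡ _
    new′ : θ A ≋ τ′ ⊛ A
    new′ = ≋-trans (\ i -> ! (*-assoc _ _ _) ∙ ap (_* ρ ^ i) (new i)) (scaled-⊛ ρ τ aF)
    gro′ : ∀ l -> ∣ τ′ (l N.+ l) ∣ ≤ C * κ ^ l
    gro′ l = ≤ˡ (! (abs-* _ _ ∙ ap (\ t -> ∣ τ (l N.+ l) ∣ * t) (abs-≡ (^-non (l N.+ l) ρ≥0)))) (≤-trans (*-monoˡ-≤ (^-non (l N.+ l) ρ≥0) (gro l)) (≤-reflexive (*-assoc _ _ _ ∙ ap (\ t -> C * t) (ap (\ t -> Q ^ l * t) (x^[l+l] ρ l) ∙ ! (^-*-dis Q (ρ * ρ) l)))))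
    τ′₀ : τ′ 0 ≡ 0#
    τ′₀ = ap (_* 1#) τ₀ ∙ zeroˡ 1#
    staN : Stage N A (rev N A)
    staN = stage N A τ′ A₀ dA τ′₀ new′ C κ C≥0 κ≥0 κ<1 gro′
    blaN : Σ[ f ∈ Seq ] (rev N A ≋ f ⊛ A × (∀ M -> sq M f ≤ 1#))
    blaN = bla N A τ′ A₀ dA τ′₀ new′ C κ C≥0 κ≥0 κ<1 gro′
   CA : Carrier
   CA = sumTo (suc N) (\ j -> ∣ aF j ∣)
   CA≥0 : 0# ≤ CA
   CA≥0 = sumTo-non (suc N) (\ j -> abs-non (aF j))
   aF≤CA : ∀ j -> ∣ aF j ∣ ≤ CA
   aF≤CA j with j NP.≤? N
   ... | yes l = term≤sumTo (suc N) (\ j -> abs-non (aF j)) j (s≤s l)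
   ... | no nl = ≤ˡ (! (ap ∣_∣ (daF j (NP.≰⇒> nl)) ∙ abs-0)) CA≥0
   Y : Carrier
   Y = Q + 1#
   1≤Y : 1# ≤ Y
   1≤Y = ≤ˡ (+-identityˡ 1#) (+-mono-≤ (fromℕ-non q) ≤-refl)
   C₁ C₂ : Carrier
   C₁ = fromℕ N * CA * Y ^ (N N.+ N)
   C₂ = C₁ + CA * (fromℕ N * Y ^ (N N.+ N))
   -- Divided by N + 1 so that N times the tolerance is at most η², the loss allowed in `1-γ²≤`.
   tol : Carrier -> Carrier
   tol η = η * η * inv (fromℕ (suc N)) (0<fromℕ {suc N} (s≤s z≤n))

   -- As R tends to √q, the Blaschke product f tends to a constant, so P and P* become proportional.
   module NeaSym {η : Carrier} (η>0 : 0# < η) (η≤1 : η ≤ 1#) (R : Carrier) (R≥0 : 0# ≤ R) (Q<R² : Q < R * R) (R²≤ : R * R ≤ Q + tol η) (i : ℕ) (i≤N : i N.≤ N) where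
    open AtRad R R≥0 Q<R²
    private
     ε = tol η
    η≥0 = <⇒≤ η>0
    Nε : fromℕ N * ε ≤ η * η
    Nε = ≤-trans (*-monoˡ-≤ (*-non (squ-non η) (<⇒≤ (inv-pos _ (0<fromℕ {suc N} (s≤s z≤n))))) (fromℕ-mono (NP.n≤1+n N))) (≤-reflexive (solve 3 (\ n h i -> n :* (h :* i) := h :* (n :* i)) idp (fromℕ (suc N)) (η * η) _ ∙ ap (\ t -> η * η * t) (inv-* _ (0<fromℕ {suc N} (s≤s z≤n))) ∙ *-identityʳ _))
    ε≥0 : 0# ≤ ε
    ε≥0 = *-non (squ-non η) (<⇒≤ (inv-pos _ (0<fromℕ {suc N} (s≤s z≤n))))
    ε≤η : ε ≤ η
    ε≤η = ≤-trans (≤ˡ (*-identityˡ ε) (*-monoˡ-≤ ε≥0 (1≤fromℕ {N} (NP.≤-trans g≥1 (NP.m≤m+n g g))))) (≤-trans Nε (≤ʳ (*-identityʳ η) (*-monoʳ-≤ η≥0 η≤1)))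
    R²-Q≤ε : R * R - Q ≤ ε
    R²-Q≤ε = ≤ʳ (solve 2 (\ q e -> (q :+ e) :- q := e) idp Q ε) (+-mono-≤ R²≤ (≤-refl { - Q }))
    R²≤Y : R * R ≤ Y
    R²≤Y = ≤-trans R²≤ (+-monoʳ-≤ Q (≤-trans ε≤η η≤1))
    1≤R² : 1# ≤ R * R
    1≤R² = ≤-trans 1≤Q (<⇒≤ Q<R²)
    1≤R : 1# ≤ R
    1≤R = squ-≤⇒≤ R≥0 (≤ˡ (! (*-identityˡ 1#)) 1≤R²)
    ρ≤1 : ρ ≤ 1#
    ρ≤1 = ≤ˡ (*-identityˡ ρ) (≤ʳ Rρ (*-monoˡ-≤ ρ≥0 1≤R))
    f = proj₁ blaN
    P≡ : rev N A ≋ f ⊛ A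
    P≡ = proj₁ (proj₂ blaN)
    f-norm = proj₂ (proj₂ blaN)
    γ = f 0
    -- The top coefficient q^g determines the constant term of f, which therefore approaches 1 as R²
    -- approaches q.
    γ≡ : γ ≡ κ ^ g
    γ≡ = begin f 0 ≡⟨ *-identityʳ _ ⟨ f 0 * 1# ≡⟨ ap (f 0 *_) A₀ ⟨ f 0 * A 0 ≡⟨ P≡ 0 ⟨ rev N A 0 ≡⟨ rev-0 N A ⟩ aF N * ρ ^ N ≡⟨ ap₂ _*_ aFN (x^[l+l] ρ g) ⟩ Q ^ g * (ρ * ρ) ^ g ≡⟨ ^-*-dis Q (ρ * ρ) g ⟨ κ ^ g ∎
    1-γ²≤ : 1# - γ * γ ≤ η * η
    1-γ²≤ = ≤-trans (≤-trans (≤-reflexive (ap₂ _-_ (! (1^ N)) (ap₂ _*_ γ≡ γ≡ ∙ ! (^-homo-* κ g g)))) (pow-gap {κ} {1#} {1#} N κ≥0 (<⇒≤ κ<1) ≤-refl ≤-refl)) (≤-trans (*-monoʳ-≤ (fromℕ-non N) (≤-trans (≤-reflexive (ap (_* (1# - κ)) (1^ N) ∙ *-identityˡ _)) (≤-trans (≤-reflexive (ap (_- κ) (! R²ρ²) ∙ solve 3 (\ r p q -> r :* p :- q :* p := (r :- q) :* p) idp (R * R) (ρ * ρ) Q)) (≤-trans (*-monoʳ-≤ (diff≥0 (<⇒≤ Q<R²)) (≤ʳ (*-identityˡ 1#) (*-mono-≤ ρ≥0 ρ≥0 ρ≤1 ρ≤1))) (≤-trans (≤-reflexive (*-identityʳ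 _)) R²-Q≤ε))))) Nε)
    -- The square sum of f is at most 1, and f 0 already takes all but η² of it.
    f-sma : ∀ l -> ∣ f (suc l) ∣ ≤ η
    f-sma l = squ-≤⇒≤ η≥0 (≤ˡ (! (abs-sq _)) (≤-trans (by-non {d = 1# - (γ * γ + f (suc l) * f (suc l))} (solve 2 (\ g x -> (1∶ :- g) :- x := 1∶ :- (g :+ x)) idp _ _) (diff≥0 (≤-trans (≤-trans (+-monoʳ-≤ (γ * γ) (term≤sumTo (suc l) (\ i -> squ-non (f (suc i))) l (NP.n<1+n l))) (≤-reflexive (! (sumTo-suc (suc l) _)))) (f-norm (suc (suc l)))))) 1-γ²≤))
    A≤CA : ∀ j -> ∣ A j ∣ ≤ CA
    A≤CA j = ≤ˡ (! (abs-* _ _ ∙ ap (\ t -> ∣ aF j ∣ * t) (abs-≡ (^-non j ρ≥0)))) (≤-trans (*-monoʳ-≤ (abs-non _) (^≤1 j ρ≥0 ρ≤1)) (≤-trans (≤-reflexive (*-identityʳ _)) (aF≤CA j)))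
    -- These are the coefficients of (f - γ) A, and all coefficients of f - γ are at most η in
    -- absolute value.
    close : ∀ j -> j N.≤ N -> ∣ rev N A j - γ * A j ∣ ≤ fromℕ N * CA * η
    close zero _ = ≤ˡ (! (ap ∣_∣ (to-dif (P≡ 0)) ∙ abs-0)) (*-non (*-non (fromℕ-non N) CA≥0) η≥0)
    close (suc j) j≤N = ≤ˡ (ap ∣_∣ (! (ap (_- γ * A (suc j)) (P≡ (suc j)) ∙ solve 2 (\ a b -> (a :+ b) :- a := b) idp _ _))) (≤ˡ (ap ∣_∣ (! (⊛-sum (tail f) A j))) (≤-trans (abs-sumTo (suc j) _) (≤-trans (sumTo-mono (suc j) (\ l _ -> ≤ˡ (! (abs-* _ _)) (*-mono-≤ (abs-non _) (abs-non _) (f-sma l) (A≤CA (j ∸ l))))) (≤-trans (≤-reflexive (sumTo-con (suc j) _)) (≤-trans (*-monoˡ-≤ (*-non η≥0 CA≥0) (fromℕ-mono j≤N)) (≤-reflexive (solve 3 (\ n h c -> n :* (h :* c) := n :* c :* h) idp (fromℕ N) η CA)))))))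
    R^ : ∀ n -> n N.≤ N -> R ^ (N N.+ n) ≤ Y ^ (N N.+ N)
    R^ n n≤N = ≤-trans (^-mono (N N.+ n) R≥0 (≤-trans (≤ˡ (*-identityʳ R) (*-monoʳ-≤ R≥0 1≤R)) R²≤Y)) (≤ˡ (*-identityʳ _) (≤-trans (*-monoʳ-≤ (^-non (N N.+ n) (≤-trans 0≤1 1≤Y)) (1≤^ (N ∸ n) 1≤Y)) (≤-reflexive (! (^-homo-* Y (N N.+ n) (N ∸ n)) ∙ ap (Y ^_) (NP.+-assoc N n (N ∸ n) ∙ ap (N N.+_) (NP.m+[n∸m]≡n n≤N))))))
    A-val : rev N A i * R ^ (N N.+ i) ≡ aF (N ∸ i) * (R * R) ^ i
    A-val = begin rev N A i * R ^ (N N.+ i) ≡⟨ ap₂ _*_ (rev-at N A i i≤N) (ap (R ^_) (ap (N._+ i) (! (NP.m∸n+n≡m i≤N)) ∙ NP.+-assoc (N ∸ i) i i)) ⟩ aF (N ∸ i) * ρ ^ (N ∸ i) * R ^ (N ∸ i N.+ (i N.+ i)) ≡⟨ ap (\ t -> aF (N ∸ i) * ρ ^ (N ∸ i) * t) (^-homo-* R (N ∸ i) (i N.+ i) ∙ ap (\ t -> R ^ (N ∸ i) * t) (x^[l+l] R i)) ⟩ aF (N ∸ i) * ρ ^ (N ∸ i) * (R ^ (N ∸ i) * (R * R) ^ i) ≡⟨ solve 4 (\ a p r s -> a :* p :* (r :* s) := (r :* p) :* (a :* s)) idp (aF (N ∸ i)) (ρ ^ (N ∸ i)) (R ^ (N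 ∸ i)) ((R * R) ^ i) ⟩ R ^ (N ∸ i) * ρ ^ (N ∸ i) * (aF (N ∸ i) * (R * R) ^ i) ≡⟨ ap (_* (aF (N ∸ i) * (R * R) ^ i)) (Rρ^ (N ∸ i)) ⟩ 1# * (aF (N ∸ i) * (R * R) ^ i) ≡⟨ *-identityˡ _ ⟩ aF (N ∸ i) * (R * R) ^ i ∎
    γA-val : γ * A i * R ^ (N N.+ i) ≡ Q ^ g * aF i
    γA-val = begin γ * A i * R ^ (N N.+ i) ≡⟨ ap₂ (\ c d -> c * A i * d) γ≡ (^-homo-* R N i) ⟩ κ ^ g * (aF i * ρ ^ i) * (R ^ N * R ^ i) ≡⟨ ap (\ c -> c * (aF i * ρ ^ i) * (R ^ N * R ^ i)) (^-*-dis Q (ρ * ρ) g ∙ ap (\ t -> Q ^ g * t) (! (x^[l+l] ρ g))) ⟩ Q ^ g * ρ ^ N * (aF i * ρ ^ i) * (R ^ N * R ^ i) ≡⟨ solve 6 (\ q p a s r t -> q :* p :* (a :* s) :* (r :* t) := (r :* p) :* (t :* s) :* (q :* a)) idp (Q ^ g) (ρ ^ N) (aF i) (ρ ^ i) (R ^ N) (R ^ i) ⟩ R ^ N * ρ ^ N * (R ^ i * ρ ^ i) * (Q ^ g * aF i) ≡⟨ ap₂ (\ c d -> c * d * (Q ^ g * aF i)) (Rρ^ N) (Rρ^ i) ⟩ 1# * 1# * (Q ^ g * aF i) ≡⟨ solve 1 (\ x -> 1∶ :* 1∶ :* x := x) idp _ ⟩ Q ^ g * aF i ∎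
    e-spl : aF (N ∸ i) * Q ^ i - Q ^ g * aF i ≡ (rev N A i - γ * A i) * R ^ (N N.+ i) + - (aF (N ∸ i) * ((R * R) ^ i - Q ^ i))
    e-spl = ! (ap (_+ - (aF (N ∸ i) * ((R * R) ^ i - Q ^ i))) (solve 3 (\ p c r -> (p :- c) :* r := p :* r :- c :* r) idp (rev N A i) (γ * A i) (R ^ (N N.+ i)) ∙ ap₂ _-_ A-val γA-val) ∙ solve 4 (\ a r b q -> (a :* r :- b) :+ :- (a :* (r :- q)) := a :* q :- b) idp (aF (N ∸ i)) ((R * R) ^ i) (Q ^ g * aF i) (Q ^ i))
    part₁ : ∣ (rev N A i - γ * A i) * R ^ (N N.+ i) ∣ ≤ C₁ * η
    part₁ = ≤ˡ (! (abs-* _ _)) (≤-trans (*-mono-≤ (abs-non _) (abs-non _) (close i i≤N) (≤ˡ (! (abs-≡ (^-non (N N.+ i) R≥0))) (R^ i i≤N))) (≤-reflexive (solve 3 (\ c h y -> c :* h :* y := c :* y :* h) idp (fromℕ N * CA) η (Y ^ (N N.+ N)))))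
    part₂ : ∣ - (aF (N ∸ i) * ((R * R) ^ i - Q ^ i)) ∣ ≤ CA * (fromℕ N * Y ^ (N N.+ N)) * η
    part₂ = ≤ˡ (! (abs-neg _ ∙ abs-* _ _)) (≤-trans (*-mono-≤ (abs-non _) (abs-non _) (aF≤CA _) (≤ˡ (! (abs-≡ (diff≥0 (^-mono i (fromℕ-non q) (<⇒≤ Q<R²))))) (≤-trans (pow-gap i (fromℕ-non q) (<⇒≤ Q<R²) R²≤Y 1≤Y) (≤-trans (*-mono-≤ (fromℕ-non i) (*-non (^-non i (≤-trans 0≤1 1≤Y)) (diff≥0 (<⇒≤ Q<R²))) (fromℕ-mono i≤N) (*-mono-≤ (^-non i (≤-trans 0≤1 1≤Y)) (diff≥0 (<⇒≤ Q<R²)) Y^i (≤-trans R²-Q≤ε ε≤η))) (≤-reflexive (! (*-assoc _ _ _))))))) (≤-reflexive (! (*-assoc _ _ _))))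
     where
     Y^i : Y ^ i ≤ Y ^ (N N.+ N)
     Y^i = ≤ˡ (*-identityʳ _) (≤-trans (*-monoʳ-≤ (^-non i (≤-trans 0≤1 1≤Y)) (1≤^ (N N.+ N ∸ i) 1≤Y)) (≤-reflexive (! (^-homo-* Y i _) ∙ ap (Y ^_) (NP.m+[n∸m]≡n (NP.≤-trans i≤N (NP.m≤m+n N N))))))
    near : ∣ aF (N ∸ i) * Q ^ i - Q ^ g * aF i ∣ ≤ C₂ * η
    near = ≤-trans (≤-reflexive (ap ∣_∣ e-spl)) (≤-trans (abs-+ _ _) (≤-trans (+-mono-≤ part₁ part₂) (≤-reflexive (solve 4 (\ c a y h -> c :* h :+ a :* y :* h := (c :+ a :* y) :* h) idp C₁ CA (fromℕ N * Y ^ (N N.+ N)) η))))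
   neaSym : ∀ {η} -> 0# < η -> η ≤ 1# -> ∀ i -> i N.≤ N -> ∣ aF (N ∸ i) * Q ^ i - Q ^ g * aF i ∣ ≤ C₂ * η
   neaSym {η} η>0 η≤1 i i≤N = use (root (fromℕ-non q) tol>0)
    where
    tol>0 : 0# < tol η
    tol>0 = *-pos (*-pos η>0 η>0) (inv-pos (fromℕ (suc N)) (0<fromℕ {suc N} (s≤s z≤n)))
    use : SqrtApp.Root (fromℕ-non q) tol>0 -> ∣ aF (N ∸ i) * Q ^ i - Q ^ g * aF i ∣ ≤ C₂ * η
    use (R , R≥0 , Q<R² , R²≤ , _) = NeaSym.near η>0 η≤1 R R≥0 Q<R² R²≤ i i≤N
   C₂≥0 : 0# ≤ C₂
   C₂≥0 = +-non (*-non (*-non (fromℕ-non N) CA≥0) (^-non (N N.+ N) (≤-trans 0≤1 1≤Y))) (*-non CA≥0 (*-non (fromℕ-non N) (^-non (N N.+ N) (≤-trans 0≤1 1≤Y))))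
   -- Both sides come from integers, and their difference is at most C₂ η for every admissible η;
   -- the choice η = 1 / (1 + C₂) makes it less than 1.
   symmetric : ∀ i -> i N.≤ N -> aF (N ∸ i) * Q ^ i ≡ Q ^ g * aF i
   symmetric i i≤N = from-dif (! int ∙ ap fromℤ (fromℤ-sma e small))
    where
    e : ℤ
    e = a (N ∸ i) ℤ.* + (q N.^ i) ℤ.+ ℤ.- (+ (q N.^ g) ℤ.* a i)
    int : fromℤ e ≡ aF (N ∸ i) * Q ^ i - Q ^ g * aF i
    int = fromℤ-+ (a (N ∸ i) ℤ.* + (q N.^ i)) (ℤ.- (+ (q N.^ g) ℤ.* a i)) ∙ ap₂ _+_ (fromℤ-* (a (N ∸ i)) (+ (q N.^ i)) ∙ ap (\ t -> aF (N ∸ i) * t) (fromℕ-^ i)) (fromℤ-neg (+ (q N.^ g) ℤ.* a i) ∙ ap -_ (fromℤ-* (+ (q N.^ g)) (a i) ∙ ap (_* aF i) (fromℕ-^ g)))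
    pos₂ : 0# < 1# + C₂
    pos₂ = +-pos 0<1 C₂≥0
    η = inv (1# + C₂) pos₂
    η>0 = inv-pos (1# + C₂) pos₂
    η≤1 : η ≤ 1#
    η≤1 = ≤ˡ (*-identityˡ η) (≤ʳ (inv-* _ pos₂) (*-monoˡ-≤ (<⇒≤ η>0) (≤ˡ (+-identityʳ 1#) (+-monoʳ-≤ 1# C₂≥0))))
    small : ∣ fromℤ e ∣ < 1#
    small l = η>0 (≤ˡ (ap (_- C₂ * η) (! (inv-* _ pos₂)) ∙ solve 2 (\ c h -> (1∶ :+ c) :* h :- c :* h := h) idp C₂ η) (≤ʳ (-‿inverseʳ (C₂ * η)) (+-mono-≤ (≤-trans l (≤ˡ (ap ∣_∣ (! int)) (neaSym η>0 η≤1 i i≤N))) (≤-refl { - (C₂ * η) }))))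

open Symmetry

-- Serre's bound for the first coefficient.

module SerIne where

 open import Data.Integer.Base using (+_; -[1+_])

 module SerBou (F : OrdFie) where
  open NorPol F public

  -- Functions bounded on |x| ≤ X.
  module BouFun (X : Carrier) (X≥0 : 0# ≤ X) where
   BF : (Carrier -> Carrier) -> Set
   BF f = Σ[ B ∈ Carrier ] (0# ≤ B × (∀ x -> ∣ x ∣ ≤ X -> ∣ f x ∣ ≤ B))
   BF-con : ∀ c -> BF (\ _ -> c)
   BF-con c = ∣ c ∣ , abs-non c , \ _ _ -> ≤-refl
   BF-id : BF (\ x -> x)
   BF-id = X , X≥0 , \ _ l -> l
   BF-+ : ∀ {f h} -> BF f -> BF h -> BF (\ x -> f x + h x)
   BF-+ (B , p , b) (C , r , c) = B + C , +-non p r , \ x l -> ≤-trans (abs-+ _ _) (+-mono-≤ (b x l) (c x l))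
   BF-* : ∀ {f h} -> BF f -> BF h -> BF (\ x -> f x * h x)
   BF-* (B , p , b) (C , r , c) = B * C , *-non p r , \ x l -> ≤ˡ (! (abs-* _ _)) (*-mono-≤ (abs-non _) (abs-non _) (b x l) (c x l))
   BF-^ : ∀ n -> BF (\ x -> x ^ n)
   BF-^ zero = BF-con 1#
   BF-^ (suc n) = BF-* BF-id (BF-^ n)
  ev-sum : ∀ n f x -> ev n f x ≡ sumTo n (\ i -> f i * x ^ i)
  ev-sum zero f x = ! (sumTo-zero _)
  ev-sum (suc n) f x = ap₂ _+_ (! (*-identityʳ (f 0))) (ap (x *_) (ev-sum n (tail f) x) ∙ sumTo-*ˡ n x _ ∙ sumTo-cong n (\ i _ -> solve 3 (\ x a p -> x :* (a :* p) := a :* (x :* p)) idp x (f (suc i)) (x ^ i))) ∙ ! (sumTo-suc n _)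
  ^-≤-pred : ∀ {x y z} n -> 0# ≤ x -> x ≤ y -> y ≤ z -> x ^ suc n ≤ y * z ^ n
  ^-≤-pred n p l m = *-mono-≤ p (^-non n p) l (^-mono n p (≤-trans l m))
  module Final (g′ q M : ℕ) (q≥1 : 1 N.≤ q) (a : ℕ -> ℤ) (a₀ : a 0 ≡ + 1) (aN : a (suc g′ N.+ suc g′) ≡ + (q N.^ suc g′)) (a-deg : ∀ i -> suc g′ N.+ suc g′ N.< i -> a i ≡ + 0) (τ : Seq) (τ₀ : τ 0 ≡ 0#) (new : θ (\ i -> fromℤ (a i)) ≋ τ ⊛ (\ i -> fromℤ (a i))) (C : Carrier) (C≥0 : 0# ≤ C) (gro : ∀ l -> ∣ τ (l N.+ l) ∣ ≤ C * fromℕ q ^ l) (M-large : 4 N.* q N.< suc M N.* suc M) where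
   g : ℕ
   g = suc g′
   open Data′ g q (s≤s z≤n) q≥1 a a₀ aN a-deg τ τ₀ new C C≥0 gro hiding (Y)
   -- The roots of z² - (M + 1) z + q are s₀ ± √W, with W > 0 by (M + 1)² > 4 q. As √W need not
   -- exist, z = s₀ + y is used with y² slightly above W; Z bounds all these z.
   m s₀ W Z : Carrier
   m = fromℕ (suc M)
   s₀ = m * half
   W = s₀ * s₀ - Q
   Z = s₀ + sqrtBou W
   two-s₀ : two * s₀ ≡ m
   two-s₀ = solve 3 (\ t m h -> t :* (m :* h) := (t :* h) :* m) idp two m half ∙ ap (_* m) half-two ∙ *-identityˡ m
   m² : fromℕ (suc M N.* suc M) ≡ two * two * (s₀ * s₀)
   m² = fromℕ-* (suc M) (suc M) ∙ ! (ap₂ _*_ two-s₀ two-s₀) ∙ solve 2 (\ t s -> (t :* s) :* (t :* s) := t :* t :* (s :* s)) idp two s₀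
   four-Q : fromℕ (4 N.* q) ≡ two * two * Q
   four-Q = fromℕ-* 4 q ∙ ap (_* Q) (solve 0 (1∶ :+ (1∶ :+ (1∶ :+ (1∶ :+ 0∶))) := (1∶ :+ 1∶) :* (1∶ :+ 1∶)) idp)
   W>0 : 0# < W
   W>0 l = 0<1 (≤-trans gap₁ (≤ʳ (zeroʳ (two * two)) (*-monoʳ-≤ (squ-non two) l)))
    where
    gap₁ : 1# ≤ two * two * W
    gap₁ = by-non (solve 3 (\ t s q -> t :* (s :- q) :- 1∶ := t :* s :- (1∶ :+ t :* q)) idp (two * two) (s₀ * s₀) Q ∙ ap₂ (\ x y -> x - (1# + y)) (! m²) (! four-Q)) (diff≥0 (fromℕ-mono {suc (4 N.* q)} M-large))
   W≥0 = <⇒≤ W>0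
   s₀≥0 : 0# ≤ s₀
   s₀≥0 = *-non (fromℕ-non (suc M)) (<⇒≤ (inv-pos two two>0))
   s₀≥1 : 1# ≤ s₀
   s₀≥1 = squ-≤⇒≤ s₀≥0 (≤ˡ (! (*-identityˡ 1#)) (≤-trans 1≤Q (by-non idp W≥0)))
   s₀>0 : 0# < s₀
   s₀>0 = <-≤-trans 0<1 s₀≥1
   Z≥s₀ : s₀ ≤ Z
   Z≥s₀ = ≤ˡ (+-identityʳ s₀) (+-monoʳ-≤ s₀ (≤-trans 0≤1 (≤ˡ (+-identityʳ 1#) (+-monoʳ-≤ 1# (fromℕ-non (suc (proj₁ (arc W))))))))
   Z>0 : 0# < Z
   Z>0 = <-≤-trans s₀>0 Z≥s₀
   open BouFun Z (<⇒≤ Z>0)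

   -- G(−z) = 0 for the numbers z with z + q / z = M + 1
   G : Carrier -> Carrier
   G x = x * x + m * x + Q
   P : Carrier -> Carrier
   P x = ev (suc N) (rev N aF) x
   -- The identity is exact, with a cofactor of G that has to be bounded: at the approximate roots
   -- used below, G is small but not 0.
   Symmetric : ℕ -> Set
   Symmetric j = Σ[ d ∈ ℤ ] Σ[ f ∈ (Carrier -> Carrier) ] (BF f × (∀ x -> x ^ (j N.+ j) + Q ^ j ≡ x ^ j * fromℤ d + G x * f x))

   -- x^{2j} + q^j modulo G, by the recursion of the Dickson polynomials.
   symTerm : ∀ j -> Symmetric j × Symmetric (suc j)
   symTerm zero = (+ 2 , (\ _ -> 0#) , BF-con 0# , \ x -> solve 1 (\ g -> 1∶ :+ 1∶ := 1∶ :* (1∶ :+ (1∶ :+ 0∶)) :+ g :* 0∶) idp (G x)) , (ℤ.- (+ suc M) , (\ _ -> 1#) , BF-con 1# , \ x -> solve 3 (\ x q m -> x :* (x :* 1∶) :+ q :* 1∶ := x :* 1∶ :* (:- m) :+ (x :* x :+ m :* x :+ q) :* 1∶) idp x Q m)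
   symTerm (suc j) with symTerm j
   ... | (d₀ , f₀ , b₀ , e₀) , (d₁ , f₁ , b₁ , e₁) = (d₁ , f₁ , b₁ , e₁) , (d₂ , f₂ , BF-+ (BF-+ (BF-* (BF-^ (suc j)) (BF-con _)) (BF-* b₁ (BF-+ (BF-* BF-id BF-id) (BF-con Q)))) (BF-* (BF-con (- Q)) (BF-* (BF-* BF-id BF-id) b₀)) , e₂)
    where
    d₂ : ℤ
    d₂ = ℤ.- (+ suc M) ℤ.* d₁ ℤ.+ ℤ.- (+ q) ℤ.* d₀
    f₂ : Carrier -> Carrier
    f₂ x = x ^ suc j * fromℤ d₁ + f₁ x * (x * x + Q) + - Q * (x * x * f₀ x)
    d₂≡ : fromℤ d₂ ≡ - m * fromℤ d₁ + - Q * fromℤ d₀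
    d₂≡ = fromℤ-+ (ℤ.- (+ suc M) ℤ.* d₁) _ ∙ ap₂ _+_ (fromℤ-* (ℤ.- (+ suc M)) d₁) (fromℤ-* (ℤ.- (+ q)) d₀ ∙ ap (_* fromℤ d₀) (fromℤ-neg (+ q)))
    double : ∀ x j -> x ^ (suc j N.+ suc j) ≡ x * (x * x ^ (j N.+ j))
    double x j = ap (\ n -> x * x ^ n) (NP.+-suc j j)
    e₂ : ∀ x -> x ^ (suc (suc j) N.+ suc (suc j)) + Q ^ suc (suc j) ≡ x ^ suc (suc j) * fromℤ d₂ + G x * f₂ x
    e₂ x = begin x ^ (suc (suc j) N.+ suc (suc j)) + Q ^ suc (suc j) ≡⟨ ap (_+ Q ^ suc (suc j)) (double x (suc j)) ⟩ x * (x * x ^ (suc j N.+ suc j)) + Q * (Q * Q ^ j) ≡⟨ ap (\ t -> x * (x * t) + Q * (Q * Q ^ j)) (double x j) ⟩ x * (x * (x * (x * x ^ (j N.+ j)))) + Q * (Q * Q ^ j) ≡⟨ solve 4 (\ x q t r -> x :* (x :* (x :* (x :* t))) :+ q :* (q :* r) := (x :* (x :* t) :+ q :* r) :* (x :* x :+ q) :- q :* (x :* x) :* (t :+ r)) idp x Q (x ^ (j N.+ j)) (Q ^ j) ⟩ (x * (x * x ^ (j N.+ j)) + Q * Q ^ j) * (x * x + Q) - Q * (x * x) * (x ^ (j N.+ j) + Q ^ j) ≡⟨ ap₂ (\ u v -> u * (x * x + Q) - Q * (x * x) * v) (ap (_+ Q ^ suc j) (! (double x j)) ∙ e₁ x)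 (e₀ x) ⟩ (x * x ^ j * fromℤ d₁ + G x * f₁ x) * (x * x + Q) - Q * (x * x) * (x ^ j * fromℤ d₀ + G x * f₀ x) ≡⟨ solve 8 (\ x p D₁ D₀ F₁ F₀ m q -> (x :* p :* D₁ :+ (x :* x :+ m :* x :+ q) :* F₁) :* (x :* x :+ q) :- q :* (x :* x) :* (p :* D₀ :+ (x :* x :+ m :* x :+ q) :* F₀) := x :* (x :* p) :* (:- m :* D₁ :+ :- q :* D₀) :+ (x :* x :+ m :* x :+ q) :* (x :* p :* D₁ :+ F₁ :* (x :* x :+ q) :+ :- q :* (x :* x :* F₀))) idp x (x ^ j) (fromℤ d₁) (fromℤ d₀) (f₁ x) (f₀ x) m Q ⟩ x * (x * x ^ j) * (- m * fromℤ d₁ + - Q * fromℤ d₀) + G x * f₂ x ≡⟨ ap (\ d -> x * (x * x ^ j) * d + G x * f₂ x) (! d₂≡) ⟩ x ^ suc (suc j) * fromℤ d₂ + G x * f₂ x ∎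
   Represented : (Carrier -> Carrier) -> Set
   Represented h = Σ[ H ∈ ℤ ] Σ[ f ∈ (Carrier -> Carrier) ] (BF f × (∀ x -> h x ≡ x ^ g * fromℤ H + G x * f x))
   represented-+ : ∀ {h k} -> Represented h -> Represented k -> Represented (\ x -> h x + k x)
   represented-+ (H , f , b , e) (K , l , c , d) = H ℤ.+ K , (\ x -> f x + l x) , BF-+ b c , \ x -> ap₂ _+_ (e x) (d x) ∙ solve 6 (\ p h G f k l -> (p :* h :+ G :* f) :+ (p :* k :+ G :* l) := p :* (h :+ k) :+ G :* (f :+ l)) idp (x ^ g) (fromℤ H) (G x) (f x) (fromℤ K) (l x) ∙ ap (\ t -> x ^ g * t + G x * (f x + l x)) (! (fromℤ-+ H K))
   pairTerm : ℕ -> Carrier -> Carrier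
   pairTerm k x = aF k * x ^ k * (x ^ ((g ∸ k) N.+ (g ∸ k)) + Q ^ (g ∸ k))
   rep-pair : ∀ k -> k N.≤ g -> Represented (pairTerm k)
   rep-pair k k≤g = fromSym (proj₁ (symTerm (g ∸ k)))
    where
    fromSym : Symmetric (g ∸ k) -> Represented (pairTerm k)
    fromSym (d , f , b , e) = a k ℤ.* d , (\ x -> aF k * (x ^ k * f x)) , BF-* (BF-con (aF k)) (BF-* (BF-^ k) b) , \ x -> ap (\ t -> aF k * x ^ k * t) (e x) ∙ solve 6 (\ a p r d G f -> a :* p :* (r :* d :+ G :* f) := (p :* r) :* (a :* d) :+ G :* (a :* (p :* f))) idp (aF k) (x ^ k) (x ^ (g ∸ k)) (fromℤ d) (G x) (f x) ∙ ap₂ (\ s t -> s * t + G x * (aF k * (x ^ k * f x))) (! (^-homo-* x k (g ∸ k)) ∙ ap (x ^_) (NP.m+[n∸m]≡n k≤g)) (! (fromℤ-* (a k) d))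
   rep-pai : ∀ n -> n N.≤ g -> Represented (\ x -> sumTo n (\ k -> pairTerm k x))
   rep-pai zero l = + 0 , (\ _ -> 0#) , BF-con 0# , \ x -> sumTo-zero _ ∙ solve 2 (\ p G -> 0∶ := p :* 0∶ :+ G :* 0∶) idp (x ^ g) (G x)
   rep-pai (suc n) l = extend (represented-+ (rep-pai n (NP.≤-trans (NP.n≤1+n n) l)) (rep-pair n (NP.≤-trans (NP.n≤1+n n) l)))
    where
    extend : Represented (\ x -> sumTo n (\ k -> pairTerm k x) + pairTerm n x) -> Represented (\ x -> sumTo (suc n) (\ k -> pairTerm k x))
    extend (H , f , b , e) = H , f , b , \ x -> sumTo-snoc n _ ∙ e x
   fun-equ : ∀ k -> k N.≤ g -> aF (N ∸ k) ≡ Q ^ (g ∸ k) * aF k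
   fun-equ k k≤g = cancel (symmetric k (NP.≤-trans k≤g (NP.m≤m+n g g)))
    where
    Q^>0 : 0# < Q ^ k
    Q^>0 = ^-pos k (<-≤-trans 0<1 1≤Q)
    cancel : aF (N ∸ k) * Q ^ k ≡ Q ^ g * aF k -> aF (N ∸ k) ≡ Q ^ (g ∸ k) * aF k
    cancel e = ≤-antisym (*-can-≤ Q^>0 (≤-reflexive e′)) (*-can-≤ Q^>0 (≤-reflexive (! e′)))
     where
     e′ : Q ^ k * aF (N ∸ k) ≡ Q ^ k * (Q ^ (g ∸ k) * aF k)
     e′ = *-comm _ _ ∙ e ∙ ap (_* aF k) (ap (Q ^_) (! (NP.m+[n∸m]≡n k≤g)) ∙ ^-homo-* Q k (g ∸ k)) ∙ *-assoc _ _ _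
   -- By the functional equation the coefficient at 2 g - k is q^(g-k) times the one at k, so the
   -- two terms combine to a k x^k (x^(2(g-k)) + q^(g-k)).
   P-pai : ∀ x -> P x ≡ sumTo g (\ k -> pairTerm k x) + aF g * x ^ g
   P-pai x = begin P x ≡⟨ ev-sum (suc N) (rev N aF) x ⟩ sumTo (suc N) (\ i -> rev N aF i * x ^ i) ≡⟨ sumTo-cong (suc N) (\ i l -> ap (_* x ^ i) (rev-at N aF i (NP.≤-pred l))) ⟩ sumTo (suc N) (\ i -> aF (N ∸ i) * x ^ i) ≡⟨ ap (\ n -> sumTo n (\ i -> aF (N ∸ i) * x ^ i)) (! (NP.+-suc g g)) ⟩ sumTo (g N.+ suc g) (\ i -> aF (N ∸ i) * x ^ i) ≡⟨ sumTo-spl g (suc g) _ ⟩ sumTo g (\ i -> aF (N ∸ i) * x ^ i) + sumTo (suc g) (\ j -> aF (N ∸ (g N.+ j)) * x ^ (g N.+ j)) ≡⟨ ap (\ t -> sumTo g (\ i -> aF (N ∸ i) * x ^ i) + t) (sumTo-rev g _ ∙ sumTo-snoc g _) ⟩ sumTo g (\ i -> aF (N ∸ i) * x ^ i) + (sumTo g (\ k -> aF (N ∸ (g N.+ (g ∸ k))) * x ^ (g N.+ (g ∸ k))) + aF (N ∸ (g N.+ (g ∸ g))) * x ^ (g N.+ (g ∸ g))) ≡⟨ ! (+-assoc _ _ _) ∙ ap₂ _+_ (! (sumTo-+ g _ _)) last ⟩ sumTo g (\ k -> aF (N ∸ k) * x ^ k + aF (N ∸ (g N.+ (g ∸ k)))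 * x ^ (g N.+ (g ∸ k))) + aF g * x ^ g ≡⟨ ap (_+ aF g * x ^ g) (sumTo-cong g (\ k l -> pair k (NP.<⇒≤ l))) ⟩ sumTo g (\ k -> pairTerm k x) + aF g * x ^ g ∎
    where
    last : aF (N ∸ (g N.+ (g ∸ g))) * x ^ (g N.+ (g ∸ g)) ≡ aF g * x ^ g
    last = ap₂ (\ m n -> aF m * x ^ n) (ap (\ n -> N ∸ n) g+0 ∙ NP.m+n∸n≡m g g) g+0
     where
     g+0 : g N.+ (g ∸ g) ≡ g
     g+0 = ap (g N.+_) (NP.n∸n≡0 g) ∙ NP.+-identityʳ g
    pair : ∀ k -> k N.≤ g -> aF (N ∸ k) * x ^ k + aF (N ∸ (g N.+ (g ∸ k))) * x ^ (g N.+ (g ∸ k)) ≡ pairTerm k x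
    pair k k≤g = ap₂ _+_ (ap (_* x ^ k) (fun-equ k k≤g)) (ap₂ (\ m t -> aF m * t) (NP.[m+n]∸[m+o]≡n∸o g g (g ∸ k) ∙ NP.m∸[m∸n]≡n k≤g) (ap (x ^_) (ap (N._+ (g ∸ k)) (! (NP.m+[n∸m]≡n k≤g)) ∙ NP.+-assoc k (g ∸ k) (g ∸ k)) ∙ ^-homo-* x k _)) ∙ solve 4 (\ r a p t -> r :* a :* p :+ a :* (p :* t) := a :* p :* (t :+ r)) idp (Q ^ (g ∸ k)) (aF k) (x ^ k) (x ^ ((g ∸ k) N.+ (g ∸ k)))
   representation : Represented P
   representation = convert (represented-+ (rep-pai g NP.≤-refl) middle)
    where
    middle : Represented (\ x -> aF g * x ^ g)
    middle = a g , (\ _ -> 0#) , BF-con 0# , \ x -> solve 3 (\ a p G -> a :* p := p :* a :+ G :* 0∶) idp (aF g) (x ^ g) (G x)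
    convert : Represented (\ x -> sumTo g (\ k -> pairTerm k x) + aF g * x ^ g) -> Represented P
    convert (H , f , b , e) = H , f , b , \ x -> P-pai x ∙ e x
   ig : Carrier
   ig = inv (fromℕ g) (0<fromℕ {g} (s≤s z≤n))
   ig>0 : 0# < ig
   ig>0 = inv-pos (fromℕ g) (0<fromℕ {g} (s≤s z≤n))
   g-ig : fromℕ g * ig ≡ 1#
   g-ig = inv-* (fromℕ g) (0<fromℕ {g} (s≤s z≤n))
   half>0 : 0# < half
   half>0 = inv-pos two two>0
   twi-half : ∀ x -> x * half + x * half ≡ x
   twi-half x = solve 2 (\ x h -> x :* h :+ x :* h := ((1∶ :+ 1∶) :* h) :* x) idp x half ∙ ap (_* x) half-two ∙ *-identityˡ x
   -- y₀ = s₀ / (2 g) is half of the margin s₀ / g gained from a 1 ≥ g M + 1. The number d bounds z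
   -- - R from below, by z² - R² ≥ W / 2 and z + R ≤ 2 Z. Neither depends on ε.
   y₀ d : Carrier
   y₀ = s₀ * ig * half
   d = W * half * inv (Z + Z) (+-pos Z>0 (<⇒≤ Z>0))
   d>0 : 0# < d
   d>0 = *-pos (*-pos W>0 half>0) (inv-pos (Z + Z) (+-pos Z>0 (<⇒≤ Z>0)))
   abs-^ : ∀ x n -> ∣ x ^ n ∣ ≡ ∣ x ∣ ^ n
   abs-^ x zero = abs-≡ 0≤1
   abs-^ x (suc n) = abs-* x (x ^ n) ∙ ap (∣ x ∣ *_) (abs-^ x n)
   abs≤⇐squ : ∀ {x y} -> 0# ≤ y -> x * x ≤ y * y -> ∣ x ∣ ≤ y
   abs≤⇐squ {x} p l = squ-≤⇒≤ p (≤ˡ (! (abs-sq x)) l)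
   module AtAppRoot (ε : Carrier) (ε>0 : 0# < ε) (ε≤W : ε ≤ W * half) (ε≤y₀ : ε ≤ y₀ * half) (R : Carrier) (R≥0 : 0# ≤ R) (Q<R² : Q < R * R) (R²≤ : R * R ≤ Q + ε) (y : Carrier) (y≥0 : 0# ≤ y) (W<y² : W < y * y) (y²≤ : y * y ≤ W + ε) (y≤ : y ≤ sqrtBou W) (a₁-large : fromℕ (suc (g N.* M)) ≤ aF 1) where
    open AtRad R R≥0 Q<R²
    z : Carrier
    z = s₀ + y
    s₀≤z : s₀ ≤ z
    s₀≤z = ≤ˡ (+-identityʳ s₀) (+-monoʳ-≤ s₀ y≥0)
    z≥0 : 0# ≤ z
    z≥0 = ≤-trans s₀≥0 s₀≤z
    z≤Z : z ≤ Z
    z≤Z = +-monoʳ-≤ s₀ y≤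
    G-z : G (- z) ≡ y * y - W
    G-z = ap (\ m -> - z * - z + m * - z + Q) (! two-s₀) ∙ solve 3 (\ s y q -> :- (s :+ y) :* :- (s :+ y) :+ (1∶ :+ 1∶) :* s :* :- (s :+ y) :+ q := y :* y :- (s :* s :- q)) idp s₀ y Q
    G≥0 : 0# ≤ G (- z)
    G≥0 = ≤ʳ (! G-z) (diff≥0 (<⇒≤ W<y²))
    G≤ε : G (- z) ≤ ε
    G≤ε = ≤ˡ (! G-z) (≤ʳ (solve 2 (\ w e -> (w :+ e) :- w := e) idp W ε) (+-mono-≤ y²≤ (≤-refl { - W })))
    z²-R² : W * half ≤ z * z - R * R
    z²-R² = ≤-trans (by-non {d = W * half - ε} (ap (\ w -> (w - ε) - W * half) (! (twi-half W)) ∙ solve 2 (\ h e -> ((h :+ h) :- e) :- h := h :- e) idp (W * half) ε) (diff≥0 ε≤W)) (≤-trans (≤-reflexive (solve 3 (\ s q e -> (s :- q) :- e := s :- (q :+ e)) idp (s₀ * s₀) Q ε)) (+-mono-≤ (*-mono-≤ s₀≥0 s₀≥0 s₀≤z s₀≤z) (neg-mono R²≤)))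
    R≤z : R ≤ z
    R≤z = squ-≤⇒≤ z≥0 (by-non idp (≤-trans (<⇒≤ (*-pos W>0 half>0)) z²-R²))
    d≤z-R : d ≤ z - R
    d≤z-R = *-can-≤ ZZ>0 (≤ˡ (! (solve 3 (\ z w i -> z :* (w :* i) := w :* (z :* i)) idp (Z + Z) (W * half) (inv (Z + Z) ZZ>0) ∙ ap (\ t -> W * half * t) (inv-* (Z + Z) ZZ>0) ∙ *-identityʳ _)) (≤-trans z²-R² (≤-trans (≤-reflexive (solve 2 (\ z r -> z :* z :- r :* r := (z :+ r) :* (z :- r)) idp z R)) (*-monoˡ-≤ (diff≥0 R≤z) (+-mono-≤ z≤Z (≤-trans R≤z z≤Z))))))
     where
     ZZ>0 : 0# < Z + Z
     ZZ>0 = +-pos Z>0 (<⇒≤ Z>0)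
    ẑ : Carrier
    ẑ = z * ρ
    1<ẑ : 1# < ẑ
    1<ẑ l = d>0 (≤-trans d≤z-R (≤ʳ (-‿inverseʳ R) (+-mono-≤ (≤ˡ (solve 3 (\ r z p -> r :* (z :* p) := z :* (r :* p)) idp R z ρ ∙ ap (z *_) Rρ ∙ *-identityʳ z) (≤ʳ (*-identityʳ R) (*-monoʳ-≤ R≥0 l))) (≤-refl { - R }))))
    -- The mean of the N factors of the recursion at ẑ; since N = 2 g, the term 2 ẑ A 1 / N becomes
    -- ẑ A 1 / g.
    T : Carrier
    T = 1# + ẑ * ẑ - ẑ * A 1 * ig
    fromℕ-N : fromℕ N ≡ fromℕ g + fromℕ g
    fromℕ-N = fromℕ-+ g g
    NT : fromℕ N * T ≡ fromℕ N * (1# + ẑ * ẑ) - (ẑ + ẑ) * A 1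
    NT = ap (_* T) fromℕ-N ∙ solve 5 (\ G i o z a -> (G :+ G) :* (o :- z :* a :* i) := (G :+ G) :* o :- (G :* i) :* ((z :+ z) :* a)) idp (fromℕ g) ig (1# + ẑ * ẑ) ẑ (A 1) ∙ ap₂ (\ n u -> n * (1# + ẑ * ẑ) - u) (! fromℕ-N) (ap (_* ((ẑ + ẑ) * A 1)) g-ig ∙ *-identityˡ _)
    N>0 : 0# < fromℕ N
    N>0 = 0<fromℕ {N} (s≤s z≤n)
    T≥0 : 0# ≤ T
    T≥0 = *-can-≤ N>0 (≤ˡ (! (zeroʳ _)) (≤ʳ (! NT) (mean-non ẑ 1<ẑ staN)))
    v : Carrier
    v = ev (suc N) (rev N A) (- ẑ)
    v²≤ : v * v ≤ T ^ N
    v²≤ = val² ẑ 1<ẑ staN T≥0 NT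
    ≤v² : (ẑ - 1#) ^ N * (ẑ - 1#) ^ N ≤ v * v
    ≤v² = val²-bel ẑ 1<ẑ staN
    v≡ : v ≡ ρ ^ N * P (- z)
    v≡ = begin v ≡⟨ ev-sum (suc N) (rev N A) (- ẑ) ⟩ sumTo (suc N) (\ i -> rev N A i * (- ẑ) ^ i) ≡⟨ sumTo-cong (suc N) (\ i l -> scaTerm i (NP.≤-pred l)) ⟩ sumTo (suc N) (\ i -> ρ ^ N * (rev N aF i * (- z) ^ i)) ≡⟨ sumTo-*ˡ (suc N) (ρ ^ N) _ ⟨ ρ ^ N * sumTo (suc N) (\ i -> rev N aF i * (- z) ^ i) ≡⟨ ap (\ t -> ρ ^ N * t) (! (ev-sum (suc N) (rev N aF) (- z))) ⟩ ρ ^ N * P (- z) ∎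
     where
     scaTerm : ∀ i -> i N.≤ N -> rev N A i * (- ẑ) ^ i ≡ ρ ^ N * (rev N aF i * (- z) ^ i)
     scaTerm i l = begin rev N A i * (- ẑ) ^ i ≡⟨ ap₂ _*_ (rev-at N A i l) (ap (_^ i) (-‿distribˡ-* z ρ) ∙ ^-*-dis (- z) ρ i) ⟩ aF (N ∸ i) * ρ ^ (N ∸ i) * ((- z) ^ i * ρ ^ i) ≡⟨ solve 4 (\ a p y r -> a :* p :* (y :* r) := (p :* r) :* (a :* y)) idp (aF (N ∸ i)) (ρ ^ (N ∸ i)) ((- z) ^ i) (ρ ^ i) ⟩ ρ ^ (N ∸ i) * ρ ^ i * (aF (N ∸ i) * (- z) ^ i) ≡⟨ ap₂ (\ p a -> p * (a * (- z) ^ i)) (! (^-homo-* ρ (N ∸ i) i) ∙ ap (ρ ^_) (NP.m∸n+n≡m l)) (! (rev-at N aF i l)) ⟩ ρ ^ N * (rev N aF i * (- z) ^ i) ∎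
    YY : Carrier
    YY = T * (R * R)
    YY≡ : YY ≡ R * R + z * z - z * aF 1 * ig
    YY≡ = solve 5 (\ r p z a i -> (1∶ :+ (z :* p) :* (z :* p) :- (z :* p) :* (a :* (p :* 1∶)) :* i) :* (r :* r) := r :* r :+ (r :* r :* (p :* p)) :* (z :* z :- z :* a :* i)) idp R ρ z (aF 1) ig ∙ ap (\ t -> R * R + t * (z * z - z * aF 1 * ig)) R²ρ² ∙ solve 3 (\ r s t -> r :+ 1∶ :* (s :- t) := r :+ s :- t) idp (R * R) (z * z) (z * aF 1 * ig)
    YY≥0 : 0# ≤ YY
    YY≥0 = *-non T≥0 (squ-non R)
    -- Up to errors of size ε, R² + z² is q + z² = (M + 1) z, while z a 1 / g ≥ z M + z / g. What
    -- remains is z - z / g, and z / g ≥ 2 y₀ leaves y₀ for the errors.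
    YY≤ : YY ≤ z - y₀
    YY≤ = ≤-trans (≤-reflexive YY≡) (≤-trans (+-mono-≤ (≤-refl {R * R + z * z}) (neg-mono large)) (by-non {d = (Q + ε - R * R) + (ε - G (- z)) + ((z * ig - s₀ * ig) + ((y₀ * half - ε) + (y₀ * half - ε)))} expression (+-non (+-non (diff≥0 R²≤) (diff≥0 G≤ε)) (+-non (diff≥0 (*-monoˡ-≤ (<⇒≤ ig>0) s₀≤z)) (+-non (diff≥0 ε≤y₀) (diff≥0 ε≤y₀))))))
     where
     large : z * (ig + fromℕ M) ≤ z * aF 1 * ig
     large = ≤ʳ (! (*-assoc _ _ _)) (*-monoʳ-≤ z≥0 (≤ˡ (ap (\ t -> (1# + t) * ig) (fromℕ-* g M) ∙ solve 3 (\ G M i -> (1∶ :+ G :* M) :* i := i :+ (G :* i) :* M) idp (fromℕ g) (fromℕ M) ig ∙ ap (\ t -> ig + t) (ap (_* fromℕ M) g-ig ∙ *-identityˡ _)) (*-monoˡ-≤ (<⇒≤ ig>0) a₁-large)))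
     expression : (z - y₀) - (R * R + z * z - z * (ig + fromℕ M)) ≡ (Q + ε - R * R) + (ε - G (- z)) + ((z * ig - s₀ * ig) + ((y₀ * half - ε) + (y₀ * half - ε)))
     expression = ! (ap₂ (\ b c -> (Q + ε - R * R) + (ε - G (- z)) + ((z * ig - b) + c)) (! (twi-half (s₀ * ig))) (solve 2 (\ h e -> (h :- e) :+ (h :- e) := (h :+ h) :- (e :+ e)) idp (y₀ * half) ε ∙ ap (_- (ε + ε)) (twi-half y₀)) ∙ solve 7 (\ q e r z M i y -> (q :+ e :- r) :+ (e :- (:- z :* :- z :+ (1∶ :+ M) :* :- z :+ q)) :+ ((z :* i :- (y :+ y)) :+ (y :- (e :+ e))) := (z :- y) :- (r :+ z :* z :- z :* (i :+ M))) idp Q ε (R * R) z (fromℕ M) ig y₀)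
    Pz : Carrier
    Pz = P (- z)
    R^N-v : R ^ N * v ≡ Pz
    R^N-v = ap (\ t -> R ^ N * t) v≡ ∙ ! (*-assoc _ _ _) ∙ ap (_* Pz) (Rρ^ N) ∙ *-identityˡ _
    -- After scaling back, P(-z)² ≤ R^(2N) T^N = YY^N, and N = 2 g makes this a square.
    Pz≤ : ∣ Pz ∣ ≤ YY ^ g
    Pz≤ = abs≤⇐squ (^-non g YY≥0) (≤-trans (≤-reflexive (ap (\ t -> t * t) (! R^N-v) ∙ solve 2 (\ r v -> (r :* v) :* (r :* v) := (v :* v) :* (r :* r)) idp (R ^ N) v)) (≤-trans (*-monoˡ-≤ (squ-non (R ^ N)) v²≤) (≤-reflexive (ap (\ t -> T ^ N * t) (! (^-*-dis R R N)) ∙ ! (^-*-dis T (R * R) N) ∙ ^-homo-* YY g g))))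
    -- `val²-bel` scaled back by R^N gives |P(-z)| ≥ (z - R)^N.
    ≤Pz : d ^ N ≤ ∣ Pz ∣
    ≤Pz = ≤-trans (^-mono N (<⇒≤ d>0) d≤z-R) (squ-≤⇒≤ (abs-non Pz) (≤ʳ (! (abs-sq Pz)) (≤-trans (≤-reflexive (ap (\ t -> t * t) zR ∙ solve 2 (\ r v -> (r :* v) :* (r :* v) := (v :* v) :* (r :* r)) idp (R ^ N) ((ẑ - 1#) ^ N))) (≤-trans (*-monoˡ-≤ (squ-non (R ^ N)) ≤v²) (≤-reflexive (solve 2 (\ r v -> (v :* v) :* (r :* r) := (r :* v) :* (r :* v)) idp (R ^ N) v ∙ ap (\ t -> t * t) R^N-v))))))
     where
     zR : (z - R) ^ N ≡ R ^ N * (ẑ - 1#) ^ N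
     zR = ap (_^ N) (! (solve 3 (\ r z p -> r :* (z :* p :- 1∶) := z :* (r :* p) :- r) idp R z ρ ∙ ap (_- R) (ap (z *_) Rρ ∙ *-identityʳ z))) ∙ ^-*-dis R (ẑ - 1#) N

    -- The integer H with P(x) ≡ x^g H modulo G is neither zero nor nonzero.
    module Imp (H : ℤ) (f : Carrier -> Carrier) (CQ : Carrier) (CQ≥0 : 0# ≤ CQ) (bf : ∀ x -> ∣ x ∣ ≤ Z -> ∣ f x ∣ ≤ CQ) (e : P (- z) ≡ (- z) ^ g * fromℤ H + G (- z) * f (- z)) (εy : ε * (1# + CQ) ≤ y₀) (εd : ε * (1# + CQ) ≤ d ^ N) where
     Gf≤ : ∣ G (- z) * f (- z) ∣ ≤ ε * CQ
     Gf≤ = ≤ˡ (! (abs-* (G (- z)) (f (- z)))) (*-mono-≤ (abs-non _) (abs-non _) (≤ˡ (! (abs-≡ G≥0)) G≤ε) (bf (- z) (≤ˡ (! (abs-neg z ∙ abs-≡ z≥0)) z≤Z)))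
     too-sma : ε * (1# + CQ) ≤ ε * CQ -> ⊥
     too-sma l = ε>0 (≤ˡ (solve 2 (\ e c -> e :* (1∶ :+ c) :- e :* c := e) idp ε CQ) (≤ʳ (-‿inverseʳ (ε * CQ)) (+-mono-≤ l (≤-refl { - (ε * CQ) }))))
     -- P(-z) would be a bounded multiple of the small number G(-z), against its lower bound d^N.
     zero-case : H ≡ + 0 -> ⊥
     zero-case H≡0 = too-sma (≤-trans εd (≤-trans ≤Pz (≤-trans (≤-reflexive (ap ∣_∣ Pz≡)) Gf≤)))
      where
      Pz≡ : Pz ≡ G (- z) * f (- z)
      Pz≡ = e ∙ ap (\ h -> (- z) ^ g * fromℤ h + G (- z) * f (- z)) H≡0 ∙ solve 2 (\ p r -> p :* 0∶ :+ r := r) idp ((- z) ^ g) (G (- z) * f (- z))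
     abs-z^g : ∣ (- z) ^ g ∣ ≡ z ^ g
     abs-z^g = abs-^ (- z) g ∙ ap (_^ g) (abs-neg z ∙ abs-≡ z≥0)
     main-term : (- z) ^ g * fromℤ H ≡ Pz + - (G (- z) * f (- z))
     main-term = solve 2 (\ u w -> u := (u :+ w) :+ :- w) idp ((- z) ^ g * fromℤ H) (G (- z) * f (- z)) ∙ ap (_+ - (G (- z) * f (- z))) (! e)
     z^g≤ : 1# ≤ ∣ fromℤ H ∣ -> z ^ g ≤ YY ^ g + ε * CQ
     z^g≤ 1≤H = ≤-trans (≤ˡ (*-identityʳ (z ^ g)) (*-monoʳ-≤ (^-non g z≥0) 1≤H)) (≤-trans (≤-reflexive (ap (_* ∣ fromℤ H ∣) (! abs-z^g) ∙ ! (abs-* ((- z) ^ g) (fromℤ H)) ∙ ap ∣_∣ main-term)) (≤-trans (abs-+ Pz (- (G (- z) * f (- z)))) (+-mono-≤ Pz≤ (≤ˡ (! (abs-neg (G (- z) * f (- z)))) Gf≤))))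
     y₀≥0 : 0# ≤ y₀
     y₀≥0 = *-non (*-non s₀≥0 (<⇒≤ ig>0)) (<⇒≤ half>0)
     YY^g≤ : YY ^ g ≤ (z - y₀) * z ^ g′
     YY^g≤ = ^-≤-pred g′ YY≥0 YY≤ (by-non {d = y₀} (solve 2 (\ z y -> z :- (z :- y) := y) idp z y₀) y₀≥0)
     -- From |H| ≥ 1 follows z^g ≤ |P(-z)| + ε CQ ≤ (z - y₀) z^(g-1) + ε CQ. As z ≥ 1 this gives y₀
     -- ≤ ε CQ, which the choice of ε excludes.
     non-case : 1# ≤ ∣ fromℤ H ∣ -> ⊥
     non-case 1≤H = too-sma (≤-trans εy (≤-trans (≤ˡ (*-identityʳ y₀) (*-monoʳ-≤ y₀≥0 (1≤^ g′ (≤-trans s₀≥1 s₀≤z)))) (by-non {d = (YY ^ g + ε * CQ - z ^ g) + ((z - y₀) * z ^ g′ - YY ^ g)} (solve 5 (\ c y k z w -> c :- y :* k := (w :+ c :- z :* k) :+ ((z :- y) :* k :- w)) idp (ε * CQ) y₀ (z ^ g′) z (YY ^ g)) (+-non (diff≥0 (z^g≤ 1≤H)) (diff≥0 YY^g≤)))))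
     imp : Dec (H ≡ + 0) -> ⊥
     imp (yes H≡0) = zero-case H≡0
     imp (no H≢0) = non-case (≮⇒≥ (\ l -> H≢0 (fromℤ-sma H l)))
   ser-F : fromℕ (suc (g N.* M)) ≤ aF 1 -> ⊥
   ser-F a₁-large = useRep representation
    where
    useRep : Represented P -> ⊥
    useRep (H , f , (CQ , CQ≥0 , bf) , e) = AtAppRoot.Imp.imp ε ε>0 ε≤W ε≤y₀ (proj₁ R) (proj₁ (proj₂ R)) (proj₁ (proj₂ (proj₂ R))) (proj₁ (proj₂ (proj₂ (proj₂ R)))) (proj₁ y) (proj₁ (proj₂ y)) (proj₁ (proj₂ (proj₂ y))) (proj₁ (proj₂ (proj₂ (proj₂ y)))) (proj₂ (proj₂ (proj₂ (proj₂ y)))) a₁-large H f CQ CQ≥0 bf (e (- (s₀ + proj₁ y))) (sca-up y₀ ε≤₃) (sca-up (d ^ N) ε≤₄) (H ℤP.≟ + 0)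
     where
     1+CQ>0 : 0# < 1# + CQ
     1+CQ>0 = +-pos 0<1 CQ≥0
     iC = inv (1# + CQ) 1+CQ>0
     iC>0 : 0# < iC
     iC>0 = inv-pos (1# + CQ) 1+CQ>0
     y₀>0 : 0# < y₀
     y₀>0 = *-pos (*-pos s₀>0 ig>0) half>0
     -- The four bounds on ε: W / 2 keeps z - R away from 0, y₀ / 2 covers the errors in `YY≤`, and
     -- the two with iC exclude the two cases for H.
     m₁ = min (W * half) (y₀ * half)
     m₂ = min (y₀ * iC) (d ^ N * iC)
     m₃ = min (proj₁ m₁) (proj₁ m₂)
     ε = proj₁ m₃
     ε>0 : 0# < ε
     ε>0 = proj₁ (proj₂ m₃) (proj₁ (proj₂ m₁) (*-pos W>0 half>0) (*-pos y₀>0 half>0)) (proj₁ (proj₂ m₂) (*-pos y₀>0 iC>0) (*-pos (^-pos N d>0) iC>0))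
     ε≤W : ε ≤ W * half
     ε≤W = ≤-trans (proj₁ (proj₂ (proj₂ m₃))) (proj₁ (proj₂ (proj₂ m₁)))
     ε≤y₀ : ε ≤ y₀ * half
     ε≤y₀ = ≤-trans (proj₁ (proj₂ (proj₂ m₃))) (proj₂ (proj₂ (proj₂ m₁)))
     ε≤₃ : ε ≤ y₀ * iC
     ε≤₃ = ≤-trans (proj₂ (proj₂ (proj₂ m₃))) (proj₁ (proj₂ (proj₂ m₂)))
     ε≤₄ : ε ≤ d ^ N * iC
     ε≤₄ = ≤-trans (proj₂ (proj₂ (proj₂ m₃))) (proj₂ (proj₂ (proj₂ m₂)))
     sca-up : ∀ t -> ε ≤ t * iC -> ε * (1# + CQ) ≤ t
     sca-up t l = ≤-trans (*-monoˡ-≤ (<⇒≤ 1+CQ>0) l) (≤-reflexive (*-assoc _ _ _ ∙ ap (t *_) (*-comm _ _ ∙ inv-* (1# + CQ) 1+CQ>0) ∙ *-identityʳ t))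
     R = root (fromℕ-non q) ε>0
     y = root W≥0 ε>0
   serre : a 1 ℤ.≤ + (g N.* M)
   serre = ℤP.≮⇒≥ (\ l -> ser-F (large (a 1) l))
    where
    large : ∀ i -> + (g N.* M) ℤ.< i -> fromℕ (suc (g N.* M)) ≤ fromℤ i
    large (+ n) (ℤ.+<+ l) = fromℕ-mono l

open SerIne

-- The ring ℤ[ζ] and sums of roots of unity.

module CycInt where

 open import Data.Nat.DivMod using (_%_; _/_; m≡m%n+[m/n]*n; m%n<n; m<n⇒m%n≡m; m%n%n≡m%n; %-distribˡ-*; _mod_)
 open import Data.Nat.Divisibility using (_∣_; divides; ∣⇒≤; m%n≡0⇒n∣m; n∣m⇒m%n≡0; ∣m+n∣m⇒∣n; _∣?_; _∣0)
 open import Data.Nat.Primality using (euclidsLemma)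
 open import Data.Integer.Base using (+_; -[1+_])
 open import Data.Fin.Base using (fromℕ<)

 -- Invertibility modulo a prime, by pigeonhole.
 module ModPri {p : ℕ} (pr : Prime p) .{{_ : NonZero p}} where
  %-equ⇒∣ : ∀ a b -> a N.≤ b -> a % p ≡ b % p -> p ∣ (b ∸ a)
  %-equ⇒∣ a b a≤b e = divides (b / p ∸ a / p) (begin b ∸ a ≡⟨ ap₂ _∸_ (m≡m%n+[m/n]*n b p) (m≡m%n+[m/n]*n a p) ⟩ (b % p N.+ b / p N.* p) ∸ (a % p N.+ a / p N.* p) ≡⟨ ap (\ r -> (b % p N.+ b / p N.* p) ∸ (r N.+ a / p N.* p)) e ⟩ (b % p N.+ b / p N.* p) ∸ (b % p N.+ a / p N.* p) ≡⟨ NP.[m+n]∸[m+o]≡n∸o (b % p) _ _ ⟩ b / p N.* p ∸ a / p N.* p ≡⟨ ! (NP.*-distribʳ-∸ p (b / p) (a / p)) ⟩ (b / p ∸ a / p) N.* p ∎)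
   where open ≡.≡-Reasoning
  private
   ind-≤ : ∀ c -> ¬ (p ∣ c) -> ∀ i j -> i N.≤ j -> j N.< p -> (c N.* i) % p ≡ (c N.* j) % p -> i ≡ j
   ind-≤ c nc i j i≤j j<p e with euclidsLemma c (j ∸ i) pr (≡.subst (p ∣_) (! (NP.*-distribˡ-∸ c j i)) (%-equ⇒∣ _ _ (NP.*-monoʳ-≤ c i≤j) e))
   ... | inj₁ d = ⊥-elim (nc d)
   ... | inj₂ d with j ∸ i in eq
   ... | zero = NP.≤-antisym i≤j (NP.m∸n≡0⇒m≤n eq)
   ... | suc t = ⊥-elim (NP.<⇒≱ (NP.≤-<-trans (NP.≤-trans (NP.≤-reflexive (! eq)) (NP.m∸n≤m j i)) j<p) (∣⇒≤ d))
   times : ℕ -> Fin p -> Fin p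
   times c i = (c N.* toℕ i) mod p
   toℕ-mod : ∀ a -> toℕ (a mod p) ≡ a % p
   toℕ-mod a = FinP.toℕ-fromℕ< (m%n<n a p)
   tim-inj : ∀ c -> ¬ (p ∣ c) -> ∀ {i j} -> times c i ≡ times c j -> i ≡ j
   tim-inj c nc {i} {j} e with NP.≤-total (toℕ i) (toℕ j)
   ... | inj₁ l = FinP.toℕ-injective (ind-≤ c nc _ _ l (FinP.toℕ<n j) (! (toℕ-mod _) ∙ ap toℕ e ∙ toℕ-mod _))
   ... | inj₂ l = FinP.toℕ-injective (! (ind-≤ c nc _ _ l (FinP.toℕ<n i) (! (toℕ-mod _) ∙ ap toℕ (! e) ∙ toℕ-mod _)))
  invMod : ∀ c -> ¬ (p ∣ c) -> Σ[ i ∈ ℕ ] (c N.* i) % p ≡ 1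
  invMod c nc with inj⇒sur (times c) (tim-inj c nc) (fromℕ< (pri>1 pr))
  ... | i , e = toℕ i , ! (toℕ-mod _) ∙ ap toℕ e ∙ FinP.toℕ-fromℕ< (pri>1 pr)

 ℤ-ring : CommutativeRing 0ℓ 0ℓ
 ℤ-ring = ℤP.+-*-commutativeRing

 module CycQuo {p : ℕ} (pr : Prime p) .{{_ : NonZero p}} where
  private
   module Pℤ = Pol ℤ-ring
   module RP = Kit Pℤ.polyRing
   module RSP = RanSums Pℤ.polyRing
   module Zℤ = Kit ℤ-ring
   open Pℤ using (Poly; poly; coeff; bound; degree; conP; X; Deg<; Monic; ⟪_⟫; atᴾ)
   ones : ℕ -> Pℤ.Seq
   ones zero = Pℤ.𝟘
   ones (suc n) = (+ 1) Pℤ.◃ ones n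
   ones-Deg : ∀ n -> Deg< (ones n) n
   ones-Deg zero i l = idp
   ones-Deg (suc n) (suc i) (s≤s l) = ones-Deg n i l
   ones-top : ∀ n -> ones (suc n) n ≡ + 1
   ones-top zero = idp
   ones-top (suc n) = ones-top n
   onesP : ℕ -> Poly
   onesP n = poly (ones n) n (ones-Deg n)
   onesP-suc : ∀ n -> onesP (suc n) RP.≈ RP.1# RP.+ X RP.* onesP n
   onesP-suc n = ⟪ (\ { zero -> ap (\ t -> + 1 ℤ.+ t) (! (ℤP.*-zeroˡ (ones n 0))) ; (suc i) -> ! (ℤP.+-identityˡ _ ∙ Pℤ.X-⊛ (ones n) (suc i)) }) ⟫
   onesP-sum : ∀ n -> onesP n RP.≈ RSP.sumTo n (\ i -> X RP.^ i)
   onesP-sum zero = RP.trans ⟪ (\ _ -> idp) ⟫ (RP.sym (RP.reflexive (RSP.sumTo-zero _)))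
   onesP-sum (suc n) = onesP-suc n RP.& RP.+-congˡ {RP.1#} (RP.*-congˡ {X} (onesP-sum n) RP.& RSP.sumTo-*ˡ n X _) RP.& RP.sym (RP.reflexive (RSP.sumTo-suc n _))
   tel : ∀ n -> X RP.^ n RP.≈ RP.1# RP.+ onesP n RP.* (X RP.- RP.1#)
   tel zero = ⟪ (\ i -> ! (ap (\ t -> Pℤ.𝟙 i ℤ.+ t) (Pℤ.⊛-zeroˡ (coeff (X RP.- RP.1#)) i) ∙ ℤP.+-identityʳ (Pℤ.𝟙 i))) ⟫
   tel (suc n) = RP.*-congˡ {X} (tel n) RP.& RP.trans (RP.solve 2 (\ x o -> x RP.:* (RP.1∶ RP.:+ o RP.:* (x RP.:- RP.1∶)) RP.:= RP.1∶ RP.:+ (RP.1∶ RP.:+ x RP.:* o) RP.:* (x RP.:- RP.1∶)) RP.refl X (onesP n)) (RP.+-congˡ {RP.1#} (RP.*-congʳ {X RP.- RP.1#} (RP.sym (onesP-suc n))))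
   Φ : Poly
   Φ = onesP p
   module Quot = QuoRing Pℤ.polyRing Φ
  ℤ[ζ] : CommutativeRing 0ℓ 0ℓ
  ℤ[ζ] = Quot.quoRing
  module Z = Kit ℤ[ζ]
  open Z using (_≈_)
  private module ZS = RanSums ℤ[ζ]
  ζ : Z.El
  ζ = X
  private
   lift : ∀ {f g} -> f RP.≈ g -> f ≈ g
   lift = Quot.≈⇒≈/
   Φ≈0 : Φ ≈ Z.0#
   Φ≈0 = Quot.≈/0 RP.1# (RP.sym (RP.*-identityʳ Φ))
   ^-same : ∀ f n -> f Z.^ n ≡ f RP.^ n
   ^-same f zero = idp
   ^-same f (suc n) = ap (f RP.*_) (^-same f n)
  ζ^p : ζ Z.^ p ≈ Z.1#
  ζ^p = Z.reflexive (^-same X p) Z.& (X RP.- RP.1#) Quot., tel p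
  private
   ZS-RSP : ∀ n f -> ZS.sumTo n f ≡ RSP.sumTo n f
   ZS-RSP zero f = ZS.sumTo-zero f ∙ ! (RSP.sumTo-zero f)
   ZS-RSP (suc n) f = ZS.sumTo-suc n f ∙ ap (f 0 RP.+_) (ZS-RSP n (\ i -> f (suc i))) ∙ ! (RSP.sumTo-suc n f)
   RSP-cong : ∀ n {f g} -> (∀ i -> f i ≡ g i) -> RSP.sumTo n f RP.≈ RSP.sumTo n g
   RSP-cong n h = RSP.sumTo-cong n (\ i _ -> RP.reflexive (h i))
  sum-all : ZS.sumTo p (\ j -> ζ Z.^ j) ≈ Z.0#
  sum-all = Z.reflexive (ZS-RSP p (\ j -> ζ Z.^ j)) Z.& lift (RSP-cong p (^-same X) RP.& RP.sym (onesP-sum p)) Z.& Φ≈0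
  private
   conℕ : ∀ n -> RP.fromℕ n RP.≈ conP (+ n)
   conℕ zero = ⟪ (\ { zero -> idp ; (suc i) -> idp }) ⟫
   conℕ (suc n) = RP.trans (RP.+-congˡ {RP.1#} (conℕ n)) ⟪ (\ { zero -> idp ; (suc i) -> idp }) ⟫
   conℤ : ∀ b -> RP.fromℤ b RP.≈ conP b
   conℤ (+ n) = conℕ n
   conℤ -[1+ n ] = RP.trans (RP.-‿cong (conℕ (suc n))) ⟪ (\ { zero -> idp ; (suc i) -> idp }) ⟫
   fromℕ-same : ∀ n -> Z.fromℕ n ≡ RP.fromℕ n
   fromℕ-same zero = idp
   fromℕ-same (suc n) = ap (RP.1# RP.+_) (fromℕ-same n)
   fromℤ-same : ∀ b -> Z.fromℤ b ≡ RP.fromℤ b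
   fromℤ-same (+ n) = fromℕ-same n
   fromℤ-same -[1+ n ] = ap RP.-_ (fromℕ-same (suc n))
   conZ : ∀ b -> Z.fromℤ b ≈ conP b
   conZ b = Z.reflexive (fromℤ-same b) Z.& lift (conℤ b)
   p-1 : Σ[ p″ ∈ ℕ ] p ≡ suc (suc p″)
   p-1 = pred² p (pri>1 pr)
    where
    pred² : ∀ n -> 1 N.< n -> Σ[ m ∈ ℕ ] n ≡ suc (suc m)
    pred² (suc (suc n)) _ = n , idp
    pred² (suc zero) (s≤s ())
   ΦM : ∀ p″ -> p ≡ suc (suc p″) -> Monic (coeff Φ) (suc p″)
   ΦM p″ e = ≡.subst (\ n -> Monic (ones n) (suc p″)) (! e) (ones-top (suc p″) , ones-Deg (suc (suc p″)))

   -- Two normal forms that agree modulo Φ agree.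
   unique : ∀ p″ -> p ≡ suc (suc p″) -> ∀ f g -> Deg< (coeff f) (suc p″) -> Deg< (coeff g) (suc p″) -> f ≈ g -> coeff f Pℤ.≋ coeff g
   unique p″ e f g df dg (w Quot., h) = \ i -> ℤP.i-j≡0⇒i≡j _ _ (atᴾ diff i ∙ Pℤ.⊛-cong {coeff Φ} Pℤ.≋-refl w≋0 i ∙ Pℤ.⊛-zeroʳ (coeff Φ) i)
    where
    diff : f RP.- g RP.≈ Φ RP.* w
    diff = RP.+-congʳ {RP.- g} h RP.& RP.solve 2 (\ a b -> (a RP.:+ b) RP.:- a RP.:= b) RP.refl g (Φ RP.* w)
    w≋0 : coeff w Pℤ.≋ Pℤ.𝟘
    w≋0 = Pℤ.Mon-⊛-sma (ΦM p″ e) _ _ (degree w) (Pℤ.Deg<-resp (atᴾ diff) (Pℤ.Deg<-⊕ {coeff f} df (Pℤ.Deg<-⊖ {coeff g} dg)))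
   norForm : ∀ p″ -> p ≡ suc (suc p″) -> ∀ Y -> Σ[ r ∈ Poly ] (Deg< (coeff r) (suc p″) × Y ≈ r)
   norForm p″ e Y with Pℤ.divMon (ΦM p″ e) (bound Y) (coeff Y) (degree Y)
   ... | w , r , dw , dr , h = poly r (suc p″) dr , dr , (poly w (bound Y) dw Quot., ⟪ (\ i -> h i ∙ ℤP.+-comm ((coeff Φ Pℤ.⊛ w) i) (r i)) ⟫)
   con-Deg : ∀ p″ b -> Deg< (coeff (conP b)) (suc p″)
   con-Deg p″ b (suc i) _ = idp
  -- Constants are normal forms, since Φ has degree p - 1 ≥ 1, and normal forms modulo Φ are unique.
  fromℤ-inj : ∀ b b′ -> Z.fromℤ b ≈ Z.fromℤ b′ -> b ≡ b′
  fromℤ-inj b b′ e = unique (proj₁ p-1) (proj₂ p-1) (conP b) (conP b′) (con-Deg _ b) (con-Deg _ b′) (Z.trans {conP b} {Z.fromℤ b} {conP b′} (Z.sym {Z.fromℤ b} {conP b} (conZ b)) (Z.trans {Z.fromℤ b} {Z.fromℤ b′} {conP b′} e (conZ b′))) 0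

  -- ℤ[ζ] / ℤ is torsion free.
  rat : ∀ k b Y -> Z.fromℕ (suc k) Z.* Y ≈ Z.fromℤ b -> Σ[ b′ ∈ ℤ ] Y ≈ Z.fromℤ b′
  rat k b Y e = fin (norForm (proj₁ p-1) (proj₂ p-1) Y)
   where
   fin : Σ[ r ∈ Poly ] (Deg< (coeff r) (suc (proj₁ p-1)) × Y ≈ r) -> Σ[ b′ ∈ ℤ ] Y ≈ Z.fromℤ b′
   fin (r , dr , Y≈r) = coeff r 0 , Z.trans {Y} {r} {Z.fromℤ (coeff r 0)} Y≈r (Z.trans {r} {conP (coeff r 0)} {Z.fromℤ (coeff r 0)} (lift ⟪ r≋ ⟫) (Z.sym {Z.fromℤ (coeff r 0)} {conP (coeff r 0)} (conZ (coeff r 0))))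
    where
    kr : Poly
    kr = conP (+ suc k) RP.* r
    kr≋ : coeff kr Pℤ.≋ Pℤ.scale (+ suc k) (coeff r)
    kr≋ = Pℤ.con-⊛ (+ suc k) (coeff r)
    dkr : Deg< (coeff kr) (suc (proj₁ p-1))
    dkr i l = kr≋ i ∙ ap (+ suc k ℤ.*_) (dr i l) ∙ ℤP.*-zeroʳ (+ suc k)
    left : kr ≈ Z.fromℕ (suc k) Z.* Y
    left = Z.*-cong {conP (+ suc k)} {Z.fromℕ (suc k)} {r} {Y} (Z.sym {Z.fromℕ (suc k)} {conP (+ suc k)} (conZ (+ suc k))) (Z.sym {Y} {r} Y≈r)
    e′ : kr ≈ conP b
    e′ = Z.trans {kr} {Z.fromℕ (suc k) Z.* Y} {conP b} left (Z.trans {Z.fromℕ (suc k) Z.* Y} {Z.fromℤ b} {conP b} e (conZ b))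
    r≋ : coeff r Pℤ.≋ Pℤ.const (coeff r 0)
    r≋ zero = idp
    r≋ (suc i) = ℤP.*-cancelˡ-≡ (+ suc k) _ _ (! (kr≋ (suc i)) ∙ unique (proj₁ p-1) (proj₂ p-1) kr (conP b) dkr (con-Deg _ b) e′ (suc i) ∙ ! (ℤP.*-zeroʳ (+ suc k)))

 -- The ring ℤ[ζ] with the properties used below.
 record CycRing (p : ℕ) : Set₁ where
  field
   ring : CommutativeRing 0ℓ 0ℓ
  private
   module Z = Kit ring
   module ZS = RanSums ring
  open Z using (_≈_)
  field
   ζ : Z.El
   ζ^p : ζ Z.^ p ≈ Z.1#
   sum-all : ZS.sumTo p (\ j -> ζ Z.^ j) ≈ Z.0#
   fromℤ-inj : ∀ b b′ -> Z.fromℤ b ≈ Z.fromℤ b′ -> b ≡ b′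
   rat : ∀ k b Y -> Z.fromℕ (suc k) Z.* Y ≈ Z.fromℤ b -> Σ[ b′ ∈ ℤ ] Y ≈ Z.fromℤ b′

 cycRing : ∀ {p} -> Prime p -> .{{_ : NonZero p}} -> CycRing p
 cycRing pr = record { ring = ℤ[ζ] ; ζ = ζ ; ζ^p = ζ^p ; sum-all = sum-all ; fromℤ-inj = fromℤ-inj ; rat = rat }
  where open CycQuo pr

 module Cyc {p : ℕ} (pr : Prime p) .{{_ : NonZero p}} (CR : CycRing p) where
  open ModPri pr public
  open CycRing CR public
  module Z = Kit ring
  module ZS = RanSums ring
  open Z using (_≈_)
  ζ^-% : ∀ n -> ζ Z.^ n ≈ ζ Z.^ (n % p)
  ζ^-% n = begin ζ ^ n ≡⟨ ap (ζ ^_) (m≡m%n+[m/n]*n n p) ⟩ ζ ^ (n % p N.+ n / p N.* p) ≈⟨ ^-homo-* ζ (n % p) (n / p N.* p) ⟩ ζ ^ (n % p) * ζ ^ (n / p N.* p) ≈⟨ *-congˡ (reflexive (ap (ζ ^_) (NP.*-comm (n / p) p)) & sym (^-assocʳ ζ p (n / p)) & ^-congˡ (n / p) ζ^p & one^ (n / p)) ⟩ ζ ^ (n % p) * 1# ≈⟨ *-identityʳ _ ⟩ ζ ^ (n % p) ∎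
   where
   open Z
   one^ : ∀ k -> 1# ^ k ≈ 1#
   one^ zero = refl
   one^ (suc k) = *-identityˡ _ & one^ k
  ζ^-cong : ∀ {m n} -> m % p ≡ n % p -> ζ Z.^ m ≈ ζ Z.^ n
  ζ^-cong {m} {n} e = ζ^-% m Z.& Z.reflexive (ap (ζ Z.^_) e) Z.& Z.sym (ζ^-% n)
  tor-free : ∀ k Y -> Z.fromℕ (suc k) Z.* Y ≈ Z.0# -> Y ≈ Z.0#
  tor-free k Y e with rat k (+ 0) Y e
  ... | b , Y≈b = Y≈b Z.& Z.reflexive (ap Z.fromℤ b≡0)
   where
   kb : + suc k ℤ.* b ≡ + 0
   kb = fromℤ-inj (+ suc k ℤ.* b) (+ 0) (Z.fromℤ-* (+ suc k) b Z.& Z.*-congˡ (Z.sym Y≈b) Z.& e)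
   b≡0 : b ≡ + 0
   b≡0 = ℤP.*-cancelˡ-≡ (+ suc k) b (+ 0) (kb ∙ ! (ℤP.*-zeroʳ (+ suc k)))

  -- An element fixed by a nontrivial power of ζ vanishes.
  fix⇒0 : ∀ c Y -> ¬ (p ∣ c) -> ζ Z.^ c Z.* Y ≈ Y -> Y ≈ Z.0#
  fix⇒0 c Y nc e with invMod c nc
  -- With i inverse to c modulo p, iterating the hypothesis i times gives ζ Y = Y. Summing ζ^j Y = Y
  -- over j < p yields p Y = 0, because the powers of ζ add up to 0.
  ... | i , ci = tor-free (N.pred p) Y (≡.subst (\ n -> Z.fromℕ n Z.* Y ≈ Z.0#) (! (NP.suc-pred p)) pY)
   where
   open Z
   many : ∀ j -> ζ ^ (c N.* j) * Y ≈ Y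
   many zero = *-congʳ (reflexive (ap (ζ ^_) (NP.*-zeroʳ c))) & *-identityˡ Y
   many (suc j) = *-congʳ (reflexive (ap (ζ ^_) (NP.*-suc c j)) & ^-homo-* ζ c (c N.* j)) & *-assoc _ _ _ & *-congˡ (many j) & e
   once : ζ * Y ≈ Y
   once = *-congʳ (sym (*-identityʳ ζ) & ζ^-cong {1} {c N.* i} (m<n⇒m%n≡m (pri>1 pr) ∙ ! ci)) & many i
   powers : ∀ j -> ζ ^ j * Y ≈ Y
   powers zero = *-identityˡ Y
   powers (suc j) = *-assoc _ _ _ & *-congˡ (powers j) & once
   pY : fromℕ p * Y ≈ 0#
   pY = begin fromℕ p * Y ≈⟨ ×-assoc-* p 1# Y ⟩ p ×ℕ (1# * Y) ≈⟨ ×-congʳ p (*-identityˡ Y) ⟩ p ×ℕ Y ≈⟨ sum-replicate p ⟨ sum {p} (\ _ -> Y) ≡⟨ ZS.sumTo-sum p (\ _ -> Y) ⟨ ZS.sumTo p (\ _ -> Y) ≈⟨ ZS.sumTo-cong p (\ j _ -> sym (powers j)) ⟩ ZS.sumTo p (\ j -> ζ ^ j * Y) ≈⟨ ZS.sumTo-*ʳ p Y (\ j -> ζ ^ j) ⟨ ZS.sumTo p (\ j -> ζ ^ j) * Y ≈⟨ *-congʳ sum-all ⟩ 0# * Y ≈⟨ zeroˡ Y ⟩ 0# ∎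
  ∣⇒%≡ : ∀ {n} -> p ∣ n -> n % p ≡ 0 % p
  ∣⇒%≡ {n} d = n∣m⇒m%n≡0 n p d ∙ ! (n∣m⇒m%n≡0 0 p (p ∣0))

  -- The sum of all ζ^{aΘ}.
  sum-ζ : ∀ Θ -> (p ∣ Θ -> ZS.sumTo p (\ a -> ζ Z.^ (a N.* Θ)) ≈ Z.fromℕ p) × (¬ (p ∣ Θ) -> ZS.sumTo p (\ a -> ζ Z.^ (a N.* Θ)) ≈ Z.0#)
  sum-ζ Θ = (\ d -> ZS.sumTo-cong p (\ a _ -> ζ^-cong {a N.* Θ} {0} (∣⇒%≡ (Data.Nat.Divisibility.∣n⇒∣m*n a d))) & reflexive (ZS.sumTo-sum p _) & sum-replicate p) , (\ nd -> fix⇒0 Θ _ nd rot)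
   where
   open Z
   import Data.Nat.Divisibility
   Y : Carrier
   Y = ZS.sumTo p (\ a -> ζ ^ (a N.* Θ))
   rot : ζ ^ Θ * Y ≈ Y
   rot = ZS.sumTo-*ˡ p (ζ ^ Θ) _ & ZS.sumTo-cong p (\ a _ -> sym (^-homo-* ζ Θ (a N.* Θ))) & +-cancelˡ 1# _ _ (begin 1# + ZS.sumTo p (\ a -> ζ ^ (suc a N.* Θ)) ≡⟨ ZS.sumTo-suc p (\ a -> ζ ^ (a N.* Θ)) ⟨ ZS.sumTo (suc p) (\ a -> ζ ^ (a N.* Θ)) ≈⟨ ZS.sumTo-snoc p (\ a -> ζ ^ (a N.* Θ)) ⟩ Y + ζ ^ (p N.* Θ) ≈⟨ +-congˡ (ζ^-cong {p N.* Θ} {0} (∣⇒%≡ (Data.Nat.Divisibility.m∣m*n Θ))) ⟩ Y + 1# ≈⟨ +-comm _ _ ⟩ 1# + Y ∎)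

open CycInt

-- Power sums of polynomials and the characters built from them.

module PowSumCha where

 open N using (_≤_; _<_)
 open import Data.Nat.DivMod using (_%_; %-distribˡ-+; %-distribˡ-*; m%n%n≡m%n; [m+kn]%n≡m%n)
 open import Data.Nat.Divisibility using () renaming (_∣_ to _∣ℕ_)
 open import Data.Nat.Primality using (euclidsLemma)
 open import Data.Fin.Permutation using (permutation)

 -- Power sums: for u = ∏ (1 - r t), the coefficients of s u = - t u' / u are the sums of the powers of the r.
 module PowSums (R : CommutativeRing 0ℓ 0ℓ) where
  open Pol R
  open RanSums R
  private
   module R = Kit R
   module S = Kit serRing
  open R using (_≈_)
  s : Seq -> Seq
  s u = quot (⊖ θ u) u
  s-⊛ : ∀ u -> u 0 ≈ R.1# -> s u ⊛ u ≋ ⊖ θ u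
  s-⊛ u u₀ = quot-⊛ (⊖ θ u) u u₀
  s-uni : ∀ f u -> u 0 ≈ R.1# -> f ⊛ u ≋ ⊖ θ u -> f ≋ s u
  s-uni f u u₀ e = at (S.from-dif ⟪ ⊛-canʳ (f ⊕ (⊖ s u)) u u₀ (≋-trans (⊛-disʳ u f (⊖ s u)) (≋-trans (⊕-cong e (at (S.sym (S.-‿distribˡ-* (s u) u) S.& S.-‿cong ⟪ s-⊛ u u₀ ⟫))) (at (S.-‿inverseʳ (⊖ θ u))))) ⟫)
  s-pro : ∀ u v -> u 0 ≈ R.1# -> v 0 ≈ R.1# -> s (u ⊛ v) ≋ s u ⊕ s v
  s-pro u v u₀ v₀ = ≋-sym (s-uni (s u ⊕ s v) (u ⊛ v) (R.*-cong u₀ v₀ R.& R.*-identityˡ _) (at (S.solve 4 (\ a b u v -> (a S.:+ b) S.:* (u S.:* v) S.:= (a S.:* u) S.:* v S.:+ u S.:* (b S.:* v)) S.refl (s u) (s v) u v S.& S.+-cong (S.*-congʳ {v} ⟪ s-⊛ u u₀ ⟫) (S.*-congˡ {u} ⟪ s-⊛ v v₀ ⟫) S.& S.solve 4 (\ a u b v -> (S.:- a) S.:* v S.:+ u S.:* (S.:- b) S.:= S.:- (a S.:* v S.:+ u S.:* b)) S.refl (θ u) u (θ v) v S.& S.-‿cong (S.sym ⟪ θ-⊛ u v ⟫))))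
  s-rec : ∀ u -> u 0 ≈ R.1# -> ∀ n -> s u n ≈ R.- (R.fromℕ n R.* u n) R.- sumTo n (\ i -> s u i R.* u (n ∸ i))
  s-rec u u₀ n = R.solve 2 (\ a b -> b R.:= (a R.:+ b) R.:- a) R.refl (sumTo n (\ i -> s u i R.* u (n ∸ i))) (s u n) R.& R.+-congʳ (R.+-congˡ (R.sym (R.*-identityʳ _) R.& R.*-congˡ (R.sym u₀ R.& R.reflexive (ap u (! (NP.n∸n≡0 n))))) R.& R.sym (sumTo-snoc n (\ i -> s u i R.* u (n ∸ i))) R.& R.sym (⊛-sum (s u) u n) R.& s-⊛ u u₀ n)
  s-0 : ∀ u -> u 0 ≈ R.1# -> s u 0 ≈ R.0#
  s-0 u u₀ = s-rec u u₀ 0 R.& R.+-congˡ (R.-‿cong (R.reflexive (sumTo-zero _))) R.& R.solve 1 (\ a -> (R.:- (R.0∶ R.:* a)) R.:- R.0∶ R.:= R.0∶) R.refl (u 0)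
  s-loc : ∀ u v -> u 0 ≈ R.1# -> v 0 ≈ R.1# -> ∀ n -> (∀ i -> i ≤ n -> u i ≈ v i) -> ∀ i -> i ≤ n -> s u i ≈ s v i
  s-loc u v u₀ v₀ zero h .0 z≤n = s-0 u u₀ R.& R.sym (s-0 v v₀)
  s-loc u v u₀ v₀ (suc n) h i i≤ = [ (\ l -> below i (NP.≤-pred l)) , (\ { idp -> here }) ]′ (NP.m≤n⇒m<n∨m≡n i≤)
   where
   below : ∀ i -> i ≤ n -> s u i ≈ s v i
   below = s-loc u v u₀ v₀ n (\ i l -> h i (NP.≤-trans l (NP.n≤1+n n)))
   here : s u (suc n) ≈ s v (suc n)
   here = s-rec u u₀ (suc n) R.& R.+-cong (R.-‿cong (R.*-congˡ (h (suc n) NP.≤-refl))) (R.-‿cong (sumTo-cong (suc n) (\ i l -> R.*-cong (below i (NP.≤-pred l)) (h (suc n ∸ i) (NP.m∸n≤m (suc n) i))))) R.& R.sym (s-rec v v₀ (suc n))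

  -- The leading term of the dependence of s_n on the n-th coefficient.
  s-dif : ∀ u v -> u 0 ≈ R.1# -> v 0 ≈ R.1# -> ∀ n -> (∀ i -> i ≤ n -> u i ≈ v i) -> s u (suc n) ≈ s v (suc n) R.- R.fromℕ (suc n) R.* (u (suc n) R.- v (suc n))
  s-dif u v u₀ v₀ n h = s-rec u u₀ (suc n) R.& R.+-congˡ (R.-‿cong (split u u₀ R.& same R.& R.sym (split v v₀))) R.& R.solve 4 (\ k a b t -> (R.:- (k R.:* a)) R.:- t R.:= ((R.:- (k R.:* b)) R.:- t) R.:- k R.:* (a R.:- b)) R.refl (R.fromℕ (suc n)) (u (suc n)) (v (suc n)) _ R.& R.+-congʳ (R.sym (s-rec v v₀ (suc n)))
   where
   split : ∀ w -> w 0 ≈ R.1# -> sumTo (suc n) (\ i -> s w i R.* w (suc n ∸ i)) ≈ sumTo n (\ i -> s w (suc i) R.* w (n ∸ i))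
   split w w₀ = R.reflexive (sumTo-suc n _) R.& R.+-congʳ (R.*-congʳ (s-0 w w₀) R.& R.zeroˡ _) R.& R.+-identityˡ _
   same : sumTo n (\ i -> s u (suc i) R.* u (n ∸ i)) ≈ sumTo n (\ i -> s v (suc i) R.* v (n ∸ i))
   same = sumTo-cong n (\ i l -> R.*-cong (s-loc u v u₀ v₀ n h (suc i) l) (h (n ∸ i) (NP.m∸n≤m n i)))

 -- An additive functional on K with values modulo p.
 record Add {q : ℕ} (K : FiniteField q) (p : ℕ) .{{_ : NonZero p}} : Set where
  open FiniteField K
  field
   fun : Carrier -> ℕ
   fun-+ : ∀ x y -> fun (x ⊕ y) % p ≡ (fun x N.+ fun y) % p

 -- The functional T(h) = ∑ ℓ_j (s_j h) and the characters χ_a(h) = ζ^{a T(h)}.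
 module Cha {q : ℕ} (K : FiniteField q) {p : ℕ} (pr : Prime p) .{{_ : NonZero p}} (CR : CycRing p) (n′ : ℕ) (ℓ : ℕ -> Add K p) (n≢0 : Kit.fromℕ (fieRing K) (suc n′) ≢ FiniteField.0# K) (v₀ : FiniteField.Carrier K) (ℓv₀ : ¬ (p ∣ℕ Add.fun (ℓ (suc n′)) v₀)) where
  n : ℕ
  n = suc n′
  open PriPow K public
  open Cyc pr CR public using (module Z; module ZS; ζ; ζ^p; ζ^-cong; fix⇒0; fromℤ-inj; rat; sum-ζ; ∣⇒%≡)
  open PowSums (fieRing K) public
  open CycRing CR public using () renaming (ring to ℤ[ζ])
  open VecSums K ℤ[ζ] public
  open Add
  infix 4 _≡ₚ_
  record _≡ₚ_ (a b : ℕ) : Set where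
   constructor mod
   field unmod : a % p ≡ b % p
  open _≡ₚ_ public
  ≡ₚ-refl : ∀ {a} -> a ≡ₚ a
  ≡ₚ-refl = mod idp
  ≡ₚ-tra : ∀ {a b c} -> a ≡ₚ b -> b ≡ₚ c -> a ≡ₚ c
  ≡ₚ-tra (mod e) (mod f) = mod (e ∙ f)
  ≡ₚ-ref : ∀ {a b} -> a ≡ b -> a ≡ₚ b
  ≡ₚ-ref idp = mod idp
  +-cong-≡ₚ : ∀ {a b c d} -> a ≡ₚ b -> c ≡ₚ d -> a N.+ c ≡ₚ b N.+ d
  +-cong-≡ₚ {a} {b} {c} {d} (mod e) (mod f) = mod (%-distribˡ-+ a c p ∙ ap₂ (\ x y -> (x N.+ y) % p) e f ∙ ! (%-distribˡ-+ b d p))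
  *-cong-≡ₚ : ∀ a {b c} -> b ≡ₚ c -> a N.* b ≡ₚ a N.* c
  *-cong-≡ₚ a {b} {c} (mod e) = mod (%-distribˡ-* a b p ∙ ap (\ x -> ((a % p) N.* x) % p) e ∙ ! (%-distribˡ-* a c p))
  fun-cong : ∀ (λ′ : Add K p) {x y} -> x ≡ y -> fun λ′ x ≡ₚ fun λ′ y
  fun-cong λ′ idp = ≡ₚ-refl
  parT : ℕ -> Seq -> ℕ
  parT zero σ = 0
  parT (suc j) σ = parT j σ N.+ fun (ℓ (suc j)) (σ (suc j))
  parT-cong : ∀ j {σ τ} -> (∀ i -> i ≤ j -> σ i ≡ τ i) -> parT j σ ≡ parT j τ
  parT-cong zero h = idp
  parT-cong (suc j) h = ap₂ (\ a b -> a N.+ fun (ℓ (suc j)) b) (parT-cong j (\ i l -> h i (NP.≤-trans l (NP.n≤1+n j)))) (h (suc j) NP.≤-refl)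
  parT-⊕ : ∀ j σ τ -> parT j (σ ⊕ τ) ≡ₚ parT j σ N.+ parT j τ
  parT-⊕ zero σ τ = ≡ₚ-refl
  parT-⊕ (suc j) σ τ = ≡ₚ-tra (+-cong-≡ₚ (parT-⊕ j σ τ) (mod (fun-+ (ℓ (suc j)) _ _))) (≡ₚ-ref (interchange (parT j σ) (parT j τ) _ _))
   where
   open import Data.Nat.Tactic.RingSolver using (solve-∀)
   interchange : ∀ a b c d -> a N.+ b N.+ (c N.+ d) ≡ a N.+ c N.+ (b N.+ d)
   interchange = solve-∀
  -- For a monic polynomial with zeros r this is the product of the 1 - r t, to which `s` applies.
  unit : ∀ {k} -> Vec K.El k -> Seq
  unit {k} v = rev k (mon v)
  unit-0 : ∀ {k} (v : Vec K.El k) -> unit v 0 ≡ K.1#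
  unit-0 {k} v = rev-0 k (mon v) ∙ proj₁ (mon-Mon v)
  opaque
   T : ∀ {k} -> Vec K.El k -> ℕ
   T v = parT n (s (unit v))
   T-def : ∀ {k} (v : Vec K.El k) -> T v ≡ parT n (s (unit v))
   T-def v = idp
  unit-pro : ∀ {i j} (u : Vec K.El i) (v : Vec K.El j) -> unit (product u v) ≋ unit u ⊛ unit v
  unit-pro {i} {j} u v = ≋-trans (rev-cong (i N.+ j) (mon-pro u v)) (rev-⊛ i j (mon u) (mon v) (proj₂ (mon-Mon u)) (proj₂ (mon-Mon v)))
  -- T sees only the coefficients up to t^n, so agreement modulo t^(n+1) is assumed instead of
  -- equality; this covers the truncated quotients used for the top coefficient.
  T-⊛ : ∀ {k i j} (w : Vec K.El k) (u : Vec K.El i) (v : Vec K.El j) -> (∀ m -> m ≤ n -> unit w m ≡ (unit u ⊛ unit v) m) -> T w ≡ₚ T u N.+ T v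
  T-⊛ w u v h = ≡ₚ-tra (≡ₚ-ref (T-def w ∙ parT-cong n (\ i l -> s-loc (unit w) (unit u ⊛ unit v) (unit-0 w) uv₀ n h i l ∙ s-pro (unit u) (unit v) (unit-0 u) (unit-0 v) i))) (≡ₚ-tra (parT-⊕ n (s (unit u)) (s (unit v))) (≡ₚ-ref (! (ap₂ N._+_ (T-def u) (T-def v)))))
   where
   uv₀ : (unit u ⊛ unit v) 0 ≡ K.1#
   uv₀ = ap₂ K._*_ (unit-0 u) (unit-0 v) ∙ K.*-identityˡ _
  T-pro : ∀ {i j} (u : Vec K.El i) (v : Vec K.El j) -> T (product u v) ≡ₚ T u N.+ T v
  T-pro u v = T-⊛ (product u v) u v (\ m _ -> unit-pro u v m)
  unit-∷ : ∀ {k} a (v : Vec K.El k) i -> i ≤ k -> unit (a ∷ v) i ≡ unit v i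
  unit-∷ {k} a v i l = rev-tail k (a ◃ mon v) i ∙ ap (K._+ rev k (mon v) i) (shi-low k i l) ∙ K.+-identityˡ _
   where
   shi-low : ∀ k i -> i ≤ k -> shift (suc k) (const a) i ≡ K.0#
   shi-low k zero l = idp
   shi-low (suc k) (suc i) (s≤s l) = shi-low k i l
  unit-∷-top : ∀ {k} a (v : Vec K.El k) -> unit (a ∷ v) (suc k) ≡ a
  unit-∷-top {k} a v = rev-at-top k (a ◃ mon v) ∙ idp
   where
   rev-at-top : ∀ m f -> rev (suc m) f (suc m) ≡ f 0
   rev-at-top zero f = idp
   rev-at-top (suc m) f = rev-at-top′ m f
    where
    rev-at-top′ : ∀ m f -> rev (suc m) f (suc m) ≡ f 0
    rev-at-top′ zero f = idp
    rev-at-top′ (suc m) f = rev-at-top′ m f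
  -- In degree k + 1 the constant term a is the coefficient of t^(k+1) in `unit`, beyond the reach
  -- of T when k ≥ n.
  T-drop : ∀ {k} a (v : Vec K.El k) -> n ≤ k -> T (a ∷ v) ≡ T v
  T-drop {k} a v n≤k = T-def (a ∷ v) ∙ parT-cong n (\ i l -> s-loc (unit (a ∷ v)) (unit v) (unit-0 (a ∷ v)) (unit-0 v) n (\ i l′ -> unit-∷ a v i (NP.≤-trans l′ n≤k)) i l) ∙ ! (T-def v)

  -- the additive character through which the constant term of a polynomial of degree n enters
  λn : K.El -> ℕ
  λn x = fun (ℓ n) (K.- (K.fromℕ n K.* x))
  λn-+ : ∀ x y -> λn (x K.+ y) ≡ₚ λn x N.+ λn y
  λn-+ x y = ≡ₚ-tra (fun-cong (ℓ n) (K.solve 3 (\ n x y -> K.:- (n K.:* (x K.:+ y)) K.:= K.:- (n K.:* x) K.:+ K.:- (n K.:* y)) idp (K.fromℕ n) x y)) (mod (fun-+ (ℓ n) _ _))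
  -- In degree n the constant term x is the coefficient of t^n in `unit`; by `s-dif` it changes the
  -- n-th power sum by -n x and no earlier one.
  T-head : ∀ x (v : Vec K.El n′) -> T (x ∷ v) ≡ₚ T (K.0# ∷ v) N.+ λn x
  T-head x v = ≡ₚ-tra (≡ₚ-ref (T-def (x ∷ v))) (≡ₚ-tra (+-cong-≡ₚ (≡ₚ-ref (parT-cong n′ (\ i l -> s-loc u w (unit-0 (x ∷ v)) (unit-0 (K.0# ∷ v)) n′ agree i l))) (≡ₚ-tra (fun-cong (ℓ n) top) (mod (fun-+ (ℓ n) _ _)))) (≡ₚ-ref (! (NP.+-assoc (parT n′ (s w)) _ _) ∙ ap (N._+ λn x) (! (T-def (K.0# ∷ v))))))
   where
   u = unit (x ∷ v)
   w = unit (K.0# ∷ v)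
   agree : ∀ i -> i ≤ n′ -> u i ≡ w i
   agree i l = unit-∷ x v i l ∙ ! (unit-∷ K.0# v i l)
   top : s u n ≡ s w n K.+ K.- (K.fromℕ n K.* x)
   top = s-dif u w (unit-0 (x ∷ v)) (unit-0 (K.0# ∷ v)) n′ agree ∙ ap (\ t -> s w n K.- K.fromℕ n K.* t) (ap₂ K._-_ (unit-∷-top x v) (unit-∷-top K.0# v) ∙ K.solve 1 (\ x -> x K.:- K.0∶ K.:= x) idp x)
  -- Chosen so that -n x₀ = v₀; this is where n has to be invertible in K.
  x₀ : K.El
  x₀ = K.- (proj₁ (inverse (K.fromℕ n) n≢0) K.* v₀)
  λn-x₀ : ¬ (p ∣ℕ λn x₀)
  λn-x₀ = ≡.subst (\ y -> ¬ (p ∣ℕ fun (ℓ n) y)) (! value) ℓv₀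
   where
   i = proj₁ (inverse (K.fromℕ n) n≢0)
   value : K.- (K.fromℕ n K.* x₀) ≡ v₀
   value = K.solve 3 (\ n i v -> K.:- (n K.:* (K.:- (i K.:* v))) K.:= (n K.:* i) K.:* v) idp (K.fromℕ n) i v₀ ∙ ap (K._* v₀) (proj₂ (inverse (K.fromℕ n) n≢0)) ∙ K.*-identityˡ v₀
  open Z using (_≈_)
  module _ (a : ℕ) (p∤a : ¬ (p ∣ℕ a)) where
   χ : ∀ {k} -> Vec K.El k -> Z.El
   χ v = ζ Z.^ (a N.* T v)
   ζ^-+ : ∀ {m i j} -> m ≡ₚ i N.+ j -> ζ Z.^ (a N.* m) ≈ ζ Z.^ (a N.* i) Z.* ζ Z.^ (a N.* j)
   ζ^-+ {m} {i} {j} e = ζ^-cong (unmod (*-cong-≡ₚ a e)) Z.& Z.reflexive (ap (ζ Z.^_) (NP.*-distribˡ-+ a i j)) Z.& Z.^-homo-* ζ (a N.* i) (a N.* j)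
   χ-pro : ∀ {i j} (u : Vec K.El i) (v : Vec K.El j) -> χ (product u v) ≈ χ u Z.* χ v
   χ-pro u v = ζ^-+ (T-pro u v)
   open New K ℤ[ζ] χ χ-pro public using (c; powSum; S′; new)
   -- Translation by x₀ permutes K and multiplies the sum by a nontrivial power of ζ.
   cha-sum : Z.sum {q} (\ i -> ζ Z.^ (a N.* λn (elt i))) ≈ Z.0#
   cha-sum = fix⇒0 (a N.* λn x₀) _ (\ d -> [ p∤a , λn-x₀ ]′ (euclidsLemma a (λn x₀) pr d)) (begin ζ ^ (a N.* λn x₀) * sum f ≈⟨ *-distribˡ-sum {q} _ f ⟩ sum {q} (\ i -> ζ ^ (a N.* λn x₀) * ζ ^ (a N.* λn (elt i))) ≈⟨ sum-cong-≋ {q} (\ i -> sym (reflexive (ap (\ y -> ζ ^ (a N.* λn y)) (elt-idx _)) & ζ^-+ (λn-+ x₀ (elt i)))) ⟩ sum {q} (\ i -> f (idx (x₀ K.+ elt i))) ≈⟨ sum-permute f (permutation (\ i -> idx (x₀ K.+ elt i)) (\ i -> idx (K.- x₀ K.+ elt i)) (\ j -> move x₀ (K.- x₀) (K.-‿inverseʳ x₀) j) (\ j -> move (K.- x₀) x₀ (K.-‿inverseˡ x₀) j)) ⟨ sum f ∎)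
    where
    open Z
    f : Fin q -> Carrier
    f i = ζ ^ (a N.* λn (elt i))
    move : ∀ x y -> x K.+ y ≡ K.0# -> ∀ j -> idx (x K.+ elt (idx (y K.+ elt j))) ≡ j
    move x y e j = ap idx (ap (x K.+_) (elt-idx _) ∙ ! (K.+-assoc x y _) ∙ ap (K._+ elt j) e ∙ K.+-identityˡ _) ∙ idx-elt j
   head-sum : ∀ (v : Vec K.El n′) -> Z.sum {q} (\ i -> χ (elt i ∷ v)) ≈ Z.0#
   head-sum v = Z.sum-cong-≋ {q} (\ i -> ζ^-+ (T-head (elt i) v)) Z.& Z.sym (Z.*-distribˡ-sum {q} _ (\ i -> ζ Z.^ (a N.* λn (elt i)))) Z.& Z.*-congˡ cha-sum Z.& Z.zeroʳ _
   -- In degree n the sum over the constant term alone vanishes by `head-sum`. In higher degree T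
   -- ignores the constant term, and the sum is q times the preceding one.
   c-zero : ∀ j -> c (j N.+ n) ≈ Z.0#
   c-zero zero = Z.reflexive (sumV-cons n′ χ) Z.& Z.sym (sumV-sum n′ q (\ v i -> χ (elt i ∷ v))) Z.& sumV-0 n′ head-sum
   c-zero (suc j) = Z.reflexive (sumV-cons (j N.+ n) χ) Z.& Z.sum-cong-≋ {q} (\ i -> sumV-cong (j N.+ n) (\ v -> Z.reflexive (ap (\ t -> ζ Z.^ (a N.* t)) (T-drop (elt i) v (NP.m≤n+m n j)))) Z.& c-zero j) Z.& Z.sum-replicate-zero q

   -- L is a polynomial of degree n - 1.
   c-Deg : Ser.Deg< ℤ[ζ] c n
   c-Deg i l = Z.reflexive (ap c (! (NP.m∸n+n≡m l))) Z.& c-zero (i ∸ n)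
   c-0 : c 0 ≈ Z.1#
   c-0 = Z.reflexive (sumV-nil χ) Z.& ζ^-cong (unmod (≡ₚ-tra (*-cong-≡ₚ a T-nil) (≡ₚ-ref (NP.*-zeroʳ a)))) Z.& Z.refl
    where
    T-nil : T [] ≡ₚ 0
    T-nil = T-nil′
     where
     -- T [] + T [] ≡ T []
     T-nil′ : T [] ≡ₚ 0
     T-nil′ = mod (cancel (unmod (T-⊛ [] [] [] (\ m _ -> ! (idem m)))))
      where
      unit[] : unit [] ≋ 𝟙
      unit[] zero = idp
      unit[] (suc i) = idp
      idem : ∀ m -> (unit [] ⊛ unit []) m ≡ unit [] m
      idem m = ⊛-cong {unit []} {𝟙} {unit []} unit[] ≋-refl m ∙ ⊛-ideˡ (unit []) m
      cancel : T [] % p ≡ (T [] N.+ T []) % p -> T [] % p ≡ 0 % p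
      cancel e = ∣⇒%≡ (≡.subst (p ∣ℕ_) (NP.m+n∸m≡n (T []) (T [])) (ModPri.%-equ⇒∣ pr (T []) (T [] N.+ T []) (NP.m≤m+n _ _) e))

open PowSumCha

-- The product of the top coefficients of two opposite L-functions.

module TopCoe where

 open N using (_≤_; _<_)
 open import Data.Nat.Divisibility using () renaming (_∣_ to _∣ℕ_)
 open import Data.Vec.Base using (replicate)

 -- The number of zeros of an affine form on K^D.
 module AffFor {q : ℕ} (K : FiniteField q) (S : CommutativeRing 0ℓ 0ℓ) where
  open Factorisation K using (module K; elt; idx; elt-idx; idx-elt; _≟ᴷ_; inverse)
  open Kit S
  open VecSums K S
  dot : ∀ {D} -> Vec K.El D -> (ℕ -> K.El) -> K.El
  dot [] c = K.0#
  dot (a ∷ v) c = a K.* c 0 K.+ dot v (\ i -> c (suc i))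
  zeros : ∀ D -> K.El -> (ℕ -> K.El) -> Carrier
  zeros D x c = sumV D (\ h -> [ (x K.+ dot h c) ≟ᴷ K.0# ])
  one-sol : ∀ y c -> c ≢ K.0# -> sum {q} (\ i -> [ (y K.+ elt i K.* c) ≟ᴷ K.0# ]) ≈ 1#
  one-sol y c c≢0 = sum-cong-≋ {q} (\ i -> [⇔] ((y K.+ elt i K.* c) ≟ᴷ K.0#) (i FinP.≟ idx z) (to i) (from i) & sym (*-identityʳ _)) & sum-δ (idx z) (\ _ -> 1#)
   where
   d = proj₁ (inverse c c≢0)
   cd : c K.* d ≡ K.1#
   cd = proj₂ (inverse c c≢0)
   z = K.- (y K.* d)
   to : ∀ i -> y K.+ elt i K.* c ≡ K.0# -> i ≡ idx z
   to i e = ! (idx-elt i) ∙ ap idx (K.from-dif (beg′))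
    where
    beg′ : elt i K.- z ≡ K.0#
    beg′ = K.solve 4 (\ x y c d -> x K.:- (K.:- (y K.:* d)) K.:= (y K.:+ x K.:* c) K.:* d K.:+ x K.:* (K.1∶ K.:- c K.:* d)) idp (elt i) y c d ∙ ap₂ (\ s t -> s K.* d K.+ elt i K.* (K.1# K.- t)) e cd ∙ K.solve 2 (\ d x -> K.0∶ K.:* d K.:+ x K.:* (K.1∶ K.:- K.1∶) K.:= K.0∶) idp d (elt i)
   from : ∀ i -> i ≡ idx z -> y K.+ elt i K.* c ≡ K.0#
   from i idp = ap (\ t -> y K.+ t K.* c) (elt-idx z) ∙ K.solve 3 (\ y c d -> y K.:+ (K.:- (y K.:* d)) K.:* c K.:= y K.:* (K.1∶ K.:- c K.:* d)) idp y c d ∙ ap (\ t -> y K.* (K.1# K.- t)) cd ∙ K.solve 1 (\ y -> y K.:* (K.1∶ K.:- K.1∶) K.:= K.0∶) idp y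
  sumV-one : ∀ k -> sumV k (\ _ -> 1#) ≈ fromℕ (q N.^ k)
  sumV-one zero = reflexive (sumV-nil _) & sym (+-identityʳ 1#)
  sumV-one (suc k) = reflexive (sumV-cons k _) & sum-cong-≋ {q} (\ i -> sumV-one k) & sum-replicate q & ×-congʳ q (sym (*-identityˡ _)) & sym (×-assoc-* q 1# _) & sym (fromℕ-* q (q N.^ k))
  zer-cons : ∀ D x c -> zeros (suc D) x c ≈ sum {q} (\ i -> zeros D (x K.+ elt i K.* c 0) (\ j -> c (suc j)))
  zer-cons D x c = reflexive (sumV-cons D _) & sum-cong-≋ {q} (\ i -> sumV-cong D (\ v -> [⇔] ((x K.+ (elt i K.* c 0 K.+ dot v (\ j -> c (suc j)))) ≟ᴷ K.0#) ((x K.+ elt i K.* c 0 K.+ dot v (\ j -> c (suc j))) ≟ᴷ K.0#) (≡.trans (K.+-assoc x _ _)) (≡.trans (! (K.+-assoc x _ _)))))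
  -- Along a coordinate with nonzero coefficient there is exactly one solution for each choice of
  -- the others.
  zer-non : ∀ D x c i -> i ≤ D -> c i ≢ K.0# -> zeros (suc D) x c ≈ fromℕ (q N.^ D)
  zer-non D x c i i≤D ci≢0 = go (c 0 ≟ᴷ K.0#)
   where
   head-case : c 0 ≢ K.0# -> zeros (suc D) x c ≈ fromℕ (q N.^ D)
   head-case c₀≢0 = zer-cons D x c & sym (sumV-sum D q _) & sumV-cong D (\ v -> sum-cong-≋ {q} (\ i -> [⇔] ((x K.+ elt i K.* c 0 K.+ dot v (\ j -> c (suc j))) ≟ᴷ K.0#) ((x K.+ dot v (\ j -> c (suc j)) K.+ elt i K.* c 0) ≟ᴷ K.0#) (≡.trans (swap v i)) (≡.trans (! (swap v i)))) & one-sol (x K.+ dot v (\ j -> c (suc j))) (c 0) c₀≢0) & sumV-one D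
    where
    swap : ∀ v i -> x K.+ dot v (\ j -> c (suc j)) K.+ elt i K.* c 0 ≡ x K.+ elt i K.* c 0 K.+ dot v (\ j -> c (suc j))
    swap v i = K.solve 3 (\ x y z -> x K.:+ y K.:+ z K.:= x K.:+ z K.:+ y) idp x (dot v (\ j -> c (suc j))) (elt i K.* c 0)
   tail-case : c 0 ≡ K.0# -> ∀ D′ i -> i ≤ D′ -> D ≡ D′ -> c i ≢ K.0# -> zeros (suc D) x c ≈ fromℕ (q N.^ D)
   tail-case c₀≡0 D′ zero l e n = ⊥-elim (n c₀≡0)
   tail-case c₀≡0 (suc D″) (suc i) (s≤s l) idp n = zer-cons D x c & sum-cong-≋ {q} (\ k -> zer-non D″ _ (\ j -> c (suc j)) i l n) & sum-replicate q & ×-congʳ q (sym (*-identityˡ _)) & sym (×-assoc-* q 1# _) & sym (fromℕ-* q (q N.^ D″))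
   go : Dec (c 0 ≡ K.0#) -> zeros (suc D) x c ≈ fromℕ (q N.^ D)
   go (yes c₀≡0) = tail-case c₀≡0 D i i≤D idp ci≢0
   go (no c₀≢0) = head-case c₀≢0
  dot-zero : ∀ {D} (h : Vec K.El D) c -> (∀ i -> i < D -> c i ≡ K.0#) -> dot h c ≡ K.0#
  dot-zero [] c z = idp
  dot-zero (a ∷ h) c z = ap₂ (\ s t -> a K.* s K.+ t) (z 0 (s≤s z≤n)) (dot-zero h (\ i -> c (suc i)) (\ i l -> z (suc i) (s≤s l))) ∙ K.solve 1 (\ a -> a K.:* K.0∶ K.:+ K.0∶ K.:= K.0∶) idp a
  zer-zero : ∀ D x c -> (∀ i -> i < D -> c i ≡ K.0#) -> zeros D x c ≈ fromℕ (q N.^ D) * [ x ≟ᴷ K.0# ]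
  zer-zero D x c z = sumV-cong D (\ h -> [⇔] ((x K.+ dot h c) ≟ᴷ K.0#) (x ≟ᴷ K.0#) (\ e -> ! (x+0 h) ∙ e) (\ e -> x+0 h ∙ e) & sym (*-identityˡ _)) & sym (sumV-*ʳ D _ (\ _ -> 1#)) & *-congʳ (sumV-one D)
   where
   x+0 : ∀ h -> x K.+ dot h c ≡ x
   x+0 h = ap (x K.+_) (dot-zero h c z) ∙ K.+-identityʳ x

 module CenCoe {q : ℕ} (K : FiniteField q) {p : ℕ} (pr : Prime p) .{{_ : NonZero p}} (CR : CycRing p) (D′ : ℕ) (ℓ : ℕ -> Add K p) (n≢0 : Kit.fromℕ (fieRing K) (suc (suc D′)) ≢ FiniteField.0# K) (v₀ : FiniteField.Carrier K) (ℓv₀ : ¬ (p ∣ℕ Add.fun (ℓ (suc (suc D′))) v₀)) where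
  open Cha K pr CR (suc D′) ℓ n≢0 v₀ ℓv₀ public
  open AffFor K ℤ[ζ] public
  open Z using (_≈_)
  D : ℕ
  D = suc D′
  -- For fixed f the coefficient is an affine form in the free coefficients of the monic h.
  conv-dot : ∀ {k} (h : Vec K.El k) f -> (mon h ⊛ f) k ≡ f 0 K.+ dot h (\ i -> f (k ∸ i))
  conv-dot [] f = K.*-identityˡ _ ∙ ! (K.+-identityʳ _)
  conv-dot {suc k} (a ∷ v) f = ap (a K.* f (suc k) K.+_) (conv-dot v f) ∙ K.solve 3 (\ x y z -> x K.:+ (y K.:+ z) K.:= y K.:+ (x K.:+ z)) idp (a K.* f (suc k)) (f 0) (dot v (\ i -> f (k ∸ i)))
  fromUnit : ∀ k -> Seq -> Vec K.El k
  fromUnit k f = toVec k (rev k f)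
  unit-fromUnit : ∀ k f -> f 0 ≡ K.1# -> ∀ i -> i ≤ k -> unit (fromUnit k f) i ≡ f i
  unit-fromUnit k f f₀ i l = rev-cong k (mon-toVec k (rev k f) (rev-at k f k NP.≤-refl ∙ ap f (NP.n∸n≡0 k) ∙ f₀ , rev-Deg k f)) i ∙ rev-at k (rev k f) i l ∙ rev-at k f (k ∸ i) (NP.m∸n≤m k i) ∙ ap f (NP.m∸[m∸n]≡n l)
  unit-inj : ∀ {k} (u v : Vec K.El k) -> (∀ i -> i ≤ k -> unit u i ≡ unit v i) -> u ≡ v
  unit-inj {k} u v h = mon-inj u v agree
   where
   agree : mon u ≋ mon v
   agree i with i NP.≤? k
   ... | yes l = ! (back u i l) ∙ h (k ∸ i) (NP.m∸n≤m k i) ∙ back v i l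
    where
    back : ∀ (u : Vec K.El k) i -> i ≤ k -> unit u (k ∸ i) ≡ mon u i
    back u i l = rev-at k (mon u) (k ∸ i) (NP.m∸n≤m k i) ∙ ap (mon u) (NP.m∸[m∸n]≡n l)
   ... | no nl = proj₂ (mon-Mon u) i (NP.≰⇒> nl) ∙ ! (proj₂ (mon-Mon v) i (NP.≰⇒> nl))
  ⊛-locᴷ : ∀ i {f f' g g' : Seq} -> (∀ j -> j ≤ i -> f j ≡ f' j) -> (∀ j -> j ≤ i -> g j ≡ g' j) -> (f ⊛ g) i ≡ (f' ⊛ g') i
  ⊛-locᴷ zero a b = ap₂ K._*_ (a 0 z≤n) (b 0 z≤n)
  ⊛-locᴷ (suc i) a b = ap₂ K._+_ (ap₂ K._*_ (a 0 z≤n) (b _ NP.≤-refl)) (⊛-locᴷ i (\ j l -> a (suc j) (s≤s l)) (\ j l -> b j (NP.≤-trans l (NP.n≤1+n i))))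
  private module SK = Kit (Ser.serRing (fieRing K))

  -- u ↦ u / h modulo t^{n+1} maps the polynomials of degree D onto those of degree n whose
  -- product with h has no term in t^n.
  module Ratio (h : Vec K.El D) where
   inv-h : Seq
   inv-h = quot 𝟙 (unit h)
   inv-h-⊛ : inv-h ⊛ unit h ≋ 𝟙
   inv-h-⊛ = quot-⊛ 𝟙 (unit h) (unit-0 h)
   ratio : Seq -> Seq
   ratio f = f ⊛ inv-h
   rat-⊛ : ∀ f -> unit h ⊛ ratio f ≋ f
   rat-⊛ f = at (SK.solve 3 (\ h f i -> h SK.:* (f SK.:* i) SK.:= f SK.:* (i SK.:* h)) SK.refl (unit h) f inv-h SK.& SK.*-congˡ {f} ⟪ inv-h-⊛ ⟫ SK.& SK.*-identityʳ f)
   ⊛-rat : ∀ f -> ratio (unit h ⊛ f) ≋ f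
   ⊛-rat f = at (SK.solve 3 (\ h f i -> (h SK.:* f) SK.:* i SK.:= f SK.:* (i SK.:* h)) SK.refl (unit h) f inv-h SK.& SK.*-congˡ {f} ⟪ inv-h-⊛ ⟫ SK.& SK.*-identityʳ f)
   rat₀ : ∀ (u : Vec K.El D) -> ratio (unit u) 0 ≡ K.1#
   rat₀ u = ap (K._* K.1#) (unit-0 u) ∙ K.*-identityˡ _
   ι : Vec K.El D -> Vec K.El n
   ι u = fromUnit n (ratio (unit u))
   unit-ι : ∀ u i -> i ≤ n -> unit (ι u) i ≡ ratio (unit u) i
   unit-ι u = unit-fromUnit n (ratio (unit u)) (rat₀ u)
   h-ι : ∀ u i -> i ≤ n -> (unit h ⊛ unit (ι u)) i ≡ unit u i
   h-ι u i l = ⊛-locᴷ i {unit h} (\ _ _ -> idp) (\ j m -> unit-ι u j (NP.≤-trans m l)) ∙ rat-⊛ (unit u) i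
   ι-inj : ∀ {u v} -> ι u ≡ ι v -> u ≡ v
   ι-inj {u} {v} e = unit-inj u v (\ i l -> ! (h-ι u i (NP.≤-trans l (NP.n≤1+n D))) ∙ ap (\ w -> (unit h ⊛ unit w) i) e ∙ h-ι v i (NP.≤-trans l (NP.n≤1+n D)))
   Cond : Vec K.El n -> Set
   Cond w = (mon h ⊛ mon w) D ≡ K.0#
   cond-unit : ∀ w -> (unit h ⊛ unit w) n ≡ (mon h ⊛ mon w) D
   cond-unit w = ! (rev-⊛ D n (mon h) (mon w) (proj₂ (mon-Mon h)) (proj₂ (mon-Mon w)) n) ∙ rev-at (D N.+ n) (mon h ⊛ mon w) n (NP.m≤n+m n D) ∙ ap (mon h ⊛ mon w) (NP.m+n∸n≡m D n)
   cond-ι : ∀ u -> Cond (ι u)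
   cond-ι u = ! (cond-unit (ι u)) ∙ h-ι u n NP.≤-refl ∙ rev-Deg D (mon u) n NP.≤-refl
   ι-sur : ∀ w -> Cond w -> Σ[ u ∈ Vec K.El D ] ι u ≡ w
   ι-sur w e = u , unit-inj (ι u) w (\ i l -> unit-ι u i l ∙ ⊛-locᴷ i {unit u} {unit h ⊛ unit w} {inv-h} (\ j m -> unit-u j (NP.≤-trans m l)) (\ _ _ -> idp) ∙ ⊛-rat (unit w) i)
    where
    hw₀ : (unit h ⊛ unit w) 0 ≡ K.1#
    hw₀ = ap₂ K._*_ (unit-0 h) (unit-0 w) ∙ K.*-identityˡ _
    u = fromUnit D (unit h ⊛ unit w)
    unit-u : ∀ i -> i ≤ n -> unit u i ≡ (unit h ⊛ unit w) i
    unit-u i l = [ (\ l′ -> unit-fromUnit D (unit h ⊛ unit w) hw₀ i (NP.≤-pred l′)) , (\ { idp -> rev-Deg D (mon u) n NP.≤-refl ∙ ! (cond-unit w ∙ e) }) ]′ (NP.m≤n⇒m<n∨m≡n l)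
   T-ι : ∀ u -> T u ≡ₚ T (ι u) N.+ T h
   T-ι u = T-⊛ u (ι u) h (\ m l -> ! (h-ι u m l) ∙ ⊛-comm (unit h) (unit (ι u)) m)
  module _ (a a′ : ℕ) (p∤a : ¬ (p ∣ℕ a)) (p∤a′ : ¬ (p ∣ℕ a′)) (a+a′ : a N.+ a′ ≡ p) where
   private
    -- Modulo t^(n+1) the reversed u is the product of those of h and `ι h u`, so T is additive
    -- here, and the total multiple of T h is a + a′ = p.
    combine : ∀ h u -> χ a p∤a u Z.* χ a′ p∤a′ h ≈ χ a p∤a (Ratio.ι h u)
    combine h u = Z.sym (Z.^-homo-* ζ (a N.* T u) (a′ N.* T h)) Z.& ζ^-cong (unmod (≡ₚ-tra (+-cong-≡ₚ (*-cong-≡ₚ a (Ratio.T-ι h u)) ≡ₚ-refl) (≡ₚ-tra (≡ₚ-ref (rearrange a a′ (T (Ratio.ι h u)) (T h))) (≡ₚ-tra (+-cong-≡ₚ {a N.* T (Ratio.ι h u)} ≡ₚ-refl (mod (∣⇒%≡ (≡.subst (\ m -> p ∣ℕ m N.* T h) (! a+a′) (Data.Nat.Divisibility.m∣m*n (T h)))))) (≡ₚ-ref (NP.+-identityʳ _))))))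
     where
     import Data.Nat.Divisibility
     open import Data.Nat.Tactic.RingSolver using (solve-∀)
     rearrange : ∀ a a′ x y -> a N.* (x N.+ y) N.+ a′ N.* y ≡ a N.* x N.+ (a N.+ a′) N.* y
     rearrange = solve-∀
    cond? : ∀ (h : Vec K.El D) (w : Vec K.El n) -> Dec (Ratio.Cond h w)
    cond? h w = (mon h ⊛ mon w) D ≟ᴷ K.0#
    count : K.El -> Vec K.El D -> Z.El
    count x w = sumV D (\ h -> [ cond? h (x ∷ w) ])
    -- The entries of x ◃ `mon w` read backwards. Index 0 is not reached for i < D, so x may be
    -- replaced by 0 there, which shows that the linear part of the form is independent of x.
    coe : Vec K.El D -> ℕ -> K.El
    coe w i = (K.0# ◃ mon w) (D ∸ i)
    cou-zer : ∀ x w -> count x w ≈ zeros D x (coe w)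
    cou-zer x w = sumV-cong D (\ h -> [⇔] (cond? h (x ∷ w)) ((x K.+ dot h (coe w)) ≟ᴷ K.0#) (≡.trans (! (value h))) (≡.trans (value h)))
     where
     dot-cong : ∀ {k} (h : Vec K.El k) {c d : ℕ -> K.El} -> (∀ i -> i < k -> c i ≡ d i) -> dot h c ≡ dot h d
     dot-cong [] e = idp
     dot-cong (a ∷ h) e = ap₂ (\ s t -> a K.* s K.+ t) (e 0 (s≤s z≤n)) (dot-cong h (\ i l -> e (suc i) (s≤s l)))
     index : ∀ i m -> i < m -> (x ◃ mon w) (m ∸ i) ≡ (K.0# ◃ mon w) (m ∸ i)
     index i m l with m ∸ i in eq
     ... | zero = ⊥-elim (NP.<⇒≱ l (NP.m∸n≡0⇒m≤n eq))
     ... | suc j = idp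
     value : ∀ h -> (mon h ⊛ mon (x ∷ w)) D ≡ x K.+ dot h (coe w)
     value h = conv-dot h (mon (x ∷ w)) ∙ ap (x K.+_) (dot-cong h (\ i l -> index i D l))
    0V : Vec K.El D
    0V = replicate D K.0#
    non-ent : ∀ {k} (w : Vec K.El k) -> w ≢ replicate k K.0# -> Σ[ j ∈ ℕ ] (j < k × mon w j ≢ K.0#)
    non-ent [] n = ⊥-elim (n idp)
    non-ent (x ∷ w) n with x ≟ᴷ K.0#
    ... | no x≢0 = 0 , s≤s z≤n , x≢0
    ... | yes idp with non-ent w (\ e -> n (ap (K.0# ∷_) e))
    ... | j , l , m = suc j , s≤s l , m
    zero-ent : ∀ k j -> j < k -> mon (replicate k K.0#) j ≡ K.0#
    zero-ent (suc k) zero l = idp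
    zero-ent (suc k) (suc j) (s≤s l) = zero-ent k j l
    T-zero : ∀ k -> k ≡ n -> T (replicate k K.0#) ≡ₚ 0
    T-zero k idp = mod (∣⇒%≡ (≡.subst (p ∣ℕ_) (NP.m+n∸m≡n t t) (ModPri.%-equ⇒∣ pr t (t N.+ t) (NP.m≤m+n _ _) (unmod (T-⊛ z z z idem)))))
     where
     z = replicate n K.0#
     t = T z
     unit-z : ∀ m -> m ≤ n -> unit z m ≡ 𝟙 m
     unit-z zero l = unit-0 z
     unit-z (suc m) l = rev-at n (mon z) (suc m) l ∙ zero-ent n (n ∸ suc m) (NP.∸-monoʳ-< {n} (s≤s z≤n) l)
     idem : ∀ m -> m ≤ n -> unit z m ≡ (unit z ⊛ unit z) m
     idem m l = ! (⊛-locᴷ m {unit z} {𝟙} {unit z} (\ j k -> unit-z j (NP.≤-trans k l)) (\ _ _ -> idp) ∙ ⊛-ideˡ (unit z) m)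
    -- If w ≠ 0, the number of h does not depend on the constant term x, and the sum of the
    -- character over x vanishes. If w = 0, the condition on h reduces to x = 0, so that all q^D
    -- polynomials h count, with character value 1.
    fibre : ∀ (w : Vec K.El D) -> Z.sum {q} (\ i -> χ a p∤a (elt i ∷ w) Z.* count (elt i) w) ≈ [ w ≟ⱽ 0V ] Z.* Z.fromℕ (q N.^ D)
    fibre w = go (w ≟ⱽ 0V)
     where
     open Z
     go : (d : Dec (w ≡ 0V)) -> sum {q} (\ i -> χ a p∤a (elt i ∷ w) * count (elt i) w) ≈ [ d ] * fromℕ (q N.^ D)
     go d@(no w≢0) = sum-cong-≋ {q} (\ i -> *-congˡ (constant (elt i))) & sym (*-distribʳ-sum {q} _ (\ i -> χ a p∤a (elt i ∷ w))) & *-congʳ (head-sum a p∤a w) & zeroˡ _ & sym (*-congʳ ([no] d w≢0) & zeroˡ _)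
      where
      constant : ∀ x -> count x w ≈ fromℕ (q N.^ D′)
      constant x = from-ent (non-ent w w≢0)
       where
       from-ent : Σ[ j ∈ ℕ ] (j < D × mon w j ≢ K.0#) -> count x w ≈ fromℕ (q N.^ D′)
       from-ent (j , s≤s l , m) = cou-zer x w & zer-non D′ x (coe w) (D′ ∸ j) (NP.m∸n≤m D′ j) (\ e -> m (ap (K.0# ◃ mon w) (! (NP.+-∸-assoc 1 (NP.m∸n≤m D′ j) ∙ ap suc (NP.m∸[m∸n]≡n l))) ∙ e))
     go d@(yes idp) = begin sum {q} (\ i -> χ a p∤a (elt i ∷ 0V) * count (elt i) 0V) ≈⟨ sum-cong-≋ {q} (\ i -> *-congˡ (cou-zer (elt i) 0V & zer-zero D (elt i) (coe 0V) (\ i l -> van (D ∸ i) (NP.m∸n≤m D i))) & solve 3 (\ x y z -> x :* (y :* z) := z :* (x :* y)) refl _ _ _ & *-congʳ ([⇔] (elt i ≟ᴷ K.0#) (i FinP.≟ idx K.0#) (\ e -> ! (idx-elt i) ∙ ap idx e) (\ e -> ap elt e ∙ elt-idx _))) ⟩ sum {q} (\ i -> [ i FinP.≟ idx K.0# ] * (χ a p∤a (elt i ∷ 0V) * fromℕ (q N.^ D))) ≈⟨ sum-δ (idx K.0#) _ ⟩ χ a p∤a (elt (idx K.0#) ∷ 0V) * fromℕ (q N.^ D) ≈⟨ *-congʳ (reflexive (ap (\ x -> χ a p∤a (x ∷ 0V)) (elt-idx K.0#)) & ζ^-cong (unmod (≡ₚ-tra (*-cong-≡ₚ a (T-zero n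 idp)) (≡ₚ-ref (NP.*-zeroʳ a)))) & sym ([yes] d idp)) ⟩ [ d ] * fromℕ (q N.^ D) ∎
      where
      van : ∀ m -> m ≤ D -> (K.0# ◃ mon 0V) m ≡ K.0#
      van zero l = idp
      van (suc j) l = zero-ent D j l
    expand : ∀ h -> c a p∤a D Z.* χ a′ p∤a′ h ≈ sumV n (\ w -> [ cond? h w ] Z.* χ a p∤a w)
    expand h = sumV-*ʳ D (χ a′ p∤a′ h) (χ a p∤a) Z.& sumV-cong D (combine h) Z.& Z.sym (sumV-rei (Ratio.ι h) (Ratio.ι-inj h) (Ratio.Cond h) (cond? h) (Ratio.cond-ι h) (Ratio.ι-sur h) (χ a p∤a))
   -- Computed like a Gauss sum times its conjugate: the terms of the double sum over u and h depend
   -- only on the truncated ratio w = u / h, and the number of h for given w is the number of zeros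
   -- of an affine form.
   cen : c a p∤a D Z.* c a′ p∤a′ D ≈ Z.fromℕ (q N.^ D)
   cen = begin c a p∤a D * sumV D (χ a′ p∤a′) ≈⟨ sumV-*ˡ D (c a p∤a D) (χ a′ p∤a′) ⟩ sumV D (\ h -> c a p∤a D * χ a′ p∤a′ h) ≈⟨ sumV-cong D expand ⟩ sumV D (\ h -> sumV n (\ w -> [ cond? h w ] * χ a p∤a w)) ≈⟨ sumV-sumV D n _ ⟩ sumV n (\ w -> sumV D (\ h -> [ cond? h w ] * χ a p∤a w)) ≈⟨ sumV-cong n (\ w -> sym (sumV-*ʳ D _ _) & *-comm _ _) ⟩ sumV n (\ w -> χ a p∤a w * sumV D (\ h -> [ cond? h w ])) ≡⟨ sumV-cons D _ ⟩ sum {q} (\ i -> sumV D (\ w -> χ a p∤a (elt i ∷ w) * count (elt i) w)) ≈⟨ sumV-sum D q _ ⟨ sumV D (\ w -> sum {q} (\ i -> χ a p∤a (elt i ∷ w) * count (elt i) w)) ≈⟨ sumV-cong D fibre ⟩ sumV D (\ w -> [ w ≟ⱽ 0V ] * fromℕ (q N.^ D)) ≈⟨ sumV-δ D 0V _ ⟩ fromℕ (q N.^ D) ∎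
    where open Z

open TopCoe

-- The product of the L-functions and its integrality.

module LPolynomials where

 open N using (_≤_; _<_)
 open import Data.Nat.Divisibility using (∣⇒≤; ∣n⇒∣m*n) renaming (_∣_ to _∣ℕ_; _∣?_ to _∣ℕ?_)
 open import Data.Integer.Base using (+_)

 module Integers where
  open Kit ℤ-ring public
  open Ser ℤ-ring public using (_≋_; _⊛_; θ; Seq)
  fromℕ≡+ : ∀ n -> fromℕ n ≡ + n
  fromℕ≡+ zero = idp
  fromℕ≡+ (suc n) = ap (\ z -> + 1 ℤ.+ z) (fromℕ≡+ n)

 -- fromℤ as a ring homomorphism.
 module FromInt (S : CommutativeRing 0ℓ 0ℓ) where
  open Kit S
  private
   module I = Integers
   module SS = Ser S
   module IS = RanSums ℤ-ring
  open RanSums S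
  fromℤ-fromℕ : ∀ n -> fromℤ (I.fromℕ n) ≈ fromℕ n
  fromℤ-fromℕ n = reflexive (ap fromℤ (I.fromℕ≡+ n))
  fromℤ-1 : fromℤ (+ 1) ≈ 1#
  fromℤ-1 = +-identityʳ 1#
  fromℤ-[] : ∀ {A : Set} (d : Dec A) -> fromℤ IS.[ d ] ≈ [ d ]
  fromℤ-[] d@(yes a) = reflexive (ap fromℤ (IS.[yes] d a)) & fromℤ-1 & sym ([yes] d a)
  fromℤ-[] d@(no na) = reflexive (ap fromℤ (IS.[no] d na)) & sym ([no] d na)
  fromℤ-sum : ∀ {n} (f : Fin n -> ℤ) -> fromℤ (I.sum f) ≈ sum (\ i -> fromℤ (f i))
  fromℤ-sum {zero} f = refl
  fromℤ-sum {suc n} f = fromℤ-+ (f Fin.zero) _ & +-congˡ (fromℤ-sum (f ∘ Fin.suc))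
  fromℤ-sumTo : ∀ n f -> fromℤ (IS.sumTo n f) ≈ sumTo n (\ i -> fromℤ (f i))
  fromℤ-sumTo n f = reflexive (ap fromℤ (IS.sumTo-sum n f)) & fromℤ-sum {n} (f ∘ toℕ) & reflexive (! (sumTo-sum n (\ i -> fromℤ (f i))))
  fromℤ-⊛ : ∀ f g n -> fromℤ ((f I.⊛ g) n) ≈ ((\ i -> fromℤ (f i)) SS.⊛ (\ i -> fromℤ (g i))) n
  fromℤ-⊛ f g zero = fromℤ-* (f 0) (g 0)
  fromℤ-⊛ f g (suc n) = fromℤ-+ (f 0 ℤ.* g (suc n)) _ & +-cong (fromℤ-* (f 0) (g (suc n))) (fromℤ-⊛ (f ∘ suc) g n)
  fromℤ-θ : ∀ f n -> fromℤ (I.θ f n) ≈ SS.θ (\ i -> fromℤ (f i)) n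
  fromℤ-θ f n = fromℤ-* (I.fromℕ n) (f n) & *-congʳ (fromℤ-fromℕ n)
  module _ {q : ℕ} (K : FiniteField q) where
   private
    module V = VecSums K S
    module VI = VecSums K ℤ-ring
    module D = DegIde K S
    module DI = DegIde K ℤ-ring
   open Factorisation K using (irr?)
   fromℤ-sumV : ∀ k f -> fromℤ (VI.sumV k f) ≈ V.sumV k (\ v -> fromℤ (f v))
   fromℤ-sumV zero f = reflexive (ap fromℤ (VI.sumV-nil f)) & reflexive (! (V.sumV-nil (\ v -> fromℤ (f v))))
   fromℤ-sumV (suc k) f = reflexive (ap fromℤ (VI.sumV-cons k f)) & fromℤ-sum {q} _ & sum-cong-≋ {q} (\ i -> fromℤ-sumV k _) & reflexive (! (V.sumV-cons k (\ v -> fromℤ (f v))))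
   fromℤ-sumPri : ∀ B (g : ∀ {d} -> Vec (FiniteField.Carrier K) d -> ℕ -> ℤ) -> fromℤ (DI.sumPri B g) ≈ D.sumPri B (\ v e -> fromℤ (g v e))
   fromℤ-sumPri B g = fromℤ-sumTo B _ & sumTo-cong B (\ i _ -> fromℤ-sumV (suc i) _ & V.sumV-cong (suc i) (\ v -> fromℤ-sumTo B _ & sumTo-cong B (\ e _ -> fromℤ-* (DI.[ irr? v ] ℤ.* I.fromℕ (suc i)) (g v (suc e)) & *-congʳ (fromℤ-* DI.[ irr? v ] (I.fromℕ (suc i)) & *-cong (fromℤ-[] (irr? v)) (fromℤ-fromℕ (suc i))))))

 module LPol {q : ℕ} (K : FiniteField q) {p : ℕ} (pr : Prime p) .{{_ : NonZero p}} (CR : CycRing p) (H′ : ℕ) (p-odd : p ≡ suc (suc H′ N.+ suc H′)) (D′ : ℕ) (ℓ : ℕ -> Add K p) (n≢0 : Kit.fromℕ (fieRing K) (suc (suc D′)) ≢ FiniteField.0# K) (v₀ : FiniteField.Carrier K) (ℓv₀ : ¬ (p ∣ℕ Add.fun (ℓ (suc (suc D′))) v₀)) where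
  open CenCoe K pr CR D′ ℓ n≢0 v₀ ℓv₀
  private
   module LS = Ser ℤ[ζ]
   module LR = Kit LS.serRing
   module DZ = DegIde K ℤ[ζ]
   module DI = DegIde K ℤ-ring
   module I = Integers
  open Z using (_≈_)
  open FromInt ℤ[ζ]
  H : ℕ
  H = suc H′
  small : ∀ a -> 0 < a -> a < p -> ¬ (p ∣ℕ a)
  small (suc a) _ a<p d = NP.<⇒≱ a<p (∣⇒≤ d)
  -- This is p - (k + 1), since p = 1 + 2 H; the pairs of k + 1 and `opposite k` for k < H exhaust
  -- the nonzero residues.
  opposite : ℕ -> ℕ
  opposite k = H N.+ H ∸ k
  p∤suc : ∀ {k} -> k < H -> ¬ (p ∣ℕ suc k)
  p∤suc {k} l = small (suc k) (s≤s z≤n) (≡.subst (suc k <_) (! p-odd) (s≤s (NP.≤-trans l (NP.m≤m+n H H))))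
  p∤opp : ∀ {k} -> k < H -> ¬ (p ∣ℕ opposite k)
  p∤opp {k} l = small (opposite k) (NP.m<n⇒0<n∸m (NP.<-≤-trans l (NP.m≤m+n H H))) (≡.subst (opposite k <_) (! p-odd) (s≤s (NP.m∸n≤m (H N.+ H) k)))
  opp-sum : ∀ {k} -> k < H -> suc k N.+ opposite k ≡ p
  opp-sum {k} l = ap suc (NP.m+[n∸m]≡n (NP.<⇒≤ (NP.<-≤-trans l (NP.m≤m+n H H)))) ∙ ! p-odd
  pair : ∀ {k} -> k < H -> LS.Seq
  pair {k} l = c (suc k) (p∤suc l) LS.⊛ c (opposite k) (p∤opp l)
  L : ∀ k -> k ≤ H -> LS.Seq
  L zero l = LS.𝟙
  L (suc k) l = pair l LS.⊛ L k (NP.<⇒≤ l)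
  σ : ∀ k -> k ≤ H -> LS.Seq
  σ zero l = LS.𝟘
  σ (suc k) l = (S′ (suc k) (p∤suc l) LS.⊕ S′ (opposite k) (p∤opp l)) LS.⊕ σ k (NP.<⇒≤ l)
  L-0 : ∀ k l -> L k l 0 ≈ Z.1#
  L-0 zero l = Z.refl
  L-0 (suc k) l = Z.*-cong (Z.*-cong (c-0 (suc k) (p∤suc l)) (c-0 (opposite k) (p∤opp l)) Z.& Z.*-identityˡ _) (L-0 k (NP.<⇒≤ l)) Z.& Z.*-identityˡ _
  c-Deg′ : ∀ a p∤a -> LS.Deg< (c a p∤a) (suc D)
  c-Deg′ = c-Deg
  pair-Deg : ∀ {k} (l : k < H) -> LS.Deg< (pair l) (suc (D N.+ D))
  pair-Deg {k} l = LS.Deg<-⊛ {c (suc k) (p∤suc l)} {c (opposite k) (p∤opp l)} (suc D) D (c-Deg′ (suc k) (p∤suc l)) (c-Deg′ (opposite k) (p∤opp l))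
  L-Deg : ∀ k l -> LS.Deg< (L k l) (suc (k N.* (D N.+ D)))
  L-Deg zero l (suc i) _ = Z.refl
  L-Deg (suc k) l = LS.Deg<-⊛ {pair l} {L k (NP.<⇒≤ l)} (suc (D N.+ D)) (k N.* (D N.+ D)) (pair-Deg l) (L-Deg k (NP.<⇒≤ l))
  L-top : ∀ k l -> L k l (k N.* (D N.+ D)) ≈ Z.fromℕ (q N.^ (D N.* k))
  L-top zero l = Z.sym (Z.reflexive (ap (\ m -> Z.fromℕ (q N.^ m)) (NP.*-zeroʳ D)) Z.& Z.+-identityʳ _)
  L-top (suc k) l = begin L (suc k) l (D N.+ D N.+ k N.* (D N.+ D)) ≈⟨ LS.top-⊛ {pair l} {L k (NP.<⇒≤ l)} (D N.+ D) (k N.* (D N.+ D)) (pair-Deg l) (L-Deg k (NP.<⇒≤ l)) ⟩ pair l (D N.+ D) * L k (NP.<⇒≤ l) (k N.* (D N.+ D)) ≈⟨ *-cong (LS.top-⊛ {c (suc k) (p∤suc l)} {c (opposite k) (p∤opp l)} D D (c-Deg′ (suc k) (p∤suc l)) (c-Deg′ (opposite k) (p∤opp l)) & cen (suc k) (opposite k) (p∤suc l) (p∤opp l) (opp-sum l)) (L-top k (NP.<⇒≤ l)) ⟩ fromℕ (q N.^ D) * fromℕ (q N.^ (D N.* k)) ≈⟨ fromℕ-* (q N.^ D) (q N.^ (D N.* k)) ⟨ fromℕ (q N.^ D N.* q N.^ (D N.* k)) ≡⟨ ap fromℕ (! (NP.^-distribˡ-+-* q D (D N.* k)) ∙ ap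 (q N.^_) (! (NP.*-suc D k))) ⟩ fromℕ (q N.^ (D N.* suc k)) ∎
   where open Z
  private
   log-der : ∀ {f g s t} -> LS.θ f LS.≋ s LS.⊛ f -> LS.θ g LS.≋ t LS.⊛ g -> LS.θ (f LS.⊛ g) LS.≋ (s LS.⊕ t) LS.⊛ (f LS.⊛ g)
   log-der {f} {g} {s} {t} e e′ = LS.≋-trans (LS.θ-⊛ f g) (LS.≋-trans (LS.⊕-cong (LS.⊛-cong {g = g} e LS.≋-refl) (LS.⊛-cong {f} LS.≋-refl e′)) (LS.at (LR.solve 4 (\ s f g t -> (s LR.:* f) LR.:* g LR.:+ f LR.:* (t LR.:* g) LR.:= (s LR.:+ t) LR.:* (f LR.:* g)) LR.refl s f g t)))
  L-new : ∀ k l -> LS.θ (L k l) LS.≋ σ k l LS.⊛ L k l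
  L-new zero l zero = Z.zeroˡ _ Z.& Z.sym (Z.zeroˡ _)
  L-new zero l (suc i) = Z.zeroʳ _ Z.& Z.sym (LS.⊛-zeroˡ LS.𝟙 (suc i))
  L-new (suc k) l = log-der {pair l} {L k (NP.<⇒≤ l)} {S′ (suc k) (p∤suc l) LS.⊕ S′ (opposite k) (p∤opp l)} {σ k (NP.<⇒≤ l)} (log-der {c (suc k) (p∤suc l)} {c (opposite k) (p∤opp l)} {S′ (suc k) (p∤suc l)} {S′ (opposite k) (p∤opp l)} (new (suc k) (p∤suc l)) (new (opposite k) (p∤opp l))) (L-new k (NP.<⇒≤ l))
  G : ℕ -> ℕ -> Z.El
  G zero Θ = Z.0#
  G (suc k) Θ = (ζ Z.^ (suc k N.* Θ) Z.+ ζ Z.^ (opposite k N.* Θ)) Z.+ G k Θ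
  σ-G : ∀ k l j -> σ k l j ≈ DZ.sumPri j (\ {d} v e -> [ e N.* d NP.≟ j ] Z.* G k (T (pow v e)))
  σ-G zero l j = Z.sym (DZ.sumPri-0 j (\ {d} v e -> [ e N.* d NP.≟ j ] Z.* G 0 (T (pow v e))) (\ _ _ _ _ _ -> Z.zeroʳ _))
  σ-G (suc k) l j = Z.+-congˡ (σ-G k (NP.<⇒≤ l) j) Z.& Z.+-congʳ (Z.sym (DZ.sumPri-+ j (\ {d} v e -> [ e N.* d NP.≟ j ] Z.* ζ Z.^ (suc k N.* T (pow v e))) (\ {d} v e -> [ e N.* d NP.≟ j ] Z.* ζ Z.^ (opposite k N.* T (pow v e))))) Z.& Z.sym (DZ.sumPri-+ j (\ {d} v e -> [ e N.* d NP.≟ j ] Z.* ζ Z.^ (suc k N.* T (pow v e)) Z.+ [ e N.* d NP.≟ j ] Z.* ζ Z.^ (opposite k N.* T (pow v e))) (\ {d} v e -> [ e N.* d NP.≟ j ] Z.* G k (T (pow v e)))) Z.& DZ.sumPri-cong j {\ {d} v e -> ([ e N.* d NP.≟ j ] Z.* ζ Z.^ (suc k N.* T (pow v e)) Z.+ [ e N.* d NP.≟ j ] Z.* ζ Z.^ (opposite k N.* T (pow v e))) Z.+ [ e N.* d NP.≟ j ] Z.* G k (T (pow v e))} {\ {d} v e -> [ e N.* d NP.≟ j ] Z.* G (suc k) (T (pow v e))} (\ {d} v e _ _ _ -> Z.solve 4 (\ b x y z -> b Z.:* x Z.:+ b Z.:* y Z.:+ b Z.:* z Z.:= b Z.:*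 (x Z.:+ y Z.:+ z)) Z.refl [ e N.* d NP.≟ j ] (ζ Z.^ (suc k N.* T (pow v e))) (ζ Z.^ (opposite k N.* T (pow v e))) (G k (T (pow v e))))
  sumTo-spl : ∀ m n f -> sumTo (m N.+ n) f ≈ sumTo m f Z.+ sumTo n (\ i -> f (m N.+ i))
  sumTo-spl zero n f = Z.sym (Z.+-congʳ (Z.reflexive (sumTo-zero f)) Z.& Z.+-identityˡ _)
  sumTo-spl (suc m) n f = Z.reflexive (sumTo-suc (m N.+ n) f) Z.& Z.+-congˡ (sumTo-spl m n (f ∘ suc)) Z.& Z.sym (Z.+-assoc _ _ _) Z.& Z.+-congʳ (Z.sym (Z.reflexive (sumTo-suc m f)))
  G-sums : ∀ k Θ -> G k Θ ≈ sumTo k (\ i -> ζ Z.^ (suc i N.* Θ)) Z.+ sumTo k (\ i -> ζ Z.^ (opposite i N.* Θ))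
  G-sums zero Θ = Z.sym (Z.+-cong (Z.reflexive (sumTo-zero _)) (Z.reflexive (sumTo-zero _)) Z.& Z.+-identityʳ _)
  G-sums (suc k) Θ = Z.+-congˡ (G-sums k Θ) Z.& Z.solve 4 (\ x y a b -> x Z.:+ y Z.:+ (a Z.:+ b) Z.:= (a Z.:+ x) Z.:+ (b Z.:+ y)) Z.refl (ζ Z.^ (suc k N.* Θ)) (ζ Z.^ (opposite k N.* Θ)) (sumTo k (\ i -> ζ Z.^ (suc i N.* Θ))) (sumTo k (\ i -> ζ Z.^ (opposite i N.* Θ))) Z.& Z.sym (Z.+-cong (sumTo-snoc k (\ i -> ζ Z.^ (suc i N.* Θ))) (sumTo-snoc k (\ i -> ζ Z.^ (opposite i N.* Θ))))
  -- `opposite` runs through the upper half of the residues in decreasing order; after reversal the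
  -- two half sums join to the range from 1 to 2 H.
  G-all : ∀ Θ -> Z.1# Z.+ G H Θ ≈ sumTo p (\ a -> ζ Z.^ (a N.* Θ))
  G-all Θ = begin 1# + G H Θ ≈⟨ +-congˡ (G-sums H Θ) ⟩ 1# + (sumTo H (f ∘ suc) + sumTo H (f ∘ opposite)) ≈⟨ +-congˡ (+-congˡ (sumTo-rev H′ (f ∘ opposite) & sumTo-cong H (\ i l -> reflexive (ap f (ref i l))))) ⟩ 1# + (sumTo H (f ∘ suc) + sumTo H (\ i -> f (suc (H N.+ i)))) ≈⟨ +-congˡ (sumTo-spl H H (f ∘ suc)) ⟨ 1# + sumTo (H N.+ H) (f ∘ suc) ≡⟨ sumTo-suc (H N.+ H) f ⟨ sumTo (suc (H N.+ H)) f ≡⟨ ap (\ m -> sumTo m f) (! p-odd) ⟩ sumTo p f ∎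
   where
   open Z
   f : ℕ -> Carrier
   f a = ζ ^ (a N.* Θ)
   ref : ∀ i -> i < H -> opposite (H′ ∸ i) ≡ suc (H N.+ i)
   ref i (s≤s l) = NP.+-∸-assoc H {H} {H′ ∸ i} (NP.≤-trans (NP.m∸n≤m H′ i) (NP.n≤1+n H′)) ∙ ap (H N.+_) (NP.+-∸-assoc 1 (NP.m∸n≤m H′ i) ∙ ap suc (NP.m∸[m∸n]≡n l)) ∙ NP.+-suc H i
  -- The sum of ζ^(aΘ) over the nonzero residues a: the full sum is p or 0, and a = 0 contributes 1.
  weiℤ : ℕ -> ℤ
  weiℤ Θ = + p ℤ.* DI.[ p ∣ℕ? Θ ] ℤ.- + 1
  weiℤ-G : ∀ Θ -> Z.fromℤ (weiℤ Θ) ≈ G H Θ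
  weiℤ-G Θ = Z.fromℤ-+ (+ p ℤ.* DI.[ p ∣ℕ? Θ ]) (ℤ.- + 1) Z.& Z.+-cong (Z.fromℤ-* (+ p) DI.[ p ∣ℕ? Θ ] Z.& Z.*-congˡ (fromℤ-[] (p ∣ℕ? Θ))) (Z.fromℤ-neg (+ 1) Z.& Z.-‿cong fromℤ-1) Z.& Z.+-congʳ (value (p ∣ℕ? Θ) Z.& Z.sym (G-all Θ)) Z.& Z.solve 2 (\ o g -> o Z.:+ g Z.:- o Z.:= g) Z.refl Z.1# (G H Θ)
   where
   value : (d : Dec (p ∣ℕ Θ)) -> Z.fromℕ p Z.* [ d ] ≈ sumTo p (\ a -> ζ Z.^ (a N.* Θ))
   value d@(yes h) = Z.*-congˡ ([yes] d h) Z.& Z.*-identityʳ _ Z.& Z.sym (proj₁ (sum-ζ Θ) h)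
   value d@(no h) = Z.*-congˡ ([no] d h) Z.& Z.zeroʳ _ Z.& Z.sym (proj₂ (sum-ζ Θ) h)
  τ : ℕ -> ℤ
  τ j = DI.sumPri j (\ {d} v e -> DI.[ e N.* d NP.≟ j ] ℤ.* weiℤ (T (pow v e)))
  τ-0 : τ 0 ≡ + 0
  τ-0 = DI.sumTo-zero _
  τ-σ : ∀ j -> Z.fromℤ (τ j) ≈ σ H NP.≤-refl j
  τ-σ j = fromℤ-sumPri K j (\ {d} v e -> DI.[ e N.* d NP.≟ j ] ℤ.* weiℤ (T (pow v e))) Z.& DZ.sumPri-cong j {\ {d} v e -> Z.fromℤ (DI.[ e N.* d NP.≟ j ] ℤ.* weiℤ (T (pow v e)))} {\ {d} v e -> [ e N.* d NP.≟ j ] Z.* G H (T (pow v e))} (\ {d} v e _ _ _ -> (Z.fromℤ-* DI.[ e N.* d NP.≟ j ] (weiℤ (T (pow v e)))) Z.& Z.*-cong (fromℤ-[] (e N.* d NP.≟ j)) (weiℤ-G (T (pow v e)))) Z.& Z.sym (σ-G H NP.≤-refl j)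
  𝓛 : LS.Seq
  𝓛 = L H NP.≤-refl
  Integral : Z.El -> Set
  Integral x = Σ[ b ∈ ℤ ] x ≈ Z.fromℤ b
  private
   ⊛-int : ∀ k f g -> (∀ j -> j ≤ k -> Integral (f j)) -> (∀ j -> j ≤ k -> Integral (g j)) -> Integral ((f LS.⊛ g) k)
   ⊛-int zero f g F G = let (a , e) = F 0 z≤n ; (b , e′) = G 0 z≤n in a ℤ.* b , Z.*-cong e e′ Z.& Z.sym (Z.fromℤ-* a b)
   ⊛-int (suc k) f g F G = let (a , e) = F 0 z≤n ; (b , e′) = G (suc k) NP.≤-refl ; (s , e″) = ⊛-int k (f ∘ suc) g (\ j l -> F (suc j) (s≤s l)) (\ j l -> G j (NP.≤-trans l (NP.n≤1+n k))) in a ℤ.* b ℤ.+ s , Z.+-cong (Z.*-cong e e′ Z.& Z.sym (Z.fromℤ-* a b)) e″ Z.& Z.sym (Z.fromℤ-+ (a ℤ.* b) s)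
   -- Newton's identity expresses k + 1 times the next coefficient by integers, and `rat` divides by
   -- k + 1. This takes the place of invariance under the Galois group.
   int-step : ∀ k -> (∀ j -> j ≤ k -> Integral (𝓛 j)) -> Integral (𝓛 (suc k))
   int-step k ih = let (s , e) = ⊛-int k (LS.tail (σ H NP.≤-refl)) 𝓛 (\ j _ -> τ (suc j) , Z.sym (τ-σ (suc j))) ih in rat k s (𝓛 (suc k)) (L-new H NP.≤-refl (suc k) Z.& Z.+-congʳ (Z.*-congʳ (Z.sym (τ-σ 0) Z.& Z.reflexive (ap Z.fromℤ τ-0)) Z.& Z.zeroˡ _) Z.& Z.+-identityˡ _ Z.& e)
   int-bel : ∀ k j -> j ≤ k -> Integral (𝓛 j)
   int-bel zero .0 z≤n = + 1 , L-0 H NP.≤-refl Z.& Z.sym fromℤ-1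
   int-bel (suc k) j l = [ (\ l′ -> int-bel k j (NP.≤-pred l′)) , (\ { idp -> int-step k (int-bel k) }) ]′ (NP.m≤n⇒m<n∨m≡n l)
  a : ℕ -> ℤ
  a k = proj₁ (int-bel k k NP.≤-refl)
  a-𝓛 : ∀ k -> Z.fromℤ (a k) ≈ 𝓛 k
  a-𝓛 k = Z.sym (proj₂ (int-bel k k NP.≤-refl))
  a-0 : a 0 ≡ + 1
  a-0 = fromℤ-inj (a 0) (+ 1) (a-𝓛 0 Z.& L-0 H NP.≤-refl Z.& Z.sym fromℤ-1)
  a-top : a (H N.* (D N.+ D)) ≡ + (q N.^ (D N.* H))
  a-top = fromℤ-inj (a (H N.* (D N.+ D))) _ (a-𝓛 (H N.* (D N.+ D)) Z.& L-top H NP.≤-refl)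
  a-Deg : ∀ i -> H N.* (D N.+ D) < i -> a i ≡ + 0
  a-Deg i l = fromℤ-inj (a i) (+ 0) (a-𝓛 i Z.& L-Deg H NP.≤-refl i l)
  a-new : I.θ a I.≋ τ I.⊛ a
  a-new k = fromℤ-inj (I.θ a k) ((τ I.⊛ a) k) (fromℤ-θ a k Z.& Z.*-congˡ (a-𝓛 k) Z.& L-new H NP.≤-refl k Z.& LS.⊛-cong {σ H NP.≤-refl} {\ i -> Z.fromℤ (τ i)} {𝓛} {\ i -> Z.fromℤ (a i)} (\ i -> Z.sym (τ-σ i)) (\ i -> Z.sym (a-𝓛 i)) k Z.& Z.sym (fromℤ-⊛ τ a k))

open LPolynomials

-- Roots, power sums, and their transport along homomorphisms.

module RooOfPol where

 open N using (_≤_; _<_)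
 open import Data.Vec.Base using (map)

 module Roots (R : CommutativeRing 0ℓ 0ℓ) where
  open Kit R
  open PowSums R using (s; s-uni; s-pro; s-0)
  private
   module P = Pol R
   module S = Kit P.serRing
  evalMon : ∀ {k} -> Vec Carrier k -> Carrier -> Carrier
  evalMon [] y = 1#
  evalMon (a ∷ v) y = a + y * evalMon v y

  -- Division by X - r.
  synth : ∀ {k} -> Carrier -> Vec Carrier (suc k) -> Vec Carrier k
  synth {zero} r _ = []
  synth {suc k} r (a ∷ v) = evalMon v r ∷ synth r v
  eval-syn : ∀ {k} r (v : Vec Carrier (suc k)) y -> evalMon v y ≈ evalMon v r + (y - r) * evalMon (synth r v) y
  eval-syn {zero} r (a ∷ []) y = solve 3 (\ a r y -> a :+ y :* 1∶ := (a :+ r :* 1∶) :+ (y :- r) :* 1∶) refl a r y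
  eval-syn {suc k} r (a ∷ v) y = +-congˡ (*-congˡ (eval-syn r v y)) & solve 5 (\ a r y e w -> a :+ y :* (e :+ (y :- r) :* w) := (a :+ r :* e) :+ (y :- r) :* (e :+ y :* w)) refl a r y (evalMon v r) (evalMon (synth r v) y)
  lin : Carrier -> P.Seq
  lin r = P.mon (- r ∷ [])
  private
   ◃-X : ∀ a f -> (a P.◃ f) P.≋ P.const a P.⊕ (0# P.◃ P.𝟙) P.⊛ f
   ◃-X a f i = head-tail i & +-congˡ (sym (P.X-⊛ f i))
    where
    head-tail : ∀ i -> (a P.◃ f) i ≈ P.const a i + (0# P.◃ f) i
    head-tail zero = sym (+-identityʳ a)
    head-tail (suc i) = sym (+-identityˡ _)
   con-* : ∀ a b -> P.const a P.⊛ P.const b P.≋ P.const (a * b)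
   con-* a b zero = refl
   con-* a b (suc i) = P.con-⊛ a (P.const b) (suc i) & zeroʳ a
   con-+ : ∀ a b -> P.const (a + b) P.≋ P.const a P.⊕ P.const b
   con-+ a b zero = refl
   con-+ a b (suc i) = sym (+-identityˡ _)
   lin-X : ∀ r -> lin r P.≋ (P.⊖ P.const r) P.⊕ (0# P.◃ P.𝟙)
   lin-X r zero = sym (+-identityʳ _)
   lin-X r (suc i) = sym (+-congʳ -0#≈0# & +-identityˡ _)
   𝟙-con : P.𝟙 P.≋ P.const 1#
   𝟙-con zero = refl
   𝟙-con (suc i) = refl
  mon-syn : ∀ {k} r (v : Vec Carrier (suc k)) -> P.mon v P.≋ P.const (evalMon v r) P.⊕ lin r P.⊛ P.mon (synth r v)
  mon-syn r v = P.at (go r v)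
   where
   C : Carrier -> P.Seq
   C = P.const
   X = 0# P.◃ P.𝟙
   eval-∷ : ∀ {k} r a (v : Vec Carrier k) -> C (evalMon (a ∷ v) r) P.≈ˢ C a S.+ C r S.* C (evalMon v r)
   eval-∷ r a v = S.trans P.⟪ con-+ a (r * evalMon v r) ⟫ (S.+-congˡ {C a} (S.sym P.⟪ con-* r (evalMon v r) ⟫))
   go : ∀ {k} r (v : Vec Carrier (suc k)) -> P.mon v P.≈ˢ C (evalMon v r) S.+ lin r S.* P.mon (synth r v)
   go {zero} r (a ∷ []) = S.trans P.⟪ ◃-X a P.𝟙 ⟫ (S.sym (S.+-cong (eval-∷ r a [] S.& S.+-congˡ {C a} (S.*-congˡ {C r} (S.sym P.⟪ 𝟙-con ⟫))) (S.*-congʳ {P.𝟙} P.⟪ lin-X r ⟫) S.& S.solve 3 (\ a r x -> (a S.:+ r S.:* S.1∶) S.:+ (S.:- r S.:+ x) S.:* S.1∶ S.:= a S.:+ x S.:* S.1∶) S.refl (C a) (C r) X))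
   go {suc k} r (a ∷ v) = S.trans P.⟪ ◃-X a (P.mon v) ⟫ (S.+-congˡ {C a} (S.*-congˡ {X} (go r v S.& S.+-congˡ {C (evalMon v r)} (S.*-congʳ {P.mon (synth r v)} P.⟪ lin-X r ⟫))) S.& S.solve 5 (\ a r x e w -> a S.:+ x S.:* (e S.:+ (S.:- r S.:+ x) S.:* w) S.:= (a S.:+ r S.:* e) S.:+ (S.:- r S.:+ x) S.:* (e S.:+ x S.:* w)) S.refl (C a) (C r) X (C (evalMon v r)) (P.mon (synth r v)) S.& S.sym (S.+-cong (eval-∷ r a v) (S.*-cong P.⟪ lin-X r ⟫ P.⟪ ◃-X (evalMon v r) (P.mon (synth r v)) ⟫)))
  unit : ∀ {k} -> Vec Carrier k -> P.Seq
  unit {k} v = P.rev k (P.mon v)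
  unit-0 : ∀ {k} (v : Vec Carrier k) -> unit v 0 ≈ 1#
  unit-0 {k} v = P.rev-0 k (P.mon v) & proj₁ (P.mon-Mon v)
  unit-syn : ∀ {k} r (v : Vec Carrier (suc k)) -> evalMon v r ≈ 0# -> unit v P.≋ unit (- r ∷ []) P.⊛ unit (synth r v)
  unit-syn {k} r v e = P.≋-trans (P.rev-cong (suc k) (P.≋-trans (mon-syn r v) (P.≋-trans (P.⊕-cong c≋0 P.≋-refl) (\ i -> +-identityˡ _)))) (P.rev-⊛ 1 k (lin r) (P.mon (synth r v)) (proj₂ (P.mon-Mon (- r ∷ []))) (proj₂ (P.mon-Mon (synth r v))))
   where
   c≋0 : P.const (evalMon v r) P.≋ P.𝟘
   c≋0 zero = e
   c≋0 (suc i) = refl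
  s-lin : ∀ r j -> s (unit (- r ∷ [])) (suc j) ≈ r ^ suc j
  s-lin r j = sym (s-uni f u (unit-0 (- r ∷ [])) (P.≋-trans (P.⊛-comm f u) e) (suc j))
   where
   u = unit (- r ∷ [])
   f : P.Seq
   f = 0# P.◃ (\ j -> r ^ suc j)
   tail-u : P.tail u P.≋ P.const (- r)
   tail-u zero = refl
   tail-u (suc i) = refl
   e : u P.⊛ f P.≋ P.⊖ P.θ u
   e zero = solve 1 (\ u -> u :* 0∶ := :- (0∶ :* u)) refl 1#
   e (suc zero) = +-congˡ (P.⊛-cong {P.tail u} {P.const (- r)} {f} tail-u P.≋-refl 0 & P.con-⊛ (- r) f 0) & solve 1 (\ r -> 1∶ :* (r :* 1∶) :+ (:- r) :* 0∶ := :- ((1∶ :+ 0∶) :* (:- r))) refl r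
   e (suc (suc i)) = +-congˡ (P.⊛-cong {P.tail u} {P.const (- r)} {f} tail-u P.≋-refl (suc i) & P.con-⊛ (- r) f (suc i)) & solve 3 (\ r p k -> 1∶ :* (r :* p) :+ (:- r) :* p := :- (k :* 0∶)) refl r (r ^ suc i) (fromℕ (suc (suc i)))
  module _ (dom : ∀ x y -> x * y ≈ 0# -> x ≈ 0# ⊎ y ≈ 0#) where
   private
    oth-root : ∀ {k} (v : Vec Carrier (suc k)) r y -> ¬ (r ≈ y) -> evalMon v r ≈ 0# -> evalMon v y ≈ 0# -> evalMon (synth r v) y ≈ 0#
    oth-root v r y r≉y e e′ with dom (y - r) (evalMon (synth r v) y) (sym (+-identityˡ _) & +-congʳ (sym e) & sym (eval-syn r v y) & e′)
    ... | inj₁ d = ⊥-elim (r≉y (sym (from-dif d)))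
    ... | inj₂ d = d
   Distinct : ∀ {k} -> (Fin k -> Carrier) -> Set
   Distinct r = ∀ i j -> r i ≈ r j -> i ≡ j
   Dis-suc : ∀ {k} {r : Fin (suc k) -> Carrier} -> Distinct r -> Distinct (r ∘ Fin.suc)
   Dis-suc d i j e = FinP.suc-injective (d (Fin.suc i) (Fin.suc j) e)
   rest-roo : ∀ {k l} (v : Vec Carrier (suc k)) (r : Fin (suc l) -> Carrier) -> Distinct r -> (∀ i -> evalMon v (r i) ≈ 0#) -> ∀ i -> evalMon (synth (r Fin.zero) v) (r (Fin.suc i)) ≈ 0#
   rest-roo v r d h i = oth-root v (r Fin.zero) (r (Fin.suc i)) (\ e -> absurd (d Fin.zero (Fin.suc i) e)) (h Fin.zero) (h (Fin.suc i))
    where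
    absurd : Fin.zero ≡ Fin.suc i -> ⊥
    absurd ()
   too-many-roo : ¬ (1# ≈ 0#) -> ∀ {k} (v : Vec Carrier k) (r : Fin (suc k) -> Carrier) -> Distinct r -> ¬ (∀ i -> evalMon v (r i) ≈ 0#)
   too-many-roo 1≉0 [] r d h = 1≉0 (h Fin.zero)
   too-many-roo 1≉0 {suc k} v r d h = too-many-roo 1≉0 (synth (r Fin.zero) v) (r ∘ Fin.suc) (Dis-suc d) (rest-roo v r d h)
   s-roo : ∀ {k} (v : Vec Carrier k) (r : Fin k -> Carrier) -> Distinct r -> (∀ i -> evalMon v (r i) ≈ 0#) -> ∀ j -> s (unit v) (suc j) ≈ sum (\ i -> r i ^ suc j)
   s-roo [] r d h j = sym (s-uni P.𝟘 (unit []) refl (\ i -> P.⊛-zeroˡ (unit []) i & sym (-‿cong (zero-θ i) & -0#≈0#)) (suc j))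
    where
    zero-θ : ∀ i -> P.θ (unit []) i ≈ 0#
    zero-θ zero = zeroˡ _
    zero-θ (suc i) = zeroʳ _
   s-roo {suc k} v r d h j = begin s (unit v) (suc j) ≈⟨ s-cong′ (suc j) ⟩ s (unit (- r Fin.zero ∷ []) P.⊛ unit w) (suc j) ≈⟨ s-pro (unit (- r Fin.zero ∷ [])) (unit w) (unit-0 (- r Fin.zero ∷ [])) (unit-0 w) (suc j) ⟩ s (unit (- r Fin.zero ∷ [])) (suc j) + s (unit w) (suc j) ≈⟨ +-cong (s-lin (r Fin.zero) j) (s-roo w (r ∘ Fin.suc) (Dis-suc d) (rest-roo v r d h) j) ⟩ sum (\ i -> r i ^ suc j) ∎
    where
    w = synth (r Fin.zero) v
    u≋ : unit v P.≋ unit (- r Fin.zero ∷ []) P.⊛ unit w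
    u≋ = unit-syn (r Fin.zero) v (h Fin.zero)
    s-cong′ : s (unit v) P.≋ s (unit (- r Fin.zero ∷ []) P.⊛ unit w)
    s-cong′ = s-uni (s (unit v)) (unit (- r Fin.zero ∷ []) P.⊛ unit w) (sym (u≋ 0) & unit-0 v) (P.≋-trans (P.⊛-cong {s (unit v)} P.≋-refl (P.≋-sym u≋)) (P.≋-trans (PowSums.s-⊛ R (unit v) (unit-0 v)) (\ i -> -‿cong (*-congˡ (u≋ i)))))

 -- Ring homomorphisms commute with the power sums.
 module Transfer (R S : CommutativeRing 0ℓ 0ℓ) where
  private
   module R = Kit R
   module S = Kit S
  module Along (ι : R.El -> S.El) (ι-cong : ∀ {x y} -> x R.≈ y -> ι x S.≈ ι y) (ι-+ : ∀ x y -> ι (x R.+ y) S.≈ ι x S.+ ι y) (ι-* : ∀ x y -> ι (x R.* y) S.≈ ι x S.* ι y) (ι-1 : ι R.1# S.≈ S.1#) where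
   private
    module PR = Pol R
    module PS = Pol S
    module RR = Roots R
    module RS = Roots S
   open S using (_≈_)
   ι-0 : ι R.0# ≈ S.0#
   ι-0 = S.+-cancelˡ (ι R.0#) _ _ (S.sym (ι-+ R.0# R.0#) S.& ι-cong (R.+-identityʳ _) S.& S.sym (S.+-identityʳ _))
   ι-neg : ∀ x -> ι (R.- x) ≈ S.- ι x
   ι-neg x = S.from-dif (S.+-congˡ (S.-‿involutive (ι x)) S.& S.sym (ι-+ (R.- x) x) S.& ι-cong (R.-‿inverseˡ x) S.& ι-0)
   ι-fromℕ : ∀ n -> ι (R.fromℕ n) ≈ S.fromℕ n
   ι-fromℕ zero = ι-0
   ι-fromℕ (suc n) = ι-+ R.1# (R.fromℕ n) S.& S.+-cong ι-1 (ι-fromℕ n)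
   ι-^ : ∀ x n -> ι (x R.^ n) ≈ ι x S.^ n
   ι-^ x zero = ι-1
   ι-^ x (suc n) = ι-* x (x R.^ n) S.& S.*-congˡ (ι-^ x n)
   quot-ι : ∀ n {g u G U} -> (∀ i -> G i ≈ ι (g i)) -> (∀ i -> U i ≈ ι (u i)) -> PS.quot G U n ≈ ι (PR.quot g u n)
   quot-ι zero eg eu = eg 0
   quot-ι (suc n) {g} {u} {G} {U} eg eu = quot-ι n (\ i -> S.+-cong (eg (suc i)) (S.-‿cong (S.*-cong (eg 0) (eu (suc i)))) S.& S.sym (ι-+ (g (suc i)) (R.- (g 0 R.* u (suc i))) S.& S.+-congˡ (ι-neg (g 0 R.* u (suc i)) S.& S.-‿cong (ι-* (g 0) (u (suc i)))))) eu
   s-ι : ∀ {u U} -> (∀ i -> U i ≈ ι (u i)) -> ∀ n -> PowSums.s S U n ≈ ι (PowSums.s R u n)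
   s-ι {u} {U} eu n = quot-ι n {PR.⊖ PR.θ u} {u} (\ i -> S.-‿cong (S.*-cong (S.sym (ι-fromℕ i)) (eu i)) S.& S.sym (ι-neg (R.fromℕ i R.* u i) S.& S.-‿cong (ι-* (R.fromℕ i) (u i)))) eu
   mon-ι : ∀ {k} (v : Vec R.El k) i -> PS.mon (map ι v) i ≈ ι (PR.mon v i)
   mon-ι [] zero = S.sym ι-1
   mon-ι [] (suc i) = S.sym ι-0
   mon-ι (a ∷ v) zero = S.refl
   mon-ι (a ∷ v) (suc i) = mon-ι v i
   rev-ι : ∀ k {f F} -> (∀ i -> F i ≈ ι (f i)) -> ∀ i -> PS.rev k F i ≈ ι (PR.rev k f i)
   rev-ι zero e zero = e 0
   rev-ι zero e (suc i) = S.sym ι-0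
   rev-ι (suc k) e zero = e (suc k)
   rev-ι (suc k) e (suc i) = rev-ι k e i
   s-unit-ι : ∀ {k} (v : Vec R.El k) n -> PowSums.s S (RS.unit (map ι v)) n ≈ ι (PowSums.s R (RR.unit v) n)
   s-unit-ι {k} v = s-ι (rev-ι k (mon-ι v))

open RooOfPol

-- Traces and linear functionals on a finite field.

module FinFieTra where

 open N using (_≤_; _<_)
 open import Data.Nat.DivMod using (_%_; _/_; _mod_; m≡m%n+[m/n]*n; m%n<n; m<n⇒m%n≡m; m%n%n≡m%n; %-distribˡ-+)
 open import Data.Nat.Divisibility using () renaming (_∣_ to _∣ℕ_)
 open import Data.Nat.Divisibility using (∣⇒≤)
 open import Data.Fin.Base using (fromℕ<; inject≤; combine; remQuot)
 open import Data.Fin.Permutation using (permutation)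
 open import Data.Vec.Base using (zipWith; replicate; tabulate; lookup)
 import Data.Vec.Properties as VecP
 open import Function.Bundles using (Inverse)

 -- Polynomial functions given by their coefficients.
 module PolFun (R : CommutativeRing 0ℓ 0ℓ) where
  open Kit R
  open Roots R using (evalMon)
  IsLow : ℕ -> (Carrier -> Carrier) -> Set
  IsMon : ℕ -> (Carrier -> Carrier) -> Set
  evalLow : ∀ {k} -> Vec Carrier k -> Carrier -> Carrier
  evalLow [] y = 0#
  evalLow (a ∷ v) y = a + y * evalLow v y
  IsLow k f = Σ[ v ∈ Vec Carrier k ] ∀ y -> evalLow v y ≈ f y
  IsMon k f = Σ[ v ∈ Vec Carrier k ] ∀ y -> evalMon v y ≈ f y
  low-0 : ∀ k -> IsLow k (\ _ -> 0#)
  low-0 zero = [] , \ y -> refl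
  low-0 (suc k) = let (v , e) = low-0 k in 0# ∷ v , \ y -> +-congˡ (*-congˡ (e y) & zeroʳ y) & +-identityˡ _
  low-^ : ∀ k j -> j < k -> IsLow k (_^ j)
  low-^ (suc k) zero l = let (v , e) = low-0 k in 1# ∷ v , \ y -> +-congˡ (*-congˡ (e y) & zeroʳ y) & +-identityʳ _
  low-^ (suc k) (suc j) (s≤s l) = let (v , e) = low-^ k j l in 0# ∷ v , \ y -> +-identityˡ _ & *-congˡ (e y)
  low-+ : ∀ {k f g} -> IsLow k f -> IsLow k g -> IsLow k (\ y -> f y + g y)
  low-+ (v , e) (w , e′) = zipWith _+_ v w , \ y -> add v w y & +-cong (e y) (e′ y)
   where
   add : ∀ {k} (v w : Vec Carrier k) y -> evalLow (zipWith _+_ v w) y ≈ evalLow v y + evalLow w y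
   add [] [] y = sym (+-identityʳ _)
   add (a ∷ v) (b ∷ w) y = +-congˡ (*-congˡ (add v w y)) & solve 5 (\ a b y s t -> a :+ b :+ y :* (s :+ t) := (a :+ y :* s) :+ (b :+ y :* t)) refl a b y _ _
  low-neg : ∀ {k f} -> IsLow k f -> IsLow k (\ y -> - f y)
  low-neg (v , e) = Data.Vec.Base.map -_ v , \ y -> neg v y & -‿cong (e y)
   where
   import Data.Vec.Base
   neg : ∀ {k} (v : Vec Carrier k) y -> evalLow (Data.Vec.Base.map -_ v) y ≈ - evalLow v y
   neg [] y = sym -0#≈0#
   neg (a ∷ v) y = +-congˡ (*-congˡ (neg v y)) & solve 3 (\ a y s -> :- a :+ y :* (:- s) := :- (a :+ y :* s)) refl a y _
  mon-^ : ∀ {k g} -> IsLow k g -> IsMon k (\ y -> g y + y ^ k)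
  mon-^ (v , e) = v , \ y -> add v y & +-congʳ (e y)
   where
   add : ∀ {k} (v : Vec Carrier k) y -> evalMon v y ≈ evalLow v y + y ^ k
   add [] y = sym (+-identityˡ _)
   add (a ∷ v) y = +-congˡ (*-congˡ (add v y)) & solve 4 (\ a y s t -> a :+ y :* (s :+ t) := (a :+ y :* s) :+ y :* t) refl a y _ _

 module Tra (R : CommutativeRing 0ℓ 0ℓ) {p : ℕ} (pr : Prime p) (char : CommutativeRing._≈_ R (Kit.fromℕ R p) (CommutativeRing.0# R)) where
  open Kit R
  open Fro R pr char public
  open PolFun R
  tr : ℕ -> Carrier -> Carrier
  tr zero y = 0#
  tr (suc N) y = tr N y + Frob N y
  tr-cong : ∀ N {x y} -> x ≈ y -> tr N x ≈ tr N y
  tr-cong zero e = refl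
  tr-cong (suc N) e = +-cong (tr-cong N e) (Frob-cong N e)
  tr-+ : ∀ N x y -> tr N (x + y) ≈ tr N x + tr N y
  tr-+ zero x y = sym (+-identityʳ _)
  tr-+ (suc N) x y = +-cong (tr-+ N x y) (Frob-+ N x y) & solve 4 (\ a b c d -> (a :+ b) :+ (c :+ d) := (a :+ c) :+ (b :+ d)) refl _ _ _ _
  tr-0 : ∀ N -> tr N 0# ≈ 0#
  tr-0 N = +-cancelˡ (tr N 0#) _ _ (sym (tr-+ N 0# 0#) & tr-cong N (+-identityʳ _) & sym (+-identityʳ _))
  tr-con : ∀ N M y -> tr (N N.+ M) y ≈ tr N y + tr M (Frob N y)
  tr-con N zero y = reflexive (ap (\ k -> tr k y) (NP.+-identityʳ N)) & sym (+-identityʳ _)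
  tr-con N (suc M) y = reflexive (ap (\ k -> tr k y) (NP.+-suc N M)) & +-cong (tr-con N M y) (sym (Frob-∘ M N y)) & +-assoc _ _ _
  tr-per : ∀ N e y -> Frob N y ≈ y -> tr (e N.* N) y ≈ fromℕ e * tr N y
  tr-per N zero y h = sym (zeroˡ _)
  tr-per N (suc e) y h = tr-con N (e N.* N) y & +-congˡ (tr-cong (e N.* N) h & tr-per N e y h) & solve 2 (\ t e -> t :+ e :* t := (1∶ :+ e) :* t) refl (tr N y) (fromℕ e)
  -- Transitivity of the trace: the powers of Frobenius below d N are grouped into d blocks of
  -- length N.
  tr-blo : ∀ d N y -> tr (d N.* N) y ≈ tr N (sum {d} (\ t -> Frob (toℕ t N.* N) y))
  tr-blo zero N y = sym (tr-0 N)
  tr-blo (suc d) N y = tr-con N (d N.* N) y & +-cong (tr-cong N (sym (*-identityʳ y))) (tr-blo d N (Frob N y) & tr-cong N (sum-cong-≋ {d} (\ t -> Frob-∘ (toℕ t N.* N) N y))) & sym (tr-+ N _ _)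
  tr-Frob : ∀ N y -> Frob 1 (tr N y) + y ≈ tr N y + Frob N y
  tr-Frob zero y = +-cong (Frob-0 1) (sym (*-identityʳ y))
  tr-Frob (suc N) y = +-congʳ (Frob-+ 1 _ _ & +-congˡ (Frob-∘ 1 N y & reflexive (ap (\ k -> Frob k y) (NP.+-comm N 1)))) & solve 3 (\ a b c -> a :+ b :+ c := (a :+ c) :+ b) refl _ _ _ & +-congʳ (tr-Frob N y)
  -- Frobenius permutes the summands cyclically.
  tr-fix : ∀ N y -> Frob N y ≈ y -> Frob 1 (tr N y) ≈ tr N y
  tr-fix N y h = +-cancelʳ y _ _ (tr-Frob N y & +-congˡ h)
  tr-low : ∀ N k -> (∀ j -> j < N -> p N.^ j < k) -> IsLow k (tr N)
  tr-low zero k h = low-0 k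
  tr-low (suc N) k h = low-+ (tr-low N k (\ j l -> h j (NP.m<n⇒m<1+n l))) (low-^ k (p N.^ N) (h N NP.≤-refl))
  tr-mon : ∀ N -> IsMon (p N.^ N) (tr (suc N))
  tr-mon N = mon-^ (tr-low N (p N.^ N) (\ j l -> NP.^-monoʳ-< p (pri>1 pr) l))

 -- An additive map on 𝔽_p^m is determined by the images of the unit vectors.
 module AddVec (G : CommutativeRing 0ℓ 0ℓ) (p : ℕ) .{{_ : NonZero p}} where
  open Kit G
  basis : ∀ {m} -> Fin m -> Vec (Fin p) m
  basis {suc m} Fin.zero = (1 mod p) ∷ replicate m (0 mod p)
  basis {suc m} (Fin.suc i) = (0 mod p) ∷ basis i
  toℕ-mod : ∀ a -> toℕ (a mod p) ≡ a % p
  toℕ-mod a = FinP.toℕ-fromℕ< (m%n<n a p)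
  mod-+ : ∀ a b -> (a mod p) +ₚ (b mod p) ≡ (a N.+ b) mod p
  mod-+ a b = FinP.toℕ-injective (toℕ-mod _ ∙ ap₂ (\ x y -> (x N.+ y) % p) (toℕ-mod a) (toℕ-mod b) ∙ ! (%-distribˡ-+ a b p) ∙ ! (toℕ-mod _))
  mod-toℕ : ∀ (c : Fin p) -> toℕ c mod p ≡ c
  mod-toℕ c = FinP.toℕ-injective (toℕ-mod _ ∙ m<n⇒m%n≡m (FinP.toℕ<n c))
  private
   0+ : ∀ c -> (0 mod p) +ₚ c ≡ c
   0+ c = ap ((0 mod p) +ₚ_) (! (mod-toℕ c)) ∙ mod-+ 0 (toℕ c) ∙ mod-toℕ c
   +0 : ∀ c -> c +ₚ (0 mod p) ≡ c
   +0 c = ap (_+ₚ (0 mod p)) (! (mod-toℕ c)) ∙ mod-+ (toℕ c) 0 ∙ ap (_mod p) (NP.+-identityʳ (toℕ c)) ∙ mod-toℕ c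
   zer+ : ∀ {m} (v : Vec (Fin p) m) -> zipWith _+ₚ_ (replicate m (0 mod p)) v ≡ v
   zer+ [] = idp
   zer+ (c ∷ v) = ap₂ _∷_ (0+ c) (zer+ v)
   ide-0 : ∀ {x} -> x ≈ x + x -> x ≈ 0#
   ide-0 {x} e = +-cancelˡ x _ _ (sym e & sym (+-identityʳ x))
  vanishes : ∀ {m} (F : Vec (Fin p) m -> Carrier) -> (∀ u v -> F (zipWith _+ₚ_ u v) ≈ F u + F v) -> (∀ i -> F (basis i) ≈ 0#) -> ∀ v -> F v ≈ 0#
  vanishes F F-+ F-basis [] = ide-0 (F-+ [] [])
  vanishes {suc m} F F-+ F-basis (c ∷ v) = reflexive (ap F (! (ap₂ _∷_ (+0 c) (zer+ v)))) & F-+ (c ∷ O) ((0 mod p) ∷ v) & +-cong head (vanishes (\ w -> F ((0 mod p) ∷ w)) tail-+ (\ i -> F-basis (Fin.suc i)) v) & +-identityʳ _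
   where
   O = replicate m (0 mod p)
   tail-+ : ∀ u v -> F ((0 mod p) ∷ zipWith _+ₚ_ u v) ≈ F ((0 mod p) ∷ u) + F ((0 mod p) ∷ v)
   tail-+ u v = reflexive (ap (\ z -> F (z ∷ zipWith _+ₚ_ u v)) (! (0+ (0 mod p)))) & F-+ _ _
   multiples : ∀ k -> F ((k mod p) ∷ O) ≈ 0#
   multiples zero = ide-0 (reflexive (ap F (! (ap₂ _∷_ (0+ (0 mod p)) (zer+ O)))) & F-+ _ _)
   multiples (suc k) = reflexive (ap F (! (ap₂ _∷_ (mod-+ 1 k) (zer+ O)))) & F-+ _ _ & +-cong (F-basis Fin.zero) (multiples k) & +-identityʳ _
   head : F (c ∷ O) ≈ 0#
   head = reflexive (ap (\ z -> F (z ∷ O)) (! (mod-toℕ c))) & multiples (toℕ c)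

 module FieFac {p m : ℕ} (pr : Prime p) .{{_ : NonZero p}} (K : FiniteField (p N.^ m)) (φ : Coordinates K p m) where
  q : ℕ
  q = p N.^ m
  open Factorisation K using (module K; elt; idx; elt-idx; idx-elt; _≟ᴷ_; inverse; 1≢0)
  open K using (_≈_; _*_; _+_; 0#; 1#; fromℕ)
  dom : ∀ x y -> x * y ≡ 0# -> x ≡ 0# ⊎ y ≡ 0#
  dom x y e with x ≟ᴷ 0#
  ... | yes x≡0 = inj₁ x≡0
  ... | no x≢0 = inj₂ (! (K.*-identityˡ y) ∙ ap (_* y) (! (proj₂ (inverse x x≢0))) ∙ K.solve 3 (\ x i y -> (x K.:* i) K.:* y K.:= i K.:* (x K.:* y)) idp x (proj₁ (inverse x x≢0)) y ∙ ap (proj₁ (inverse x x≢0) *_) e ∙ K.zeroʳ _)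
  finDom : FinDom (fieRing K) q
  finDom = record { dom = dom ; 1≉0 = 1≢0 ; rep = elt ; index = idx ; ind-cong = ap idx ; rep-ind = elt-idx ; ind-rep = idx-elt }

  -- Translation by 1 permutes K, so the sum of all elements is unchanged by adding q · 1.
  private
   q≡0 : fromℕ q ≡ 0#
   q≡0 = K.+-cancelˡ (K.sum elt) _ _ (begin sum elt + fromℕ q ≈⟨ +-congˡ (sum-replicate q) ⟨ sum elt + sum {q} (\ _ -> 1#) ≈⟨ ∑-distrib-+ {q} elt (\ _ -> 1#) ⟨ sum {q} (\ i -> elt i + 1#) ≈⟨ sum-cong-≋ {q} (\ i -> elt-idx (elt i + 1#)) ⟨ sum {q} (\ i -> elt (idx (elt i + 1#))) ≈⟨ sum-permute elt (permutation (\ i -> idx (elt i + 1#)) (\ i -> idx (elt i + - 1#)) (\ i -> move (- 1#) 1# (-‿inverseˡ 1#) i) (\ i -> move 1# (- 1#) (-‿inverseʳ 1#) i)) ⟨ sum elt ≈⟨ +-identityʳ _ ⟨ sum elt + 0# ∎)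
    where
    open K
    move : ∀ x y -> x + y ≡ 0# -> ∀ i -> idx (elt (idx (elt i + x)) + y) ≡ i
    move x y e i = ap idx (ap (_+ y) (elt-idx _) ∙ K.+-assoc _ x y ∙ ap (\ z -> elt i + z) e ∙ K.+-identityʳ _) ∙ idx-elt i
   pow-0 : ∀ k -> fromℕ (p N.^ k) ≡ 0# -> fromℕ p ≡ 0#
   pow-0 zero e = ⊥-elim (1≢0 (! (K.+-identityʳ 1#) ∙ e))
   pow-0 (suc k) e with dom (fromℕ p) (fromℕ (p N.^ k)) (! (K.fromℕ-* p (p N.^ k)) ∙ e)
   ... | inj₁ d = d
   ... | inj₂ d = pow-0 k d
  char : fromℕ p ≡ 0#
  char = pow-0 m q≡0
  open Tra (fieRing K) pr char public
  open PolFun (fieRing K)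
  open Roots (fieRing K) using (too-many-roo; evalMon)
  open ModPri pr using (invMod)
  Frob-m : ∀ x -> Frob m x ≡ x
  Frob-m = Fer.fer (fieRing K) q finDom
  fromℕ-% : ∀ a -> fromℕ a ≡ fromℕ (a % p)
  fromℕ-% a = ap fromℕ (m≡m%n+[m/n]*n a p) ∙ K.fromℕ-+ (a % p) _ ∙ ap (fromℕ (a % p) +_) (K.fromℕ-* (a / p) p ∙ ap (fromℕ (a / p) *_) char ∙ K.zeroʳ _) ∙ K.+-identityʳ _
  fromℕ-mod : ∀ {a b} -> a % p ≡ b % p -> fromℕ a ≡ fromℕ b
  fromℕ-mod {a} {b} e = fromℕ-% a ∙ ap fromℕ e ∙ ! (fromℕ-% b)
  fromℕ≢0 : ∀ a -> ¬ (p ∣ℕ a) -> fromℕ a ≢ 0#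
  fromℕ≢0 a p∤a e with invMod a p∤a
  ... | i , ai≡1 = 1≢0 (! (K.+-identityʳ 1#) ∙ fromℕ-mod {1} {a N.* i} (m<n⇒m%n≡m (pri>1 pr) ∙ ! ai≡1) ∙ K.fromℕ-* a i ∙ ap (_* fromℕ i) e ∙ K.zeroˡ _)
  fromℕ-injective : ∀ {a b} -> a < p -> b < p -> fromℕ a ≡ fromℕ b -> a ≡ b
  fromℕ-injective {a} {b} a<p b<p e = [ (\ l -> go l b<p e) , (\ l -> ! (go l a<p (! e))) ]′ (NP.≤-total a b)
   where
   go : ∀ {a b} -> a ≤ b -> b < p -> fromℕ a ≡ fromℕ b -> a ≡ b
   go {a} {b} a≤b b<p e with b ∸ a in eq
   ... | zero = NP.≤-antisym a≤b (NP.m∸n≡0⇒m≤n eq)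
   ... | suc t = ⊥-elim (fromℕ≢0 (suc t) (\ d -> NP.<⇒≱ (NP.≤-<-trans (NP.≤-trans (NP.≤-reflexive (! eq)) (NP.m∸n≤m b a)) b<p) (∣⇒≤ d)) (K.+-cancelˡ (fromℕ a) _ _ (! (K.fromℕ-+ a (suc t)) ∙ ap fromℕ (ap (a N.+_) (! eq) ∙ NP.m+[n∸m]≡n a≤b) ∙ ! e ∙ ! (K.+-identityʳ _))))
  -- The prime field already provides p roots of y^p - y; a further fixed element would be one too
  -- many.
  pri-fie : ∀ y -> Frob 1 y ≡ y -> Σ[ c ∈ Fin p ] fromℕ (toℕ c) ≡ y
  pri-fie y h with FinP.any? {p} (\ c -> fromℕ (toℕ c) ≟ᴷ y)
  ... | yes r = r
  ... | no nr = ⊥-elim (too-many-roo dom 1≢0 (proj₁ poly) roots distinct (\ i -> proj₂ poly (roots i) ∙ is-root i))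
   where
   poly : IsMon p (\ y -> K.- (y K.^ 1) + y K.^ p)
   poly = mon-^ (low-neg (low-^ p 1 (pri>1 pr)))
   roots : Fin (suc p) -> K.El
   roots Fin.zero = y
   roots (Fin.suc c) = fromℕ (toℕ c)
   distinct : ∀ i j -> roots i ≡ roots j -> i ≡ j
   distinct Fin.zero Fin.zero e = idp
   distinct Fin.zero (Fin.suc j) e = ⊥-elim (nr (j , ! e))
   distinct (Fin.suc i) Fin.zero e = ⊥-elim (nr (i , e))
   distinct (Fin.suc i) (Fin.suc j) e = ap Fin.suc (FinP.toℕ-injective (fromℕ-injective (FinP.toℕ<n i) (FinP.toℕ<n j) e))
   fixed : ∀ z -> Frob 1 z ≡ z -> K.- (z K.^ 1) + z K.^ p ≡ 0#
   fixed z e = ap₂ (\ s t -> K.- s + t) (K.*-identityʳ z) (ap (z K.^_) (! (NP.*-identityʳ p)) ∙ e) ∙ K.-‿inverseˡ z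
   is-root : ∀ i -> K.- (roots i K.^ 1) + roots i K.^ p ≡ 0#
   is-root Fin.zero = fixed y h
   is-root (Fin.suc c) = fixed _ (Frob-fromℕ 1 (toℕ c))
  m≥1 : Σ[ m′ ∈ ℕ ] m ≡ suc m′
  m≥1 = go m idp
   where
   go : ∀ k -> m ≡ k -> Σ[ m′ ∈ ℕ ] m ≡ suc m′
   go (suc k) e = k , e
   go zero e = ⊥-elim (1≢0 (! (elt-idx 1#) ∙ ap elt (all-equ (ap (p N.^_) e) (idx 1#) (idx 0#)) ∙ elt-idx 0#))
    where
    all-equ : ∀ {n} -> n ≡ 1 -> (i j : Fin n) -> i ≡ j
    all-equ idp Fin.zero Fin.zero = idp
  -- The trace is a monic polynomial of degree p^(m-1) < q in its argument, so it cannot vanish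
  -- everywhere.
  tr-nonzero : (∀ z -> tr m z ≡ 0#) -> ⊥
  tr-nonzero h = too-many-roo dom 1≢0 (proj₁ (tr-mon m′)) (elt ∘ small) (\ i j e -> FinP.inject≤-injective _ _ i j (! (idx-elt _) ∙ ap idx e ∙ idx-elt _)) (\ i -> proj₂ (tr-mon m′) _ ∙ ap (\ k -> tr k (elt (small i))) (! (proj₂ m≥1)) ∙ h _)
   where
   m′ = proj₁ m≥1
   small : Fin (suc (p N.^ m′)) -> Fin q
   small i = inject≤ i (≡.subst (\ k -> p N.^ m′ < p N.^ k) (! (proj₂ m≥1)) (NP.^-monoʳ-< p (pri>1 pr) {m′} {suc m′} NP.≤-refl))
  tr-non : ∀ b -> (∀ y -> tr m (b * y) ≡ 0#) -> b ≡ 0#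
  tr-non b h with b ≟ᴷ 0#
  ... | yes e = e
  ... | no b≢0 = ⊥-elim (tr-nonzero (\ z -> ap (tr m) (! (K.sym (K.*-assoc b _ z) K.& K.*-congʳ (proj₂ (inverse b b≢0)) K.& K.*-identityˡ z)) ∙ h (proj₁ (inverse b b≢0) * z)))
  private
   open Coordinates φ
   open AddVec (fieRing K) p
   from : Vec (Fin p) m -> K.El
   from = Inverse.from coordIso
   from-coo : ∀ x -> from (coord x) ≡ x
   from-coo = Inverse.strictlyInverseʳ coordIso
   coo-from : ∀ v -> coord (from v) ≡ v
   coo-from = Inverse.strictlyInverseˡ coordIso
   from-+ : ∀ u v -> from (zipWith _+ₚ_ u v) ≡ from u + from v
   from-+ u v = ap from (! (additive (from u) (from v) ∙ ap₂ (zipWith _+ₚ_) (coo-from u) (coo-from v))) ∙ from-coo _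
   agree : (h h′ : K.El -> K.El) -> (∀ x y -> h (x + y) ≡ h x + h y) -> (∀ x y -> h′ (x + y) ≡ h′ x + h′ y) -> (∀ i -> h (from (basis i)) ≡ h′ (from (basis i))) -> ∀ y -> h y ≡ h′ y
   agree h h′ h-+ h′-+ e y = K.from-dif (ap (\ z -> h z K.- h′ z) (! (from-coo y)) ∙ vanishes (\ v -> h (from v) K.- h′ (from v)) (\ u v -> ap₂ K._-_ (ap h (from-+ u v) ∙ h-+ _ _) (ap h′ (from-+ u v) ∙ h′-+ _ _) ∙ K.solve 4 (\ a b c d -> (a K.:+ b) K.:- (c K.:+ d) K.:= (a K.:- c) K.:+ (b K.:- d)) idp (h (from u)) (h (from v)) (h′ (from u)) (h′ (from v))) (\ i -> K.to-dif (e i)) (coord y))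
   value : ∀ y -> Σ[ c ∈ Fin p ] fromℕ (toℕ c) ≡ tr m y
   value y = pri-fie (tr m y) (tr-fix m y (Frob-m y))
   tr-*-+ : ∀ a x y -> tr m (a * (x + y)) ≡ tr m (a * x) + tr m (a * y)
   tr-*-+ a x y = ap (tr m) (K.distribˡ a x y) ∙ tr-+ m _ _
   values : K.El -> Vec (Fin p) m
   values a = tabulate (\ i -> proj₁ (value (a * from (basis i))))
   code : Fin q -> Fin q
   code i = idx (from (values (elt i)))
   from-injective : ∀ {i j} -> idx (from i) ≡ idx (from j) -> i ≡ j
   from-injective {i} {j} e = ! (coo-from i) ∙ ap coord (! (elt-idx _) ∙ ap elt e ∙ elt-idx _) ∙ coo-from j
   tab-inj : ∀ {n} {f g : Fin n -> Fin p} -> tabulate f ≡ tabulate g -> ∀ i -> f i ≡ g i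
   tab-inj {f = f} {g} e i = ! (VecP.lookup∘tabulate f i) ∙ ap (\ v -> lookup v i) e ∙ VecP.lookup∘tabulate g i
   val-inj : ∀ a b -> values a ≡ values b -> a ≡ b
   val-inj a b e = K.from-dif (tr-non (a K.- b) (\ y -> ap (tr m) (K.solve 3 (\ a b y -> (a K.:- b) K.:* y K.:= a K.:* y K.:+ (K.:- b) K.:* y) idp a b y) ∙ tr-+ m _ _ ∙ ap (_+ tr m (K.- b * y)) (agree (\ y -> tr m (a * y)) (\ y -> tr m (b * y)) (tr-*-+ a) (tr-*-+ b) same y) ∙ ! (tr-+ m _ _) ∙ ap (tr m) (K.solve 2 (\ b y -> b K.:* y K.:+ (K.:- b) K.:* y K.:= K.0∶) idp b y) ∙ tr-0 m))
    where
    same : ∀ i -> tr m (a * from (basis i)) ≡ tr m (b * from (basis i))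
    same i = ! (proj₂ (value _)) ∙ ap (fromℕ ∘ toℕ) (tab-inj e i) ∙ proj₂ (value _)
   code-inj : ∀ {i j} -> code i ≡ code j -> i ≡ j
   code-inj {i} {j} e = ! (idx-elt i) ∙ ap idx (val-inj _ _ (from-injective e)) ∙ idx-elt j

  -- By counting, every functional on K has the form y ↦ Tr(a y).
  tra-form : ∀ (λ′ : Add K p) -> Σ[ a ∈ K.El ] ∀ y -> tr m (a * y) ≡ fromℕ (Add.fun λ′ y)
  tra-form λ′ = found (inj⇒sur code code-inj (idx (from tar)))
   where
   open Add λ′
   tar : Vec (Fin p) m
   tar = tabulate (\ i -> fun (from (basis i)) mod p)
   found : Σ[ i ∈ Fin q ] code i ≡ idx (from tar) -> Σ[ a ∈ K.El ] ∀ y -> tr m (a * y) ≡ fromℕ (fun y)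
   found (i , e) = a , agree (\ y -> tr m (a * y)) (fromℕ ∘ fun) (tr-*-+ a) (\ x y -> fromℕ-mod {fun (x + y)} {fun x N.+ fun y} (fun-+ x y) ∙ K.fromℕ-+ (fun x) (fun y)) (\ k -> ! (proj₂ (value _)) ∙ ap (fromℕ ∘ toℕ) (tab-inj (from-injective e) k) ∙ ap fromℕ (toℕ-mod (fun (from (basis k)))) ∙ ! (fromℕ-% (fun (from (basis k)))))
    where a = elt i

open FinFieTra

-- Residue fields and the trace of f at a prime.

module ResidueFields where

 open N using (_≤_; _<_)
 open import Data.Fin.Base using (inject≤; combine; remQuot)
 open import Data.Vec.Base using (map)
 open import Relation.Binary.Definitions using (tri<; tri≈; tri>)

 module VecInd {q : ℕ} (K : FiniteField q) where
  open Factorisation K using (module K; elt; idx; elt-idx; idx-elt)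
  vecInd : ∀ {k} -> Vec K.El k -> Fin (q N.^ k)
  vecInd [] = Fin.zero
  vecInd (a ∷ v) = combine (idx a) (vecInd v)
  vecAt : ∀ k -> Fin (q N.^ k) -> Vec K.El k
  vecAt zero i = []
  vecAt (suc k) i = elt (proj₁ (remQuot {q} (q N.^ k) i)) ∷ vecAt k (proj₂ (remQuot {q} (q N.^ k) i))
  vecAt-ind : ∀ {k} (v : Vec K.El k) -> vecAt k (vecInd v) ≡ v
  vecAt-ind [] = idp
  vecAt-ind {suc k} (a ∷ v) = ap (\ t -> elt (proj₁ t) ∷ vecAt k (proj₂ t)) (FinP.remQuot-combine {q} {q N.^ k} (idx a) (vecInd v)) ∙ ap₂ _∷_ (elt-idx a) (vecAt-ind v)
  vecInd-at : ∀ k i -> vecInd (vecAt k i) ≡ i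
  vecInd-at zero Fin.zero = idp
  vecInd-at (suc k) i = ap₂ (combine {q}) (idx-elt _) (vecInd-at k _) ∙ FinP.combine-remQuot {q} (q N.^ k) i

 -- A finite extension E = K[x] of K, with v(x) = 0.
 module Ext {p m : ℕ} (pr : Prime p) .{{_ : NonZero p}} (K : FiniteField (p N.^ m)) (φ : Coordinates K p m) (E : CommutativeRing 0ℓ 0ℓ) where
  private
   module E = Kit E
   module K = Kit (fieRing K)
  module Over {d : ℕ} (1≤d : 1 ≤ d) (F : FinDom E ((p N.^ m) N.^ d)) (ι : K.El -> E.El) (ι-+ : ∀ x y -> ι (x K.+ y) E.≈ ι x E.+ ι y) (ι-* : ∀ x y -> ι (x K.* y) E.≈ ι x E.* ι y) (ι-1 : ι K.1# E.≈ E.1#) (x : E.El) (gen : ∀ y -> Σ[ w ∈ Vec K.El d ] PolFun.evalLow E (map ι w) x E.≈ y) (v : Vec K.El d) (root : Roots.evalMon E (map ι v) x E.≈ E.0#) where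
   open FieFac pr K φ using (q; char; Frob-m; m≥1)
   private
    module FF = FieFac pr K φ
   open E using (_≈_)
   open FinDom F
   open Transfer.Along (fieRing K) E ι (\ e -> E.reflexive (ap ι e)) ι-+ ι-* ι-1
   open PolFun E
   charE : E.fromℕ p ≈ E.0#
   charE = E.sym (ι-fromℕ p) E.& E.reflexive (ap ι char) E.& ι-0
   open Tra E pr charE public
   open Roots E
   frob-q^d : ∀ y -> Frob (d N.* m) y ≈ y
   frob-q^d y = E.reflexive (ap (y E.^_) (ap (p N.^_) (NP.*-comm d m) ∙ ! (NP.^-*-assoc p m d))) E.& Fer.fer E _ F y
   FrobK-blo : ∀ t a -> FF.Frob (t N.* m) a ≡ a
   FrobK-blo zero a = K.*-identityʳ a
   FrobK-blo (suc t) a = ! (FF.Frob-∘ (t N.* m) m a) ∙ ap (FF.Frob (t N.* m)) (Frob-m a) ∙ FrobK-blo t a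
   Frob-ι : ∀ t a -> Frob (t N.* m) (ι a) ≈ ι a
   Frob-ι t a = E.sym (ι-^ a (p N.^ (t N.* m))) E.& E.reflexive (ap ι (FrobK-blo t a))
   Frob-evalMon : ∀ t {k} (w : Vec K.El k) y -> Frob (t N.* m) (evalMon (map ι w) y) ≈ evalMon (map ι w) (Frob (t N.* m) y)
   Frob-evalMon t [] y = Frob-1 (t N.* m)
   Frob-evalMon t (a ∷ w) y = Frob-+ (t N.* m) _ _ E.& E.+-cong (Frob-ι t a) (Frob-* (t N.* m) _ _ E.& E.*-congˡ (Frob-evalMon t w y))
   Frob-evalLow : ∀ t {k} (w : Vec K.El k) y -> Frob (t N.* m) (evalLow (map ι w) y) ≈ evalLow (map ι w) (Frob (t N.* m) y)
   Frob-evalLow t [] y = Frob-0 (t N.* m)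
   Frob-evalLow t (a ∷ w) y = Frob-+ (t N.* m) _ _ E.& E.+-cong (Frob-ι t a) (Frob-* (t N.* m) _ _ E.& E.*-congˡ (Frob-evalLow t w y))
   evalLow-cong : ∀ {k} (w : Vec E.El k) {y z} -> y ≈ z -> evalLow w y ≈ evalLow w z
   evalLow-cong [] e = E.refl
   evalLow-cong (a ∷ w) e = E.+-congˡ (E.*-cong e (evalLow-cong w e))
   ^-zero : ∀ k y -> y E.^ k ≈ E.0# -> y ≈ E.0#
   ^-zero zero y e = ⊥-elim (1≉0 e)
   ^-zero (suc k) y e = [ (\ h -> h) , ^-zero k y ]′ (dom y (y E.^ k) e)
   Frob-inj : ∀ k {y z} -> Frob k y ≈ Frob k z -> y ≈ z
   Frob-inj k {y} {z} e = E.from-dif (^-zero (p N.^ k) (y E.- z) (Frob-+ k y (E.- z) E.& E.+-congˡ (Frob-neg k z) E.& E.to-dif e))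
   conj : Fin d -> E.El
   conj i = Frob (toℕ i N.* m) x
   private
    -- A power of Frobenius that fixes K and the generator x fixes all q^d elements, which are too
    -- many roots for y^(q^t) - y when t < d.
    not-fix : ∀ t -> 0 < t -> t < d -> ¬ (Frob (t N.* m) x ≈ x)
    not-fix t 0<t t<d h = too-many-roo dom 1≉0 (proj₁ power) (rep ∘ small) (\ i j e -> FinP.inject≤-injective _ _ i j (! (ind-rep _) ∙ ind-cong e ∙ ind-rep _)) (\ i -> proj₂ power _ E.& E.+-cong (E.-‿cong (E.*-identityʳ _)) (fixed (rep (small i))) E.& E.-‿inverseˡ _)
     where
     fixed : ∀ y -> Frob (t N.* m) y ≈ y
     fixed y = go (gen y)
      where
      go : Σ[ w ∈ Vec K.El d ] evalLow (map ι w) x ≈ y -> Frob (t N.* m) y ≈ y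
      go (w , e) = Frob-cong (t N.* m) (E.sym e) E.& Frob-evalLow t w x E.& evalLow-cong (map ι w) h E.& e
     m>0 : 0 < m
     m>0 = ≡.subst (0 <_) (! (proj₂ m≥1)) (s≤s z≤n)
     N>1 : 1 < p N.^ (t N.* m)
     N>1 = NP.^-monoʳ-< p (pri>1 pr) {0} {t N.* m} (NP.*-mono-≤ 0<t m>0)
     power : IsMon (p N.^ (t N.* m)) (\ y -> E.- (y E.^ 1) E.+ y E.^ (p N.^ (t N.* m)))
     power = mon-^ (low-neg (low-^ (p N.^ (t N.* m)) 1 N>1))
     fewer : p N.^ (t N.* m) < q N.^ d
     fewer = ≡.subst (p N.^ (t N.* m) <_) (ap (p N.^_) (NP.*-comm d m) ∙ ! (NP.^-*-assoc p m d)) (NP.^-monoʳ-< p (pri>1 pr) {t N.* m} {d N.* m} (NP.*-monoˡ-< m {{N.>-nonZero m>0}} t<d))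
     small : Fin (suc (p N.^ (t N.* m))) -> Fin (q N.^ d)
     small i = inject≤ i fewer
    conj-< : ∀ i j -> toℕ i < toℕ j -> ¬ (conj i ≈ conj j)
    conj-< i j l e = not-fix t (NP.m<n⇒0<n∸m l) (NP.≤-<-trans (NP.m∸n≤m (toℕ j) (toℕ i)) (FinP.toℕ<n j)) (E.sym (Frob-inj (toℕ i N.* m) (e E.& E.reflexive (ap (\ k -> Frob k x) split) E.& E.sym (Frob-∘ (toℕ i N.* m) (t N.* m) x))))
     where
     t = toℕ j ∸ toℕ i
     split : toℕ j N.* m ≡ t N.* m N.+ toℕ i N.* m
     split = ap (N._* m) (! (NP.m∸n+n≡m (NP.<⇒≤ l))) ∙ NP.*-distribʳ-+ m t (toℕ i)
   conj-dis : ∀ i j -> conj i ≈ conj j -> i ≡ j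
   conj-dis i j e with NP.<-cmp (toℕ i) (toℕ j)
   ... | tri< l _ _ = ⊥-elim (conj-< i j l e)
   ... | tri≈ _ eq _ = FinP.toℕ-injective eq
   ... | tri> _ _ l = ⊥-elim (conj-< j i l (E.sym e))
   -- The d conjugates of x are distinct zeros of v, hence all of them, and `s-roo` applies.
   pow-sums : ∀ j -> E.sum (\ i -> conj i E.^ suc j) ≈ ι (PowSums.s (fieRing K) (Roots.unit (fieRing K) v) (suc j))
   pow-sums j = E.sym (s-roo dom (map ι v) conj conj-dis (\ i -> E.sym (Frob-evalMon (toℕ i) v x) E.& Frob-cong (toℕ i N.* m) root E.& Frob-0 (toℕ i N.* m)) j) E.& s-unit-ι v (suc j)
   module _ (α : ℕ -> K.El) where
    value : ℕ -> E.El
    value zero = E.0#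
    value (suc j) = value j E.+ ι (α (suc j)) E.* x E.^ suc j
    combination : ℕ -> K.El
    combination zero = K.0#
    combination (suc j) = combination j K.+ α (suc j) K.* PowSums.s (fieRing K) (Roots.unit (fieRing K) v) (suc j)
    -- The trace from E to K of the value of f at x: each monomial x^j contributes α j times the
    -- j-th power sum of the zeros of v.
    sum-con : ∀ j -> E.sum {d} (\ t -> Frob (toℕ t N.* m) (value j)) ≈ ι (combination j)
    sum-con zero = E.sum-cong-≋ {d} (\ t -> Frob-0 (toℕ t N.* m)) E.& E.sum-replicate-zero d E.& E.sym ι-0
    sum-con (suc j) = E.sum-cong-≋ {d} (\ t -> Frob-+ (toℕ t N.* m) _ _ E.& E.+-congˡ (Frob-* (toℕ t N.* m) _ _ E.& E.*-cong (Frob-ι (toℕ t) (α (suc j))) (^-^-comm x (suc j) (p N.^ (toℕ t N.* m))))) E.& E.∑-distrib-+ {d} _ _ E.& E.+-cong (sum-con j) (E.sym (E.*-distribˡ-sum {d} _ _) E.& E.*-congˡ (pow-sums j) E.& E.sym (ι-* _ _)) E.& E.sym (ι-+ _ _)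
    tr-ι : ∀ N a -> tr N (ι a) ≈ ι (FF.tr N a)
    tr-ι zero a = E.sym ι-0
    tr-ι (suc N) a = E.+-cong (tr-ι N a) (E.sym (ι-^ a (p N.^ N))) E.& E.sym (ι-+ _ _)

    -- The absolute trace of f(x) is the functional T evaluated at the minimal polynomial of x.
    tra-val : ∀ (ℓ : ℕ -> Add K p) -> (∀ k y -> FF.tr m (α k K.* y) ≡ K.fromℕ (Add.fun (ℓ k) y)) -> ∀ (Θ : ℕ -> ℕ) -> Θ 0 ≡ 0 -> (∀ j -> Θ (suc j) ≡ Θ j N.+ Add.fun (ℓ (suc j)) (PowSums.s (fieRing K) (Roots.unit (fieRing K) v) (suc j))) -> ∀ j e -> tr (e N.* (d N.* m)) (value j) ≈ E.fromℕ (e N.* Θ j)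
    tra-val ℓ h Θ Θ-0 Θ-suc j e = tr-per (d N.* m) e (value j) (frob-q^d (value j)) E.& E.*-congˡ (tr-blo d m (value j) E.& tr-cong m (sum-con j) E.& tr-ι m (combination j) E.& E.reflexive (ap ι (functional j)) E.& ι-fromℕ (Θ j)) E.& E.sym (E.fromℕ-* e (Θ j))
     where
     functional : ∀ j -> FF.tr m (combination j) ≡ K.fromℕ (Θ j)
     functional zero = FF.tr-0 m ∙ ap K.fromℕ (! Θ-0)
     functional (suc j) = FF.tr-+ m _ _ ∙ ap₂ K._+_ (functional j) (h (suc j) _) ∙ ! (K.fromℕ-+ (Θ j) _) ∙ ap K.fromℕ (! (Θ-suc j))

 -- The residue field of an irreducible polynomial.
 module ResFie {q : ℕ} (K : FiniteField q) {d : ℕ} (v : Vec (FiniteField.Carrier K) d) (irr : Factorisation.Irreducible K v) where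
  open Factorisation K
  open VecInd K
  open QuoRing polyRing (monP v) public renaming (quoRing to E)
  private module E = Kit E
  ∣⇒≈0 : ∀ {F} -> monP v ∣ F -> F ≈/ P.0#
  ∣⇒≈0 (w , e) = ≈/0 w e
  ≈0⇒∣ : ∀ {F} -> F ≈/ P.0# -> monP v ∣ F
  ≈0⇒∣ {F} (w , e) = w , e P.& P.+-identityˡ (monP v P.* w)
  opaque
   remainder : Poly -> Poly
   remainder F = proj₁ (proj₂ (divide v F))
   rem-Deg : ∀ F -> Deg< (coeff (remainder F)) d
   rem-Deg F = proj₁ (proj₂ (proj₂ (divide v F)))
   rem-≈ : ∀ F -> F ≈/ remainder F
   rem-≈ F = proj₁ (divide v F) , proj₂ (proj₂ (proj₂ (divide v F))) P.& P.+-comm (monP v P.* proj₁ (divide v F)) (proj₁ (proj₂ (divide v F)))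
  unique : ∀ r r′ -> Deg< (coeff r) d -> Deg< (coeff r′) d -> r ≈/ r′ -> coeff r ≋ coeff r′
  unique r r′ dr dr′ (w , e) = atᴾ (P.from-dif {r} {r′} ⟪ rem-zero v (r P.- r′) P.0# (r P.- r′) (Deg<-⊕ dr (Deg<-⊖ dr′)) (P.solve 3 (\ p a b -> a P.:- b P.:= p P.:* P.0∶ P.:+ (a P.:- b)) P.refl (monP v) r r′) (w , P.+-congʳ {P.- r′} {r} {r′ P.+ monP v P.* w} e P.& P.solve 3 (\ b p w -> (b P.:+ p P.:* w) P.:- b P.:= p P.:* w) P.refl r′ (monP v) w) ⟫)
  lowSeq : ∀ {k} -> Vec K.El k -> Seq
  lowSeq [] = 𝟘
  lowSeq (a ∷ w) = a ◃ lowSeq w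
  lowSeq-Deg : ∀ {k} (w : Vec K.El k) -> Deg< (lowSeq w) k
  lowSeq-Deg [] i l = idp
  lowSeq-Deg (a ∷ w) (suc i) (s≤s l) = lowSeq-Deg w i l
  lowSeq-toVec : ∀ k f -> Deg< f k -> lowSeq (toVec k f) ≋ f
  lowSeq-toVec zero f h i = ! (h i z≤n)
  lowSeq-toVec (suc k) f h zero = idp
  lowSeq-toVec (suc k) f h (suc i) = lowSeq-toVec k (tail f) (\ j l -> h (suc j) (s≤s l)) i
  toVec-lowSeq : ∀ {k} (w : Vec K.El k) f -> f ≋ lowSeq w -> toVec k f ≡ w
  toVec-lowSeq [] f e = idp
  toVec-lowSeq (a ∷ w) f e = ap₂ _∷_ (e 0) (toVec-lowSeq w (tail f) (\ i -> e (suc i)))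
  toVec-cong : ∀ k {f g} -> f ≋ g -> toVec k f ≡ toVec k g
  toVec-cong zero e = idp
  toVec-cong (suc k) e = ap₂ _∷_ (e 0) (toVec-cong k (\ i -> e (suc i)))
  lowP : ∀ {k} -> Vec K.El k -> Poly
  lowP {k} w = poly (lowSeq w) k (lowSeq-Deg w)
  private
   one : monP v ∣ P.1# -> monP v ∣ monP []
   one (w , e) = w , P.trans {monP []} {P.1#} ⟪ ≋-refl ⟫ e
  finDom : FinDom E (q N.^ d)
  finDom = record { dom = \ F G e -> [ (\ h -> inj₁ (∣⇒≈0 h)) , (\ h -> inj₂ (∣⇒≈0 h)) ]′ (euc {v = v} irr F G (≈0⇒∣ e)) ; 1≉0 = \ e -> NP.<⇒≱ (proj₁ irr) (∣-deg v [] (one (≈0⇒∣ e))) ; rep = \ i -> lowP (vecAt d i) ; index = \ F -> vecInd (toVec d (coeff (remainder F))) ; ind-cong = \ {F} {G} e -> ap vecInd (toVec-cong d (unique (remainder F) (remainder G) (rem-Deg F) (rem-Deg G) (E.trans {remainder F} {F} {remainder G} (E.sym {F} {remainder F} (rem-≈ F)) (E.trans {F} {G} {remainder G} e (rem-≈ G))))) ; rep-ind = \ F -> E.trans {_} {remainder F} {F} (≈⇒≈/ ⟪ ≋-trans (\ i -> ap (\ w -> lowSeq w i) (vecAt-ind (toVec d (coeff (remainder F))))) (lowSeq-toVec d (coeff (remainder F)) (rem-Deg F)) ⟫) (E.sym {F} {remainder F} (rem-≈ F)) ; ind-rep = \ i -> ap vecInd (toVec-lowSeq (vecAt d i) (coeff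 (remainder (lowP (vecAt d i)))) (unique (remainder (lowP (vecAt d i))) (lowP (vecAt d i)) (rem-Deg _) (lowSeq-Deg (vecAt d i)) (E.sym {lowP (vecAt d i)} {remainder (lowP (vecAt d i))} (rem-≈ (lowP (vecAt d i)))))) ∙ vecInd-at d i }
  con-+ : ∀ a b -> conP (a K.+ b) P.≈ conP a P.+ conP b
  con-+ a b = ⟪ (\ { zero -> idp ; (suc i) -> ! (K.+-identityˡ K.0#) }) ⟫
  con-* : ∀ a b -> conP (a K.* b) P.≈ conP a P.* conP b
  con-* a b = ⟪ (\ i -> ! (con-⊛ a (const b) i ∙ go i)) ⟫
   where
   go : ∀ i -> a K.* const b i ≡ const (a K.* b) i
   go zero = idp
   go (suc i) = K.zeroʳ a
  con-1 : conP K.1# P.≈ P.1#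
  con-1 = ⟪ (\ { zero -> idp ; (suc i) -> idp }) ⟫
  private
   ◃-X : ∀ a f -> const a ⊕ ((K.0# ◃ 𝟙) ⊛ f) ≋ a ◃ f
   ◃-X a f zero = ap (a K.+_) (X-⊛ f 0) ∙ K.+-identityʳ a
   ◃-X a f (suc i) = ap (K.0# K.+_) (X-⊛ f (suc i)) ∙ K.+-identityˡ _
  evalMon-X : ∀ {k} (w : Vec K.El k) -> coeff (Roots.evalMon polyRing (map conP w) X) ≋ mon w
  evalMon-X [] = ≋-refl
  evalMon-X (a ∷ w) = ≋-trans (⊕-cong {const a} ≋-refl (⊛-cong {K.0# ◃ 𝟙} ≋-refl (evalMon-X w))) (◃-X a (mon w))
  evalLow-X : ∀ {k} (w : Vec K.El k) -> coeff (PolFun.evalLow polyRing (map conP w) X) ≋ lowSeq w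
  evalLow-X [] = ≋-refl
  evalLow-X (a ∷ w) = ≋-trans (⊕-cong {const a} ≋-refl (⊛-cong {K.0# ◃ 𝟙} ≋-refl (evalLow-X w))) (◃-X a (lowSeq w))
  private
   same-evalMon : ∀ {k} (w : Vec Poly k) y -> Roots.evalMon E w y P.≈ Roots.evalMon polyRing w y
   same-evalMon [] y = P.refl {P.1#}
   same-evalMon (a ∷ w) y = P.+-congˡ {a} (P.*-congˡ {y} (same-evalMon w y))
   same-evalLow : ∀ {k} (w : Vec Poly k) y -> PolFun.evalLow E w y P.≈ PolFun.evalLow polyRing w y
   same-evalLow [] y = P.refl {P.0#}
   same-evalLow (a ∷ w) y = P.+-congˡ {a} (P.*-congˡ {y} (same-evalLow w y))
  root : Roots.evalMon E (map conP v) X ≈/ P.0#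
  root = ∣⇒≈0 (P.1# , same-evalMon (map conP v) X P.& P.trans ⟪ evalMon-X v ⟫ (P.sym (P.*-identityʳ (monP v))))
  gen : ∀ F -> Σ[ w ∈ Vec K.El d ] PolFun.evalLow E (map conP w) X ≈/ F
  gen F = w , E.trans {_} {remainder F} {F} (≈⇒≈/ (P.trans (same-evalLow (map conP w) X) ⟪ ≋-trans (evalLow-X w) (lowSeq-toVec d (coeff (remainder F)) (rem-Deg F)) ⟫)) (E.sym {F} {remainder F} (rem-≈ F))
   where w = toVec d (coeff (remainder F))

open ResidueFields

-- The coordinate ring of an Artin-Schreier curve and its weights.

module ArtSchCur where

 open N using (_≤_; _<_)
 open import Data.Vec.Base using (replicate)

 module Mon (R : CommutativeRing 0ℓ 0ℓ) where
  open Pol R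
  private
   module R = Kit R
   module P = Kit polyRing
  open R using (_≈_)
  X^-shi : ∀ k -> coeff (X P.^ k) ≋ shift k 𝟙
  X^-shi zero = ≋-refl
  X^-shi (suc k) = ≋-trans (⊛-cong {R.0# ◃ 𝟙} ≋-refl (X^-shi k)) (X-⊛ (shift k 𝟙))
  shi-𝟙-≡ : ∀ k -> shift k 𝟙 k ≈ R.1#
  shi-𝟙-≡ zero = R.refl
  shi-𝟙-≡ (suc k) = shi-𝟙-≡ k
  shi-𝟙-≢ : ∀ k i -> i ≢ k -> shift k 𝟙 i ≈ R.0#
  shi-𝟙-≢ zero zero ne = ⊥-elim (ne idp)
  shi-𝟙-≢ zero (suc i) ne = R.refl
  shi-𝟙-≢ (suc k) zero ne = R.refl
  shi-𝟙-≢ (suc k) (suc i) ne = shi-𝟙-≢ k i (ne ∘ ap suc)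
  mon-zer : ∀ k -> mon (replicate k R.0#) ≋ shift k 𝟙
  mon-zer zero = ≋-refl
  mon-zer (suc k) zero = R.refl
  mon-zer (suc k) (suc i) = mon-zer k i
  ◃-poly : ∀ a f -> const a ⊕ ((R.0# ◃ 𝟙) ⊛ f) ≋ a ◃ f
  ◃-poly a f zero = R.+-congˡ (X-⊛ f 0) R.& R.+-identityʳ a
  ◃-poly a f (suc i) = R.+-congˡ (X-⊛ f (suc i)) R.& R.+-identityˡ _

 -- The ring O = K[X,Y] / (Y^p - Y - f(X)), filtered by the weights p of X and n = deg f of Y.
 -- Elements are represented by the coefficients N b a of X^a Y^b, b < p.
 module Curve {q : ℕ} (K : FiniteField q) (p″ n : ℕ) (1≤n : 1 ≤ n) where
  open Factorisation K
  module Of (f : Poly) (f-Deg : Deg< (coeff f) (suc n)) (f-top : coeff f n ≢ FiniteField.0# K) where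
   p : ℕ
   p = suc (suc p″)
   module PY = Pol polyRing
   module Y = Kit PY.polyRing
   private
    module MX = Mon (fieRing K)
    module MY = Mon polyRing
   rel : Vec Poly p
   rel = (P.- f) ∷ (P.- P.1#) ∷ replicate p″ P.0#
   g : PY.Poly
   g = PY.poly (PY.mon rel) (suc p) (proj₂ (PY.mon-Mon rel))
   open QuoRing PY.polyRing g public renaming (quoRing to O)
   module O = Kit O
   𝕏 𝕐 : PY.Poly
   𝕏 = PY.conP X
   𝕐 = PY.X
   k : K.El -> PY.Poly
   k c = PY.conP (conP c)
   Y^p : 𝕐 Y.^ p ≈/ 𝕐 Y.+ PY.conP f
   Y^p = Y.1# , Y.solve 4 (\ y f s o -> y Y.:* (y Y.:* s) Y.:= (y Y.:+ f) Y.:+ ((Y.:- f) Y.:+ y Y.:* ((Y.:- o) Y.:+ y Y.:* s)) Y.:+ y Y.:* (o Y.:- Y.1∶)) Y.refl 𝕐 (PY.conP f) (𝕐 Y.^ p″) (PY.conP P.1#) Y.& Y.+-cong (Y.+-congˡ {𝕐 Y.+ PY.conP f} (Y.sym g-ring)) (Y.*-congˡ {𝕐} (Y.to-dif one) Y.& Y.zeroʳ 𝕐) Y.& Y.+-identityʳ _ Y.& Y.+-congˡ {𝕐 Y.+ PY.conP f} (Y.sym (Y.*-identityʳ g))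
    where
    one : PY.conP P.1# Y.≈ Y.1#
    one = PY.⟪ (\ { zero -> P.refl {P.1#} ; (suc i) -> P.refl {P.0#} }) ⟫
    neg : ∀ F -> PY.conP (P.- F) Y.≈ Y.- PY.conP F
    neg F = PY.⟪ (\ { zero -> P.refl {P.- F} ; (suc i) -> P.sym P.-0#≈0# }) ⟫
    tailP : PY.Poly
    tailP = PY.poly (PY.mon (replicate p″ P.0#)) (suc p″) (proj₂ (PY.mon-Mon (replicate p″ P.0#)))
    tail≈ : tailP Y.≈ 𝕐 Y.^ p″
    tail≈ = PY.⟪ PY.≋-trans (MY.mon-zer p″) (PY.≋-sym (MY.X^-shi p″)) ⟫
    g₁ : PY.Poly
    g₁ = PY.poly (PY.mon ((P.- P.1#) ∷ replicate p″ P.0#)) (suc (suc p″)) (proj₂ (PY.mon-Mon ((P.- P.1#) ∷ replicate p″ P.0#)))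
    g₁≈ : g₁ Y.≈ (Y.- PY.conP P.1#) Y.+ 𝕐 Y.* 𝕐 Y.^ p″
    g₁≈ = Y.trans {g₁} {PY.conP (P.- P.1#) Y.+ 𝕐 Y.* tailP} PY.⟪ PY.≋-sym (MY.◃-poly (P.- P.1#) (PY.mon (replicate p″ P.0#))) ⟫ (Y.+-cong (neg P.1#) (Y.*-congˡ {𝕐} tail≈))
    g-ring : g Y.≈ (Y.- PY.conP f) Y.+ 𝕐 Y.* ((Y.- PY.conP P.1#) Y.+ 𝕐 Y.* 𝕐 Y.^ p″)
    g-ring = Y.trans {g} {PY.conP (P.- f) Y.+ 𝕐 Y.* g₁} PY.⟪ PY.≋-sym (MY.◃-poly (P.- f) (PY.mon ((P.- P.1#) ∷ replicate p″ P.0#))) ⟫ (Y.+-cong (neg f) (Y.*-congˡ {𝕐} g₁≈))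
   Ent : Set
   Ent = ℕ -> Seq
   -- The coefficients of the normal form are given by a separate table N, so that the effect of
   -- each ring operation is computed on tables.
   record Rep (z : PY.Poly) (N : Ent) : Set where
    constructor rep
    field
     normal : PY.Poly
     ent : ∀ b -> coeff (PY.coeff normal b) ≋ N b
     reduced : PY.Deg< (PY.coeff normal) p
     equ : z ≈/ normal
   open Rep public
   rep-cong : ∀ {z z′ N} -> z ≈/ z′ -> Rep z′ N -> Rep z N
   rep-cong {z} {z′} e (rep nf en re eq) = rep nf en re (O.trans {z} {z′} {nf} e eq)
   rep-+ : ∀ {z z′ N N′} -> Rep z N -> Rep z′ N′ -> Rep (z Y.+ z′) (\ b -> N b ⊕ N′ b)
   rep-+ {z} {z′} (rep nf en re eq) (rep nf′ en′ re′ eq′) = rep (nf Y.+ nf′) (\ b -> ⊕-cong (en b) (en′ b)) (PY.Deg<-⊕ re re′) (O.+-cong {z} {nf} {z′} {nf′} eq eq′)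
   rep-con : ∀ {z N} (F : Poly) -> Rep z N -> Rep (PY.conP F Y.* z) (\ b -> coeff F ⊛ N b)
   rep-con {z} F (rep nf en re eq) = rep (PY.conP F Y.* nf) (\ b -> ≋-trans (atᴾ (PY.con-⊛ F (PY.coeff nf) b)) (⊛-cong {coeff F} ≋-refl (en b))) (\ b l -> P.trans {_} {F P.* PY.coeff nf b} {P.0#} (PY.con-⊛ F (PY.coeff nf) b) (P.trans {_} {F P.* P.0#} (P.*-congˡ {F} (re b l)) (P.zeroʳ F))) (O.*-congˡ {PY.conP F} {z} {nf} eq)
   rep-ent : ∀ {z N N′} -> (∀ b -> N b ≋ N′ b) -> Rep z N -> Rep z N′
   rep-ent e (rep nf en re eq) = rep nf (\ b -> ≋-trans (en b) (e b)) re eq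
   rep-k : ∀ {z N} c -> Rep z N -> Rep (k c Y.* z) (\ b -> scale c (N b))
   rep-k c r = rep-ent (\ b -> con-⊛ c _) (rep-con (conP c) r)
   rep-X : ∀ {z N} -> Rep z N -> Rep (𝕏 Y.* z) (\ b -> K.0# ◃ N b)
   rep-X r = rep-ent (\ b -> X-⊛ _) (rep-con X r)
   one : Ent
   one zero = 𝟙
   one (suc b) = 𝟘
   rep-1 : Rep Y.1# one
   rep-1 = rep Y.1# (\ { zero -> ≋-refl ; (suc b) -> ≋-refl }) (\ { (suc b) _ -> P.refl {P.0#} }) (O.refl {Y.1#})
   rep-0 : Rep Y.0# (\ _ -> 𝟘)
   rep-0 = rep Y.0# (\ b -> ≋-refl) (\ b _ -> P.refl {P.0#}) (O.refl {Y.0#})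
   rep-zero : ∀ {z N} -> Rep z N -> (∀ b -> N b ≋ 𝟘) -> z ≈/ Y.0#
   rep-zero {z} (rep nf en re eq) h = O.trans {z} {nf} {Y.0#} eq (≈⇒≈/ PY.⟪ (\ b -> ⟪ ≋-trans (en b) (h b) ⟫) ⟫)
   -- Multiplication by Y shifts the rows, and the row that reaches Y^p is removed by a multiple of
   -- the relation. Among the rows below p only 0 and 1 receive a correction.
   timY : Ent -> Ent
   timY N zero = (⊖ (N (suc p″) ⊛ coeff (P.- f)))
   timY N (suc b) = N b ⊕ (⊖ (N (suc p″) ⊛ coeff (PY.mon rel (suc b))))
   rep-Y : ∀ {z N} -> Rep z N -> Rep (𝕐 Y.* z) (timY N)
   rep-Y {z} {N} (rep nf en re eq) = rep nf′ en′ re′ (O.trans {𝕐 Y.* z} {𝕐 Y.* nf} {nf′} (O.*-congˡ {𝕐} {z} {nf} eq) reduce)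
    where
    top : Poly
    top = PY.coeff nf (suc p″)
    nf′ : PY.Poly
    nf′ = (𝕐 Y.* nf) Y.- (PY.conP top Y.* g)
    reduce : 𝕐 Y.* nf ≈/ nf′
    reduce = PY.conP top , Y.solve 3 (\ a b c -> a Y.:= (a Y.:- b Y.:* c) Y.:+ c Y.:* b) Y.refl (𝕐 Y.* nf) (PY.conP top) g
    row : ∀ b -> PY.coeff nf′ b P.≈ (P.0# PY.◃ PY.coeff nf) b P.- top P.* PY.mon rel b
    row b = P.+-cong {PY._⊛_ (PY.coeff 𝕐) (PY.coeff nf) b} {(P.0# PY.◃ PY.coeff nf) b} (PY.X-⊛ (PY.coeff nf) b) (P.-‿cong {_} {top P.* PY.mon rel b} (PY.con-⊛ top (PY.mon rel) b))
    en′ : ∀ b -> coeff (PY.coeff nf′ b) ≋ timY N b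
    en′ zero i = atᴾ (row zero) i ∙ K.+-identityˡ _ ∙ ap K.-_ (⊛-cong {coeff top} {N (suc p″)} {coeff (P.- f)} (en (suc p″)) ≋-refl i)
    en′ (suc b) i = atᴾ (row (suc b)) i ∙ ap₂ (\ x y -> x K.- y) (en b i) (⊛-cong {coeff top} {N (suc p″)} {coeff (PY.mon rel (suc b))} (en (suc p″)) ≋-refl i)
    re′ : PY.Deg< (PY.coeff nf′) p
    re′ (suc b) l = row (suc b) P.& cancel (NP.m≤n⇒m<n∨m≡n l)
     where
     cancel : p < suc b ⊎ p ≡ suc b -> PY.coeff nf b P.- top P.* PY.mon rel (suc b) P.≈ P.0#
     cancel (inj₁ l′) = P.+-cong {PY.coeff nf b} {P.0#} (re b (NP.≤-pred l′)) (P.-‿cong {_} {P.0#} (P.trans {_} {top P.* P.0#} (P.*-congˡ {top} (proj₂ (PY.mon-Mon rel) (suc b) l′)) (P.zeroʳ top))) P.& P.-‿inverseʳ P.0#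
     cancel (inj₂ idp) = P.+-congˡ {top} (P.-‿cong {_} {top} (P.trans {_} {top P.* P.1#} (P.*-congˡ {top} (proj₁ (PY.mon-Mon rel))) (P.*-identityʳ top))) P.& P.-‿inverseʳ top

   -- If D divides an element of O, then it divides the coefficients of its normal form.
   rep-∣ : ∀ {z N} (r : Rep z N) (D : Poly) w -> z ≈/ PY.conP D Y.* w -> ∀ b -> D ∣ PY.coeff (normal r) b
   rep-∣ {z} (rep nf en re eq) D w h = go (O.trans {nf} {z} {PY.conP D Y.* w} (O.sym {z} {nf} eq) h) (PY.divMon {PY.mon rel} (PY.mon-Mon rel) (PY.bound w) (PY.coeff w) (PY.degree w))
    where
    go : nf ≈/ PY.conP D Y.* w -> Σ[ w₁ ∈ PY.Seq ] Σ[ w₂ ∈ PY.Seq ] (PY.Deg< w₁ (PY.bound w) × PY.Deg< w₂ p × PY.coeff w PY.≋ (PY.mon rel PY.⊛ w₁) PY.⊕ w₂) -> ∀ b -> D ∣ PY.coeff nf b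
    go (u , e) (w₁ , w₂ , d₁ , d₂ , e₁) b = w₂ b , P.trans {_} {PY.coeff (PY.conP D Y.* W₂) b} (PY.atᴾ (Y.from-dif {nf} {PY.conP D Y.* W₂} (diff Y.& Y.*-congˡ {g} {M} {Y.0#} PY.⟪ M≋0 ⟫ Y.& Y.zeroʳ g)) b) (PY.con-⊛ D w₂ b)
     where
     W₁ = PY.poly w₁ (PY.bound w) d₁
     W₂ = PY.poly w₂ p d₂
     M = PY.conP D Y.* W₁ Y.+ u
     split : w Y.≈ g Y.* W₁ Y.+ W₂
     split = PY.⟪ e₁ ⟫
     diff : nf Y.- PY.conP D Y.* W₂ Y.≈ g Y.* M
     diff = Y.+-congʳ {Y.- (PY.conP D Y.* W₂)} {nf} {PY.conP D Y.* (g Y.* W₁ Y.+ W₂) Y.+ g Y.* u} (e Y.& Y.+-congʳ {g Y.* u} (Y.*-congˡ {PY.conP D} {w} {g Y.* W₁ Y.+ W₂} split)) Y.& Y.solve 5 (\ d g a c u -> d Y.:* (g Y.:* a Y.:+ c) Y.:+ g Y.:* u Y.:- d Y.:* c Y.:= g Y.:* (d Y.:* a Y.:+ u)) Y.refl (PY.conP D) g W₁ W₂ u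
     DW₂ : PY.Deg< (PY.coeff (PY.conP D Y.* W₂)) p
     DW₂ i l = P.trans {_} {D P.* w₂ i} {P.0#} (PY.con-⊛ D w₂ i) (P.trans {_} {D P.* P.0#} (P.*-congˡ {D} (d₂ i l)) (P.zeroʳ D))
     M≋0 : PY.coeff M PY.≋ PY.𝟘
     M≋0 = PY.Mon-⊛-sma (PY.mon-Mon rel) (PY.bound M) (PY.coeff M) (PY.degree M) (PY.Deg<-resp (PY.atᴾ diff) (PY.Deg<-⊕ re (PY.Deg<-⊖ DW₂)))
   weight : ℕ -> ℕ -> ℕ
   weight a b = p N.* a N.+ n N.* b
   Small : ℕ -> Ent -> Set
   Small B N = ∀ b a -> b < p -> B ≤ weight a b -> N b a ≡ K.0#
   record Leads (B : ℕ) (N : Ent) : Set where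
    constructor leads
    field
     row column : ℕ
     row<p : row < p
     at-top : weight column row ≡ B
     nonzero : N row column ≢ K.0#
     below : Small (suc B) N
   open Leads public
   sma-mono : ∀ {B B′ N} -> B ≤ B′ -> Small B N -> Small B′ N
   sma-mono l h b a b<p w = h b a b<p (NP.≤-trans l w)
   wei-X : ∀ a b -> weight (suc a) b ≡ weight a b N.+ p
   wei-X a b = ap (N._+ n N.* b) (NP.*-suc p a ∙ NP.+-comm p _) ∙ NP.+-assoc (p N.* a) p _ ∙ ap (p N.* a N.+_) (NP.+-comm p _) ∙ ! (NP.+-assoc (p N.* a) _ p)
   wei-Y : ∀ a b -> weight a (suc b) ≡ weight a b N.+ n
   wei-Y a b = ap (p N.* a N.+_) (NP.*-suc n b ∙ NP.+-comm n _) ∙ ! (NP.+-assoc (p N.* a) _ n)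
   -- X^n and Y^p have the same weight n p, so replacing Y^p by the top term of f preserves weights.
   wei-wrap : ∀ a -> weight (a N.+ n) 0 ≡ weight a (suc p″) N.+ n
   wei-wrap a = ap₂ N._+_ (NP.*-distribˡ-+ p a n) (NP.*-zeroʳ n) ∙ NP.+-identityʳ _ ∙ ap (p N.* a N.+_) (NP.*-comm p n ∙ NP.*-suc n (suc p″) ∙ NP.+-comm n _) ∙ ! (NP.+-assoc (p N.* a) _ n)
   sma-X : ∀ {B N} -> Small B N -> Small (B N.+ p) (\ b -> K.0# ◃ N b)
   sma-X h b zero b<p w = idp
   sma-X {B} h b (suc a) b<p w = h b a b<p (NP.+-cancelʳ-≤ p B _ (NP.≤-trans w (NP.≤-reflexive (wei-X a b))))
   ⊛-zero : ∀ F G -> G ≋ 𝟘 -> F ⊛ G ≋ 𝟘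
   ⊛-zero F G e = ≋-trans (⊛-cong {F} ≋-refl e) (⊛-zeroʳ F)
   -- Between its constant and its leading coefficient the relation has only the -1 at Y, so a
   -- correction can enter row 1 only.
   rest-zero : ∀ (N : Ent) a b -> suc b < p -> (b ≡ 0 -> N (suc p″) a ≡ K.0#) -> (N (suc p″) ⊛ coeff (PY.mon rel (suc b))) a ≡ K.0#
   rest-zero N a zero l h = ⊛-cong {N (suc p″)} ≋-refl min-one a ∙ ⊛-comm (N (suc p″)) (const (K.- K.1#)) a ∙ con-⊛ (K.- K.1#) (N (suc p″)) a ∙ ap ((K.- K.1#) K.*_) (h idp) ∙ K.zeroʳ _
    where
    min-one : coeff (P.- P.1#) ≋ const (K.- K.1#)
    min-one zero = idp
    min-one (suc i) = K.-0#≈0#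
   rest-zero N a (suc b) l h = ⊛-zero (N (suc p″)) _ (atᴾ (P.trans {PY.mon (replicate p″ P.0#) b} (MY.mon-zer p″ b) (MY.shi-𝟙-≢ p″ b (\ { idp -> NP.<-irrefl idp l })))) a
   sma-Y : ∀ {B N} -> Small B N -> Small (B N.+ n) (timY N)
   sma-Y {B} {N} h zero a b<p w = ap K.-_ (bel-f (a NP.<? n) ∙ idp) ∙ K.-0#≈0#
    where
    top = N (suc p″)
    f′-Deg : Deg< (coeff (P.- f)) (suc n)
    f′-Deg = Deg<-⊖ f-Deg
    van : ∀ i -> a ≤ i N.+ n -> top i ≡ K.0#
    van i l = h (suc p″) i NP.≤-refl (NP.+-cancelʳ-≤ n B _ (NP.≤-trans w (NP.≤-trans (NP.+-monoˡ-≤ (n N.* 0) (NP.*-monoʳ-≤ p l)) (NP.≤-reflexive (wei-wrap i)))))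
    bel-f : Dec (a < n) -> (top ⊛ coeff (P.- f)) a ≡ K.0#
    bel-f (yes a<n) = ⊛-comm top (coeff (P.- f)) a ∙ ⊛-zero (coeff (P.- f)) top (\ i -> van i (NP.≤-trans (NP.<⇒≤ a<n) (NP.m≤n+m n i))) a
    bel-f (no a≮n) = Deg<-⊛ {top} {coeff (P.- f)} (a ∸ n) n (\ i l -> van i (NP.≤-trans (NP.m≤n+m∸n a n) (NP.≤-trans (NP.+-monoʳ-≤ n l) (NP.≤-reflexive (NP.+-comm n i))))) f′-Deg a (NP.≤-reflexive (NP.m∸n+n≡m (NP.≮⇒≥ a≮n)))
   sma-Y {B} {N} h (suc b) a b<p w = ap₂ (\ x y -> x K.- y) (h b a (NP.<-trans (NP.n<1+n b) b<p) (NP.+-cancelʳ-≤ n B _ (NP.≤-trans w (NP.≤-reflexive (wei-Y a b))))) (rest-zero N a b b<p (\ { idp -> h (suc p″) a NP.≤-refl (NP.≤-trans (NP.+-cancelʳ-≤ n B _ (NP.≤-trans w (NP.≤-reflexive (wei-Y a 0)))) (NP.+-monoʳ-≤ (p N.* a) (NP.*-monoʳ-≤ n z≤n))) })) ∙ K.-‿inverseʳ K.0#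
   lea-X : ∀ {B N} -> Leads B N -> Leads (B N.+ p) (\ b -> K.0# ◃ N b)
   lea-X (leads b a b<p idp nz h) = leads b (suc a) b<p (wei-X a b) nz (sma-X h)
   nonzero-* : ∀ {x y} -> x ≢ K.0# -> y ≢ K.0# -> x K.* y ≢ K.0#
   nonzero-* {x} {y} x≢0 y≢0 e = y≢0 (! (K.*-identityˡ y) ∙ ap (K._* y) (! (proj₂ (inverse x x≢0))) ∙ K.solve 3 (\ x i y -> (x K.:* i) K.:* y K.:= i K.:* (x K.:* y)) idp x (proj₁ (inverse x x≢0)) y ∙ ap (\ z -> proj₁ (inverse x x≢0) K.* z) e ∙ K.zeroʳ _)
   -- A leading term below the last row moves up by one row. From the last row it passes to row 0,
   -- multiplied by the top coefficient of f.
   lea-Y : ∀ {B N} -> Leads B N -> Leads (B N.+ n) (timY N)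
   lea-Y {B} {N} (leads b a b<p idp nz h) = [ inner , (\ e -> outer (NP.suc-injective e)) ]′ (NP.m≤n⇒m<n∨m≡n b<p)
    where
    inner : suc b < p -> Leads (weight a b N.+ n) (timY N)
    inner l = leads (suc b) a l (wei-Y a b) (\ e -> nz (! (ap (\ y -> N b a K.- y) rest ∙ K.solve 1 (\ x -> x K.:- K.0∶ K.:= x) idp (N b a)) ∙ e)) (sma-Y h)
     where
     rest : (N (suc p″) ⊛ coeff (PY.mon rel (suc b))) a ≡ K.0#
     rest = rest-zero N a b l (\ { idp -> h (suc p″) a NP.≤-refl (NP.+-monoʳ-< (p N.* a) (NP.*-monoʳ-< n {{N.>-nonZero 1≤n}} (s≤s z≤n))) })
    outer : b ≡ suc p″ -> Leads (weight a b N.+ n) (timY N)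
    outer idp = leads 0 (a N.+ n) (s≤s z≤n) (wei-wrap a) (\ e -> nonzero-* nz f-top (! value ∙ e)) (sma-Y h)
     where
     top = N (suc p″)
     top-Deg : Deg< top (suc a)
     top-Deg i l = h (suc p″) i NP.≤-refl (NP.+-monoˡ-< (n N.* suc p″) (NP.*-monoʳ-< p l))
     value : K.- ((top ⊛ coeff (P.- f)) (a N.+ n)) ≡ top a K.* coeff f n
     value = ap K.-_ (top-⊛ {top} {coeff (P.- f)} a n top-Deg (Deg<-⊖ f-Deg)) ∙ K.solve 2 (\ x y -> K.:- (x K.:* (K.:- y)) K.:= x K.:* y) idp (top a) (coeff f n)
   sma-+ : ∀ {B N N′} -> Small B N -> Small B N′ -> Small B (\ b -> N b ⊕ N′ b)
   sma-+ h h′ b a l w = ap₂ K._+_ (h b a l w) (h′ b a l w) ∙ K.+-identityʳ K.0#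
   sma-k : ∀ {B N} c -> Small B N -> Small B (\ b -> scale c (N b))
   sma-k c h b a l w = ap (c K.*_) (h b a l w) ∙ K.zeroʳ c
   lea-k : ∀ {B N} c -> c ≢ K.0# -> Leads B N -> Leads B (\ b -> scale c (N b))
   lea-k c c≢0 (leads b a l e nz h) = leads b a l e (nonzero-* c≢0 nz) (sma-k c h)
   lea-+ : ∀ {B N N′} -> Small B N -> Leads B N′ -> Leads B (\ b -> N b ⊕ N′ b)
   lea-+ {B} h (leads b a l e nz h′) = leads b a l e (\ z -> nz (! (ap (K._+ _) (h b a l (NP.≤-reflexive (! e))) ∙ K.+-identityˡ _) ∙ z)) (sma-+ (sma-mono (NP.n≤1+n B) h) h′)
   lea-1 : Leads 0 one
   lea-1 = leads 0 0 (s≤s z≤n) (ap₂ N._+_ (NP.*-zeroʳ p) (NP.*-zeroʳ n)) 1≢0 (\ { zero zero _ w -> ⊥-elim (NP.<⇒≱ w (NP.≤-reflexive (ap₂ N._+_ (NP.*-zeroʳ p) (NP.*-zeroʳ n)))) ; zero (suc a) _ _ -> idp ; (suc b) a _ _ -> idp })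

   -- A leading term of weight B, and a bound on the weight.
   record Lead (B : ℕ) (z : PY.Poly) : Set where
    constructor lead
    field
     {matrix} : Ent
     isRep : Rep z matrix
     isLead : Leads B matrix
   open Lead public
   record Bounded (B : ℕ) (z : PY.Poly) : Set where
    constructor bounded
    field
     {matrix} : Ent
     isRep : Rep z matrix
     isSmall : Small B matrix
   lead⇒bou : ∀ {B z} -> Lead B z -> Bounded (suc B) z
   lead⇒bou (lead r h) = bounded r (below h)
   lead-resp : ∀ {B B′ z z′} -> B ≡ B′ -> z′ ≈/ z -> Lead B z -> Lead B′ z′
   lead-resp idp e (lead r h) = lead (rep-cong e r) h
   bou-resp : ∀ {B B′ z z′} -> B ≤ B′ -> z′ ≈/ z -> Bounded B z -> Bounded B′ z′
   bou-resp l e (bounded r h) = bounded (rep-cong e r) (sma-mono l h)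
   lead-X^ : ∀ {B z} i -> Lead B z -> Lead (B N.+ p N.* i) (𝕏 O.^ i Y.* z)
   lead-X^ {B} {z} zero h = lead-resp (! (ap (B N.+_) (NP.*-zeroʳ p) ∙ NP.+-identityʳ B)) (O.*-identityˡ z) h
   lead-X^ {B} {z} (suc i) h = lead-resp (NP.+-assoc B _ p ∙ ap (B N.+_) (NP.+-comm _ p ∙ ! (NP.*-suc p i))) (O.*-assoc 𝕏 (𝕏 O.^ i) z) (times (lead-X^ i h))
    where
    times : ∀ {B z} -> Lead B z -> Lead (B N.+ p) (𝕏 Y.* z)
    times (lead r h) = lead (rep-X r) (lea-X h)
   lead-Y^ : ∀ {B z} i -> Lead B z -> Lead (B N.+ n N.* i) (𝕐 O.^ i Y.* z)
   lead-Y^ {B} {z} zero h = lead-resp (! (ap (B N.+_) (NP.*-zeroʳ n) ∙ NP.+-identityʳ B)) (O.*-identityˡ z) h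
   lead-Y^ {B} {z} (suc i) h = lead-resp (NP.+-assoc B _ n ∙ ap (B N.+_) (NP.+-comm _ n ∙ ! (NP.*-suc n i))) (O.*-assoc 𝕐 (𝕐 O.^ i) z) (times (lead-Y^ i h))
    where
    times : ∀ {B z} -> Lead B z -> Lead (B N.+ n) (𝕐 Y.* z)
    times (lead r h) = lead (rep-Y r) (lea-Y h)
   bou-tra : ∀ {B z} c i -> Bounded B z -> Bounded (B N.+ n N.* i) ((𝕐 Y.+ k c) O.^ i Y.* z)
   bou-tra {B} {z} c zero h = bou-resp (NP.m≤m+n B _) (O.*-identityˡ z) h
   bou-tra {B} {z} c (suc i) h = bou-resp (NP.≤-reflexive (NP.+-assoc B _ n ∙ ap (B N.+_) (NP.+-comm _ n ∙ ! (NP.*-suc n i)))) (O.trans {_} {(𝕐 Y.+ k c) Y.* Z} {𝕐 Y.* Z Y.+ k c Y.* Z} (O.*-assoc (𝕐 Y.+ k c) ((𝕐 Y.+ k c) O.^ i) z) (O.distribʳ Z 𝕐 (k c))) (times (bou-tra c i h))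
    where
    Z = (𝕐 Y.+ k c) O.^ i Y.* z
    times : ∀ {B} -> Bounded B Z -> Bounded (B N.+ n) (𝕐 Y.* Z Y.+ k c Y.* Z)
    times {B} (bounded r h) = bounded (rep-+ (rep-Y r) (rep-k c r)) (sma-+ (sma-Y h) (sma-mono (NP.m≤m+n B n) (sma-k c h)))

open ArtSchCur

-- Frobenius at points of the curve, linear systems, and exponents.

module AuxPol where

 open N using (_≤_; _<_)
 open import Data.Nat.DivMod using (_%_; _/_; m≡m%n+[m/n]*n; m%n<n; m<n⇒m%n≡m; %-distribˡ-*; [m+kn]%n≡m%n; m*n/n≡m; m/n*n≡m)
 open import Data.Nat.Divisibility using () renaming (_∣_ to _∣ℕ_)
 open import Data.Nat.Tactic.RingSolver using (solve-∀)
 open import Data.Fin.Base using (fromℕ<)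
 open import Data.Vec.Base using (tabulate; lookup)
 import Data.Vec.Properties as VecP

 foldSum : {A : Set} -> (A -> A -> A) -> A -> (ℕ -> A) -> ℕ -> A
 foldSum _+_ 0# z zero = 0#
 foldSum _+_ 0# z (suc t) = foldSum _+_ 0# z t + z t

 -- A point (x, y) of the curve y^p = y + f on which x is fixed by Frobenius and y is translated by c.
 module Van (Q : CommutativeRing 0ℓ 0ℓ) {p : ℕ} (pr : Prime p) (char : CommutativeRing._≈_ Q (Kit.fromℕ Q p) (CommutativeRing.0# Q))
  where
  private
   module Q = Kit Q
   module F = Tra Q pr char
  module AtPoint (l c : ℕ) (x y fx : Q.El) (x-fixed : F.Frob (l N.+ l) x Q.≈ x) (equ : y Q.^ p Q.≈ y Q.+ fx) (trace : F.tr (l N.+ l) fx Q.≈ Q.fromℕ c) where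
   open Q
   open F
   s : ℕ
   s = p N.^ l
   -- Iterating y^p = y + f adds the conjugates of f one at a time.
   Frob-y : ∀ M -> Frob M y ≈ y + tr M fx
   Frob-y zero = *-identityʳ y & sym (+-identityʳ y)
   Frob-y (suc M) = sym (^-assocʳ y p (p N.^ M)) & Frob-cong M equ & Frob-+ M y fx & +-congʳ (Frob-y M) & +-assoc _ _ _
   y-tra : Frob (l N.+ l) y ≈ y + fromℕ c
   y-tra = Frob-y (l N.+ l) & +-congˡ trace
   Frob-^ : ∀ k u a -> Frob k (u ^ a) ≈ Frob k u ^ a
   Frob-^ k u a = ^-^-comm u a (p N.^ k)
   -- The core of the method: with s = p^l, raising to the power s turns the exponent a + s b into s
   -- a + s² b, and the Frobenius of order s² sends u to w. A high exponent s b is thereby reduced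
   -- to b.
   power : ∀ {u w} -> Frob (l N.+ l) u ≈ w -> ∀ a b -> Frob l (u ^ (a N.+ s N.* b)) ≈ u ^ (s N.* a) * w ^ b
   power {u} {w} h a b = begin (u ^ (a N.+ s N.* b)) ^ s ≈⟨ ^-assocʳ u (a N.+ s N.* b) s ⟩ u ^ ((a N.+ s N.* b) N.* s) ≡⟨ ap (u ^_) (expand a b s) ⟩ u ^ (s N.* a N.+ s N.* s N.* b) ≈⟨ ^-homo-* u (s N.* a) (s N.* s N.* b) ⟩ u ^ (s N.* a) * u ^ (s N.* s N.* b) ≈⟨ *-congˡ (^-assocʳ u (s N.* s) b) ⟨ u ^ (s N.* a) * (u ^ (s N.* s)) ^ b ≡⟨ ap (\ k -> u ^ (s N.* a) * (u ^ k) ^ b) (! (NP.^-distribˡ-+-* p l l)) ⟩ u ^ (s N.* a) * Frob (l N.+ l) u ^ b ≈⟨ *-congˡ (^-congˡ b h) ⟩ u ^ (s N.* a) * w ^ b ∎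
    where
    expand : ∀ a b s -> (a N.+ s N.* b) N.* s ≡ s N.* a N.+ s N.* s N.* b
    expand = solve-∀
   monomial : ∀ a₁ b₁ a₂ b₂ -> Frob l (x ^ (a₁ N.+ s N.* a₂) * (y ^ (b₁ N.+ s N.* b₂) * 1#)) ≈ x ^ (s N.* a₁ N.+ a₂) * (y ^ (s N.* b₁) * ((y + fromℕ c) ^ b₂ * 1#))
   monomial a₁ b₁ a₂ b₂ = Frob-* l _ _ & *-cong (power x-fixed a₁ a₂ & sym (^-homo-* x (s N.* a₁) a₂)) (Frob-cong l (*-identityʳ _) & power y-tra b₁ b₂ & *-congˡ (sym (*-identityʳ _)))
   Frob-mul : ∀ j -> Frob (j N.* (l N.+ l)) x ≈ x
   Frob-mul zero = *-identityʳ x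
   Frob-mul (suc j) = sym (Frob-∘ (j N.* (l N.+ l)) (l N.+ l) x) & Frob-cong (j N.* (l N.+ l)) x-fixed & Frob-mul j
   Frob-mul-y : ∀ j -> Frob (j N.* (l N.+ l)) y ≈ y + fromℕ j * fromℕ c
   Frob-mul-y zero = *-identityʳ y & sym (+-congˡ (zeroˡ _) & +-identityʳ y)
   Frob-mul-y (suc j) = sym (Frob-∘ (j N.* (l N.+ l)) (l N.+ l) y) & Frob-cong (j N.* (l N.+ l)) y-tra & Frob-+ (j N.* (l N.+ l)) y (fromℕ c) & +-cong (Frob-mul-y j) (Frob-fromℕ (j N.* (l N.+ l)) c) & solve 3 (\ y j c -> (y :+ j :* c) :+ c := y :+ (1∶ :+ j) :* c) refl y (fromℕ j) (fromℕ c)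
   -- After p rounds of 2 l Frobenius steps y has been translated by p c = 0.
   per : ℕ
   per = p N.* (l N.+ l)
   y-per : Frob per y ≈ y
   y-per = Frob-mul-y p & +-congˡ (*-congʳ char & zeroˡ _) & +-identityʳ y
   per-spl : Σ[ r ∈ ℕ ] per ≡ l N.+ r
   per-spl with pri>1 pr
   ... | s≤s {n = p′} _ = l N.+ p′ N.* (l N.+ l) , NP.+-assoc l l _

   -- Frobenius has finite order on the monomials, so it may be inverted.
   van : ∀ (κ z ẑ : ℕ -> Carrier) -> (∀ t -> Frob l (κ t) ≈ κ t) -> (∀ t -> Frob per (κ t) ≈ κ t) -> (i j : ℕ -> ℕ) -> (∀ t -> z t ≈ x ^ i t * (y ^ j t * 1#)) -> (∀ t -> Frob l (z t) ≈ ẑ t) -> ∀ M -> foldSum _+_ 0# (\ t -> κ t * ẑ t) M ≈ 0# -> foldSum _+_ 0# (\ t -> κ t * z t) M ≈ 0#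
   van κ z ẑ κ-fixed κ-period i j shape image M h = sym (fixed M) & reflexive (ap (\ k -> Frob k (S M)) (proj₂ per-spl)) & sym (Frob-∘ (proj₁ per-spl) l (S M)) & Frob-cong (proj₁ per-spl) (apply M & h) & Frob-0 (proj₁ per-spl)
    where
    S : ℕ -> Carrier
    S = foldSum _+_ 0# (\ t -> κ t * z t)
    apply : ∀ M -> Frob l (S M) ≈ foldSum _+_ 0# (\ t -> κ t * ẑ t) M
    apply zero = Frob-0 l
    apply (suc M) = Frob-+ l _ _ & +-cong (apply M) (Frob-* l _ _ & *-cong (κ-fixed M) (image M))
    z-per : ∀ t -> Frob per (z t) ≈ z t
    z-per t = Frob-cong per (shape t) & Frob-* per _ _ & *-cong (Frob-^ per x (i t) & ^-congˡ (i t) (Frob-mul p)) (Frob-* per _ _ & *-cong (Frob-^ per y (j t) & ^-congˡ (j t) y-per) (Frob-1 per)) & sym (shape t)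
    fixed : ∀ M -> Frob per (S M) ≈ S M
    fixed zero = Frob-0 per
    fixed (suc M) = Frob-+ per _ _ & +-cong (fixed M) (Frob-* per _ _ & *-cong (κ-period M) (z-per M))

 -- An underdetermined homogeneous linear system over a finite field, by pigeonhole.
 module LinSys {q : ℕ} (K : FiniteField q) where
  open Factorisation K using (module K; idx; elt; elt-idx; idx-elt; _≟ᴷ_; 1≢0)
  open VecInd K
  open K using (Carrier; _+_; _*_; 0#)
  nth : ∀ {k} -> Vec Carrier k -> ℕ -> Carrier
  nth [] t = 0#
  nth (a ∷ v) zero = a
  nth (a ∷ v) (suc t) = nth v t
  dif : ∀ {k} (u v : Vec Carrier k) -> u ≢ v -> Σ[ t ∈ ℕ ] (t < k × nth u t ≢ nth v t)
  dif [] [] ne = ⊥-elim (ne idp)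
  dif (a ∷ u) (b ∷ v) ne with a ≟ᴷ b
  ... | no a≢b = 0 , s≤s z≤n , a≢b
  ... | yes idp = let (t , l , h) = dif u v (\ e -> ne (ap (a ∷_) e)) in suc t , s≤s l , h
  q>1 : 1 < q
  q>1 = two-ele (idx K.1#) (idx 0#) (\ e -> 1≢0 (! (elt-idx _) ∙ ap elt e ∙ elt-idx _))
   where
   two-ele : ∀ {n} (i j : Fin n) -> i ≢ j -> 1 < n
   two-ele {suc zero} Fin.zero Fin.zero ne = ⊥-elim (ne idp)
   two-ele {suc (suc n)} i j ne = s≤s (s≤s z≤n)
  row-sum : (ℕ -> Carrier) -> (ℕ -> Carrier) -> ℕ -> Carrier
  row-sum κ N = foldSum _+_ 0# (\ t -> κ t * N t)
  row-sum-dif : ∀ κ κ′ N M -> row-sum (\ t -> κ t K.- κ′ t) N M ≡ row-sum κ N M K.- row-sum κ′ N M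
  row-sum-dif κ κ′ N zero = ! (K.-‿inverseʳ 0#)
  row-sum-dif κ κ′ N (suc M) = ap (\ x -> x + (κ M K.- κ′ M) * N M) (row-sum-dif κ κ′ N M) ∙ K.solve 5 (\ a b k k′ n -> (a K.:- b) K.:+ (k K.:- k′) K.:* n K.:= (a K.:+ k K.:* n) K.:- (b K.:+ k′ K.:* n)) idp (row-sum κ N M) (row-sum κ′ N M) (κ M) (κ′ M) (N M)
  sol : ∀ {B M} -> B < M -> (N : ℕ -> ℕ -> Carrier) -> Σ[ κ ∈ (ℕ -> Carrier) ] ((Σ[ t ∈ ℕ ] (t < M × κ t ≢ 0#)) × (∀ b -> b < B -> row-sum κ (N b) M ≡ 0#))
  sol {B} {M} B<M N = found (FinP.pigeonhole (NP.^-monoʳ-< q q>1 {B} {M} B<M) (vecInd ∘ rows ∘ vecAt M))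
   where
   rows : Vec Carrier M -> Vec Carrier B
   rows κ = tabulate (\ b -> row-sum (nth κ) (N (toℕ b)) M)
   found : Σ[ i ∈ Fin (q N.^ M) ] Σ[ j ∈ Fin (q N.^ M) ] (i Fin.< j × vecInd (rows (vecAt M i)) ≡ vecInd (rows (vecAt M j))) -> Σ[ κ ∈ (ℕ -> Carrier) ] ((Σ[ t ∈ ℕ ] (t < M × κ t ≢ 0#)) × (∀ b -> b < B -> row-sum κ (N b) M ≡ 0#))
   found (i , j , i<j , e) = (\ t -> nth u t K.- nth v t) , difference (dif u v u≢v) , zero-rows
    where
    u = vecAt M i
    v = vecAt M j
    u≢v : u ≢ v
    u≢v u≡v = NP.<-irrefl (ap toℕ (! (vecInd-at M i) ∙ ap vecInd u≡v ∙ vecInd-at M j)) i<j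
    difference : Σ[ t ∈ ℕ ] (t < M × nth u t ≢ nth v t) -> Σ[ t ∈ ℕ ] (t < M × nth u t K.- nth v t ≢ 0#)
    difference (t , l , ne) = t , l , (\ z -> ne (K.from-dif z))
    same-rows : rows u ≡ rows v
    same-rows = ! (vecAt-ind (rows u)) ∙ ap (vecAt B) e ∙ vecAt-ind (rows v)
    zero-rows : ∀ b -> b < B -> row-sum (\ t -> nth u t K.- nth v t) (N b) M ≡ 0#
    zero-rows b l = row-sum-dif (nth u) (nth v) (N b) M ∙ K.to-dif (≡.subst (\ b -> row-sum (nth u) (N b) M ≡ row-sum (nth v) (N b) M) (FinP.toℕ-fromℕ< l) (! (VecP.lookup∘tabulate (\ b -> row-sum (nth u) (N (toℕ b)) M) (fromℕ< l)) ∙ ap (\ w -> lookup w (fromℕ< l)) same-rows ∙ VecP.lookup∘tabulate (\ b -> row-sum (nth v) (N (toℕ b)) M) (fromℕ< l)))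

 -- The exponents a, b < p with p a + n b = w.
 module Exponents {p : ℕ} (pr : Prime p) .{{_ : NonZero p}} (n : ℕ) (p∤n : ¬ (p ∣ℕ n)) where
  open ModPri pr
  private
   n⁻¹ : ℕ
   n⁻¹ = proj₁ (invMod n p∤n)
   n*n⁻¹ : (n N.* n⁻¹) % p ≡ 1 % p
   n*n⁻¹ = proj₂ (invMod n p∤n) ∙ ! (m<n⇒m%n≡m (pri>1 pr))
  β α : ℕ -> ℕ
  β w = (w N.* n⁻¹) % p
  α w = (w ∸ n N.* β w) / p
  private
   tim-can : ∀ b -> (b N.* (n N.* n⁻¹)) % p ≡ b % p
   tim-can b = %-distribˡ-* b (n N.* n⁻¹) p ∙ ap (\ x -> ((b % p) N.* x) % p) n*n⁻¹ ∙ ! (%-distribˡ-* b 1 p) ∙ ap (_% p) (NP.*-identityʳ b)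
  β-uni : ∀ a b -> b < p -> β (p N.* a N.+ n N.* b) ≡ b
  β-uni a b b<p = ap (_% p) (arr p a n b n⁻¹) ∙ [m+kn]%n≡m%n (b N.* (n N.* n⁻¹)) (a N.* n⁻¹) p ∙ tim-can b ∙ m<n⇒m%n≡m b<p
   where
   arr : ∀ p a n b i -> (p N.* a N.+ n N.* b) N.* i ≡ b N.* (n N.* i) N.+ a N.* i N.* p
   arr = solve-∀
  α-uni : ∀ a b -> b < p -> α (p N.* a N.+ n N.* b) ≡ a
  α-uni a b b<p = ap (\ k -> (p N.* a N.+ n N.* b ∸ n N.* k) / p) (β-uni a b b<p) ∙ ap (_/ p) (NP.m+n∸n≡m (p N.* a) (n N.* b) ∙ NP.*-comm p a) ∙ m*n/n≡m a p
  -- The choice of β w makes w - n β w divisible by p, and w ≥ n p keeps this difference from being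
  -- cut off at 0.
  exp : ∀ w -> n N.* p ≤ w -> p N.* α w N.+ n N.* β w ≡ w
  exp w l = ap (N._+ n N.* β w) (NP.*-comm p (α w) ∙ m/n*n≡m (%-equ⇒∣ (n N.* β w) w below congruent)) ∙ NP.m∸n+n≡m below
   where
   below : n N.* β w ≤ w
   below = NP.≤-trans (NP.*-monoʳ-≤ n (NP.<⇒≤ (m%n<n (w N.* n⁻¹) p))) l
   arr : ∀ n w i -> n N.* (w N.* i) ≡ w N.* (n N.* i)
   arr = solve-∀
   congruent : (n N.* β w) % p ≡ w % p
   congruent = %-distribˡ-* n (β w) p ∙ ap (\ x -> ((n % p) N.* x) % p) (m%n%n≡m%n (w N.* n⁻¹) p) ∙ ! (%-distribˡ-* n (w N.* n⁻¹) p) ∙ ap (_% p) (arr n w n⁻¹) ∙ tim-can w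
    where open import Data.Nat.DivMod using (m%n%n≡m%n)

 -- The pairs (low, high) with low < S in lexicographic order.
 module Pairs (S′ : ℕ) where
  S : ℕ
  S = suc S′
  next : (ℕ × ℕ) -> ℕ × ℕ
  next (i , j) with suc i NP.<? S
  ... | yes _ = suc i , j
  ... | no _ = 0 , suc j
  pairAt : ℕ -> ℕ × ℕ
  pairAt zero = 0 , 0
  pairAt (suc t) = next (pairAt t)
  low high : ℕ -> ℕ
  low t = proj₁ (pairAt t)
  high t = proj₂ (pairAt t)
  Valid : ℕ × ℕ -> Set
  Valid (i , j) = i < S
  next-val : ∀ x -> Valid x -> Valid (next x)
  next-val (i , j) v with suc i NP.<? S
  ... | yes l = l
  ... | no _ = s≤s z≤n
  low<S : ∀ t -> low t < S
  low<S zero = s≤s z≤n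
  low<S (suc t) = next-val (pairAt t) (low<S t)
  position : ℕ × ℕ -> ℕ
  position (i , j) = j N.* S N.+ i
  next-pos : ∀ x -> Valid x -> position (next x) ≡ suc (position x)
  next-pos (i , j) v with suc i NP.<? S
  ... | yes l = NP.+-suc (j N.* S) i
  ... | no nl = NP.+-identityʳ _ ∙ ap (N._+ j N.* S) (! (NP.≤-antisym v (NP.≮⇒≥ nl))) ∙ ap suc (NP.+-comm i (j N.* S))
  pos-pairAt : ∀ t -> position (pairAt t) ≡ t
  pos-pairAt zero = idp
  pos-pairAt (suc t) = next-pos (pairAt t) (low<S t) ∙ ap suc (pos-pairAt t)
  high-< : ∀ t U -> t < U N.* S -> high t < U
  high-< t U l = NP.*-cancelʳ-< S (high t) U (NP.≤-<-trans (NP.≤-trans (NP.m≤m+n _ (low t)) (NP.≤-reflexive (pos-pairAt t))) l)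
  value : ℕ -> ℕ -> ℕ × ℕ -> ℕ
  value γ s (i , j) = (γ N.+ i) N.+ s N.* (γ N.+ j)
  -- When i returns from S - 1 to 0, the term s (γ + j) grows by s = γ + S, which is more than i had
  -- contributed.
  next-value : ∀ γ s -> s ≡ γ N.+ S -> ∀ x -> Valid x -> value γ s x < value γ s (next x)
  next-value γ s e (i , j) v with suc i NP.<? S
  ... | yes l = NP.+-monoˡ-< (s N.* (γ N.+ j)) (NP.+-monoʳ-< γ (NP.n<1+n i))
  ... | no nl = NP.<-≤-trans (NP.+-monoˡ-< (s N.* (γ N.+ j)) (≡.subst (γ N.+ i <_) (! e) (NP.+-monoʳ-< γ v))) (NP.≤-trans (NP.≤-reflexive (! (ap (s N.*_) (NP.+-suc γ j) ∙ NP.*-suc s (γ N.+ j)))) (NP.m≤n+m _ (γ N.+ 0)))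

open AuxPol

-- Bombieri's auxiliary polynomials.

module BomMet where

 open N using (_≤_; _<_)
 open import Data.Nat.DivMod using (_%_)
 open import Data.Nat.Divisibility using () renaming (_∣_ to _∣ℕ_)
 open import Data.Nat.Tactic.RingSolver using (solve-∀)

 -- The residue field of v with the structure of an extension of K.
 module Res {p m : ℕ} (pr : Prime p) .{{_ : NonZero p}} (K : FiniteField (p N.^ m)) (φ : Coordinates K p m) {d : ℕ} (v : Vec (FiniteField.Carrier K) d) (irr : Factorisation.Irreducible K v) where
  open Factorisation K using (X; conP; module K; ⟪_⟫)
  open ResFie K v irr public
  open Ext.Over pr K φ E (proj₁ irr) finDom conP (\ a b -> ≈⇒≈/ (con-+ a b)) (\ a b -> ≈⇒≈/ (con-* a b)) (≈⇒≈/ con-1) X gen v root public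
  opaque
    XFix : ℕ -> Set
    XFix N = Frob N X ≈/ X
    TraIs : ℕ -> Factorisation.Poly K -> ℕ -> Set
    TraIs N F c = tr N F ≈/ Kit.fromℕ E c
    fix⇒XFix : ∀ {N} -> Frob N X ≈/ X -> XFix N
    fix⇒XFix h = h
    tra⇒TraIs : ∀ {N F c} -> tr N F ≈/ Kit.fromℕ E c -> TraIs N F c
    tra⇒TraIs h = h

  -- The ring homomorphism from the residue field to a quotient in which v vanishes.
  module Transport (Q : CommutativeRing 0ℓ 0ℓ) where
   private
    module Q = Kit Q
    module P = Factorisation.P K
   module Along (ρ : Factorisation.Poly K -> Q.El) (ρ-cong : ∀ {F G} -> F ≈/ G -> ρ F Q.≈ ρ G) (ρ-+ : ∀ F G -> ρ (F P.+ G) Q.≈ ρ F Q.+ ρ G) (ρ-* : ∀ F G -> ρ (F P.* G) Q.≈ ρ F Q.* ρ G) (ρ-1 : ρ P.1# Q.≈ Q.1#) where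
    private
      module T = Transfer.Along E Q ρ ρ-cong ρ-+ ρ-* ρ-1
      module E = Kit E
    charQ : Q.fromℕ p Q.≈ Q.0#
    charQ = Q.sym (T.ι-fromℕ p) Q.& ρ-cong charE Q.& T.ι-0
    module FQ = Tra Q pr charQ
    Frob-ρ : ∀ N F -> FQ.Frob N (ρ F) Q.≈ ρ (Frob N F)
    Frob-ρ N F = Q.sym (T.ι-^ F (p N.^ N))
    tr-ρ : ∀ N F -> FQ.tr N (ρ F) Q.≈ ρ (tr N F)
    tr-ρ zero F = Q.sym T.ι-0
    tr-ρ (suc N) F = Q.+-cong (tr-ρ N F) (Frob-ρ N F) Q.& Q.sym (ρ-+ (tr N F) (Frob N F))
    opaque
     unfolding XFix
     X-ρ : ∀ N -> XFix N -> FQ.Frob N (ρ X) Q.≈ ρ X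
     X-ρ N h = Frob-ρ N X Q.& ρ-cong h
     tra-ρ : ∀ N F c -> TraIs N F c -> FQ.tr N (ρ F) Q.≈ Q.fromℕ c
     tra-ρ N F c h = tr-ρ N F Q.& ρ-cong h Q.& T.ι-fromℕ c
    sca-ρ : ∀ t a -> FQ.Frob (t N.* m) (ρ (conP a)) Q.≈ ρ (conP a)
    sca-ρ t a = Frob-ρ (t N.* m) (conP a) Q.& ρ-cong (Frob-ι t a)
    fromℕ-ρ : ∀ c -> ρ (conP (K.fromℕ c)) Q.≈ Q.fromℕ c
    fromℕ-ρ c = ρ-cong (constant c) Q.& T.ι-fromℕ c
      where
      constant : ∀ c -> conP (K.fromℕ c) ≈/ E.fromℕ c
      constant zero = ≈⇒≈/ ⟪ (\ { zero -> idp ; (suc i) -> idp }) ⟫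
      constant (suc c) = E.trans {conP (K.fromℕ (suc c))} {conP K.1# P.+ conP (K.fromℕ c)} (≈⇒≈/ (con-+ K.1# (K.fromℕ c))) (E.+-cong {conP K.1#} {P.1#} {conP (K.fromℕ c)} {E.fromℕ c} (≈⇒≈/ con-1) (constant c))

 module Bom {p″ m : ℕ} (pr : Prime (suc (suc p″))) (K : FiniteField (suc (suc p″) N.^ m)) (φ : Coordinates K (suc (suc p″)) m) (n′ : ℕ) (p∤n : ¬ (suc (suc p″) ∣ℕ suc n′)) (α : ℕ -> FiniteField.Carrier K) (α-top : α (suc n′) ≢ FiniteField.0# K) where
  private
   p n q : ℕ
   p = suc (suc p″)
   n = suc n′
   q = p N.^ m
  open Factorisation K
  open LinSys K
  private
   module FF = FieFac pr K φ
   module MX = Mon (fieRing K)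
  fP : ℕ -> Poly
  fP zero = P.0#
  fP (suc j) = fP j P.+ conP (α (suc j)) P.* X P.^ suc j
  fP-term : ∀ j i -> coeff (conP (α j) P.* X P.^ j) i ≡ α j K.* shift j 𝟙 i
  fP-term j i = con-⊛ (α j) (coeff (X P.^ j)) i ∙ ap (α j K.*_) (MX.X^-shi j i)
  fP-Deg : ∀ j -> Deg< (coeff (fP j)) (suc j)
  fP-Deg zero i l = idp
  fP-Deg (suc j) i l = ap₂ K._+_ (fP-Deg j i (NP.<⇒≤ l)) (fP-term (suc j) i ∙ ap (α (suc j) K.*_) (MX.shi-𝟙-≢ (suc j) i (\ { idp -> NP.<-irrefl idp l })) ∙ K.zeroʳ _) ∙ K.+-identityʳ K.0#
  fP-top : ∀ j -> coeff (fP (suc j)) (suc j) ≡ α (suc j)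
  fP-top j = ap₂ K._+_ (fP-Deg j (suc j) NP.≤-refl) (fP-term (suc j) (suc j) ∙ ap (α (suc j) K.*_) (MX.shi-𝟙-≡ (suc j)) ∙ K.*-identityʳ _) ∙ K.+-identityˡ _
  open Curve.Of K p″ n (s≤s z≤n) (fP n) (fP-Deg n) (\ e -> α-top (! (fP-top n′) ∙ e)) hiding (p)
  open Exponents pr n p∤n using (exp; β-uni; α-uni) renaming (β to row-of; α to column-of)
  lin : (ℕ -> K.El) -> (ℕ -> PY.Poly) -> ℕ -> PY.Poly
  lin κ z = foldSum Y._+_ Y.0# (\ t -> k (κ t) Y.* z t)
  bou-+k : ∀ {B z z′} c -> Bounded B z -> Bounded B z′ -> Bounded B (z Y.+ k c Y.* z′)
  bou-+k c (bounded r h) (bounded r′ h′) = bounded (rep-+ r (rep-k c r′)) (sma-+ h (sma-k c h′))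
  lead-+k : ∀ {B z z′} c -> c ≢ K.0# -> Bounded B z -> Lead B z′ -> Lead B (z Y.+ k c Y.* z′)
  lead-+k c c≢0 (bounded r h) (lead r′ h′) = lead (rep-+ r (rep-k c r′)) (lea-+ h (lea-k c c≢0 h′))
  k-0 : ∀ z -> k K.0# Y.* z Y.≈ Y.0#
  k-0 z = Y.*-congʳ {z} {k K.0#} {Y.0#} PY.⟪ (\ { zero -> ⟪ (\ { zero -> idp ; (suc i) -> idp }) ⟫ ; (suc b) -> P.refl {P.0#} }) ⟫ Y.& Y.zeroˡ z
  -- The leading weights increase strictly, so the last nonzero coefficient decides the leading term
  -- of the combination.
  module Lea (κ : ℕ -> K.El) (z : ℕ -> PY.Poly) (W : ℕ -> ℕ) (W-< : ∀ t -> W t < W (suc t)) (lead-z : ∀ t -> Lead (W t) (z t)) where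
   lin-bou : ∀ M -> Bounded (W M) (lin κ z M)
   lin-bou zero = bounded rep-0 (\ _ _ _ _ -> idp)
   lin-bou (suc M) = bou-+k (κ M) (bou-resp (NP.<⇒≤ (W-< M)) (O.refl {lin κ z M}) (lin-bou M)) (bou-resp (W-< M) (O.refl {z M}) (lead⇒bou (lead-z M)))
   lin-lead : ∀ M -> (Σ[ t ∈ ℕ ] (t < M × κ t ≢ K.0#)) -> Σ[ t ∈ ℕ ] (t < M × Lead (W t) (lin κ z M))
   lin-lead zero (t , () , _)
   lin-lead (suc M) (t , l , ne) = go (κ M ≟ᴷ K.0#)
     where
     go : Dec (κ M ≡ K.0#) -> Σ[ t ∈ ℕ ] (t < suc M × Lead (W t) (lin κ z (suc M)))
     go (no κ≢0) = M , NP.≤-refl , lead-+k (κ M) κ≢0 (lin-bou M) (lead-z M)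
     go (yes κ≡0) with lin-lead M (t , NP.≤∧≢⇒< (NP.≤-pred l) (\ { idp -> ne κ≡0 }) , ne)
     ... | t′ , l′ , h = t′ , NP.m<n⇒m<1+n l′ , lead-resp idp (≈⇒≈/ (Y.+-congˡ {lin κ z M} (Y.reflexive (ap (\ c -> k c Y.* z M) κ≡0) Y.& k-0 (z M)) Y.& Y.+-identityʳ _)) h
  lin-rep : ∀ κ z (N : ℕ -> Ent) -> (∀ t -> Rep (z t) (N t)) -> ∀ M -> Rep (lin κ z M) (\ b a -> row-sum κ (\ t -> N t b a) M)
  lin-rep κ z N r zero = rep-0
  lin-rep κ z N r (suc M) = rep-+ (lin-rep κ z N r M) (rep-k (κ M) (r M))
  row-sum-0 : ∀ κ N M -> (∀ t -> t < M -> N t ≡ K.0#) -> row-sum κ N M ≡ K.0#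
  row-sum-0 κ N zero h = idp
  row-sum-0 κ N (suc M) h = ap₂ (\ x y -> x K.+ κ M K.* y) (row-sum-0 κ N M (\ t l -> h t (NP.m<n⇒m<1+n l))) (h M NP.≤-refl) ∙ K.solve 1 (\ k -> K.0∶ K.:+ k K.:* K.0∶ K.:= K.0∶) idp (κ M)

  -- More unknowns than weights below the bound.
  rel-exi : ∀ {B M} -> B < M -> (ẑ : ℕ -> PY.Poly) (bou-of : ℕ -> ℕ) -> (∀ t -> t < M -> bou-of t ≤ B) -> (∀ t -> Bounded (bou-of t) (ẑ t)) -> Σ[ κ ∈ (ℕ -> K.El) ] ((Σ[ t ∈ ℕ ] (t < M × κ t ≢ K.0#)) × lin κ ẑ M ≈/ Y.0#)
  rel-exi {B} {M} B<M ẑ bou-of below bnd = found (sol B<M (\ w t -> N t (row-of w) (column-of w)))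
   where
   N : ℕ -> Ent
   N t = Bounded.matrix (bnd t)
   found : Σ[ κ ∈ (ℕ -> K.El) ] ((Σ[ t ∈ ℕ ] (t < M × κ t ≢ K.0#)) × (∀ w -> w < B -> row-sum κ (\ t -> N t (row-of w) (column-of w)) M ≡ K.0#)) -> Σ[ κ ∈ (ℕ -> K.El) ] ((Σ[ t ∈ ℕ ] (t < M × κ t ≢ K.0#)) × lin κ ẑ M ≈/ Y.0#)
   found (κ , nz , e) = κ , nz , rep-zero r (\ b a -> zero-entry b a (b NP.<? p) (weight a b NP.<? B))
     where
     r : Rep (lin κ ẑ M) (\ b a -> row-sum κ (\ t -> N t b a) M)
     r = lin-rep κ ẑ N (\ t -> Bounded.isRep (bnd t)) M
     zero-entry : ∀ b a -> Dec (b < p) -> Dec (weight a b < B) -> row-sum κ (\ t -> N t b a) M ≡ K.0#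
     zero-entry b a (no b≥p) _ = ! (ent r b a) ∙ atᴾ (reduced r b (NP.≮⇒≥ b≥p)) a
     zero-entry b a (yes b<p) (yes w<B) = ≡.subst₂ (\ b′ a′ -> row-sum κ (\ t -> N t b′ a′) M ≡ K.0#) (β-uni a b b<p) (α-uni a b b<p) (e (weight a b) w<B)
     zero-entry b a (yes b<p) (no w≥B) = row-sum-0 κ (\ t -> N t b a) M (\ t l -> Bounded.isSmall (bnd t) b a b<p (NP.≤-trans (below t l) (NP.≮⇒≥ w≥B)))
  bou-X^ : ∀ {B z} i -> Bounded B z -> Bounded (B N.+ p N.* i) (𝕏 O.^ i Y.* z)
  bou-X^ {B} {z} zero h = bou-resp (NP.m≤m+n B _) (O.*-identityˡ z) h
  bou-X^ {B} {z} (suc i) h = bou-resp (NP.≤-reflexive (NP.+-assoc B _ p ∙ ap (B N.+_) (NP.+-comm _ p ∙ ! (NP.*-suc p i)))) (O.*-assoc 𝕏 (𝕏 O.^ i) z) (times (bou-X^ i h))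
   where
   times : ∀ {B z} -> Bounded B z -> Bounded (B N.+ p) (𝕏 Y.* z)
   times (bounded r h) = bounded (rep-X r) (sma-X h)
  bou-Y^ : ∀ {B z} i -> Bounded B z -> Bounded (B N.+ n N.* i) (𝕐 O.^ i Y.* z)
  bou-Y^ {B} {z} zero h = bou-resp (NP.m≤m+n B _) (O.*-identityˡ z) h
  bou-Y^ {B} {z} (suc i) h = bou-resp (NP.≤-reflexive (NP.+-assoc B _ n ∙ ap (B N.+_) (NP.+-comm _ n ∙ ! (NP.*-suc n i)))) (O.*-assoc 𝕐 (𝕐 O.^ i) z) (times (bou-Y^ i h))
   where
   times : ∀ {B z} -> Bounded B z -> Bounded (B N.+ n) (𝕐 Y.* z)
   times (bounded r h) = bounded (rep-Y r) (sma-Y h)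
  -- From weight n p on, every weight belongs to exactly one monomial X^a Y^b with b < p.
  γ : ℕ
  γ = n N.* p
  -- One polynomial divisible by all primes of class c. With s = q^l, p times its degree is at most
  -- s² + (2 γ + 1) s, so the class contains about q^(2l) / p points up to a multiple of q^l at
  -- most.
  record Mul (l c : ℕ) : Set where
   field
     {size} : ℕ
     poly′ : Vec K.El size
     size-bou : p N.* size ≤ p N.^ (l N.* m) N.* (p N.^ (l N.* m) N.+ (γ N.+ γ N.+ 1))
     divisible : ∀ {d} (v : Vec K.El d) (irr : Irreducible v) -> Res.XFix pr K φ v irr (l N.* m N.+ l N.* m) -> Res.TraIs pr K φ v irr (l N.* m N.+ l N.* m) (fP n) c -> monP v ∣ monP poly′
  module Con (l c δ : ℕ) (s≡ : p N.^ (l N.* m) ≡ (γ N.+ 1) N.* (γ N.+ 2) N.+ δ) where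
   s : ℕ
   s = p N.^ (l N.* m)
   S′ : ℕ
   S′ = γ N.* γ N.+ γ N.+ γ N.+ 1 N.+ δ
   open Pairs S′
   s-spl : s ≡ γ N.+ S
   s-spl = s≡ ∙ arith γ δ
     where
     arith : ∀ γ δ -> (γ N.+ 1) N.* (γ N.+ 2) N.+ δ ≡ γ N.+ suc (γ N.* γ N.+ γ N.+ γ N.+ 1 N.+ δ)
     arith = solve-∀
   -- There are M = U S unknowns with S = s - γ, against the weights below B = s² + 2 γ + 1. For U =
   -- s + γ + 1 one gets M = s² + s - γ² - γ, and M > B means s ≥ γ² + 3 γ + 2, the threshold (γ +
   -- 1)(γ + 2).
   U M B : ℕ
   U = s N.+ γ N.+ 1
   M = U N.* S
   B = suc (s N.* (γ N.+ S′) N.+ (γ N.+ (s N.+ γ)))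
   B<M : B < M
   B<M = ≡.subst (\ s -> suc (s N.* (γ N.+ S′) N.+ (γ N.+ (s N.+ γ))) < (s N.+ γ N.+ 1) N.* S) (! s-spl) (NP.≤-trans (NP.m≤m+n _ δ) (NP.≤-reflexive (arith γ δ)))
     where
     arith : ∀ γ δ -> suc (suc ((γ N.+ suc (γ N.* γ N.+ γ N.+ γ N.+ 1 N.+ δ)) N.* (γ N.+ (γ N.* γ N.+ γ N.+ γ N.+ 1 N.+ δ)) N.+ (γ N.+ ((γ N.+ suc (γ N.* γ N.+ γ N.+ γ N.+ 1 N.+ δ)) N.+ γ)))) N.+ δ ≡ ((γ N.+ suc (γ N.* γ N.+ γ N.+ γ N.+ 1 N.+ δ)) N.+ γ N.+ 1) N.* suc (γ N.* γ N.+ γ N.+ γ N.+ 1 N.+ δ)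
     arith = solve-∀
   a₁ b₁ a₂ b₂ : ℕ -> ℕ
   a₁ t = column-of (γ N.+ low t)
   b₁ t = row-of (γ N.+ low t)
   a₂ t = column-of (γ N.+ high t)
   b₂ t = row-of (γ N.+ high t)
   -- The factor s on the second pair of exponents gives the z distinct leading weights. At a point
   -- of the class the power s of z is ẑ, where this factor has moved to the first pair; the weights
   -- of the ẑ are all below B.
   z ẑ : ℕ -> PY.Poly
   z t = 𝕏 O.^ (a₁ t N.+ s N.* a₂ t) Y.* (𝕐 O.^ (b₁ t N.+ s N.* b₂ t) Y.* Y.1#)
   ẑ t = 𝕏 O.^ (s N.* a₁ t N.+ a₂ t) Y.* (𝕐 O.^ (s N.* b₁ t) Y.* ((𝕐 Y.+ k (K.fromℕ c)) O.^ b₂ t Y.* Y.1#))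
   W : ℕ -> ℕ
   W t = value γ s (pairAt t)
   wei₁ : ∀ t -> p N.* a₁ t N.+ n N.* b₁ t ≡ γ N.+ low t
   wei₁ t = exp _ (NP.m≤m+n γ (low t))
   wei₂ : ∀ t -> p N.* a₂ t N.+ n N.* b₂ t ≡ γ N.+ high t
   wei₂ t = exp _ (NP.m≤m+n γ (high t))
   lead-z : ∀ t -> Lead (W t) (z t)
   lead-z t = lead-resp (arith p n s (a₁ t) (b₁ t) (a₂ t) (b₂ t) ∙ ap₂ (\ x y -> x N.+ s N.* y) (wei₁ t) (wei₂ t)) (O.refl {z t}) (lead-X^ (a₁ t N.+ s N.* a₂ t) (lead-Y^ (b₁ t N.+ s N.* b₂ t) (lead rep-1 lea-1)))
     where
     arith : ∀ p n s a₁ b₁ a₂ b₂ -> 0 N.+ n N.* (b₁ N.+ s N.* b₂) N.+ p N.* (a₁ N.+ s N.* a₂) ≡ (p N.* a₁ N.+ n N.* b₁) N.+ s N.* (p N.* a₂ N.+ n N.* b₂)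
     arith = solve-∀
   bou-of : ℕ -> ℕ
   bou-of t = suc (s N.* (γ N.+ low t) N.+ (γ N.+ high t))
   bou-ẑ : ∀ t -> Bounded (bou-of t) (ẑ t)
   bou-ẑ t = bou-resp (NP.≤-reflexive (arith p n s (a₁ t) (b₁ t) (a₂ t) (b₂ t) ∙ ap₂ (\ x y -> suc (s N.* x N.+ y)) (wei₁ t) (wei₂ t))) (O.refl {ẑ t}) (bou-X^ (s N.* a₁ t N.+ a₂ t) (bou-Y^ (s N.* b₁ t) (bou-tra (K.fromℕ c) (b₂ t) (lead⇒bou (lead rep-1 lea-1)))))
     where
     arith : ∀ p n s a₁ b₁ a₂ b₂ -> 1 N.+ n N.* b₂ N.+ n N.* (s N.* b₁) N.+ p N.* (s N.* a₁ N.+ a₂) ≡ suc (s N.* (p N.* a₁ N.+ n N.* b₁) N.+ (p N.* a₂ N.+ n N.* b₂))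
     arith = solve-∀
   high≤ : ∀ t -> t < M -> high t ≤ s N.+ γ
   high≤ t t<M = NP.≤-pred (NP.≤-trans (high-< t U t<M) (NP.≤-reflexive (NP.+-comm (s N.+ γ) 1)))
   bou-of≤ : ∀ t -> t < M -> bou-of t ≤ B
   bou-of≤ t t<M = s≤s (NP.+-mono-≤ (NP.*-monoʳ-≤ s (NP.+-monoʳ-≤ γ (NP.≤-pred (low<S t)))) (NP.+-monoʳ-≤ γ (high≤ t t<M)))
   W≤ : ∀ t -> t < M -> W t ≤ s N.* (s N.+ (γ N.+ γ N.+ 1))
   W≤ t t<M = NP.≤-trans (NP.+-mono-≤ (NP.≤-trans (NP.+-monoʳ-≤ γ (NP.<⇒≤ (low<S t))) (NP.≤-reflexive (! s-spl))) (NP.*-monoʳ-≤ s (NP.+-monoʳ-≤ γ (high≤ t t<M)))) (NP.≤-reflexive (arith s γ))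
     where
     arith : ∀ s γ -> s N.+ s N.* (γ N.+ (s N.+ γ)) ≡ s N.* (s N.+ (γ N.+ γ N.+ 1))
     arith = solve-∀
   L : ℕ
   L = l N.* m
   module Spe (Q : CommutativeRing 0ℓ 0ℓ) (charQ : CommutativeRing._≈_ Q (Kit.fromℕ Q p) (CommutativeRing.0# Q)) where
    private
     module Q = Kit Q
     module FQ = Tra Q pr charQ
    module Along (ρ : PY.Poly -> Q.El) (ρ-cong : ∀ {a b} -> a ≈/ b -> ρ a Q.≈ ρ b) (ρ-+ : ∀ a b -> ρ (a Y.+ b) Q.≈ ρ a Q.+ ρ b) (ρ-* : ∀ a b -> ρ (a Y.* b) Q.≈ ρ a Q.* ρ b) (ρ-1 : ρ Y.1# Q.≈ Q.1#) (X-fix : FQ.Frob (L N.+ L) (ρ 𝕏) Q.≈ ρ 𝕏) (trace : FQ.tr (L N.+ L) (ρ (PY.conP (fP n))) Q.≈ Q.fromℕ c) (scalar : ∀ t a -> FQ.Frob (t N.* m) (ρ (k a)) Q.≈ ρ (k a)) (ρ-c : ρ (k (K.fromℕ c)) Q.≈ Q.fromℕ c) where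
     open Q
     private
      module TY = Transfer.Along PY.polyRing Q ρ (\ e -> ρ-cong (≈⇒≈/ e)) ρ-+ ρ-* ρ-1
      module TO = Transfer.Along O Q ρ ρ-cong ρ-+ ρ-* ρ-1
      equ′ : ρ 𝕐 ^ p ≈ ρ 𝕐 + ρ (PY.conP (fP n))
      equ′ = sym (TY.ι-^ 𝕐 p) & ρ-cong Y^p & ρ-+ 𝕐 (PY.conP (fP n))
     open Van.AtPoint Q pr charQ L c (ρ 𝕏) (ρ 𝕐) (ρ (PY.conP (fP n))) X-fix equ′ trace using (monomial; van; per)
     sca-per : ∀ a -> FQ.Frob per (ρ (k a)) ≈ ρ (k a)
     sca-per a = reflexive (ap (\ N -> FQ.Frob N (ρ (k a))) (! (arith p l m))) & scalar (p N.* (l N.+ l)) a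
      where
      arith : ∀ p l m -> p N.* (l N.+ l) N.* m ≡ p N.* (l N.* m N.+ l N.* m)
      arith = solve-∀
     ρ-mon : ∀ i j -> ρ (𝕏 O.^ i Y.* (𝕐 O.^ j Y.* Y.1#)) ≈ ρ 𝕏 ^ i * (ρ 𝕐 ^ j * 1#)
     ρ-mon i j = ρ-* _ _ & *-cong (TO.ι-^ 𝕏 i) (ρ-* _ _ & *-cong (TO.ι-^ 𝕐 j) ρ-1)
     ρ-ẑ : ∀ t -> ρ (ẑ t) ≈ ρ 𝕏 ^ (s N.* a₁ t N.+ a₂ t) * (ρ 𝕐 ^ (s N.* b₁ t) * ((ρ 𝕐 + fromℕ c) ^ b₂ t * 1#))
     ρ-ẑ t = ρ-* _ _ & *-cong (TO.ι-^ 𝕏 (s N.* a₁ t N.+ a₂ t)) (ρ-* _ _ & *-cong (TO.ι-^ 𝕐 (s N.* b₁ t)) (ρ-* _ _ & *-cong (TO.ι-^ (𝕐 Y.+ k (K.fromℕ c)) (b₂ t) & ^-congˡ (b₂ t) (ρ-+ _ _ & +-congˡ ρ-c)) ρ-1))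
     ρ-lin : ∀ κ z M -> ρ (lin κ z M) ≈ foldSum _+_ 0# (\ t -> ρ (k (κ t)) * ρ (z t)) M
     ρ-lin κ z zero = TO.ι-0
     ρ-lin κ z (suc M) = ρ-+ _ _ & +-cong (ρ-lin κ z M) (ρ-* _ _)
     vanishes : ∀ κ -> lin κ ẑ M ≈/ Y.0# -> ρ (lin κ z M) ≈ 0#
     vanishes κ e = ρ-lin κ z M & van (\ t -> ρ (k (κ t))) (\ t -> ρ (z t)) (\ t -> ρ (ẑ t)) (\ t -> scalar l (κ t)) (\ t -> sca-per (κ t)) (\ t -> a₁ t N.+ s N.* a₂ t) (\ t -> b₁ t N.+ s N.* b₂ t) (\ t -> ρ-mon (a₁ t N.+ s N.* a₂ t) (b₁ t N.+ s N.* b₂ t)) (\ t -> FQ.Frob-cong L (ρ-mon (a₁ t N.+ s N.* a₂ t) (b₁ t N.+ s N.* b₂ t)) & monomial (a₁ t) (b₁ t) (a₂ t) (b₂ t) & sym (ρ-ẑ t)) M (sym (ρ-lin κ ẑ M) & ρ-cong e & TO.ι-0)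
   -- All points over the prime v are treated at once, in the quotient of the coordinate ring by v.
   module AtPrime {d : ℕ} (v : Vec K.El d) (irr : Irreducible v) where
     module D = QuoRing O (PY.conP (monP v))
     private
      Q = D.quoRing
      module Q = Kit Q
      open Q using (_≈_)
      Y⇒Q : ∀ {a b} -> a Y.≈ b -> a ≈ b
      Y⇒Q e = D.≈⇒≈/ (≈⇒≈/ e)
      con-cong : ∀ {F G} -> QuoRing._≈/_ polyRing (monP v) F G -> PY.conP F ≈ PY.conP G
      con-cong {F} {G} (QuoRing._,_ w e) = D._,_ (PY.conP w) (≈⇒≈/ PY.⟪ (\ { zero -> e ; (suc b) -> P.sym (P.+-identityˡ _ P.& PY.con-⊛ (monP v) (PY.const w) (suc b) P.& P.zeroʳ (monP v)) }) ⟫)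
      con-Y+ : ∀ F G -> PY.conP (F P.+ G) ≈ PY.conP F Y.+ PY.conP G
      con-Y+ F G = Y⇒Q PY.⟪ (\ { zero -> P.refl {F P.+ G} ; (suc b) -> P.sym (P.+-identityˡ P.0#) }) ⟫
      con-Y* : ∀ F G -> PY.conP (F P.* G) ≈ PY.conP F Y.* PY.conP G
      con-Y* F G = Y⇒Q PY.⟪ (\ { zero -> P.refl {F P.* G} ; (suc b) -> P.sym (PY.con-⊛ F (PY.const G) (suc b) P.& P.zeroʳ F) }) ⟫
      con-Y1 : PY.conP P.1# ≈ Y.1#
      con-Y1 = Y⇒Q PY.⟪ (\ { zero -> P.refl {P.1#} ; (suc b) -> P.refl {P.0#} }) ⟫
     multiple : Res.XFix pr K φ v irr (L N.+ L) -> Res.TraIs pr K φ v irr (L N.+ L) (fP n) c -> ∀ κ -> lin κ ẑ M ≈/ Y.0# -> Σ[ w ∈ PY.Poly ] lin κ z M ≈/ PY.conP (monP v) Y.* w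
     multiple X-fix trace κ e = go (Spe.Along.vanishes Q T.charQ (\ a -> a) D.≈⇒≈/ (\ a b -> Q.refl {a Y.+ b}) (\ a b -> Q.refl {a Y.* b}) (Q.refl {Y.1#}) (T.X-ρ (L N.+ L) X-fix) (T.tra-ρ (L N.+ L) (fP n) c trace) T.sca-ρ (T.fromℕ-ρ c) κ e)
      where
      module T = Res.Transport.Along pr K φ v irr Q PY.conP con-cong con-Y+ con-Y* con-Y1
      go : lin κ z M ≈ Y.0# -> Σ[ w ∈ PY.Poly ] lin κ z M ≈/ PY.conP (monP v) Y.* w
      go (D._,_ w e) = w , O.trans {lin κ z M} {Y.0# Y.+ PY.conP (monP v) Y.* w} {PY.conP (monP v) Y.* w} e (O.+-identityˡ (PY.conP (monP v) Y.* w))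
   -- A relation among the ẑ makes the same combination of the z vanish at all points of the class,
   -- although it is nonzero in the coordinate ring by its leading weight. The entries of its normal
   -- form are then divisible by every prime of the class.
   construct : Mul l c
   construct = from-rel (rel-exi B<M ẑ bou-of bou-of≤ bou-ẑ)
     where
     from-rel : Σ[ κ ∈ (ℕ -> K.El) ] ((Σ[ t ∈ ℕ ] (t < M × κ t ≢ K.0#)) × lin κ ẑ M ≈/ Y.0#) -> Mul l c
     from-rel (κ , nz , e) = from-lead (Lea.lin-lead κ z W (\ t -> next-value γ s s-spl (pairAt t) (low<S t)) lead-z M nz)
      where
      from-lead : Σ[ t ∈ ℕ ] (t < M × Lead (W t) (lin κ z M)) -> Mul l c
      from-lead (t , t<M , h) = from-nor (normalise (suc a) A A-Deg)
       where
       r = Lead.isRep h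
       b = row (Lead.isLead h)
       a = column (Lead.isLead h)
       -- The row of the leading term: A is nonzero of degree a, and p a is at most the leading
       -- weight.
       A = PY.coeff (normal r) b
       A-Deg : Deg< (coeff A) (suc a)
       A-Deg i l = ent r b i ∙ below (Lead.isLead h) b i (row<p (Lead.isLead h)) (≡.subst (_< weight i b) (at-top (Lead.isLead h)) (NP.+-monoˡ-< (n N.* b) (NP.*-monoʳ-< p l)))
       from-nor : (A P.≈ P.0#) ⊎ (Σ[ j ∈ ℕ ] Σ[ w ∈ Vec K.El j ] Σ[ c ∈ K.El ] (j < suc a × c ≢ K.0# × A P.≈ conP c P.* monP w)) -> Mul l c
       from-nor (inj₁ A≈0) = ⊥-elim (nonzero (Lead.isLead h) (! (ent r b a) ∙ atᴾ A≈0 a))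
       from-nor (inj₂ (j , w , c₀ , j≤a , c≢0 , eq)) = record { poly′ = w ; size-bou = NP.≤-trans (NP.*-monoʳ-≤ p (NP.≤-pred j≤a)) (NP.≤-trans (NP.m≤m+n (p N.* a) (n N.* b)) (NP.≤-trans (NP.≤-reflexive (at-top (Lead.isLead h))) (W≤ t t<M))) ; divisible = \ v irr X-fix trace -> con-can {monP v} c₀ (monP w) c≢0 (divides v (quotient v (AtPrime.multiple v irr X-fix trace κ e))) }
        where
        quotient : ∀ {d} (v : Vec K.El d) -> Σ[ w ∈ PY.Poly ] lin κ z M ≈/ PY.conP (monP v) Y.* w -> monP v ∣ A
        quotient v (w , h) = rep-∣ r (monP v) w h b
        divides : ∀ {d} (v : Vec K.El d) -> monP v ∣ A -> monP v ∣ conP c₀ P.* monP w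
        divides v (u , e′) = u , P.sym eq P.& e′

open BomMet

-- Prime powers counted by class.

module PriCla where

 open N using (_≤_; _<_)
 open import Data.Nat.DivMod using (_%_; m%n<n)
 open import Data.Nat.Divisibility using (m%n≡0⇒n∣m; n∣m⇒m%n≡0) renaming (_∣_ to _∣ℕ_; _∣?_ to _∣ℕ?_)
 open import Data.Integer.Base using (+_; +≤+)
 open import Relation.Nullary using (_×-dec_)

 module OrdSums {q : ℕ} (K : FiniteField q) where
  open PriPow K using (module K; Irreducible; irr?)
  open DegIde K ℤ-ring
  private module I = Integers
  []-01 : ∀ {A : Set} (d : Dec A) -> (A × [ d ] ≡ + 1) ⊎ (¬ A × [ d ] ≡ + 0)
  []-01 d@(yes a) = inj₁ (a , [yes] d a)
  []-01 d@(no na) = inj₂ (na , [no] d na)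
  []-non : ∀ {A : Set} (d : Dec A) -> + 0 ℤ.≤ [ d ]
  []-non d = [ (\ { (_ , e) -> ≡.subst (+ 0 ℤ.≤_) (! e) (+≤+ z≤n) }) , (\ { (_ , e) -> ℤP.≤-reflexive (! e) }) ]′ ([]-01 d)
  sumTo-mono : ∀ n {f g : ℕ -> ℤ} -> (∀ i -> i < n -> f i ℤ.≤ g i) -> sumTo n f ℤ.≤ sumTo n g
  sumTo-mono zero {f} {g} h = ℤP.≤-reflexive (sumTo-zero f ∙ ! (sumTo-zero g))
  sumTo-mono (suc n) {f} {g} h = ℤP.≤-trans (ℤP.≤-reflexive (sumTo-snoc n f)) (ℤP.≤-trans (ℤP.+-mono-≤ (sumTo-mono n (\ i l -> h i (NP.m<n⇒m<1+n l))) (h n NP.≤-refl)) (ℤP.≤-reflexive (! (sumTo-snoc n g))))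
  sum-mono : ∀ {n} {f g : Fin n -> ℤ} -> (∀ i -> f i ℤ.≤ g i) -> I.sum f ℤ.≤ I.sum g
  sum-mono {zero} h = ℤP.≤-refl
  sum-mono {suc n} h = ℤP.+-mono-≤ (h Fin.zero) (sum-mono (\ i -> h (Fin.suc i)))
  sumV-mono : ∀ k {f g : Vec K.El k -> ℤ} -> (∀ v -> f v ℤ.≤ g v) -> sumV k f ℤ.≤ sumV k g
  sumV-mono zero {f} {g} h = ≡.subst₂ ℤ._≤_ (! (sumV-nil f)) (! (sumV-nil g)) (h [])
  sumV-mono (suc k) {f} {g} h = ≡.subst₂ ℤ._≤_ (! (sumV-cons k f)) (! (sumV-cons k g)) (sum-mono {q} (\ i -> sumV-mono k (\ v -> h _)))
  sumPri-mono : ∀ B (g h : ∀ {d} -> Vec K.El d -> ℕ -> ℤ) -> (∀ {i} (v : Vec K.El (suc i)) -> Irreducible v -> sumTo B (\ e -> g v (suc e)) ℤ.≤ sumTo B (\ e -> h v (suc e))) -> sumPri B g ℤ.≤ sumPri B h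
  sumPri-mono B g h le = sumTo-mono B (\ i _ -> sumV-mono (suc i) (\ v -> ≡.subst₂ ℤ._≤_ (sumTo-*ˡ B ([ irr? v ] ℤ.* I.fromℕ (suc i)) (\ e -> g v (suc e))) (sumTo-*ˡ B ([ irr? v ] ℤ.* I.fromℕ (suc i)) (\ e -> h v (suc e))) (row v ([]-01 (irr? v)))))
   where
   row : ∀ {i} (v : Vec K.El (suc i)) -> (Irreducible v × [ irr? v ] ≡ + 1) ⊎ (¬ Irreducible v × [ irr? v ] ≡ + 0) -> ([ irr? v ] ℤ.* I.fromℕ (suc i)) ℤ.* sumTo B (\ e -> g v (suc e)) ℤ.≤ ([ irr? v ] ℤ.* I.fromℕ (suc i)) ℤ.* sumTo B (\ e -> h v (suc e))
   row {i} v (inj₁ (ir , e)) = ≡.subst (\ w -> w ℤ.* sumTo B (\ e -> g v (suc e)) ℤ.≤ w ℤ.* sumTo B (\ e -> h v (suc e))) (! (ap₂ ℤ._*_ e (I.fromℕ≡+ (suc i)) ∙ ℤP.*-identityˡ (+ suc i))) (ℤP.*-monoˡ-≤-nonNeg (+ suc i) (le v ir))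
   row {i} v (inj₂ (_ , e)) = ℤP.≤-reflexive (col (sumTo B (\ e -> g v (suc e))) ∙ ! (col (sumTo B (\ e -> h v (suc e)))))
    where
    col : ∀ x -> ([ irr? v ] ℤ.* I.fromℕ (suc i)) ℤ.* x ≡ + 0
    col x = ap (\ w -> w ℤ.* I.fromℕ (suc i) ℤ.* x) e ∙ idp
  at-most-one : ∀ B (f : ℕ -> ℤ) -> (∀ e -> f e ≡ + 0 ⊎ f e ≡ + 1) -> (∀ e e′ -> f e ≡ + 1 -> f e′ ≡ + 1 -> e ≡ e′) -> sumTo B f ℤ.≤ + 1
  at-most-one zero f h u = ≡.subst (ℤ._≤ + 1) (! (sumTo-zero f)) (+≤+ z≤n)
  at-most-one (suc B) f h u = ℤP.≤-trans (ℤP.≤-reflexive (sumTo-snoc B f)) (go (h B))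
   where
   go : f B ≡ + 0 ⊎ f B ≡ + 1 -> sumTo B f ℤ.+ f B ℤ.≤ + 1
   go (inj₁ e) = ≡.subst (ℤ._≤ + 1) (! (ap (\ x -> sumTo B f ℤ.+ x) e ∙ ℤP.+-identityʳ _)) (at-most-one B f h u)
   go (inj₂ e) = ℤP.≤-reflexive (ap₂ ℤ._+_ (sumTo-0 B (\ i l -> [ (\ z -> z) , (\ o -> ⊥-elim (NP.<-irrefl (u i B o e) l)) ]′ (h i))) e)

 -- Primes P of degree d and exponents e with d e = j, counted with weight d, by the class of T(P^e) modulo p.
 module ClaCou {q : ℕ} (K : FiniteField q) {p : ℕ} .{{_ : NonZero p}} (T : ∀ {d} -> Vec (FiniteField.Carrier K) d -> ℕ) where
  open PriPow K using (module K; Irreducible; irr?; monP; _∣_; _∣?_; pow; pow-suc; ∣-trans)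
  open OrdSums K public
  private
   module I = Integers
   module N1 = New K ℤ-ring (\ _ -> + 1) (\ _ _ -> idp)
   module A = AffFor K ℤ-ring
  open DegIde K ℤ-ring public
  Good : ℕ -> ℕ -> ∀ {d} -> Vec K.El d -> ℕ -> Set
  Good c j {d} v e = (e N.* d ≡ j) × (T (pow v e) % p ≡ c)
  good? : ∀ c j {d} (v : Vec K.El d) e -> Dec (Good c j v e)
  good? c j {d} v e = (e N.* d NP.≟ j) ×-dec (T (pow v e) % p NP.≟ c)
  count : ℕ -> ℕ -> ℤ
  count c j = sumPri j (\ v e -> [ good? c j v e ])
  total : ℕ -> ℤ
  total j = sumPri j (\ {d} v e -> [ e N.* d NP.≟ j ] ℤ.* + 1)
  -- A comparison with `deg-ide` for h, prime by prime: e d = j allows at most one exponent on the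
  -- left, and a prime dividing h contributes at least e = 1 on the right.
  cou-bou : ∀ c j {k} (h : Vec K.El k) -> (∀ {d} (v : Vec K.El d) e -> Irreducible v -> Good c j v e -> monP v ∣ monP h) -> count c j ℤ.≤ + k
  cou-bou c j {k} h div = ≡.subst₂ ℤ._≤_ extend (deg-ide k B NP.≤-refl (NP.m≤n⊔m j k) h ∙ I.fromℕ≡+ k) (sumPri-mono B (\ v e -> [ good? c j v e ]) (dvd h) row)
   where
   B = j N.⊔ k
   extend : sumPri B (\ v e -> [ good? c j v e ]) ≡ count c j
   extend = N1.sumPri-ext (NP.m≤m⊔n j k) (\ v e -> [ good? c j v e ]) (\ {d} v e l -> [no] (good? c j v (suc e)) (\ { (idp , _) -> NP.<⇒≱ l (NP.m≤m+n d _) })) (\ {d} v e l -> [no] (good? c j v e) (\ { (idp , _) -> NP.<⇒≱ l (NP.m≤m*n e (suc d)) }))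
   row : ∀ {i} (v : Vec K.El (suc i)) -> Irreducible v -> sumTo B (\ e -> [ good? c j v (suc e) ]) ℤ.≤ sumTo B (\ e -> dvd h v (suc e))
   row {i} v ir = go B (v ∣? monP h)
    where
    go : ∀ B -> Dec (monP v ∣ monP h) -> sumTo B (\ e -> [ good? c j v (suc e) ]) ℤ.≤ sumTo B (\ e -> dvd h v (suc e))
    go B (no nd) = sumTo-mono B (\ e _ -> ℤP.≤-trans (ℤP.≤-reflexive ([no] (good? c j v (suc e)) (\ g -> nd (div v (suc e) ir g)))) ([]-non (pow v (suc e) ∣? monP h)))
    go zero (yes d) = ℤP.≤-reflexive (sumTo-zero _ ∙ ! (sumTo-zero _))
    go (suc B) (yes d) = ℤP.≤-trans (at-most-one (suc B) (\ e -> [ good? c j v (suc e) ]) (\ e -> [ (\ { (_ , x) -> inj₂ x }) , (\ { (_ , x) -> inj₁ x }) ]′ ([]-01 (good? c j v (suc e)))) unique) (ℤP.≤-trans (ℤP.≤-reflexive (! first)) (ℤP.≤-trans (ℤP.≤-reflexive (! (ℤP.+-identityʳ _))) (ℤP.≤-trans (ℤP.+-monoʳ-≤ (dvd h v 1) rest) (ℤP.≤-reflexive (! (sumTo-suc B _))))))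
     where
     holds : ∀ e -> [ good? c j v (suc e) ] ≡ + 1 -> Good c j v (suc e)
     holds e x = [ proj₁ , (\ { (_ , y) -> ⊥-elim (1≢0 (! x ∙ y)) }) ]′ ([]-01 (good? c j v (suc e)))
      where
      1≢0 : + 1 ≢ + 0
      1≢0 ()
     unique : ∀ e e′ -> [ good? c j v (suc e) ] ≡ + 1 -> [ good? c j v (suc e′) ] ≡ + 1 -> e ≡ e′
     unique e e′ x y = NP.suc-injective (NP.*-cancelʳ-≡ (suc e) (suc e′) (suc i) (proj₁ (holds e x) ∙ ! (proj₁ (holds e′ y))))
     first : dvd h v 1 ≡ + 1
     first = [yes] (pow v 1 ∣? monP h) (∣-trans {monP (pow v 1)} {monP v} {monP h} (P.1# , one) d)
      where
      open PriPow K using (module P; ⟪_⟫; ⊛-ideʳ; ≋-trans; ≋-sym; mon; mon-pro; ⊛-cong; ≋-refl; _⊛_)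
      one : monP v P.≈ monP (pow v 1) P.* P.1#
      one = P.sym (P.*-identityʳ (monP (pow v 1)) P.& P.trans (pow-suc v 0) ⟪ ⊛-ideʳ (mon v) ⟫)
     rest : + 0 ℤ.≤ sumTo B (\ e -> dvd h v (suc (suc e)))
     rest = ℤP.≤-trans (ℤP.≤-reflexive (! (sumTo-0 B (\ _ _ -> idp)))) (sumTo-mono B {\ _ -> + 0} (\ e _ -> []-non (pow v (suc (suc e)) ∣? monP h)))
  geo : ∀ k -> N1.c k ≡ + (q N.^ k)
  geo k = A.sumV-one k ∙ I.fromℕ≡+ (q N.^ k)
  -- Newton's identity for the trivial character, whose series has the coefficients q^k; the
  -- candidate q^j satisfies the same identity, and the series can be cancelled.
  tot-pow : ∀ j -> total (suc j) ≡ + (q N.^ suc j)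
  tot-pow j = ! (I.from-dif (S.⊛-canʳ (g S.⊕ (S.⊖ total)) N1.c (geo 0 ∙ idp) difference (suc j)))
   where
   module S = Ser ℤ-ring
   pw g : ℕ -> ℤ
   pw k = + (q N.^ k)
   g zero = + 0
   g (suc i) = pw (suc i)
   tail-pro : ∀ k -> (S.tail g S.⊛ pw) k ≡ I.fromℕ (suc k) ℤ.* pw (suc k)
   tail-pro zero = ap (\ x -> x ℤ.* + 1) (idp {x = pw 1}) ∙ ℤP.*-identityʳ (pw 1) ∙ ! (ℤP.*-identityˡ (pw 1))
   tail-pro (suc k) = ap₂ ℤ._+_ (pow-+ 1 (suc k)) (S.⊛-cong {S.tail (S.tail g)} {\ i -> pw 1 ℤ.* S.tail g i} {pw} {pw} (\ i -> ! (pow-+ 1 (suc i))) (\ _ -> idp) k ∙ S.sca-⊛ (pw 1) (S.tail g) pw k ∙ ap (\ x -> pw 1 ℤ.* x) (tail-pro k) ∙ I.solve 3 (\ a b c -> a I.:* (b I.:* c) I.:= b I.:* (a I.:* c)) idp (pw 1) (I.fromℕ (suc k)) (pw (suc k)) I.& ap (\ x -> I.fromℕ (suc k) ℤ.* x) (pow-+ 1 (suc k))) ∙ I.solve 2 (\ a b -> b I.:+ a I.:* b I.:= (I.1∶ I.:+ a) I.:* b) idp (I.fromℕ (suc k)) (pw (suc (suc k)))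
    where
    pow-+ : ∀ a b -> pw a ℤ.* pw b ≡ pw (a N.+ b)
    pow-+ a b = ! (ℤP.pos-* (q N.^ a) (q N.^ b)) ∙ ap +_ (! (NP.^-distribˡ-+-* q a b))
   g-pro : ∀ k -> (g S.⊛ N1.c) k ≡ S.θ N1.c k
   g-pro zero = ℤP.*-zeroˡ (N1.c 0) ∙ ! (ℤP.*-zeroˡ (N1.c 0))
   g-pro (suc k) = ap (\ x -> x ℤ.+ (S.tail g S.⊛ N1.c) k) (ℤP.*-zeroˡ (N1.c (suc k))) ∙ ℤP.+-identityˡ _ ∙ S.⊛-cong {S.tail g} (\ _ -> idp) geo k ∙ tail-pro k ∙ ap (\ x -> I.fromℕ (suc k) ℤ.* x) (! (geo (suc k)))
   difference : (g S.⊕ (S.⊖ total)) S.⊛ N1.c S.≋ S.𝟘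
   difference k = S.⊛-disʳ N1.c g (S.⊖ total) k ∙ ap₂ ℤ._+_ (g-pro k) (S.at (I′.sym (I′.-‿distribˡ-* total N1.c)) k ∙ ap ℤ.-_ (! (N1.new k))) ∙ ℤP.+-inverseʳ (S.θ N1.c k)
    where module I′ = Kit S.serRing
  cou-sum : ∀ j -> sumTo p (\ c -> count c j) ≡ total j
  cou-sum j = sumPri-sumTo j p (\ c v e -> [ good? c j v e ]) ∙ sumPri-cong j {\ v e -> sumTo p (\ c -> [ good? c j v e ])} {\ {d} v e -> [ e N.* d NP.≟ j ] ℤ.* + 1} (\ v e _ _ _ -> term v e)
   where
   term : ∀ {d} (v : Vec K.El d) e -> sumTo p (\ c -> [ good? c j v e ]) ≡ [ e N.* d NP.≟ j ] ℤ.* + 1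
   term {d} v e = sumTo-sin p (T (pow v e) % p) _ (m%n<n (T (pow v e)) p) (\ c ne -> [no] (good? c j v e) (\ g -> ne (! (proj₂ g)))) ∙ [⇔] (good? (T (pow v e) % p) j v e) (e N.* d NP.≟ j) proj₁ (\ x -> x , idp) ∙ ! (ℤP.*-identityʳ _)
  cou-non : ∀ c j -> + 0 ℤ.≤ count c j
  cou-non c j = ≡.subst (ℤ._≤ count c j) (sumPri-0 j (\ _ _ -> + 0) (\ _ _ _ _ _ -> idp)) (sumPri-mono j (\ _ _ -> + 0) (\ v e -> [ good? c j v e ]) (\ v ir -> sumTo-mono j (\ e _ -> []-non (good? c j v (suc e)))))

  -- ∑ (p [p | T] - 1)
  exc : ∀ j -> sumPri j (\ {d} v e -> [ e N.* d NP.≟ j ] ℤ.* (+ p ℤ.* [ p ∣ℕ? T (pow v e) ] ℤ.- + 1)) ≡ + p ℤ.* count 0 j ℤ.- total j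
  exc j = sumPri-cong j {\ {d} v e -> [ e N.* d NP.≟ j ] ℤ.* (+ p ℤ.* [ p ∣ℕ? T (pow v e) ] ℤ.- + 1)} {\ {d} v e -> + p ℤ.* [ good? 0 j v e ] ℤ.+ (ℤ.- + 1) ℤ.* ([ e N.* d NP.≟ j ] ℤ.* + 1)} (\ v e _ _ _ -> term v e) ∙ sumPri-+ j (\ v e -> + p ℤ.* [ good? 0 j v e ]) (\ {d} v e -> (ℤ.- + 1) ℤ.* ([ e N.* d NP.≟ j ] ℤ.* + 1)) ∙ ap₂ ℤ._+_ (! (sumPri-*ˡ j (+ p) (\ v e -> [ good? 0 j v e ]))) (! (sumPri-*ˡ j (ℤ.- + 1) (\ {d} v e -> [ e N.* d NP.≟ j ] ℤ.* + 1)) ∙ ℤP.-1*i≡-i (total j))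
   where
   term : ∀ {d} (v : Vec K.El d) e -> [ e N.* d NP.≟ j ] ℤ.* (+ p ℤ.* [ p ∣ℕ? T (pow v e) ] ℤ.- + 1) ≡ + p ℤ.* [ good? 0 j v e ] ℤ.+ (ℤ.- + 1) ℤ.* ([ e N.* d NP.≟ j ] ℤ.* + 1)
   term {d} v e = (I.solve 3 (\ b p t -> b I.:* (p I.:* t I.:- I.1∶) I.:= p I.:* (b I.:* t) I.:+ (I.:- I.1∶) I.:* (b I.:* I.1∶)) idp [ e N.* d NP.≟ j ] (+ p) [ p ∣ℕ? T (pow v e) ]) ∙ ap (\ x -> + p ℤ.* x ℤ.+ (ℤ.- + 1) ℤ.* ([ e N.* d NP.≟ j ] ℤ.* + 1)) (! ([×] (good? 0 j v e) (e N.* d NP.≟ j) (p ∣ℕ? T (pow v e)) proj₁ (\ g -> m%n≡0⇒n∣m (T (pow v e)) p (proj₂ g)) (\ x y -> x , n∣m⇒m%n≡0 (T (pow v e)) p y)))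

open PriCla

-- Error terms of the even power sums.

module ErrTer where

 open N using (_≤_; _<_)
 open import Data.Nat.DivMod using (_%_; _/_; m≡m%n+[m/n]*n; m<n⇒m%n≡m; m%n<n)
 open import Data.Nat.Divisibility using (∣⇒≤) renaming (_∣_ to _∣ℕ_)
 open import Data.Nat.Tactic.RingSolver using (solve-∀)
 open import Data.Integer.Base using (+_; +≤+)

 module ChaP (R : CommutativeRing 0ℓ 0ℓ) {p : ℕ} (pr : Prime p) .{{_ : NonZero p}} (char : CommutativeRing._≈_ R (Kit.fromℕ R p) (CommutativeRing.0# R)) where
  open Kit R
  open Fro R pr char
  Frob-ite : ∀ N e y -> Frob N y ≈ y -> Frob (e N.* N) y ≈ y
  Frob-ite N zero y h = *-identityʳ y
  Frob-ite N (suc e) y h = sym (Frob-∘ (e N.* N) N y) & Frob-cong (e N.* N) h & Frob-ite N e y h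
  fromℕ-% : ∀ a -> fromℕ a ≈ fromℕ (a % p)
  fromℕ-% a = reflexive (ap fromℕ (m≡m%n+[m/n]*n a p)) & fromℕ-+ (a % p) _ & +-congˡ (fromℕ-* (a / p) p & *-congˡ char & zeroʳ _) & +-identityʳ _

 module Gro {p″ m : ℕ} (pr : Prime (suc (suc p″))) (K : FiniteField (suc (suc p″) N.^ m)) (φ : Coordinates K (suc (suc p″)) m) (CR : CycRing (suc (suc p″))) (D′ : ℕ) (n<p : D′ < p″) (ℓ : ℕ -> Add K (suc (suc p″))) (v₀ : FiniteField.Carrier K) (ℓv₀ : ¬ (suc (suc p″) ∣ℕ Add.fun (ℓ (suc (suc D′))) v₀)) where
  private
   module FF = FieFac pr K φ
  p n q : ℕ
  p = suc (suc p″)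
  n = suc (suc D′)
  q = p N.^ m
  p∤n : ¬ (p ∣ℕ n)
  p∤n d = NP.<⇒≱ (s≤s (s≤s n<p)) (∣⇒≤ d)
  n≢0 : Kit.fromℕ (fieRing K) n ≢ FiniteField.0# K
  n≢0 = FF.fromℕ≢0 n p∤n
  open Cha K pr CR (suc D′) ℓ n≢0 v₀ ℓv₀ using (T; T-def; T-⊛; T-pro; parT; _≡ₚ_; mod; unmod; ≡ₚ-tra; ≡ₚ-refl; +-cong-≡ₚ; ≡ₚ-ref; s; unit; unit-0)
  open PriPow K using (module K; Irreducible; monP; _∣_; pow; product; conP; X; module P; coeff; ⊛-ideˡ; ≋-sym; polyRing) public
  open ClaCou K {p} T
  α : ℕ -> K.El
  α k = proj₁ (FF.tra-form (ℓ k))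
  α-top : α n ≢ K.0#
  α-top e = FF.fromℕ≢0 _ ℓv₀ (! (proj₂ (FF.tra-form (ℓ n)) v₀) ∙ ap (FF.tr m) (ap (K._* v₀) e ∙ K.zeroˡ v₀) ∙ FF.tr-0 m)
  module B = Bom pr K φ (suc D′) p∤n α α-top
  T-[] : T [] ≡ₚ 0
  T-[] = mod (! (ap (_% p) (NP.m+n∸m≡n t t)) ∙ ∣⇒0 (ModPri.%-equ⇒∣ pr t (t N.+ t) (NP.m≤m+n t t) (unmod (T-⊛ [] [] [] (\ i _ -> ! (idem i))))))
   where
   open import Data.Nat.Divisibility using (n∣m⇒m%n≡0)
   open PriPow K using (_⊛_; 𝟙; _≋_; ⊛-cong; ≋-trans; ≋-refl)
   t = T []
   ∣⇒0 : p ∣ℕ t N.+ t ∸ t -> (t N.+ t ∸ t) % p ≡ 0 % p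
   ∣⇒0 d = n∣m⇒m%n≡0 _ p d
   unit[] : unit [] ≋ 𝟙
   unit[] zero = idp
   unit[] (suc i) = idp
   idem : (unit [] ⊛ unit []) ≋ unit []
   idem = ≋-trans (⊛-cong {g = unit []} unit[] ≋-refl) (⊛-ideˡ (unit []))
  T-pow : ∀ {d} (v : Vec K.El d) e -> T (pow v e) ≡ₚ e N.* T v
  T-pow v zero = T-[]
  T-pow v (suc e) = ≡ₚ-tra (T-pro v (pow v e)) (+-cong-≡ₚ {T v} ≡ₚ-refl (T-pow v e))
  -- A pair (v, e) of class c with e d = 2 l fulfils the two conditions of `divisible`: X is fixed
  -- by the Frobenius of K applied 2 l times, and the trace of f is c.
  module AtCla (l c : ℕ) {d : ℕ} (v : Vec K.El d) (irr : Irreducible v) (e : ℕ) (good : Good c (l N.+ l) v e) where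
   private
    module R = Res pr K φ v irr
    module E = Kit R.E
    module C = ChaP R.E pr R.charE
    module TP = Transfer.Along polyRing R.E (\ z -> z) R.≈⇒≈/ (\ a b -> E.refl {a P.+ b}) (\ a b -> E.refl {a P.* b}) (E.refl {P.1#})
   N : ℕ
   N = l N.* m N.+ l N.* m
   N≡ : e N.* (d N.* m) ≡ N
   N≡ = ! (NP.*-assoc e d m) ∙ ap (N._* m) (proj₁ good) ∙ NP.*-distribʳ-+ m l l
   X-fix : R.XFix N
   X-fix = R.fix⇒XFix (≡.subst (\ N -> R.Frob N X R.≈/ X) N≡ (C.Frob-ite (d N.* m) e X (R.frob-q^d X)))
   val≈ : ∀ j -> B.fP j R.≈/ R.value α j
   val≈ zero = E.refl {P.0#}
   val≈ (suc j) = E.+-cong {B.fP j} {R.value α j} {conP (α (suc j)) P.* X P.^ suc j} {conP (α (suc j)) P.* X E.^ suc j} (val≈ j) (E.*-congˡ {conP (α (suc j))} {X P.^ suc j} {X E.^ suc j} (TP.ι-^ X (suc j)))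
   Θ : ℕ -> ℕ
   Θ j = parT j (s (unit v))
   eΘ : (e N.* Θ n) % p ≡ c
   eΘ = ap (\ t -> (e N.* t) % p) (! (T-def v)) ∙ ! (unmod (T-pow v e)) ∙ proj₂ good
   class : E.fromℕ (e N.* Θ n) R.≈/ E.fromℕ c
   class = E.trans {E.fromℕ (e N.* Θ n)} {E.fromℕ ((e N.* Θ n) % p)} {E.fromℕ c} (C.fromℕ-% (e N.* Θ n)) (E.reflexive (ap E.fromℕ eΘ))
   trace : R.TraIs N (B.fP n) c
   trace = R.tra⇒TraIs (≡.subst (\ N -> R.tr N (B.fP n) R.≈/ E.fromℕ c) N≡ (E.trans {R.tr (e N.* (d N.* m)) (B.fP n)} {R.tr (e N.* (d N.* m)) (R.value α n)} {E.fromℕ c} (R.tr-cong (e N.* (d N.* m)) {B.fP n} {R.value α n} (val≈ n)) (E.trans {R.tr (e N.* (d N.* m)) (R.value α n)} {E.fromℕ (e N.* Θ n)} {E.fromℕ c} (R.tra-val α ℓ (\ k -> proj₂ (FF.tra-form (ℓ k))) Θ idp (\ j -> idp) n e) class)))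
  side : ℕ -> ℕ
  side l = p N.^ (l N.* m)
  q^2l : ∀ l -> q N.^ (l N.+ l) ≡ side l N.* side l
  q^2l l = NP.^-*-assoc p m (l N.+ l) ∙ ap (p N.^_) (NP.*-comm m (l N.+ l) ∙ NP.*-distribʳ-+ m l l) ∙ NP.^-distribˡ-+-* p (l N.* m) (l N.* m)
  -- Above the threshold the excess (2 γ + 1) s left by the auxiliary polynomial is at most C₀ s.
  -- Below it the trivial bound suffices, as p s² ≤ p · thr · s.
  thr C₀ : ℕ
  thr = (B.γ N.+ 1) N.* (B.γ N.+ 2)
  C₀ = p N.* thr
  cou-≤ : ∀ l c -> thr ≤ side l -> + p ℤ.* count c (l N.+ l) ℤ.≤ + (side l N.* side l N.+ C₀ N.* side l)
  cou-≤ l c large = ℤP.≤-trans (ℤP.*-monoˡ-≤-nonNeg (+ p) (cou-bou c (l N.+ l) poly′ (\ v e irr good -> divisible v irr (AtCla.X-fix l c v irr e good) (AtCla.trace l c v irr e good)))) (ℤP.≤-trans (ℤP.≤-reflexive (! (ℤP.pos-* p size))) (+≤+ (NP.≤-trans size-bou (NP.≤-trans (NP.≤-reflexive (arith (side l) B.γ)) (NP.+-monoʳ-≤ (side l N.* side l) (NP.*-monoˡ-≤ (side l) small))))))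
   where
   open B.Mul (B.Con.construct l c (side l ∸ thr) (! (NP.m+[n∸m]≡n large)))
   arith : ∀ s γ -> s N.* (s N.+ (γ N.+ γ N.+ 1)) ≡ s N.* s N.+ (γ N.+ γ N.+ 1) N.* s
   arith = solve-∀
   expand : ∀ γ -> (γ N.+ γ N.+ 1) N.+ (γ N.* γ N.+ γ N.+ 1) ≡ (γ N.+ 1) N.* (γ N.+ 2)
   expand = solve-∀
   small : B.γ N.+ B.γ N.+ 1 ≤ C₀
   small = NP.≤-trans (NP.≤-trans (NP.m≤m+n _ _) (NP.≤-reflexive (expand B.γ))) (NP.m≤n*m thr p)
  tot-squ : ∀ l′ -> let l = suc l′ in total (l N.+ l) ≡ + (side l N.* side l)
  tot-squ l′ = tot-pow (l′ N.+ suc l′) ∙ ap +_ (q^2l (suc l′))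
  cou-tot : ∀ l′ c -> c < p -> let l = suc l′ in count c (l N.+ l) ℤ.≤ + (side l N.* side l)
  cou-tot l′ c c<p = ≡.subst₂ ℤ._≤_ single (cou-sum j ∙ tot-squ l′) (sumTo-mono p pick)
   where
   j = suc l′ N.+ suc l′
   pick : ∀ i -> i < p -> [ i NP.≟ c ] ℤ.* count i j ℤ.≤ count i j
   pick i _ = [ (\ { (_ , e) -> ℤP.≤-reflexive (ap (\ x -> x ℤ.* count i j) e ∙ ℤP.*-identityˡ (count i j)) }) , (\ { (_ , e) -> ≡.subst (ℤ._≤ count i j) (! (ap (\ x -> x ℤ.* count i j) e ∙ ℤP.*-zeroˡ (count i j))) (cou-non i j) }) ]′ ([]-01 (i NP.≟ c))
   single : sumTo p (\ i -> [ i NP.≟ c ] ℤ.* count i j) ≡ count c j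
   single = sumTo-sin p c _ c<p (\ i ne -> ap (\ x -> x ℤ.* count i j) ([no] (i NP.≟ c) ne) ∙ ℤP.*-zeroˡ (count i j)) ∙ ap (\ x -> x ℤ.* count c j) ([yes] (c NP.≟ c) idp) ∙ ℤP.*-identityˡ (count c j)
  cla-bou : ∀ l′ c -> c < p -> let l = suc l′ in + p ℤ.* count c (l N.+ l) ℤ.≤ + (side l N.* side l N.+ C₀ N.* side l)
  cla-bou l′ c c<p = [ cou-≤ (suc l′) c , (\ l -> ℤP.≤-trans (ℤP.*-monoˡ-≤-nonNeg (+ p) (cou-tot l′ c c<p)) (ℤP.≤-trans (ℤP.≤-reflexive (! (ℤP.pos-* p (t N.* t)))) (+≤+ (NP.≤-trans (NP.*-monoʳ-≤ p (NP.*-monoˡ-≤ t l)) (NP.≤-trans (NP.≤-reflexive (! (NP.*-assoc p thr t))) (NP.m≤n+m _ (t N.* t))))))) ]′ (NP.≤-total thr (side (suc l′)))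
   where t = side (suc l′)
  sumTo-bou : ∀ k (f : ℕ -> ℤ) x -> (∀ i -> i < k -> f i ℤ.≤ x) -> sumTo k f ℤ.≤ + k ℤ.* x
  sumTo-bou zero f x h = ℤP.≤-reflexive (sumTo-zero f ∙ ! (ℤP.*-zeroˡ x))
  sumTo-bou (suc k) f x h = ℤP.≤-trans (ℤP.≤-reflexive (sumTo-snoc k f)) (ℤP.≤-trans (ℤP.+-mono-≤ (sumTo-bou k f x (\ i l -> h i (NP.m<n⇒m<1+n l))) (h k NP.≤-refl)) (ℤP.≤-reflexive (ℤP.+-comm (+ k ℤ.* x) x ∙ ! (ℤP.suc-* (+ k) x))))
  dev : ℕ -> ℤ
  dev j = + p ℤ.* count 0 j ℤ.- total j
  dev-upp : ∀ l′ -> let l = suc l′ in dev (l N.+ l) ℤ.≤ + (p N.* C₀ N.* side l)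
  dev-upp l′ = ℤP.≤-trans (ℤP.+-monoˡ-≤ (ℤ.- total j) (cla-bou l′ 0 (s≤s z≤n))) (ℤP.≤-trans (ℤP.≤-reflexive (ap₂ (\ a b -> a ℤ.- b) (ℤP.pos-+ (t N.* t) (C₀ N.* t)) (tot-squ l′) ∙ Integers.solve 2 (\ a b -> (a I.:+ b) I.:- a I.:= b) idp (+ (t N.* t)) (+ (C₀ N.* t)))) (+≤+ (NP.*-monoˡ-≤ t (NP.m≤n*m C₀ p))))
   where
   module I = Integers
   t = side (suc l′)
   j = suc l′ N.+ suc l′
  -- The p classes together have q^(2l) elements, so upper bounds for the other p - 1 classes give a
  -- lower bound for class 0.
  dev-low : ∀ l′ -> let l = suc l′ in ℤ.- dev (l N.+ l) ℤ.≤ + (p N.* C₀ N.* side l)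
  dev-low l′ = ℤP.≤-trans (ℤP.≤-reflexive negated) (ℤP.≤-trans (ℤP.+-monoˡ-≤ (ℤ.- (+ p′ ℤ.* A)) oth) (ℤP.≤-trans (ℤP.≤-reflexive cancel) (+≤+ (NP.≤-trans (NP.*-monoˡ-≤ (C₀ N.* t) (NP.n≤1+n p′)) (NP.≤-reflexive (! (NP.*-assoc p C₀ t)))))))
   where
   module I = Integers
   t = side (suc l′)
   j = suc l′ N.+ suc l′
   p′ = suc p″
   A Y R : ℤ
   A = + (t N.* t)
   Y = + (C₀ N.* t)
   R = sumTo p′ (\ c -> count (suc c) j)
   all : count 0 j ℤ.+ R ≡ A
   all = ! (sumTo-suc p′ (\ c -> count c j)) ∙ cou-sum j ∙ tot-squ l′
   oth : + p ℤ.* R ℤ.≤ + p′ ℤ.* (A ℤ.+ Y)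
   oth = ℤP.≤-trans (ℤP.≤-reflexive (sumTo-*ˡ p′ (+ p) (\ c -> count (suc c) j))) (sumTo-bou p′ _ (A ℤ.+ Y) (\ c l -> ℤP.≤-trans (cla-bou l′ (suc c) (s≤s l)) (ℤP.≤-reflexive (ℤP.pos-+ (t N.* t) (C₀ N.* t)))))
   negated : ℤ.- dev j ≡ + p ℤ.* R ℤ.- + p′ ℤ.* A
   negated = ap₂ (\ a b -> ℤ.- (+ p ℤ.* a ℤ.- b)) (cou≡ (count 0 j) R A all) (tot-squ l′) ∙ ap (\ w -> ℤ.- (w ℤ.* (A ℤ.- R) ℤ.- A)) (ℤP.pos-+ 1 p′) ∙ I.solve 3 (\ a r p′ -> I.:- ((I.1∶ I.:+ p′) I.:* (a I.:- r) I.:- a) I.:= (I.1∶ I.:+ p′) I.:* r I.:- p′ I.:* a) idp A R (+ p′) ∙ ap (\ w -> w ℤ.* R ℤ.- + p′ ℤ.* A) (! (ℤP.pos-+ 1 p′))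
    where
    cou≡ : ∀ x r a -> x ℤ.+ r ≡ a -> x ≡ a ℤ.- r
    cou≡ x r a e = I.solve 2 (\ x r -> x I.:= (x I.:+ r) I.:- r) idp x r ∙ ap (\ w -> w ℤ.- r) e
   cancel : + p′ ℤ.* (A ℤ.+ Y) ℤ.- + p′ ℤ.* A ≡ + (p′ N.* (C₀ N.* t))
   cancel = I.solve 3 (\ p a y -> p I.:* (a I.:+ y) I.:- p I.:* a I.:= p I.:* y) idp (+ p′) A Y ∙ ! (ℤP.pos-* p′ (C₀ N.* t))

open ErrTer

-- The rational numbers and the count of zeros in degree at least two.

module PoiCou where

 open N using (_≤_; _<_)
 open import Data.Nat.DivMod using (_%_)
 open import Data.Nat.Divisibility using () renaming (_∣_ to _∣ℕ_)
 open import Data.Nat.Coprimality using (1-coprimeTo; sym)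
 open import Data.Integer.Base using (+_; -[1+_]; +≤+; -≤+)
 open import Data.Rational.Base as ℚ using (ℚ; mkℚ; 0ℚ; 1ℚ; toℚᵘ)
 import Data.Rational.Properties as ℚP
 open import Data.Rational.Unnormalised.Base as ℚᵘ using (mkℚᵘ; *≡*)
 import Data.Rational.Unnormalised.Properties as ℚᵘP
 open import Data.Fin.Permutation using (permutation)

 module Rat where
  ℚ-ring : CommutativeRing 0ℓ 0ℓ
  ℚ-ring = ℚP.+-*-commutativeRing
  open Kit ℚ-ring using (fromℕ)
  whole : ℕ -> ℚ
  whole n = mkℚ (+ n) 0 (sym (1-coprimeTo n))
  fromℕ-who : ∀ n -> fromℕ n ≡ whole n
  fromℕ-who zero = ℚP.toℚᵘ-injective (*≡* idp)
  fromℕ-who (suc n) = ap (1ℚ ℚ.+_) (fromℕ-who n) ∙ ℚP.toℚᵘ-injective (ℚᵘP.≃-trans (ℚP.toℚᵘ-homo-+ 1ℚ (whole n)) (*≡* (ap (ℤ._* + 1) (ap (\ z -> + 1 ℤ.+ z) (ℤP.*-identityʳ (+ n))))))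
  -- The denominator is at least 1, so the numerator alone gives a bound.
  bel-who : ∀ x -> x ℚ.≤ fromℕ ℤ.∣ ℚ.numerator x ∣
  bel-who x@(mkℚ i d _) = ≡.subst (x ℚ.≤_) (! (fromℕ-who ℤ.∣ i ∣)) (ℚ.*≤* (bound i))
   where
   bound : ∀ i -> i ℤ.* + 1 ℤ.≤ + ℤ.∣ i ∣ ℤ.* + suc d
   bound (+ n) = ≡.subst₂ ℤ._≤_ (! (ℤP.*-identityʳ (+ n))) (ℤP.pos-* n (suc d)) (+≤+ (NP.m≤m*n n (suc d)))
   bound -[1+ n ] = ≡.subst (ℤ._≤ + suc n ℤ.* + suc d) (! (ℤP.*-identityʳ -[1+ n ])) -≤+
  non-* : ∀ {x y} -> 0ℚ ℚ.≤ x -> 0ℚ ℚ.≤ y -> 0ℚ ℚ.≤ x ℚ.* y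
  non-* {x} {y} p r = ≡.subst (ℚ._≤ x ℚ.* y) (ℚP.*-zeroʳ x) (ℚP.*-monoˡ-≤-nonNeg x {{ℚ.nonNegative p}} r)
  ℚ-fie : OrdFie
  ℚ-fie = record { Carrier = ℚ ; _+_ = ℚ._+_ ; _*_ = ℚ._*_ ; -_ = ℚ.-_ ; 0# = 0ℚ ; 1# = 1ℚ ; isCommutativeRing = ℚP.+-*-isCommutativeRing ; _≤_ = ℚ._≤_ ; ≤-total = ℚP.≤-total ; ≤-trans = ℚP.≤-trans ; ≤-antisym = ℚP.≤-antisym ; _≤?_ = ℚP._≤?_ ; +-monoʳ-≤ = \ z -> ℚP.+-monoʳ-≤ z ; *-non = non-* ; inverse = \ x x≢0 -> ℚ.1/_ x {{ℚ.≢-nonZero x≢0}} , ℚP.*-inverseʳ x {{ℚ.≢-nonZero x≢0}} ; 0≢1 = \ () ; arc = \ x -> ℤ.∣ ℚ.numerator x ∣ , bel-who x }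

 -- The sums ∑_{0 < j ≤ k} ℓ_j(x^j).
 module PowForm {q : ℕ} (K : FiniteField q) {p : ℕ} .{{_ : NonZero p}} (ℓ : ℕ -> Add K p) where
  open FiniteField K
  value : ℕ -> Carrier -> ℕ
  value zero x = 0
  value (suc j) x = value j x N.+ Add.fun (ℓ (suc j)) (x ^ suc j)

 module HighDeg {p″ m : ℕ} (pr : Prime (suc (suc p″))) (K : FiniteField (suc (suc p″) N.^ m)) (φ : Coordinates K (suc (suc p″)) m) (H′ : ℕ) (p-odd : suc (suc p″) ≡ suc (suc H′ N.+ suc H′)) (D′ : ℕ) (n<p : D′ < p″) (ℓ : ℕ -> Add K (suc (suc p″))) (v₀ : FiniteField.Carrier K) (ℓv₀ : ¬ (suc (suc p″) ∣ℕ Add.fun (ℓ (suc (suc D′))) v₀)) (F : OrdFie) where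
  p n : ℕ
  p = suc (suc p″)
  n = suc (suc D′)
  CR : CycRing p
  CR = cycRing pr
  private
   module G = Gro pr K φ CR D′ n<p ℓ v₀ ℓv₀
   module L = LPol K pr CR H′ p-odd D′ ℓ G.n≢0 v₀ ℓv₀
   module T = Cha K pr CR (suc D′) ℓ G.n≢0 v₀ ℓv₀
   module OF = OrdKit F
   module FI = FromInt OF.ring
   module C = ClaCou K {p} T.T
   module I = Integers
   open OF using (_*_; -_; ∣_∣; fromℕ; fromℤ) renaming (_≤_ to _≤ᶠ_)
  -- g′ is g - 1 for g = H D = (p - 1)(n - 1) / 2, written so that `suc g′` unfolds to the product
  -- of H and D.
  q D H g′ : ℕ
  q = p N.^ m
  D = suc D′
  H = suc H′
  g′ = D′ N.+ H′ N.* D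
  τ-dev : ∀ j -> L.τ j ≡ G.dev j
  τ-dev j = C.exc j
  fromℤ-mono : ∀ {i j} -> i ℤ.≤ j -> fromℤ i ≤ᶠ fromℤ j
  fromℤ-mono {i} {j} l = OF.by-non (! (OF.fromℤ-+ j (ℤ.- i) ∙ ap (\ x -> fromℤ j OF.+ x) (OF.fromℤ-neg i))) (non (j ℤ.- i) (ℤP.i≤j⇒0≤j-i l))
   where
   non : ∀ k -> + 0 ℤ.≤ k -> OF.0# ≤ᶠ fromℤ k
   non (+ k) _ = OF.fromℕ-non k
  fromℕ-^ : ∀ l -> fromℕ (G.side l) ≡ fromℕ q OF.^ l
  fromℕ-^ zero = OF.+-identityʳ OF.1#
  fromℕ-^ (suc l) = ap fromℕ (NP.^-distribˡ-+-* p m (l N.* m)) ∙ OF.fromℕ-* q (G.side l) ∙ ap (\ x -> fromℕ q * x) (fromℕ-^ l)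
  gro : ∀ l -> ∣ fromℤ (L.τ (l N.+ l)) ∣ ≤ᶠ fromℕ (p N.* G.C₀) * fromℕ q OF.^ l
  gro zero = OF.≤ˡ (! (ap (\ t -> ∣ fromℤ t ∣) L.τ-0 ∙ OF.abs-0)) (OF.*-non (OF.fromℕ-non (p N.* G.C₀)) OF.0≤1)
  gro (suc l) = OF.abs-≤ (OF.≤-trans (fromℤ-mono (≡.subst (ℤ._≤ bound) (! (τ-dev j)) (G.dev-upp l))) (OF.≤-reflexive bou≡)) (OF.≤-trans (OF.≤-reflexive (! (OF.fromℤ-neg (L.τ j)))) (OF.≤-trans (fromℤ-mono (≡.subst (\ t -> ℤ.- t ℤ.≤ bound) (! (τ-dev j)) (G.dev-low l))) (OF.≤-reflexive bou≡)))
   where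
   j = suc l N.+ suc l
   bound : ℤ
   bound = + (p N.* G.C₀ N.* G.side (suc l))
   bou≡ : fromℤ bound ≡ fromℕ (p N.* G.C₀) * fromℕ q OF.^ suc l
   bou≡ = OF.fromℕ-* (p N.* G.C₀) (G.side (suc l)) ∙ ap (\ x -> fromℕ (p N.* G.C₀) * x) (fromℕ-^ (suc l))
  deg≡ : suc g′ N.+ suc g′ ≡ H N.* (D N.+ D)
  deg≡ = ! (NP.*-distribˡ-+ H D D) ∙ idp
  q≥1 : 1 ≤ q
  q≥1 = NP.m^n>0 p m
  -- Serre's bound for the product of all nontrivial L-functions, of degree 2 g with top coefficient
  -- q^g.
  q<p-pow : ∀ M -> 4 N.* q < suc M N.* suc M -> L.a 1 ℤ.≤ + (suc g′ N.* M)
  q<p-pow M M-large = SerBou.Final.serre F g′ q M q≥1 L.a L.a-0 (ap L.a deg≡ ∙ L.a-top ∙ ap (\ k -> + (q N.^ k)) (NP.*-comm D H)) (\ i l -> L.a-Deg i (≡.subst (_< i) deg≡ l)) (\ i -> fromℤ (L.τ i)) (ap fromℤ L.τ-0) (\ i -> ! (FI.fromℤ-θ L.a i) ∙ ap fromℤ (L.a-new i) ∙ FI.fromℤ-⊛ L.τ L.a i) (fromℕ (p N.* G.C₀)) (OF.fromℕ-non (p N.* G.C₀)) gro M-large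
  -- Newton's identity at index 1, with τ 0 = 0 and a 0 = 1.
  a-1 : L.a 1 ≡ G.dev 1
  a-1 = ! (ℤP.*-identityˡ (L.a 1)) ∙ L.a-new 1 ∙ ap₂ (\ x y -> x ℤ.* L.a 1 ℤ.+ L.τ 1 ℤ.* y) L.τ-0 L.a-0 ∙ ap₂ ℤ._+_ (ℤP.*-zeroˡ (L.a 1)) (ℤP.*-identityʳ (L.τ 1)) ∙ ℤP.+-identityˡ (L.τ 1) ∙ τ-dev 1
  open Factorisation K using (module K; elt; idx; elt-idx; idx-elt; Irreducible; irr?)
  open PriPow K using (pow)
  open PowForm K ℓ

  -- The polynomials X - x of degree one correspond to the points x of K.
  zero? : ∀ i -> Dec (value n (elt i) % p ≡ 0)
  zero? i = value n (elt i) % p NP.≟ 0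
  T-lin : ∀ x -> T.T (K.- x ∷ []) ≡ value n x
  T-lin x = T.T-def (K.- x ∷ []) ∙ go n
   where
   same-^ : ∀ j -> x K.^ j ≡ FiniteField._^_ K x j
   same-^ zero = idp
   same-^ (suc j) = ap (x K.*_) (same-^ j)
   go : ∀ j -> T.parT j (T.s (T.unit (K.- x ∷ []))) ≡ value j x
   go zero = idp
   go (suc j) = ap₂ (\ a b -> a N.+ Add.fun (ℓ (suc j)) b) (go j) (Roots.s-lin (fieRing K) x j ∙ same-^ (suc j))
  cou-zer : C.count 0 1 ≡ I.sum (\ i -> C.[ zero? i ])
  cou-zer = C.sumTo-suc 0 _ ∙ ap (\ x -> C.sumV 1 f₁ ℤ.+ x) (C.sumTo-zero _) ∙ ℤP.+-identityʳ _ ∙ C.sumV-cons 0 f₁ ∙ I.sum-cong-≋ {q} (\ i -> C.sumV-nil (\ w -> f₁ (elt i ∷ w)) ∙ term i) ∙ I.sum-permute f₂ (permutation neg neg neg-neg neg-neg) ∙ I.sum-cong-≋ {q} same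
   where
   f₁ : Vec K.El 1 -> ℤ
   f₁ v = C.sumTo 1 (\ e -> (C.[ irr? v ] ℤ.* I.fromℕ 1) ℤ.* C.[ C.good? 0 1 v (suc e) ])
   f₂ : Fin q -> ℤ
   f₂ i = C.[ C.good? 0 1 (elt i ∷ []) 1 ]
   lin-irr : ∀ (v : Vec K.El 1) -> Irreducible v
   lin-irr v = s≤s z≤n , \ { (suc j) _ (s≤s ()) }
   term : ∀ i -> f₁ (elt i ∷ []) ≡ f₂ i
   term i = C.sumTo-suc 0 _ ∙ ap₂ (\ x y -> (x ℤ.* + 1) ℤ.* f₂ i ℤ.+ y) (C.[yes] (irr? (elt i ∷ [])) (lin-irr (elt i ∷ []))) (C.sumTo-zero _) ∙ ℤP.+-identityʳ _ ∙ ℤP.*-identityˡ (f₂ i)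
   -- The vector with the single entry a stands for X + a, whose zero is -a; hence the sum is
   -- permuted by negation.
   neg : Fin q -> Fin q
   neg i = idx (K.- elt i)
   neg-neg : ∀ i -> neg (neg i) ≡ i
   neg-neg i = ap (\ x -> idx (K.- x)) (elt-idx _) ∙ ap idx (K.-‿involutive (elt i)) ∙ idx-elt i
   same : ∀ i -> f₂ (neg i) ≡ C.[ zero? i ]
   same i = C.[⇔] (C.good? 0 1 (elt (neg i) ∷ []) 1) (zero? i) (\ g -> ! class ∙ proj₂ g) (\ e -> idp , class ∙ e)
    where
    class : T.T (pow (elt (neg i) ∷ []) 1) % p ≡ value n (elt i) % p
    class = T.unmod (G.T-pow (elt (neg i) ∷ []) 1) ∙ ap (_% p) (NP.*-identityˡ _ ∙ ap (\ x -> T.T (x ∷ [])) (elt-idx (K.- elt i)) ∙ T-lin (elt i))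
  zer-bou : ∀ M -> 4 N.* q < suc M N.* suc M -> + p ℤ.* I.sum (\ i -> C.[ zero? i ]) ℤ.≤ + (q N.+ suc g′ N.* M)
  zer-bou M M-large = ℤP.≤-trans (ℤP.≤-reflexive (ap (\ x -> + p ℤ.* x) (! cou-zer) ∙ split)) (ℤP.≤-trans (ℤP.+-monoʳ-≤ (C.total 1) (≡.subst (ℤ._≤ + (suc g′ N.* M)) a-1 (q<p-pow M M-large))) (ℤP.≤-reflexive (ap (\ x -> x ℤ.+ + (suc g′ N.* M)) (C.tot-pow 0 ∙ ap +_ (NP.*-identityʳ q)) ∙ ! (ℤP.pos-+ q (suc g′ N.* M)))))
   where
   split : + p ℤ.* C.count 0 1 ≡ C.total 1 ℤ.+ G.dev 1
   split = I.solve 2 (\ x t -> x I.:= t I.:+ (x I.:- t)) idp (+ p ℤ.* C.count 0 1) (C.total 1)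

open PoiCou

-- From the code to the count of zeros.

open N using (_+_; _*_; _^_; _≤_; _<_; _≡ᵇ_; _≤ᵇ_)
open NP
open import Data.Nat.DivMod using (_%_; _mod_; m%n<n; m<n⇒m%n≡m; m%n%n≡m%n)
open import Data.Nat.Divisibility using (_∣_; _∣?_; divides; n∣m⇒m%n≡0; m%n≡0⇒n∣m; _∣0)
open import Data.Nat.ListAction using (sum)
open import Data.Nat.Primality using (prime⇒irreducible)
open import Data.Nat.Tactic.RingSolver using (solve-∀)
open import Data.Integer.Base using (+_; +≤+)
open import Data.Bool.Base using (Bool; true; false; not; _∧_; T)
open import Data.Vec.Base using (lookup)
open import Data.Vec.Properties using (lookup-zipWith)
open import Data.List.Base as List using (List; []; _∷_; map; allFin; tabulate; filter; length)
open import Data.List.Properties using (length-tabulate; map-cong; map-tabulate)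
open import Function.Bundles using (Inverse)
open import Relation.Nullary using (¬?)
open ≡ using (refl; sym; trans; cong; cong₂; subst)
open AddCou

-- The downward search keeps n < (k + 1)², which holds at the start k = n.
sqrt-upp : ∀ n -> n < suc ⌊√ n ⌋ * suc ⌊√ n ⌋
sqrt-upp n = go n (≤-trans (s≤s (m≤m+n n _)) (≤-reflexive refl))
 where
 go : ∀ k -> n < suc k * suc k -> n < suc (sqrtSearch n k) * suc (sqrtSearch n k)
 go zero l = l
 go (suc k) l with (suc k * suc k) ≤ᵇ n in eq
 ... | true = l
 ... | false = go k (≰⇒> (\ h -> subst T eq (≤⇒≤ᵇ h)))

open Add

sum-snoc : ∀ r (F : ℕ -> ℕ) -> sum (map (F ∘ toℕ) (allFin (suc r))) ≡ sum (map (F ∘ toℕ) (allFin r)) + F r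
sum-snoc r F = trans (cong sum (map-tabulate {n = suc r} (\ i -> i) (F ∘ toℕ))) (trans (go r F) (cong (\ l -> sum l + F r) (sym (map-tabulate {n = r} (\ i -> i) (F ∘ toℕ)))))
 where
 go : ∀ r (F : ℕ -> ℕ) -> sum (tabulate {n = suc r} (F ∘ toℕ)) ≡ sum (tabulate {n = r} (F ∘ toℕ)) + F r
 go zero F = +-comm (F 0) 0
 go (suc r) F = trans (cong (\ x -> F 0 + x) (go r (F ∘ suc))) (sym (+-assoc (F 0) _ _))

module _ {q : ℕ} (K : FiniteField q) {p : ℕ} .{{_ : NonZero p}} where
 open FiniteField K using (Carrier)

 zeroFun : Add K p
 zeroFun = record { fun = \ _ -> 0 ; fun-+ = \ _ _ -> refl }

 -- The finite family is continued by the zero functional, so that one indexing by ℕ serves all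
 -- degrees.
 extend : ∀ {r} -> (Fin r -> Add K p) -> ℕ -> Add K p
 extend {zero} f k = zeroFun
 extend {suc r} f zero = f Fin.zero
 extend {suc r} f (suc k) = extend (f ∘ Fin.suc) k

 ext-toℕ : ∀ {r} (f : Fin r -> Add K p) k -> extend f (toℕ k) ≡ f k
 ext-toℕ f Fin.zero = refl
 ext-toℕ f (Fin.suc k) = ext-toℕ (f ∘ Fin.suc) k

 Trivial : Add K p -> Set
 Trivial A = ∀ x -> p ∣ fun A x

 ext-tri : ∀ {r} (f : Fin r -> Add K p) k -> r ≤ k -> Trivial (extend f k)
 ext-tri {zero} f k l x = p ∣0
 ext-tri {suc r} f (suc k) (s≤s l) x = ext-tri (f ∘ Fin.suc) k l x

 tri? : (A : Add K p) -> Trivial A ⊎ (Σ[ x ∈ Carrier ] ¬ (p ∣ fun A x))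
 tri? A with FinP.any? (\ i -> ¬? (p ∣? fun A (Inverse.to (FiniteField.enum K) i)))
 ... | yes (i , h) = inj₂ (_ , h)
 ... | no none = inj₁ \ x -> eve x (p ∣? fun A x)
  where
  eve : ∀ x -> Dec (p ∣ fun A x) -> p ∣ fun A x
  eve x (yes d) = d
  eve x (no nd) = ⊥-elim (none (Inverse.from (FiniteField.enum K) x , subst (\ y -> ¬ (p ∣ fun A y)) (sym (Inverse.strictlyInverseˡ (FiniteField.enum K) x)) nd))

 -- The largest index with a nontrivial functional.
 Last : (ℕ -> Add K p) -> Set
 Last ℓ = Σ[ n ∈ ℕ ] Σ[ x ∈ Carrier ] (¬ (p ∣ fun (ℓ n) x) × (∀ i -> n < i -> Trivial (ℓ i)))

 last : ∀ ℓ j -> (∀ i -> j < i -> Trivial (ℓ i)) -> Last ℓ ⊎ (∀ i -> Trivial (ℓ i))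
 last ℓ j above with tri? (ℓ j)
 ... | inj₂ (x , h) = inj₁ (j , x , h , above)
 last ℓ zero above | inj₁ t = inj₂ \ { zero -> t ; (suc i) -> above (suc i) (s≤s z≤n) }
 last ℓ (suc j) above | inj₁ t = last ℓ j (\ i l -> [ (\ l′ -> above i l′) , (\ { refl -> t }) ]′ (m≤n⇒m<n∨m≡n l))

 module _ (ℓ : ℕ -> Add K p) where
  open PowForm K ℓ
  val-tri : ∀ n -> (∀ i -> n < i -> Trivial (ℓ i)) -> ∀ k x -> value (k + n) x % p ≡ value n x % p
  val-tri n h zero x = refl
  val-tri n h (suc k) x = trans (+-cong-≈ₚ p {value (k + n) x} {value n x} {_} {0} (val-tri n h k x) (trans (n∣m⇒m%n≡0 _ p (h (suc (k + n)) (s≤s (m≤n+m n k)) _)) (sym (n∣m⇒m%n≡0 0 p (p ∣0))))) (cong (_% p) (+-identityʳ (value n x)))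
  val-0 : ∀ n -> (∀ i -> Trivial (ℓ i)) -> ∀ x -> value n x % p ≡ 0
  val-0 n h x = trans (cong (\ k -> value k x % p) (sym (+-identityʳ n))) (trans (val-tri 0 (\ i _ -> h i) n x) (n∣m⇒m%n≡0 0 p (p ∣0)))

length-filter : ∀ {q n} (K : FiniteField q) {P : Fin n -> Set} (P? : ∀ i -> Dec (P i)) -> + length (filter P? (allFin n)) ≡ Integers.sum (\ i -> RanSums.[_] ℤ-ring (P? i))
length-filter {n = n} K P? = go P? (\ i -> i)
 where
 open RanSums ℤ-ring
 go : ∀ {A : Set} {P : A -> Set} (P? : ∀ x -> Dec (P x)) {n} (f : Fin n -> A) -> + length (filter P? (tabulate f)) ≡ Integers.sum (\ i -> [ P? (f i) ])
 go P? {zero} f = refl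
 go P? {suc n} f with P? (f Fin.zero) in eq
 ... | yes h = trans (ℤP.pos-+ 1 _) (cong₂ ℤ._+_ (sym ([yes] (yes h) h)) (go P? (f ∘ Fin.suc)))
 ... | no nh = trans (sym (ℤP.+-identityˡ _)) (cong₂ ℤ._+_ (sym ([no] (no nh) nh)) (go P? (f ∘ Fin.suc)))

pri-odd : ∀ {p} -> Prime p -> 2 < p -> Σ[ H′ ∈ ℕ ] p ≡ suc (suc H′ + suc H′)
pri-odd {p} pr 2<p = go (evenOrOdd p)
 where
 evenOrOdd : ∀ k -> Σ[ h ∈ ℕ ] (k ≡ h + h ⊎ k ≡ suc (h + h))
 evenOrOdd zero = 0 , inj₁ refl
 evenOrOdd (suc k) with evenOrOdd k
 ... | h , inj₁ e = h , inj₂ (cong suc e)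
 ... | h , inj₂ e = suc h , inj₁ (trans (cong suc e) (cong suc (sym (+-suc h h))))
 go : Σ[ h ∈ ℕ ] (p ≡ h + h ⊎ p ≡ suc (h + h)) -> Σ[ H′ ∈ ℕ ] p ≡ suc (suc H′ + suc H′)
 go (suc h , inj₂ e) = h , e
 go (zero , inj₂ e) = ⊥-elim (<⇒≱ 2<p (≤-trans (≤-reflexive e) (s≤s z≤n)))
 go (h , inj₁ e) = ⊥-elim ([ (\ ()) , (\ { refl -> <-irrefl refl 2<p }) ]′ (prime⇒irreducible pr (divides h (trans e (trans (cong (\ x -> h + x) (sym (+-identityʳ h))) (*-comm 2 h))))))

-- Matching on 1 < p exposes p as p″ + 2, the form in which the curve and its residues are set up.
high-deg : ∀ {p m} .{{_ : NonZero p}} -> 1 < p -> (pr : Prime p) (K : FiniteField (p ^ m)) (φ : Coordinates K p m) (ℓ : ℕ -> Add K p) (H′ D′ : ℕ) -> p ≡ suc (suc H′ + suc H′) -> suc (suc D′) < p -> (v₀ : FiniteField.Carrier K) -> ¬ (p ∣ fun (ℓ (suc (suc D′))) v₀) -> p * length (filter (\ i -> PowForm.value K ℓ (suc (suc D′)) (Inverse.to (FiniteField.enum K) i) % p ≟ 0) (allFin (p ^ m))) ≤ p ^ m + suc H′ * suc D′ * ⌊√ (4 * (p ^ m)) ⌋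
high-deg {p} {m} (s≤s (s≤s z≤n)) pr K φ ℓ H′ D′ p-odd (s≤s (s≤s n<p)) v₀ h = ℤP.drop‿+≤+ (subst (ℤ._≤ + (p ^ m + suc H′ * suc D′ * ⌊√ (4 * (p ^ m)) ⌋)) (trans (cong (\ x -> + p ℤ.* x) (sym (length-filter K zero?))) (sym (ℤP.pos-* p (length (filter zero? (allFin (p ^ m))))))) (zer-bou ⌊√ (4 * (p ^ m)) ⌋ (sqrt-upp (4 * (p ^ m)))))
 where open HighDeg pr K φ H′ p-odd D′ n<p ℓ v₀ h Rat.ℚ-fie using (zero?; zer-bou)

module CodeBound {p m : ℕ} .{{_ : NonZero p}} (pr : Prime p) (K : FiniteField (p ^ m)) (φ : Coordinates K p m) (r : ℕ) (r<p : r < p) (λc : Code.Coeffs K φ r) (positive : 0 < Code.weight K φ r λc) where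

 open FiniteField K renaming (_^_ to _^ᴷ_)
 open Coordinates φ
 open Code K φ r

 q : ℕ
 q = p ^ m

 coo-⊕ : ∀ x y i -> _≈ₚ_ p (toℕ (lookup (coord (x ⊕ y)) i)) (toℕ (lookup (coord x) i) + toℕ (lookup (coord y) i))
 coo-⊕ x y i = trans (cong (_% p) (trans (cong (\ v -> toℕ (lookup v i)) (additive x y)) (trans (cong toℕ (lookup-zipWith _+ₚ_ i (coord x) (coord y))) (toℕ-mod _ p)))) (%-≈ₚ p _)

 functional : Fin r -> Add K p
 functional k = record { fun = \ x -> sum (map (\ i -> toℕ (λc k i) * toℕ (lookup (coord x) i)) (allFin m)) ; fun-+ = \ x y -> sum-map-≈ₚ p _ _ _ (\ i -> trans (*-cong-≈ₚ p {a = toℕ (λc k i)} refl (coo-⊕ x y i)) (cong (_% p) (*-distribˡ-+ (toℕ (λc k i)) _ _))) (allFin m) }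

 -- Index j holds the functional that is applied to x^j; the rows of the matrix start with j = 1.
 ℓ : ℕ -> Add K p
 ℓ zero = zeroFun K
 ℓ (suc k) = extend K functional k

 open PowForm K ℓ

 cod-val : ∀ x -> toℕ (codeword λc x) ≡ value r x % p
 cod-val x = trans (toℕ-mod _ p) (cong (_% p) (trans (cong sum (map-cong (\ k -> cong (\ A -> fun A (x ^ᴷ suc (toℕ k))) (sym (ext-toℕ K functional k))) (allFin r))) (list r)))
  where
  list : ∀ j -> sum (map (\ k -> fun (ℓ (suc (toℕ k))) (x ^ᴷ suc (toℕ k))) (allFin j)) ≡ value j x
  list zero = refl
  list (suc j) = trans (sum-snoc j (\ k -> fun (ℓ (suc k)) (x ^ᴷ suc k))) (cong (_+ fun (ℓ (suc j)) (x ^ᴷ suc j)) (list j))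

 cou : Fin q -> Bool
 cou j = isNonzero (Inverse.to enum j) ∧ not (toℕ (codeword λc (Inverse.to enum j)) ≡ᵇ 0)

 -- All exponents are positive and additive functionals vanish at 0. Thus 0 is a zero that no column
 -- of the code sees, and q - d appears instead of q - 1 - d.
 val-at-0 : ∀ n -> value n 0# % p ≡ 0
 val-at-0 zero = n∣m⇒m%n≡0 0 p (p ∣0)
 val-at-0 (suc n) = trans (+-cong-≈ₚ p {value n 0#} {0} {fun (ℓ (suc n)) (0# ^ᴷ suc n)} {0} (trans (val-at-0 n) (sym (n∣m⇒m%n≡0 0 p (p ∣0)))) (trans (n∣m⇒m%n≡0 _ p (subst (\ y -> p ∣ fun (ℓ (suc n)) y) (sym (R.zeroˡ _)) (AddFun.ℓ-0# K pr (fun (ℓ (suc n))) (fun-+ (ℓ (suc n)))))) (sym (n∣m⇒m%n≡0 0 p (p ∣0))))) (n∣m⇒m%n≡0 0 p (p ∣0))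
  where
  open import Algebra.Bundles using (CommutativeRing)
  module R = CommutativeRing (fieRing K)

 unc-zero : ∀ j -> cou j ≡ false -> value r (Inverse.to enum j) % p ≡ 0
 unc-zero j e with Inverse.from enum (Inverse.to enum j) FinP.≟ Inverse.from enum 0#
 ... | no _ = trans (sym (cod-val _)) (≡ᵇ-fal _ e)
 ... | yes e' = trans (cong (\ z -> value r z % p) (trans (sym (Inverse.strictlyInverseˡ enum _)) (trans (cong (Inverse.to enum) e') (Inverse.strictlyInverseˡ enum 0#)))) (val-at-0 r)

 counted-nonzero : ∀ j -> cou j ≡ true -> value r (Inverse.to enum j) % p ≢ 0
 counted-nonzero j e d with isNonzero (Inverse.to enum j)
 ... | true = ≡ᵇ-true _ e (trans (cod-val _) d)

 -- p times the number of zeros of a codeword exceeds q by at most X.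
 few-zer : ∀ {P : Fin q -> Set} (P? : ∀ i -> Dec (P i)) -> (∀ i -> value r (Inverse.to enum i) % p ≡ 0 -> P i) -> ∀ X -> p * length (filter P? (allFin q)) ≤ q + X -> p * (q ∸ weight λc) ≤ q + X
 few-zer P? h X l = ≤-trans (*-monoʳ-≤ p (m≤n+o⇒m∸n≤o q (weight λc) (subst (_≤ weight λc + length (filter P? (allFin q))) (length-tabulate {n = q} (\ i -> i)) (ind-sum≥ P? cou (\ j e -> h j (unc-zero j e)) (allFin q))))) l

 -- Doubled to clear the denominator 2, with ⌊√(4q)⌋ in the role of ⌊2√q⌋.
 Goal : Set
 Goal = 2 * (1 + p * (q ∸ weight λc)) ≤ 2 * (1 + q) + (r ∸ 1) * (p ∸ 1) * ⌊√ (4 * q) ⌋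

 -- n is the last index with a nontrivial functional, the true degree of the word. The bound grows
 -- with the degree, so n ≤ r suffices.
 conclude : ∀ n -> n ≤ r -> (v₀ : Carrier) -> ¬ (p ∣ fun (ℓ n) v₀) -> (∀ i -> n < i -> Trivial K (ℓ i)) -> Goal
 conclude zero n≤r v₀ h above = ⊥-elim (h (p ∣0))
 conclude (suc zero) n≤r v₀ h above = ≤-trans (*-monoʳ-≤ 2 (s≤s (≤-trans (few-zer zero? lin 0 (≤-trans (p*zer≤q v₀ h) (m≤m+n q 0))) (≤-reflexive (+-identityʳ q))))) (m≤m+n _ _)
  where
  open AddFun K pr (fun (ℓ 1)) (fun-+ (ℓ 1))
  open import Algebra.Bundles using (CommutativeRing)
  module R = CommutativeRing (fieRing K)
  lin : ∀ i -> value r (Inverse.to enum i) % p ≡ 0 -> fun (ℓ 1) (Inverse.to enum i) % p ≡ 0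
  lin i e = trans (cong (\ y -> fun (ℓ 1) y % p) (sym (R.*-identityʳ _))) (trans (sym (val-tri K ℓ 1 above (r ∸ 1) _)) (trans (cong (\ k -> value k (Inverse.to enum i) % p) (m∸n+n≡m n≤r)) e))
 -- Here 2 ≤ n ≤ r < p, so the prime p is odd and the nontrivial characters can be paired.
 conclude (suc (suc D′)) n≤r v₀ h above = fin (pri-odd pr (≤-<-trans (≤-trans (s≤s (s≤s z≤n)) n≤r) r<p))
  where
  M = ⌊√ (4 * q) ⌋
  fin : Σ[ H′ ∈ ℕ ] p ≡ suc (suc H′ + suc H′) -> Goal
  fin (H′ , p-odd) = ≤-trans (*-monoʳ-≤ 2 (s≤s (few-zer (\ i -> value (suc (suc D′)) (Inverse.to enum i) % p ≟ 0) reduce (suc H′ * suc D′ * M) (high-deg (pri>1 pr) pr K φ ℓ H′ D′ p-odd (≤-<-trans n≤r r<p) v₀ h)))) (≤-trans (≤-reflexive (arith q (suc H′) (suc D′) M)) (+-monoʳ-≤ (2 * (1 + q)) (*-monoˡ-≤ M (≤-trans (*-monoˡ-≤ (suc H′ + suc H′) (∸-monoˡ-≤ 1 n≤r)) (≤-reflexive (cong (\ k -> (r ∸ 1) * (k ∸ 1)) (sym p-odd)))))))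
   where
   arith : ∀ q h d M -> 2 * (1 + (q + h * d * M)) ≡ 2 * (1 + q) + d * (h + h) * M
   arith = solve-∀
   reduce : ∀ i -> value r (Inverse.to enum i) % p ≡ 0 -> value (suc (suc D′)) (Inverse.to enum i) % p ≡ 0
   reduce i e = trans (sym (val-tri K ℓ (suc (suc D′)) above (r ∸ suc (suc D′)) _)) (trans (cong (\ k -> value k (Inverse.to enum i) % p) (m∸n+n≡m n≤r)) e)

 bound : Goal
 bound = go (last K ℓ r above)
  where
  above : ∀ i -> r < i -> Trivial K (ℓ i)
  above (suc i) (s≤s l) = ext-tri K functional i l
  go : Last K ℓ ⊎ (∀ i -> Trivial K (ℓ i)) -> Goal
  -- Without a nontrivial functional the codeword is 0, against its positive weight.
  go (inj₂ t) = let (j , e) = ind-sum>0 cou (allFin q) positive in ⊥-elim (counted-nonzero j e (val-0 K ℓ r t _))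
  go (inj₁ (n , v₀ , h , t)) = conclude n (≮⇒≥ (\ r<n -> h (above n r<n v₀))) v₀ h t

theorem4p4 : (p m r : ℕ) → Prime p → .{{_ : NonZero p}} →
    1 ≤ r → r < p →
    (K : FiniteField (p ^ m)) → (φ : Coordinates K p m) →
    (d : ℕ) → Code.IsMinDistance K φ r d →
    2 * (1 + p * ((p ^ m) ∸ d))
      ≤ 2 * (1 + p ^ m) + (r ∸ 1) * (p ∸ 1) * ⌊√ (4 * (p ^ m)) ⌋
theorem4p4 p m r pr 1≤r r<p K φ d ((λc , positive , refl) , _) = CodeBound.bound pr K φ r r<p λc positive
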